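{- Let $A=(q,q^4;q^5)_\infty$, $B=(q^2,q^3;q^5)_\infty$, $E_1=(q;q)_\infty$, $E_5=(q^5;q^5)_\infty$ and $S=\sum_{n=-\infty}^{\infty}(-1)^n n\, q^{n(5n+1)/2}$. For $r\in\{2,4\}$ write $G_r(q)=\sum_{n\ge0}\big[NB_5(1,5,5n+r)-NB_5(4,5,5n+r)+3NB_5(2,5,5n+r)-3NB_5(3,5,5n+r)\big]q^n$. Then \begin{align*} G_2(q)=\;&-70q^5\frac{A^{11}E_5^{17}}{B^{13}E_1^{18}}+2165q^4\frac{A^6E_5^{17}}{B^8E_1^{18}}-\frac{3265}{2}q^3\frac{A\,E_5^{17}}{B^3E_1^{18}}+\frac{5745}{2}q^2\frac{B^2E_5^{17}}{A^4E_1^{18}}+\frac{1965}{2}q\frac{B^7E_5^{17}}{A^9E_1^{18}}+\frac{35}{2}\frac{B^{12}E_5^{17}}{A^{14}E_1^{18}}\\ &+10q^4\frac{A^9E_5^{15}}{B^{10}E_1^{18}}-45q^3\frac{A^4E_5^{15}}{B^5E_1^{18}}-\frac{165}{2}q^2\frac{E_5^{15}}{A\,E_1^{18}}-200q\frac{B^5E_5^{15}}{A^6E_1^{18}}-\frac{15}{2}\frac{B^{10}E_5^{15}}{A^{11}E_1^{18}},\\[4pt] G_4(q)=\;&5S\Big(2q^4\frac{A^{11}E_5^{14}}{B^{13}E_1^{18}}-q^3\frac{A^6E_5^{14}}{B^8E_1^{18}}+2108q^2\frac{A\,E_5^{14}}{B^3E_1^{18}}-4q\frac{B^2E_5^{14}}{A^4E_1^{18}}-3\frac{B^7E_5^{14}}{A^9E_1^{18}}-5q^3\frac{A^9E_5^{12}}{B^{10}E_1^{18}}+30q^2\frac{A^4E_5^{12}}{B^5E_1^{18}}\Big)\\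 &-\frac52q^5\frac{A^{13}E_5^{17}}{B^{15}E_1^{18}}+825q^4\frac{A^8E_5^{17}}{B^{10}E_1^{18}}+\frac{1865}{2}q^2\frac{E_5^{17}}{A^2E_1^{18}}+\frac{4125}{2}q\frac{B^5E_5^{17}}{A^7E_1^{18}}+\frac{275}{2}\frac{B^{10}E_5^{17}}{A^{12}E_1^{18}}\\ &-5q^4\frac{A^{11}E_5^{15}}{B^{12}E_1^{18}}+\frac{1895}{2}q^2\frac{A\,E_5^{15}}{B^2E_1^{18}}-245q\frac{B^3E_5^{15}}{A^4E_1^{18}}-\frac{95}{2}\frac{B^8E_5^{15}}{A^9E_1^{18}}-\frac52q^3\frac{A^9E_5^{13}}{B^9E_1^{18}}+15q^2\frac{A^4E_5^{13}}{B^4E_1^{18}}. \end{align*}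
   Context: Notation: $(a;q)_\infty=\prod_{n\ge0}(1-aq^n)$ and $(a_1,\dots,a_t;q)_\infty=(a_1;q)_\infty\cdots(a_t;q)_\infty$; identities are of formal power series in $q$ (equivalently analytic for $|q|<1$). For $k\ge2$, a $k$-colored partition of $n\ge0$ is a $k$-tuple $\pi=(\pi^{(1)},\dots,\pi^{(k)})$ of ordinary partitions with $|\pi^{(1)}|+\cdots+|\pi^{(k)}|=n$ (written $\pi\vdash n$); $\#(\pi^{(i)})$ is the number of parts of $\pi^{(i)}$, and $\mathrm{crank}_k(\pi)=\#(\pi^{(1)})-\#(\pi^{(2)})$. For $k\ge2$, $j\ge2$, $0\le m\le j-1$, $n\ge0$, $$NB_k(m,j,n)=\sum_{\pi\vdash n,\ \mathrm{crank}_k(\pi)\equiv m \pmod j}\#(\pi^{(1)}).$$ -}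

module Defs where

open import Data.Nat as ℕ using (ℕ; zero; suc; _∸_; _⊓_; _≤ᵇ_; NonZero)
open import Data.Integer as ℤ using (ℤ; +_; -[1+_])
open import Data.Integer.DivMod using (_%ℕ_)
open import Data.Rational as ℚ using (ℚ; 0ℚ; 1ℚ; _/_)
open import Data.List as L using (List; []; _∷_; [_]; map; concatMap; upTo; length; foldr; zipWith)
open import Data.Vec as V using (Vec; []; _∷_)
open import Data.Nat.ListAction using () renaming (sum to sumℕ)
open import Data.Bool using (Bool; true; false; if_then_else_)

-- Formal power series in q with rational coefficients:
-- a series is its coefficient function  n ↦ [q^n] f.

PS : Set
PS = ℕ → ℚ

sumℚ : List ℚ → ℚ
sumℚ = foldr ℚ._+_ 0ℚ

ℤ→ℚ : ℤ → ℚ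
ℤ→ℚ z = z / 1

ℕ→ℚ : ℕ → ℚ
ℕ→ℚ n = (+ n) / 1

const : ℚ → PS
const c zero    = c
const c (suc _) = 0ℚ

oneS : PS
oneS = const 1ℚ

qPow : ℕ → PS → PS
qPow k f n = if k ≤ᵇ n then f (n ∸ k) else 0ℚ

qMon : ℕ → PS
qMon k = qPow k oneS

infixl 6 _⊕_ _⊖_
infixl 7 _⊛_ _·_

_⊕_ : PS → PS → PS
(f ⊕ g) n = f n ℚ.+ g n

_⊖_ : PS → PS → PS
(f ⊖ g) n = f n ℚ.- g n

_·_ : ℚ → PS → PS
(c · f) n = c ℚ.* f n

_⊛_ : PS → PS → PS
(f ⊛ g) n = sumℚ (map (λ i → f i ℚ.* g (n ∸ i)) (upTo (suc n)))

_^S_ : PS → ℕ → PS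
f ^S zero  = oneS
f ^S suc k = f ⊛ (f ^S k)

-- Multiplicative inverse of a series with constant term 1:
-- g_0 = 1,  g_{n} = - Σ_{k=1}^{n} f_k g_{n-k}.
-- invList f n = [g_n, g_{n-1}, ..., g_0].
invList : PS → ℕ → List ℚ
invList f zero    = [ 1ℚ ]
invList f (suc n) =
  let gs = invList f n
  in ℚ.- sumℚ (zipWith ℚ._*_ (map (λ i → f (suc i)) (upTo (suc n))) gs) ∷ gs

invS : PS → PS
invS f n with invList f n
... | []    = 0ℚ
... | g ∷ _ = g

-- negative powers  f^{-k}  (for f with constant term 1)
_^-_ : PS → ℕ → PS
f ^- k = invS (f ^S k)

-- q-Pochhammer symbol (q^a; q^d)_∞ = ∏_{m ≥ 0} (1 - q^{a + d m}),  a ≥ 1.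
-- Since every factor is 1 - q^e with e ≥ a ≥ 1 and exponents increase, the
-- coefficient of q^n equals that of the finite product over m < n + 1.

finPoch : ℕ → ℕ → ℕ → PS
finPoch a d zero    = oneS
finPoch a d (suc M) = finPoch a d M ⊛ (oneS ⊖ qMon (a ℕ.+ d ℕ.* M))

qPoch : (a d : ℕ) → PS
qPoch a d n = finPoch a d (suc n) n

-- S = Σ_{n ∈ ℤ} (-1)^n n q^{n(5n+1)/2}.
-- For n ≠ 0, n(5n+1)/2 ≥ 2|n|, so only |n| ≤ N contributes to [q^N].

sTerm : ℕ → ℤ → ℚ
sTerm N n =
  if ⌊ n ℤ.* (+ 5 ℤ.* n ℤ.+ + 1) ≟ + (2 ℕ.* N) ⌋ then ℤ→ℚ (sign n ℤ.* n) else 0ℚ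
  where
  open import Data.Integer using (_≟_)
  open import Relation.Nullary.Decidable using (⌊_⌋)
  sign : ℤ → ℤ
  sign z = if ⌊ ℤ.∣ z ∣ ℕ.% 2 ℕ.≟ 0 ⌋ then + 1 else ℤ.- (+ 1)

S-series : PS
S-series N = sumℚ (map (λ i → sTerm N (+ i ℤ.- + N)) (upTo (suc (2 ℕ.* N))))

-- Partitions: a partition of n is a nonincreasing list of positive
-- integers summing to n.  `partitions n` enumerates each exactly once.

-- partsBounded f n b : partitions of n with all parts ≤ b (fuel f ≥ n)
partsBounded : ℕ → ℕ → ℕ → List (List ℕ)
partsBounded _       zero    _ = [ [] ]
partsBounded zero    (suc n) _ = []
partsBounded (suc f) (suc n) b =
  concatMap (λ i → map (suc i ∷_) (partsBounded f (suc n ∸ suc i) (suc i)))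
            (upTo (suc n ⊓ b))

partitions : ℕ → List (List ℕ)
partitions n = partsBounded n n n

coloredPartitions : (k n : ℕ) → List (Vec (List ℕ) k)
coloredPartitions zero    zero    = [ [] ]
coloredPartitions zero    (suc _) = []
coloredPartitions (suc k) n =
  concatMap (λ i → concatMap (λ p → map (p ∷_) (coloredPartitions k (n ∸ i)))
                             (partitions i))
            (upTo (suc n))

-- crank_k(π) = #(π^(1)) - #(π^(2))   (only meaningful for k ≥ 2)
crank : ∀ {k} → Vec (List ℕ) k → ℤ
crank (p₁ ∷ p₂ ∷ _) = + length p₁ ℤ.- + length p₂
crank _ = + 0

NB : (k m j n : ℕ) .{{_ : NonZero j}} → ℕ
NB k m j n = sumℕ (map weight (coloredPartitions k n))
  where
  open import Relation.Nullary.Decidable using (⌊_⌋)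
  first : Vec (List ℕ) k → ℕ
  first [] = 0
  first (p ∷ _) = length p
  weight : Vec (List ℕ) k → ℕ
  weight π = if ⌊ (crank π %ℕ j) ℕ.≟ m ⌋ then first π else 0

A E₁ E₅ : PS
A  = qPoch 1 5 ⊛ qPoch 4 5
E₁ = qPoch 1 1
E₅ = qPoch 5 5

B : PS
B = qPoch 2 5 ⊛ qPoch 3 5

G : ℕ → PS
G r n = ℕ→ℚ (NB 5 1 5 (5 ℕ.* n ℕ.+ r)) ℚ.- ℕ→ℚ (NB 5 4 5 (5 ℕ.* n ℕ.+ r))
        ℚ.+ ℕ→ℚ 3 ℚ.* ℕ→ℚ (NB 5 2 5 (5 ℕ.* n ℕ.+ r))
        ℚ.- ℕ→ℚ 3 ℚ.* ℕ→ℚ (NB 5 3 5 (5 ℕ.* n ℕ.+ r))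

{-# OPTIONS --safe #-}
-- Let F(x) = Σ_π x^#(π¹) x^-#(π²) q^|π| = 1 / (T(x) E₁²), where T(x) = (q, xq, q/x; q)_∞, with coefficients
-- in ℚ(ζ)[ε], ζ⁵ = 1, ε² = 0. At x = ζ(1 + ε) the ε-part of F weighs π by crank(π) ζ^crank(π); exchanging π¹
-- and π² shows that this is twice #(π¹) ζ^crank(π) under an odd functional, so G is read off from F.
-- By the Jacobi triple product (1 - 1/x) T(x) is a theta series, and it splits by exponents modulo 5. With
-- a, b, e the series A, B, E₅ at q⁵ and y = qa/b this yields T(ζ) = eb(1 + (ζ² + ζ³) y), and then
-- T(ζ) T(ζ²) = E₁ E₅ gives E₁ = e (b/a) (1 - y - y²). At x = 1 + ε it is Jacobi's series for E₁³, whose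
-- comparison with the cube of the last formula evaluates S and its companion. The norm of E₁ under q ↦ ζᵏq gives
-- 1 - 11w - w² = A¹¹B for w = qA⁵/B⁵. So F is a polynomial in y divided by powers of 1 - 11y⁵ - y¹⁰, and taking
-- the exponents ≡ r modulo 5 is a finite computation with integer polynomials.
module Submission where

open import Level using (0ℓ)
open import Algebra.Bundles using (CommutativeRing; CommutativeMonoid)
open import Data.Bool using (true; false; if_then_else_)
import Data.Bool as Bool
open import Data.Empty using (⊥-elim)
open import Data.Fin using (Fin; zero; suc)
open import Data.Integer as ℤ using (ℤ; +_; -[1+_])
import Data.Integer.DivMod as ℤ÷
import Data.Integer.Properties as ℤₚ
open import Data.List as L using (List; []; _∷_; _++_; length; upTo; concatMap)
import Data.List.Properties as Lₚ
open import Data.Nat as ℕ using (ℕ; zero; suc; z≤n; s≤s)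
open import Data.Nat.ListAction using () renaming (sum to sumℕ)
import Data.Nat.Properties as ℕₚ
import Data.Nat.Solver
open import Data.Product using (_×_; _,_; proj₁; proj₂)
open import Data.Rational as ℚ using (ℚ; 0ℚ; 1ℚ; _/_)
import Data.Rational.Properties as ℚₚ
open import Data.Rational.Unnormalised as ℚᵘ using (mkℚᵘ; *≡*)
import Data.Rational.Unnormalised.Properties as ℚᵘₚ
open import Data.Sum using (inj₁; inj₂)
open import Data.Unit using (tt)
open import Data.Vec as Vec using (Vec; []; _∷_; lookup; tabulate; replicate)
open import Data.Vec.N-ary using (N-ary; _$ⁿ_)
import Defs as D
open import Function using (_∘_)
open import Relation.Binary.PropositionalEquality as ≡ using (_≡_)
open import Relation.Nullary using (yes; no; ¬_)
open import Relation.Nullary.Decidable using (⌊_⌋)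
open import Relation.Nullary.Negation using (contradiction)

-- The weights 0, 1, 3, -3, -1 sum to zero, so they extend to a linear functional on ℚ(ζ). Being
-- odd, it kills ℚ(ζ + ζ⁻¹), and only the components along ζ - ζ⁴ and ζ² - ζ³ survive. Dual numbers
-- replace the derivative in x: infinite products stay products, and first-order terms are read off
-- algebraically. Inverting T(x) to first order costs a square of T(ζ), which its conjugate turns
-- into powers of 1 - y - y². The numerators are again multiples of 1 - y - y²; this is why the
-- extracted parts are divisible by 1 - 11w - w². The S in G₄ does not come out of the dissection,
-- where both derivative series are eliminated. On the right-hand side S is replaced by its
-- evaluation, after which both sides are polynomials in q and inverse products. Divisions are
-- postponed: identities are first multiplied by 10a³b³ or by powers of a, b, e, and reductions
-- modulo ε² or the cyclotomic polynomial carry explicit cofactors, because the normal forms know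
-- only the laws of commutative rings.

-- Normal forms of integer polynomials in several variables

module PolynomialSyntax where
  infixl 6 _⊞_ _⊟_
  infixl 7 _⊠_
  infixr 8 _⊡_
  infix 8 ⊖_
  infix 4 _⊜_

  data Ex (n : ℕ) : Set where
    var : Fin n → Ex n
    con : ℤ → Ex n
    _⊞_ _⊠_ _⊟_ : Ex n → Ex n → Ex n
    _⊡_ : Ex n → ℕ → Ex n
    ⊖_ : Ex n → Ex n

  _⊜_ : ∀ {n} → Ex n → Ex n → Ex n × Ex n
  _⊜_ = _,_

  Monomial : ℕ → Set
  Monomial = Vec ℕ

  Poly : ℕ → Set
  Poly n = List (Monomial n × ℤ)

  data Cmp {n} (m m′ : Monomial n) : Set where
    lt gt : Cmp m m′
    eq : m ≡ m′ → Cmp m m′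

  cmp : ∀ {n} (m m′ : Monomial n) → Cmp m m′
  cmp [] [] = eq ≡.refl
  cmp (k ∷ m) (k′ ∷ m′) with k ℕ.≟ k′
  ... | no _ with k ℕ.<ᵇ k′
  ...   | true = lt
  ...   | false = gt
  cmp (k ∷ m) (k′ ∷ m′) | yes p with cmp m m′
  ...   | lt = lt
  ...   | gt = gt
  ...   | eq q = eq (≡.cong₂ _∷_ p q)

  -- Zero coefficients disappear and `ins` keeps the monomials in a fixed order, so equal
  -- polynomials end up as the same list.
  mk : ∀ {n} → Monomial n → ℤ → Poly n → Poly n
  mk m (+ 0) p = p
  mk m c p = (m , c) ∷ p

  ins : ∀ {n} → Monomial n → ℤ → Poly n → Poly n
  ins m c [] = mk m c []
  ins m c ((m′ , c′) ∷ p) with cmp m m′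
  ... | lt = mk m c ((m′ , c′) ∷ p)
  ... | gt = (m′ , c′) ∷ ins m c p
  ... | eq _ = mk m (c ℤ.+ c′) p

  addP : ∀ {n} → Poly n → Poly n → Poly n
  addP [] q = q
  addP ((m , c) ∷ p) q = ins m c (addP p q)

  mulM : ∀ {n} → Monomial n → Monomial n → Monomial n
  mulM [] [] = []
  mulM (k ∷ m) (l ∷ n) = (k ℕ.+ l) ∷ mulM m n

  scale : ∀ {n} → Monomial n → ℤ → Poly n → Poly n
  scale m c [] = []
  scale m c ((m′ , c′) ∷ p) = (mulM m m′ , c ℤ.* c′) ∷ scale m c p

  mulP : ∀ {n} → Poly n → Poly n → Poly n
  mulP [] q = []
  mulP ((m , c) ∷ p) q = addP (scale m c q) (mulP p q)

  conP : ∀ {n} → ℤ → Poly n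
  conP {n} c = mk (replicate n 0) c []

  powP : ∀ {n} → Poly n → ℕ → Poly n
  powP p zero = conP (+ 1)
  powP p (suc k) = mulP p (powP p k)

  unit : ∀ {n} → Fin n → Monomial n
  unit zero = 1 ∷ replicate _ 0
  unit (suc i) = 0 ∷ unit i

  norm : ∀ {n} → Ex n → List (Vec ℕ n × ℤ)
  norm (var i) = (unit i , + 1) ∷ []
  norm (con c) = conP c
  norm (e ⊞ f) = addP (norm e) (norm f)
  norm (e ⊠ f) = mulP (norm e) (norm f)
  norm (e ⊟ f) = addP (norm e) (mulP (conP -[1+ 0 ]) (norm f))
  norm (e ⊡ k) = powP (norm e) k
  norm (⊖ e) = mulP (conP -[1+ 0 ]) (norm e)

open PolynomialSyntax using (Ex; var; con; _⊞_; _⊠_; _⊟_; _⊡_; ⊖_; _⊜_)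

-- Commutative rings: polynomial identities, antidiagonal sums, the finite triple product

module RingKit (R : CommutativeRing 0ℓ 0ℓ) where
  open CommutativeRing R public hiding (zero)
  open PolynomialSyntax
  open import Algebra.Properties.Ring ring public
    using (-‿distribˡ-*; -‿distribʳ-*; -‿involutive; -0#≈0#; -‿+-comm; x∙y⁻¹≈ε⇒x≈y; +-cancelˡ)
  open import Algebra.Properties.Semiring.Exp semiring public
    using (_^_; ^-congˡ; ^-homo-*; ^-assocʳ)
  open import Algebra.Properties.CommutativeSemiring.Exp commutativeSemiring public
    using (^-distrib-*)
  open import Algebra.Properties.Semiring.Mult semiring
    using (×-homo-+; ×1-homo-*) renaming (_×_ to _×′_)
  open import Algebra.Properties.CommutativeSemigroup (CommutativeMonoid.commutativeSemigroup +-commutativeMonoid)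
    using (interchange)
  open import Algebra.Properties.CommutativeSemigroup (CommutativeMonoid.commutativeSemigroup *-commutativeMonoid)
    using () renaming (interchange to *-interchange)
  open import Relation.Binary.Reasoning.Setoid setoid

  ⟪_⟫ : ℤ → Carrier
  ⟪ + n ⟫ = n ×′ 1#
  ⟪ -[1+ n ] ⟫ = - (suc n ×′ 1#)

  private
    ⊖-hom : ∀ m n → ⟪ m ℤ.⊖ n ⟫ ≈ (m ×′ 1#) - (n ×′ 1#)
    ⊖-hom m zero = sym (trans (+-congˡ -0#≈0#) (+-identityʳ _))
    ⊖-hom zero (suc n) = sym (+-identityˡ _)
    ⊖-hom (suc m) (suc n) = begin
      ⟪ suc m ℤ.⊖ suc n ⟫                      ≡⟨ ≡.cong ⟪_⟫ (ℤₚ.[1+m]⊖[1+n]≡m⊖n m n) ⟩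
      ⟪ m ℤ.⊖ n ⟫                              ≈⟨ ⊖-hom m n ⟩
      (m ×′ 1#) - (n ×′ 1#)                    ≈⟨ +-identityˡ _ ⟨
      0# + ((m ×′ 1#) - (n ×′ 1#))             ≈⟨ +-congʳ (-‿inverseʳ 1#) ⟨
      (1# - 1#) + ((m ×′ 1#) - (n ×′ 1#))      ≈⟨ interchange _ _ _ _ ⟩
      (1# + m ×′ 1#) + (- 1# - (n ×′ 1#))      ≈⟨ +-congˡ (-‿+-comm _ _) ⟩
      (1# + m ×′ 1#) - (1# + n ×′ 1#)          ∎

  ⟪⟫-+ : ∀ i j → ⟪ i ℤ.+ j ⟫ ≈ ⟪ i ⟫ + ⟪ j ⟫
  ⟪⟫-+ (+ m) (+ n) = ×-homo-+ 1# m n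
  ⟪⟫-+ (+ m) -[1+ n ] = ⊖-hom m (suc n)
  ⟪⟫-+ -[1+ m ] (+ n) = trans (⊖-hom n (suc m)) (+-comm _ _)
  ⟪⟫-+ -[1+ m ] -[1+ n ] = begin
    - (suc (suc (m ℕ.+ n)) ×′ 1#)            ≡⟨ ≡.cong (λ k → - (k ×′ 1#)) (≡.cong suc (≡.sym (ℕₚ.+-suc m n))) ⟩
    - ((suc m ℕ.+ suc n) ×′ 1#)              ≈⟨ -‿cong (×-homo-+ 1# (suc m) (suc n)) ⟩
    - (suc m ×′ 1# + suc n ×′ 1#)            ≈⟨ -‿+-comm _ _ ⟨
    - (suc m ×′ 1#) - (suc n ×′ 1#)          ∎

  ⟪⟫-neg : ∀ i → ⟪ ℤ.- i ⟫ ≈ - ⟪ i ⟫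
  ⟪⟫-neg (+ zero) = sym -0#≈0#
  ⟪⟫-neg (+ suc n) = refl
  ⟪⟫-neg -[1+ n ] = sym (-‿involutive _)

  private
    ⟪⟫-*⁺ : ∀ m j → ⟪ + m ℤ.* j ⟫ ≈ ⟪ + m ⟫ * ⟪ j ⟫
    ⟪⟫-*⁺ m (+ n) = trans (reflexive (≡.cong ⟪_⟫ (≡.sym (ℤₚ.pos-* m n)))) (×1-homo-* m n)
    ⟪⟫-*⁺ m -[1+ n ] = begin
      ⟪ + m ℤ.* -[1+ n ] ⟫            ≡⟨ ≡.cong ⟪_⟫ (ℤₚ.neg-distribʳ-* (+ m) (+ suc n)) ⟨
      ⟪ ℤ.- (+ m ℤ.* + suc n) ⟫       ≈⟨ ⟪⟫-neg (+ m ℤ.* + suc n) ⟩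
      - ⟪ + m ℤ.* + suc n ⟫           ≈⟨ -‿cong (⟪⟫-*⁺ m (+ suc n)) ⟩
      - (⟪ + m ⟫ * ⟪ + suc n ⟫)       ≈⟨ -‿distribʳ-* _ _ ⟩
      ⟪ + m ⟫ * - ⟪ + suc n ⟫         ∎

  ⟪⟫-* : ∀ i j → ⟪ i ℤ.* j ⟫ ≈ ⟪ i ⟫ * ⟪ j ⟫
  ⟪⟫-* (+ m) j = ⟪⟫-*⁺ m j
  ⟪⟫-* -[1+ m ] j = begin
    ⟪ -[1+ m ] ℤ.* j ⟫              ≡⟨ ≡.cong ⟪_⟫ (ℤₚ.neg-distribˡ-* (+ suc m) j) ⟨
    ⟪ ℤ.- (+ suc m ℤ.* j) ⟫         ≈⟨ ⟪⟫-neg (+ suc m ℤ.* j) ⟩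
    - ⟪ + suc m ℤ.* j ⟫             ≈⟨ -‿cong (⟪⟫-*⁺ (suc m) j) ⟩
    - (⟪ + suc m ⟫ * ⟪ j ⟫)         ≈⟨ -‿distribˡ-* _ _ ⟩
    - ⟪ + suc m ⟫ * ⟪ j ⟫           ∎

  ⟪1⟫ : ⟪ + 1 ⟫ ≈ 1#
  ⟪1⟫ = +-identityʳ 1#

  -- The constants 0 and 1 have clauses of their own because `⟪ + 1 ⟫` unfolds to `1# + 0#`;
  -- evaluated identities then contain the zero and unit of the ring itself.
  ⟦_⟧ : ∀ {n} → Ex n → Vec Carrier n → Carrier
  ⟦ var i ⟧ ρ = lookup ρ i
  ⟦ con (+ 0) ⟧ ρ = 0#
  ⟦ con (+ 1) ⟧ ρ = 1#
  ⟦ con i ⟧ ρ = ⟪ i ⟫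
  ⟦ e ⊞ f ⟧ ρ = ⟦ e ⟧ ρ + ⟦ f ⟧ ρ
  ⟦ e ⊠ f ⟧ ρ = ⟦ e ⟧ ρ * ⟦ f ⟧ ρ
  ⟦ e ⊟ f ⟧ ρ = ⟦ e ⟧ ρ - ⟦ f ⟧ ρ
  ⟦ e ⊡ k ⟧ ρ = ⟦ e ⟧ ρ ^ k
  ⟦ ⊖ e ⟧ ρ = - ⟦ e ⟧ ρ

  con≈ : ∀ {n} (ρ : Vec Carrier n) c → ⟪ c ⟫ ≈ ⟦ con c ⟧ ρ
  con≈ ρ (+ 0) = refl
  con≈ ρ (+ 1) = ⟪1⟫
  con≈ ρ (+ suc (suc n)) = refl
  con≈ ρ -[1+ n ] = refl

  private
    evM : ∀ {n} → Vec Carrier n → Monomial n → Carrier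
    evM [] [] = 1#
    evM (x ∷ ρ) (k ∷ m) = x ^ k * evM ρ m

    ev : ∀ {n} → Vec Carrier n → Poly n → Carrier
    ev ρ [] = 0#
    ev ρ ((m , c) ∷ p) = ⟪ c ⟫ * evM ρ m + ev ρ p

    mk-ok : ∀ {n} (ρ : Vec Carrier n) m c p → ev ρ (mk m c p) ≈ ⟪ c ⟫ * evM ρ m + ev ρ p
    mk-ok ρ m (+ 0) p = sym (trans (+-congʳ (zeroˡ _)) (+-identityˡ _))
    mk-ok ρ m (+ suc n) p = refl
    mk-ok ρ m -[1+ n ] p = refl

    ins-ok : ∀ {n} (ρ : Vec Carrier n) m c p → ev ρ (ins m c p) ≈ ⟪ c ⟫ * evM ρ m + ev ρ p
    ins-ok ρ m c [] = mk-ok ρ m c []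
    ins-ok ρ m c ((m′ , c′) ∷ p) with cmp m m′
    ... | lt = mk-ok ρ m c ((m′ , c′) ∷ p)
    ... | gt = begin
      ⟪ c′ ⟫ * evM ρ m′ + ev ρ (ins m c p)               ≈⟨ +-congˡ (ins-ok ρ m c p) ⟩
      ⟪ c′ ⟫ * evM ρ m′ + (⟪ c ⟫ * evM ρ m + ev ρ p)     ≈⟨ +-assoc _ _ _ ⟨
      ⟪ c′ ⟫ * evM ρ m′ + ⟪ c ⟫ * evM ρ m + ev ρ p       ≈⟨ +-congʳ (+-comm _ _) ⟩
      ⟪ c ⟫ * evM ρ m + ⟪ c′ ⟫ * evM ρ m′ + ev ρ p       ≈⟨ +-assoc _ _ _ ⟩
      ⟪ c ⟫ * evM ρ m + (⟪ c′ ⟫ * evM ρ m′ + ev ρ p)     ∎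
    ... | eq ≡.refl = begin
      ev ρ (mk m (c ℤ.+ c′) p)                           ≈⟨ mk-ok ρ m (c ℤ.+ c′) p ⟩
      ⟪ c ℤ.+ c′ ⟫ * evM ρ m + ev ρ p                    ≈⟨ +-congʳ (*-congʳ (⟪⟫-+ c c′)) ⟩
      (⟪ c ⟫ + ⟪ c′ ⟫) * evM ρ m + ev ρ p                ≈⟨ +-congʳ (distribʳ _ _ _) ⟩
      ⟪ c ⟫ * evM ρ m + ⟪ c′ ⟫ * evM ρ m + ev ρ p        ≈⟨ +-assoc _ _ _ ⟩
      ⟪ c ⟫ * evM ρ m + (⟪ c′ ⟫ * evM ρ m + ev ρ p)      ∎

    addP-ok : ∀ {n} (ρ : Vec Carrier n) p q → ev ρ (addP p q) ≈ ev ρ p + ev ρ q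
    addP-ok ρ [] q = sym (+-identityˡ _)
    addP-ok ρ ((m , c) ∷ p) q = begin
      ev ρ (ins m c (addP p q))                 ≈⟨ ins-ok ρ m c (addP p q) ⟩
      ⟪ c ⟫ * evM ρ m + ev ρ (addP p q)         ≈⟨ +-congˡ (addP-ok ρ p q) ⟩
      ⟪ c ⟫ * evM ρ m + (ev ρ p + ev ρ q)       ≈⟨ +-assoc _ _ _ ⟨
      ⟪ c ⟫ * evM ρ m + ev ρ p + ev ρ q         ∎

    mulM-ok : ∀ {n} (ρ : Vec Carrier n) m m′ → evM ρ (mulM m m′) ≈ evM ρ m * evM ρ m′
    mulM-ok [] [] [] = sym (*-identityˡ 1#)
    mulM-ok (x ∷ ρ) (k ∷ m) (l ∷ m′) = begin
      x ^ (k ℕ.+ l) * evM ρ (mulM m m′)             ≈⟨ *-cong (^-homo-* x k l) (mulM-ok ρ m m′) ⟩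
      x ^ k * x ^ l * (evM ρ m * evM ρ m′)          ≈⟨ *-interchange _ _ _ _ ⟩
      x ^ k * evM ρ m * (x ^ l * evM ρ m′)          ∎

    scale-ok : ∀ {n} (ρ : Vec Carrier n) m c p → ev ρ (scale m c p) ≈ ⟪ c ⟫ * evM ρ m * ev ρ p
    scale-ok ρ m c [] = sym (zeroʳ _)
    scale-ok ρ m c ((m′ , c′) ∷ p) = begin
      ⟪ c ℤ.* c′ ⟫ * evM ρ (mulM m m′) + ev ρ (scale m c p)
        ≈⟨ +-cong (*-cong (⟪⟫-* c c′) (mulM-ok ρ m m′)) (scale-ok ρ m c p) ⟩
      ⟪ c ⟫ * ⟪ c′ ⟫ * (evM ρ m * evM ρ m′) + ⟪ c ⟫ * evM ρ m * ev ρ p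
        ≈⟨ +-congʳ (*-interchange _ _ _ _) ⟩
      ⟪ c ⟫ * evM ρ m * (⟪ c′ ⟫ * evM ρ m′) + ⟪ c ⟫ * evM ρ m * ev ρ p
        ≈⟨ distribˡ _ _ _ ⟨
      ⟪ c ⟫ * evM ρ m * (⟪ c′ ⟫ * evM ρ m′ + ev ρ p) ∎

    mulP-ok : ∀ {n} (ρ : Vec Carrier n) p q → ev ρ (mulP p q) ≈ ev ρ p * ev ρ q
    mulP-ok ρ [] q = sym (zeroˡ _)
    mulP-ok ρ ((m , c) ∷ p) q = begin
      ev ρ (addP (scale m c q) (mulP p q))           ≈⟨ addP-ok ρ (scale m c q) (mulP p q) ⟩
      ev ρ (scale m c q) + ev ρ (mulP p q)           ≈⟨ +-cong (scale-ok ρ m c q) (mulP-ok ρ p q) ⟩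
      ⟪ c ⟫ * evM ρ m * ev ρ q + ev ρ p * ev ρ q     ≈⟨ distribʳ _ _ _ ⟨
      (⟪ c ⟫ * evM ρ m + ev ρ p) * ev ρ q            ∎

    evM-0 : ∀ {n} (ρ : Vec Carrier n) → evM ρ (replicate n 0) ≈ 1#
    evM-0 [] = refl
    evM-0 (x ∷ ρ) = trans (*-identityˡ _) (evM-0 ρ)

    conP-ok : ∀ {n} (ρ : Vec Carrier n) c → ev ρ (conP c) ≈ ⟪ c ⟫
    conP-ok {n} ρ c = begin
      ev ρ (mk (replicate n 0) c [])                 ≈⟨ mk-ok ρ (replicate n 0) c [] ⟩
      ⟪ c ⟫ * evM ρ (replicate n 0) + 0#             ≈⟨ +-identityʳ _ ⟩
      ⟪ c ⟫ * evM ρ (replicate n 0)                  ≈⟨ *-congˡ (evM-0 ρ) ⟩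
      ⟪ c ⟫ * 1#                                     ≈⟨ *-identityʳ _ ⟩
      ⟪ c ⟫                                          ∎

    powP-ok : ∀ {n} (ρ : Vec Carrier n) p k → ev ρ (powP p k) ≈ ev ρ p ^ k
    powP-ok ρ p zero = trans (conP-ok ρ (+ 1)) ⟪1⟫
    powP-ok ρ p (suc k) = trans (mulP-ok ρ p (powP p k)) (*-congˡ (powP-ok ρ p k))

    unit-ok : ∀ {n} (ρ : Vec Carrier n) i → evM ρ (unit i) ≈ lookup ρ i
    unit-ok (x ∷ ρ) zero = trans (*-cong (*-identityʳ x) (evM-0 ρ)) (*-identityʳ x)
    unit-ok (x ∷ ρ) (suc i) = trans (*-identityˡ _) (unit-ok ρ i)

    negP-ok : ∀ {n} (ρ : Vec Carrier n) p → ev ρ (mulP (conP -[1+ 0 ]) p) ≈ - ev ρ p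
    negP-ok ρ p = begin
      ev ρ (mulP (conP -[1+ 0 ]) p)       ≈⟨ mulP-ok ρ (conP -[1+ 0 ]) p ⟩
      ev ρ (conP -[1+ 0 ]) * ev ρ p       ≈⟨ *-congʳ (trans (conP-ok ρ -[1+ 0 ]) (-‿cong ⟪1⟫)) ⟩
      - 1# * ev ρ p                       ≈⟨ trans (sym (-‿distribˡ-* _ _)) (-‿cong (*-identityˡ _)) ⟩
      - ev ρ p                            ∎

    norm-ok : ∀ {n} (ρ : Vec Carrier n) e → ev ρ (norm e) ≈ ⟦ e ⟧ ρ
    norm-ok ρ (var i) = begin
      ⟪ + 1 ⟫ * evM ρ (unit i) + 0#    ≈⟨ +-identityʳ _ ⟩
      ⟪ + 1 ⟫ * evM ρ (unit i)         ≈⟨ *-congʳ ⟪1⟫ ⟩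
      1# * evM ρ (unit i)              ≈⟨ *-identityˡ _ ⟩
      evM ρ (unit i)                   ≈⟨ unit-ok ρ i ⟩
      lookup ρ i                       ∎
    norm-ok ρ (con c) = trans (conP-ok ρ c) (con≈ ρ c)
    norm-ok ρ (e ⊞ f) = trans (addP-ok ρ (norm e) (norm f)) (+-cong (norm-ok ρ e) (norm-ok ρ f))
    norm-ok ρ (e ⊠ f) = trans (mulP-ok ρ (norm e) (norm f)) (*-cong (norm-ok ρ e) (norm-ok ρ f))
    norm-ok ρ (e ⊟ f) =
      trans (addP-ok ρ (norm e) _) (+-cong (norm-ok ρ e) (trans (negP-ok ρ (norm f)) (-‿cong (norm-ok ρ f))))
    norm-ok ρ (⊖ e) = trans (negP-ok ρ (norm e)) (-‿cong (norm-ok ρ e))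
    norm-ok ρ (e ⊡ k) = trans (powP-ok ρ (norm e) k) (^-congˡ k (norm-ok ρ e))

  data _≈ᵛ_ : ∀ {n} → Vec Carrier n → Vec Carrier n → Set where
    [] : [] ≈ᵛ []
    _∷_ : ∀ {n x y} {ρ σ : Vec Carrier n} → x ≈ y → ρ ≈ᵛ σ → (x ∷ ρ) ≈ᵛ (y ∷ σ)

  ⟦⟧-cong : ∀ {n} (e : Ex n) {ρ σ} → ρ ≈ᵛ σ → ⟦ e ⟧ ρ ≈ ⟦ e ⟧ σ
  ⟦⟧-cong (var zero) (p ∷ ps) = p
  ⟦⟧-cong (var (suc i)) (p ∷ ps) = ⟦⟧-cong (var i) ps
  ⟦⟧-cong (con (+ 0)) ps = refl
  ⟦⟧-cong (con (+ 1)) ps = refl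
  ⟦⟧-cong (con (+ suc (suc n))) ps = refl
  ⟦⟧-cong (con -[1+ n ]) ps = refl
  ⟦⟧-cong (e ⊞ f) ps = +-cong (⟦⟧-cong e ps) (⟦⟧-cong f ps)
  ⟦⟧-cong (e ⊠ f) ps = *-cong (⟦⟧-cong e ps) (⟦⟧-cong f ps)
  ⟦⟧-cong (e ⊟ f) ps = +-cong (⟦⟧-cong e ps) (-‿cong (⟦⟧-cong f ps))
  ⟦⟧-cong (e ⊡ k) ps = ^-congˡ k (⟦⟧-cong e ps)
  ⟦⟧-cong (⊖ e) ps = -‿cong (⟦⟧-cong e ps)

  AllVec : ∀ n → (Vec Carrier n → Set) → Set
  AllVec zero P = P []
  AllVec (suc n) P = ∀ x → AllVec n (P ∘ (x ∷_))

  private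
    curryAll : ∀ n {P : Vec Carrier n → Set} → (∀ ρ → P ρ) → AllVec n P
    curryAll zero f = f []
    curryAll (suc n) f x = curryAll n (f ∘ (x ∷_))

  -- An identity of integer polynomials is inherited by every commutative ring through ℤ → R, so
  -- comparing closed normal forms, by `≡.refl`, is enough. The same proof term serves ℤ,
  -- coefficient rings and rings of series.
  solve : ∀ n (f : N-ary n (Ex n) (Ex n × Ex n)) →
          let e = f $ⁿ tabulate var in
          norm (proj₁ e) ≡ norm (proj₂ e) →
          AllVec n (λ ρ → ⟦ proj₁ e ⟧ ρ ≈ ⟦ proj₂ e ⟧ ρ)
  solve n f p = curryAll n (λ ρ →
    let e = f $ⁿ tabulate var in
    trans (sym (norm-ok ρ (proj₁ e)))
      (trans (reflexive (≡.cong (ev ρ) p)) (norm-ok ρ (proj₂ e))))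

  -- Reduction modulo a relation r = 0. The cofactor t has to be supplied, since `solve` only sees
  -- free variables; in applications r is ε², the cyclotomic polynomial at ζ, or k u - 1 for a unit
  -- u.
  modulo : ∀ {y z r} t → r ≈ 0# → y ≈ z + r * t → y ≈ z
  modulo t h p = trans p (trans (+-congˡ (trans (*-congʳ h) (zeroˡ t))) (+-identityʳ _))

  cancel : ∀ {u f g} k → k * u ≈ 1# → u * f ≈ u * g → f ≈ g
  cancel {u} {f} {g} k h p = begin
    f              ≈⟨ *-identityˡ f ⟨
    1# * f         ≈⟨ *-congʳ h ⟨
    k * u * f      ≈⟨ trans (*-assoc k u f) (*-congˡ p) ⟩
    k * (u * g)    ≈⟨ *-assoc k u g ⟨
    k * u * g      ≈⟨ trans (*-congʳ h) (*-identityˡ g) ⟩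
    g              ∎

  -- Carrying both indices avoids truncated subtraction. The same sum is the Cauchy product of
  -- series and, with terms indexed by k - N, a symmetric bilateral sum.
  diagSum : ℕ → (ℕ → ℕ → Carrier) → Carrier
  diagSum zero f = f 0 0
  diagSum (suc n) f = f 0 (suc n) + diagSum n (λ k l → f (suc k) l)

  diagSum-cong : ∀ n {f g} → (∀ k l → k ℕ.+ l ≡ n → f k l ≈ g k l) → diagSum n f ≈ diagSum n g
  diagSum-cong zero h = h 0 0 ≡.refl
  diagSum-cong (suc n) h = +-cong (h 0 (suc n) ≡.refl)
    (diagSum-cong n (λ k l e → h (suc k) l (≡.cong suc e)))

  diagSum-+ : ∀ n f g → diagSum n (λ k l → f k l + g k l) ≈ diagSum n f + diagSum n g
  diagSum-+ zero f g = refl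
  diagSum-+ (suc n) f g = trans (+-congˡ (diagSum-+ n (λ k l → f (suc k) l) (λ k l → g (suc k) l))) (interchange _ _ _ _)

  diagSum-*ˡ : ∀ n c f → diagSum n (λ k l → c * f k l) ≈ c * diagSum n f
  diagSum-*ˡ zero c f = refl
  diagSum-*ˡ (suc n) c f = trans (+-congˡ (diagSum-*ˡ n c _)) (sym (distribˡ _ _ _))

  diagSum-0 : ∀ n {f} → (∀ k l → k ℕ.+ l ≡ n → f k l ≈ 0#) → diagSum n f ≈ 0#
  diagSum-0 zero h = h 0 0 ≡.refl
  diagSum-0 (suc n) h = trans (+-cong (h 0 (suc n) ≡.refl)
    (diagSum-0 n (λ k l e → h (suc k) l (≡.cong suc e)))) (+-identityˡ 0#)

  diagSum-last : ∀ n f → diagSum (suc n) f ≈ diagSum n (λ k l → f k (suc l)) + f (suc n) 0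
  diagSum-last zero f = refl
  diagSum-last (suc n) f = trans (+-congˡ (diagSum-last n (λ k l → f (suc k) l))) (sym (+-assoc _ _ _))

  diagSum-swap : ∀ n f → diagSum n f ≈ diagSum n (λ k l → f l k)
  diagSum-swap zero f = refl
  diagSum-swap (suc n) f = begin
    f 0 (suc n) + diagSum n (λ k l → f (suc k) l)     ≈⟨ +-congˡ (diagSum-swap n _) ⟩
    f 0 (suc n) + diagSum n (λ k l → f (suc l) k)     ≈⟨ +-comm _ _ ⟩
    diagSum n (λ k l → f (suc l) k) + f 0 (suc n)     ≈⟨ diagSum-last n (λ k l → f l k) ⟨
    diagSum (suc n) (λ k l → f l k)                   ∎

  diagSum-blocks : ∀ m f → diagSum (4 ℕ.+ m ℕ.* 5) f ≈ diagSum m (λ k l →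
    f (k ℕ.* 5) (4 ℕ.+ l ℕ.* 5) + (f (1 ℕ.+ k ℕ.* 5) (3 ℕ.+ l ℕ.* 5) +
    (f (2 ℕ.+ k ℕ.* 5) (2 ℕ.+ l ℕ.* 5) + (f (3 ℕ.+ k ℕ.* 5) (1 ℕ.+ l ℕ.* 5) +
    f (4 ℕ.+ k ℕ.* 5) (l ℕ.* 5)))))
  diagSum-blocks zero f = refl
  diagSum-blocks (suc m) f = trans
    (+-congˡ (+-congˡ (+-congˡ (+-congˡ (+-congˡ (diagSum-blocks m (λ k l → f (5 ℕ.+ k) l)))))))
    (solve 6 (λ a b c d e s → a ⊞ (b ⊞ (c ⊞ (d ⊞ (e ⊞ s)))) ⊜ (a ⊞ (b ⊞ (c ⊞ (d ⊞ e)))) ⊞ s)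
      ≡.refl _ _ _ _ _ _)

  -- A finite form of the Jacobi triple product for u v = p, with
  -- D n = (p;p)_n and I n = 1 / D n in place of q-binomial coefficients.
  module FiniteTripleProduct (u v p : Carrier) (uv≈p : u * v ≈ p)
    (D I : ℕ → Carrier) (D-0 : D 0 ≈ 1#) (D-suc : ∀ n → D (suc n) ≈ D n * (1# - p ^ suc n))
    (I-D : ∀ n → I n * D n ≈ 1#) where

    -- This is (-w)^j p^(j(j-1)/2), the j-th term of the theta series.
    geo : Carrier → ℕ → Carrier
    geo w zero = 1#
    geo w (suc j) = - (w * p ^ j * geo w j)

    zTerm : Carrier → Carrier → ℤ → Carrier
    zTerm w w′ (+ j) = geo w j
    zTerm w w′ -[1+ j ] = geo w′ (suc j)

    fin : Carrier → ℕ → Carrier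
    fin w zero = 1#
    fin w (suc n) = fin w n * (1# - w * p ^ n)

    private
      zTerm-0⊖ : ∀ w w′ m → zTerm w w′ (0 ℤ.⊖ m) ≈ geo w′ m
      zTerm-0⊖ w w′ zero = refl
      zTerm-0⊖ w w′ (suc m) = refl

      zTerm-swap : ∀ w w′ m n → zTerm w w′ (m ℤ.⊖ n) ≈ zTerm w′ w (n ℤ.⊖ m)
      zTerm-swap w w′ zero zero = refl
      zTerm-swap w w′ zero (suc n) = refl
      zTerm-swap w w′ (suc m) zero = refl
      zTerm-swap w w′ (suc m) (suc n) = begin
        zTerm w w′ (suc m ℤ.⊖ suc n)     ≡⟨ ≡.cong (zTerm w w′) (ℤₚ.[1+m]⊖[1+n]≡m⊖n m n) ⟩
        zTerm w w′ (m ℤ.⊖ n)             ≈⟨ zTerm-swap w w′ m n ⟩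
        zTerm w′ w (n ℤ.⊖ m)             ≡⟨ ≡.cong (zTerm w′ w) (ℤₚ.[1+m]⊖[1+n]≡m⊖n n m) ⟨
        zTerm w′ w (suc n ℤ.⊖ suc m)     ∎

      -- Consecutive terms have ratio -w p^j with j = k - M, and l + j = N. The case split keeps all
      -- exponents natural; at negative indices the ratio comes from `w * w′ ≈ p`.
      step : ∀ w w′ → w * w′ ≈ p → ∀ k M N l → k ℕ.+ l ≡ N ℕ.+ M →
             p ^ l * zTerm w w′ (suc k ℤ.⊖ M) ≈ - (w * p ^ N) * zTerm w w′ (k ℤ.⊖ M)
      step w w′ ww k zero N l e = begin
        p ^ l * - (w * p ^ k * geo w k)
          ≈⟨ solve 4 (λ a b c d → a ⊠ ⊖ (b ⊠ c ⊠ d) ⊜ ⊖ (b ⊠ (c ⊠ a)) ⊠ d) ≡.refl _ _ _ _ ⟩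
        - (w * (p ^ k * p ^ l)) * geo w k
          ≈⟨ *-congʳ (-‿cong (*-congˡ (sym (^-homo-* p k l)))) ⟩
        - (w * p ^ (k ℕ.+ l)) * geo w k
          ≡⟨ ≡.cong (λ n → - (w * p ^ n) * geo w k) (≡.trans e (ℕₚ.+-identityʳ N)) ⟩
        - (w * p ^ N) * geo w k ∎
      step w w′ ww zero (suc M) N l e = begin
        p ^ l * zTerm w w′ (1 ℤ.⊖ suc M)
          ≡⟨ ≡.cong₂ (λ n i → p ^ n * zTerm w w′ i) (≡.trans e (ℕₚ.+-suc N M)) (ℤₚ.[1+m]⊖[1+n]≡m⊖n 0 M) ⟩
        p ^ suc (N ℕ.+ M) * zTerm w w′ (0 ℤ.⊖ M)
          ≈⟨ *-cong (*-cong (sym ww) (^-homo-* p N M)) (zTerm-0⊖ w w′ M) ⟩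
        w * w′ * (p ^ N * p ^ M) * geo w′ M
          ≈⟨ solve 5 (λ a b c d g → a ⊠ b ⊠ (c ⊠ d) ⊠ g ⊜ ⊖ (a ⊠ c) ⊠ ⊖ (b ⊠ d ⊠ g)) ≡.refl _ _ _ _ _ ⟩
        - (w * p ^ N) * geo w′ (suc M) ∎
      step w w′ ww (suc k) (suc M) N l e = begin
        p ^ l * zTerm w w′ (suc (suc k) ℤ.⊖ suc M)
          ≡⟨ ≡.cong (λ i → p ^ l * zTerm w w′ i) (ℤₚ.[1+m]⊖[1+n]≡m⊖n (suc k) M) ⟩
        p ^ l * zTerm w w′ (suc k ℤ.⊖ M)
          ≈⟨ step w w′ ww k M N l (ℕₚ.suc-injective (≡.trans e (ℕₚ.+-suc N M))) ⟩
        - (w * p ^ N) * zTerm w w′ (k ℤ.⊖ M)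
          ≡⟨ ≡.cong (λ i → - (w * p ^ N) * zTerm w w′ i) (ℤₚ.[1+m]⊖[1+n]≡m⊖n k M) ⟨
        - (w * p ^ N) * zTerm w w′ (suc k ℤ.⊖ suc M) ∎

      -- This is 1/(p;p)_(k-1), with the value 0 at k = 0 so that `I-step` also holds where 1 - p^k
      -- vanishes. The boundary terms of the recurrences then drop out by themselves.
      J : ℕ → Carrier
      J zero = 0#
      J (suc k) = I k

      I-step : ∀ k → I k * (1# - p ^ k) ≈ J k
      I-step zero = trans (*-congˡ (-‿inverseʳ 1#)) (zeroʳ _)
      I-step (suc k) = begin
        I (suc k) * (1# - p ^ suc k)
          ≈⟨ *-identityˡ _ ⟨
        1# * (I (suc k) * (1# - p ^ suc k))
          ≈⟨ *-congʳ (I-D k) ⟨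
        I k * D k * (I (suc k) * (1# - p ^ suc k))
          ≈⟨ solve 4 (λ a b c d → a ⊠ b ⊠ (c ⊠ d) ⊜ a ⊠ (c ⊠ (b ⊠ d))) ≡.refl _ _ _ _ ⟩
        I k * (I (suc k) * (D k * (1# - p ^ suc k)))
          ≈⟨ *-congˡ (trans (*-congˡ (sym (D-suc k))) (I-D (suc k))) ⟩
        I k * 1#
          ≈⟨ *-identityʳ _ ⟩
        I k ∎

      I-0 : I 0 ≈ 1#
      I-0 = trans (sym (*-identityʳ _)) (trans (*-congˡ (sym D-0)) (I-D 0))

    term : ℕ → ℕ → ℕ → Carrier
    term M k l = I k * I l * zTerm u v (k ℤ.⊖ M)

    private
      -- The q-Pascal rule in the form 1 - p^(k+l) = (1 - p^l) + p^l (1 - p^k): each summand lowers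
      -- one index, and after reindexing `step` turns the second sum into -u p^N times the first.
      u-step : ∀ N M n → n ≡ N ℕ.+ M →
               diagSum (suc n) (term M) * D (suc n) ≈ diagSum n (term M) * D n * (1# - u * p ^ N)
      u-step N M n e = begin
        diagSum (suc n) (term M) * D (suc n)
          ≈⟨ trans (*-congˡ (trans (D-suc n) (*-comm _ _))) (trans (sym (*-assoc _ _ _)) (*-congʳ (trans (*-comm _ _) (sym (diagSum-*ˡ (suc n) _ (term M)))))) ⟩
        diagSum (suc n) (λ k l → (1# - p ^ suc n) * term M k l) * D n
          ≈⟨ *-congʳ (trans (diagSum-cong (suc n) split) (diagSum-+ (suc n) (λ k l → I k * J l * z k) (λ k l → J k * I l * (p ^ l * z k)))) ⟩
        (diagSum (suc n) (λ k l → I k * J l * z k) + diagSum (suc n) (λ k l → J k * I l * (p ^ l * z k))) * D n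
          ≈⟨ *-congʳ (+-cong
               (trans (diagSum-last n (λ k l → I k * J l * z k)) (trans (+-congˡ (trans (*-congʳ (zeroʳ _)) (zeroˡ _))) (+-identityʳ _)))
               (trans (+-congʳ (trans (*-congʳ (zeroˡ _)) (zeroˡ _))) (+-identityˡ _))) ⟩
        (diagSum n (term M) + diagSum n (λ k l → I k * I l * (p ^ l * z (suc k)))) * D n
          ≈⟨ *-congʳ (trans (sym (diagSum-+ n (term M) (λ k l → I k * I l * (p ^ l * z (suc k))))) (diagSum-cong n collect)) ⟩
        diagSum n (λ k l → (1# - u * p ^ N) * term M k l) * D n
          ≈⟨ *-congʳ (diagSum-*ˡ n _ (term M)) ⟩
        (1# - u * p ^ N) * diagSum n (term M) * D n
          ≈⟨ trans (*-assoc _ _ _) (*-comm _ _) ⟩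
        diagSum n (term M) * D n * (1# - u * p ^ N) ∎
        where
        z = λ k → zTerm u v (k ℤ.⊖ M)
        split : ∀ k l → k ℕ.+ l ≡ suc n →
                (1# - p ^ suc n) * term M k l ≈ I k * J l * z k + J k * I l * (p ^ l * z k)
        split k l f = begin
          (1# - p ^ suc n) * term M k l
            ≈⟨ *-congʳ (+-congˡ (-‿cong (trans (reflexive (≡.cong (p ^_) (≡.sym f))) (^-homo-* p k l)))) ⟩
          (1# - p ^ k * p ^ l) * (I k * I l * z k)
            ≈⟨ solve 5 (λ a b c d g → (con (+ 1) ⊟ a ⊠ b) ⊠ (c ⊠ d ⊠ g) ⊜
                 c ⊠ (d ⊠ (con (+ 1) ⊟ b)) ⊠ g ⊞ (c ⊠ (con (+ 1) ⊟ a)) ⊠ d ⊠ (b ⊠ g)) ≡.refl _ _ _ _ _ ⟩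
          I k * (I l * (1# - p ^ l)) * z k + (I k * (1# - p ^ k)) * I l * (p ^ l * z k)
            ≈⟨ +-cong (*-congʳ (*-congˡ (I-step l))) (*-congʳ (*-congʳ (I-step k))) ⟩
          I k * J l * z k + J k * I l * (p ^ l * z k) ∎
        collect : ∀ k l → k ℕ.+ l ≡ n →
                  term M k l + I k * I l * (p ^ l * z (suc k)) ≈ (1# - u * p ^ N) * term M k l
        collect k l f = trans (+-congˡ (*-congˡ (step u v uv≈p k M N l (≡.trans f e))))
          (solve 3 (λ i x y → i ⊠ x ⊞ i ⊠ (⊖ y ⊠ x) ⊜ (con (+ 1) ⊟ y) ⊠ (i ⊠ x)) ≡.refl _ _ _)

      -- The mirror rule 1 - p^(k+l) = (1 - p^k) + p^k (1 - p^l). Since M changes, the terms are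
      -- recentred, and `step` is applied with u and v exchanged.
      v-step : ∀ M n → diagSum (suc n) (term (suc M)) * D (suc n) ≈ diagSum n (term M) * D n * (1# - v * p ^ M)
      v-step M n = begin
        diagSum (suc n) (term (suc M)) * D (suc n)
          ≈⟨ trans (*-congˡ (trans (D-suc n) (*-comm _ _))) (trans (sym (*-assoc _ _ _)) (*-congʳ (trans (*-comm _ _) (sym (diagSum-*ˡ (suc n) _ (term (suc M))))))) ⟩
        diagSum (suc n) (λ k l → (1# - p ^ suc n) * term (suc M) k l) * D n
          ≈⟨ *-congʳ (trans (diagSum-cong (suc n) split) (diagSum-+ (suc n) (λ k l → J k * I l * z k) (λ k l → I k * J l * (p ^ k * z k)))) ⟩
        (diagSum (suc n) (λ k l → J k * I l * z k) + diagSum (suc n) (λ k l → I k * J l * (p ^ k * z k))) * D n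
          ≈⟨ *-congʳ (+-cong
               (trans (+-congʳ (trans (*-congʳ (zeroˡ _)) (zeroˡ _))) (+-identityˡ _))
               (trans (diagSum-last n (λ k l → I k * J l * (p ^ k * z k))) (trans (+-congˡ (trans (*-congʳ (zeroʳ _)) (zeroˡ _))) (+-identityʳ _)))) ⟩
        (diagSum n (λ k l → I k * I l * z (suc k)) + diagSum n (λ k l → I k * I l * (p ^ k * z k))) * D n
          ≈⟨ *-congʳ (trans (sym (diagSum-+ n (λ k l → I k * I l * z (suc k)) (λ k l → I k * I l * (p ^ k * z k)))) (diagSum-cong n collect)) ⟩
        diagSum n (λ k l → (1# - v * p ^ M) * term M k l) * D n
          ≈⟨ *-congʳ (diagSum-*ˡ n _ (term M)) ⟩
        (1# - v * p ^ M) * diagSum n (term M) * D n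
          ≈⟨ trans (*-assoc _ _ _) (*-comm _ _) ⟩
        diagSum n (term M) * D n * (1# - v * p ^ M) ∎
        where
        z = λ k → zTerm u v (k ℤ.⊖ suc M)
        split : ∀ k l → k ℕ.+ l ≡ suc n →
                (1# - p ^ suc n) * term (suc M) k l ≈ J k * I l * z k + I k * J l * (p ^ k * z k)
        split k l f = begin
          (1# - p ^ suc n) * term (suc M) k l
            ≈⟨ *-congʳ (+-congˡ (-‿cong (trans (reflexive (≡.cong (p ^_) (≡.sym f))) (^-homo-* p k l)))) ⟩
          (1# - p ^ k * p ^ l) * (I k * I l * z k)
            ≈⟨ solve 5 (λ a b c d g → (con (+ 1) ⊟ a ⊠ b) ⊠ (c ⊠ d ⊠ g) ⊜
                 (c ⊠ (con (+ 1) ⊟ a)) ⊠ d ⊠ g ⊞ c ⊠ (d ⊠ (con (+ 1) ⊟ b)) ⊠ (a ⊠ g)) ≡.refl _ _ _ _ _ ⟩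
          (I k * (1# - p ^ k)) * I l * z k + I k * (I l * (1# - p ^ l)) * (p ^ k * z k)
            ≈⟨ +-cong (*-congʳ (*-congʳ (I-step k))) (*-congʳ (*-congˡ (I-step l))) ⟩
          J k * I l * z k + I k * J l * (p ^ k * z k) ∎
        collect : ∀ k l → k ℕ.+ l ≡ n →
                  I k * I l * z (suc k) + I k * I l * (p ^ k * z k) ≈ (1# - v * p ^ M) * term M k l
        collect k l f = begin
          I k * I l * z (suc k) + I k * I l * (p ^ k * z k)
            ≈⟨ +-cong (*-congˡ (reflexive (≡.cong (zTerm u v) (ℤₚ.[1+m]⊖[1+n]≡m⊖n k M))))
                      (*-congˡ (trans (*-congˡ (zTerm-swap u v k (suc M)))
                        (trans (step v u (trans (*-comm v u) uv≈p) M k M k ≡.refl)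
                        (*-congˡ (zTerm-swap v u M k))))) ⟩
          I k * I l * zTerm u v (k ℤ.⊖ M) + I k * I l * (- (v * p ^ M) * zTerm u v (k ℤ.⊖ M))
            ≈⟨ solve 3 (λ i x y → i ⊠ x ⊞ i ⊠ (⊖ y ⊠ x) ⊜ (con (+ 1) ⊟ y) ⊠ (i ⊠ x)) ≡.refl _ _ _ ⟩
          (1# - v * p ^ M) * term M k l ∎

    -- `D n * I k * I l` is the q-binomial coefficient, so this is the q-binomial theorem recentred
    -- at M. The induction peels off the factors in v by `v-step`, then those in u by `u-step`.
    finite-tripleProduct : ∀ N M n → n ≡ N ℕ.+ M → diagSum n (term M) * D n ≈ fin u N * fin v M
    finite-tripleProduct zero zero .0 ≡.refl = begin
      I 0 * I 0 * 1# * D 0   ≈⟨ *-cong (trans (*-identityʳ _) (*-cong I-0 I-0)) D-0 ⟩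
      1# * 1# * 1#           ≈⟨ *-identityʳ _ ⟩
      1# * 1#                ∎
    finite-tripleProduct (suc N) zero .(suc (N ℕ.+ 0)) ≡.refl = begin
      diagSum (suc (N ℕ.+ 0)) (term 0) * D (suc (N ℕ.+ 0))              ≈⟨ u-step N 0 (N ℕ.+ 0) ≡.refl ⟩
      diagSum (N ℕ.+ 0) (term 0) * D (N ℕ.+ 0) * (1# - u * p ^ N)       ≈⟨ *-congʳ (finite-tripleProduct N zero _ ≡.refl) ⟩
      fin u N * 1# * (1# - u * p ^ N)                              ≈⟨ trans (*-congʳ (*-identityʳ _)) (sym (*-identityʳ _)) ⟩
      fin u N * (1# - u * p ^ N) * 1#                              ∎
    finite-tripleProduct N (suc M) n e with ≡.trans e (ℕₚ.+-suc N M)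
    ... | ≡.refl = begin
      diagSum (suc (N ℕ.+ M)) (term (suc M)) * D (suc (N ℕ.+ M))        ≈⟨ v-step M (N ℕ.+ M) ⟩
      diagSum (N ℕ.+ M) (term M) * D (N ℕ.+ M) * (1# - v * p ^ M)       ≈⟨ *-congʳ (finite-tripleProduct N M _ ≡.refl) ⟩
      fin u N * fin v M * (1# - v * p ^ M)                         ≈⟨ *-assoc _ _ _ ⟩
      fin u N * (fin v M * (1# - v * p ^ M))                       ∎

-- Formal power series, congruences modulo powers of q, inverses and infinite products

module Series (K : CommutativeRing 0ℓ 0ℓ) where
  module K = RingKit K

  S : Set
  S = ℕ → K.Carrier

  infix 4 _≋_ _≋[_]_

  -- A record rather than a bare family of coefficient equations, so that f and g can be recovered
  -- from the type of a proof.
  record _≋_ (f g : S) : Set where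
    constructor ⟨_⟩
    field at : ∀ n → f n K.≈ g n
  open _≋_ public

  cst : K.Carrier → S
  cst c zero = c
  cst c (suc n) = K.0#

  private
    infixl 6 _⊕_
    infixl 7 _⊛_

    _⊕_ _⊛_ : S → S → S
    (f ⊕ g) n = f n K.+ g n
    (f ⊛ g) n = K.diagSum n (λ k l → f k K.* g l)

    neg : S → S
    neg f n = K.- f n

    tail : S → S
    tail f n = f (suc n)

    ⊛-cong : ∀ {f f′ g g′} → f ≋ f′ → g ≋ g′ → (f ⊛ g) ≋ (f′ ⊛ g′)
    ⊛-cong p q = ⟨ (λ n → K.diagSum-cong n (λ k l _ → K.*-cong (at p k) (at q l))) ⟩

    ⊛-comm : ∀ f g → (f ⊛ g) ≋ (g ⊛ f)
    ⊛-comm f g = ⟨ (λ n → K.trans (K.diagSum-swap n _) (K.diagSum-cong n (λ k l _ → K.*-comm _ _))) ⟩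

    ⊛-distribʳ : ∀ h f g → ((f ⊕ g) ⊛ h) ≋ ((f ⊛ h) ⊕ (g ⊛ h))
    ⊛-distribʳ h f g = ⟨ (λ n → K.trans (K.diagSum-cong n (λ k l _ → K.distribʳ _ _ _))
      (K.diagSum-+ n (λ k l → f k K.* h l) (λ k l → g k K.* h l))) ⟩

    ⊛-identityˡ : ∀ f → (cst K.1# ⊛ f) ≋ f
    ⊛-identityˡ f = ⟨ go ⟩
      where
      go : ∀ n → (cst K.1# ⊛ f) n K.≈ f n
      go zero = K.*-identityˡ _
      go (suc n) = K.trans (K.+-cong (K.*-identityˡ _) (K.diagSum-0 n (λ k l _ → K.zeroˡ _))) (K.+-identityʳ _)

    ⊛-assoc : ∀ f g h → ((f ⊛ g) ⊛ h) ≋ (f ⊛ (g ⊛ h))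
    ⊛-assoc f g h = ⟨ (λ n → go n f) ⟩
      where
      open import Relation.Binary.Reasoning.Setoid K.setoid
      go : ∀ n f → ((f ⊛ g) ⊛ h) n K.≈ (f ⊛ (g ⊛ h)) n
      go zero f = K.*-assoc _ _ _
      go (suc n) f = begin
        f 0 K.* g 0 K.* h (suc n) K.+ K.diagSum n (λ k l → (f 0 K.* g (suc k) K.+ (tail f ⊛ g) k) K.* h l)
          ≈⟨ K.+-cong (K.*-assoc _ _ _) (K.trans (K.diagSum-cong n (λ k l _ → K.trans (K.distribʳ _ _ _) (K.+-congʳ (K.*-assoc _ _ _))))
               (K.diagSum-+ n (λ k l → f 0 K.* (g (suc k) K.* h l)) (λ k l → (tail f ⊛ g) k K.* h l))) ⟩
        f 0 K.* (g 0 K.* h (suc n)) K.+ (K.diagSum n (λ k l → f 0 K.* (g (suc k) K.* h l)) K.+ ((tail f ⊛ g) ⊛ h) n)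
          ≈⟨ K.+-congˡ (K.+-cong (K.diagSum-*ˡ n _ (λ k l → g (suc k) K.* h l)) (go n (tail f))) ⟩
        f 0 K.* (g 0 K.* h (suc n)) K.+ (f 0 K.* K.diagSum n (λ k l → g (suc k) K.* h l) K.+ (tail f ⊛ (g ⊛ h)) n)
          ≈⟨ K.trans (K.sym (K.+-assoc _ _ _)) (K.+-congʳ (K.sym (K.distribˡ _ _ _))) ⟩
        (f ⊛ (g ⊛ h)) (suc n) ∎

  seriesRing : CommutativeRing 0ℓ 0ℓ
  seriesRing = record
    { Carrier = S ; _≈_ = _≋_ ; _+_ = _⊕_ ; _*_ = _⊛_ ; -_ = neg ; 0# = λ n → K.0# ; 1# = cst K.1#
    ; isCommutativeRing = record
      { isRing = record
        { +-isAbelianGroup = record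
          { isGroup = record
            { isMonoid = record
              { isSemigroup = record
                { isMagma = record
                  { isEquivalence = record
                    { refl = ⟨ (λ n → K.refl) ⟩
                    ; sym = λ p → ⟨ (λ n → K.sym (at p n)) ⟩
                    ; trans = λ p q → ⟨ (λ n → K.trans (at p n) (at q n)) ⟩ }
                  ; ∙-cong = λ p q → ⟨ (λ n → K.+-cong (at p n) (at q n)) ⟩ }
                ; assoc = λ f g h → ⟨ (λ n → K.+-assoc _ _ _) ⟩ }
              ; identity = (λ f → ⟨ (λ n → K.+-identityˡ _) ⟩) , (λ f → ⟨ (λ n → K.+-identityʳ _) ⟩) }
            ; inverse = (λ f → ⟨ (λ n → K.-‿inverseˡ _) ⟩) , (λ f → ⟨ (λ n → K.-‿inverseʳ _) ⟩)
            ; ⁻¹-cong = λ p → ⟨ (λ n → K.-‿cong (at p n)) ⟩ }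
          ; comm = λ f g → ⟨ (λ n → K.+-comm _ _) ⟩ }
        ; *-cong = ⊛-cong
        ; *-assoc = ⊛-assoc
        ; *-identity = ⊛-identityˡ , (λ f → ⟨ (λ n → K.trans (at (⊛-comm f (cst K.1#)) n) (at (⊛-identityˡ f) n)) ⟩)
        ; distrib = (λ h f g → ⟨ (λ n → K.trans (at (⊛-comm h (f ⊕ g)) n) (K.trans (at (⊛-distribʳ h f g) n)
                      (K.+-cong (at (⊛-comm f h) n) (at (⊛-comm g h) n)))) ⟩)
                  , ⊛-distribʳ }
      ; *-comm = ⊛-comm } }

  open RingKit seriesRing public
  module ≋-Reasoning where
    open import Relation.Binary.Reasoning.Setoid setoid public

  -- Congruence modulo q^n, the q-adic substitute for convergence.
  record _≋[_]_ (f : S) (n : ℕ) (g : S) : Set where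
    constructor ⟨_⟩
    field below : ∀ i → i ℕ.< n → f i K.≈ g i
  open _≋[_]_ public

  mod-refl : ∀ {f n} → f ≋[ n ] f
  mod-refl = ⟨ (λ _ _ → K.refl) ⟩

  mod-≈ : ∀ {f g n} → f ≋ g → f ≋[ n ] g
  mod-≈ p = ⟨ (λ i _ → at p i) ⟩

  mod-sym : ∀ {f g n} → f ≋[ n ] g → g ≋[ n ] f
  mod-sym p = ⟨ (λ i h → K.sym (below p i h)) ⟩

  mod-trans : ∀ {f g h n} → f ≋[ n ] g → g ≋[ n ] h → f ≋[ n ] h
  mod-trans p q = ⟨ (λ i h → K.trans (below p i h) (below q i h)) ⟩

  mod-weaken : ∀ {f g m n} → m ℕ.≤ n → f ≋[ n ] g → f ≋[ m ] g
  mod-weaken le p = ⟨ (λ i h → below p i (ℕₚ.<-≤-trans h le)) ⟩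

  mod-+ : ∀ {f f′ g g′ n} → f ≋[ n ] f′ → g ≋[ n ] g′ → f + g ≋[ n ] f′ + g′
  mod-+ p q = ⟨ (λ i h → K.+-cong (below p i h) (below q i h)) ⟩

  mod-neg : ∀ {f f′ n} → f ≋[ n ] f′ → - f ≋[ n ] - f′
  mod-neg p = ⟨ (λ i h → K.-‿cong (below p i h)) ⟩

  mod-* : ∀ {f f′ g g′ n} → f ≋[ n ] f′ → g ≋[ n ] g′ → f * g ≋[ n ] f′ * g′
  mod-* p q = ⟨ (λ i h → K.diagSum-cong i (λ k l e → K.*-cong
    (below p k (ℕₚ.≤-<-trans (ℕₚ.≤-trans (ℕₚ.m≤m+n k l) (ℕₚ.≤-reflexive e)) h))
    (below q l (ℕₚ.≤-<-trans (ℕₚ.≤-trans (ℕₚ.m≤n+m l k) (ℕₚ.≤-reflexive e)) h)))) ⟩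

  mod-limit : ∀ {f g} → (∀ n → f ≋[ n ] g) → f ≋ g
  mod-limit h = ⟨ (λ n → below (h (suc n)) n ℕₚ.≤-refl) ⟩

  -- The passage from finite to infinite identities: a truncated sum or product F n is shown to
  -- approximate both sides.
  limit-unique : ∀ (F : ℕ → S) {f g} → (∀ n → F n ≋[ n ] f) → (∀ n → F n ≋[ n ] g) → f ≋ g
  limit-unique F p q = mod-limit (λ n → mod-trans (mod-sym (p n)) (q n))

  mod-diagSum : ∀ n {F G : ℕ → ℕ → S} {m} → (∀ k l → k ℕ.+ l ≡ n → F k l ≋[ m ] G k l) → diagSum n F ≋[ m ] diagSum n G
  mod-diagSum zero h = h 0 0 ≡.refl
  mod-diagSum (suc n) h = mod-+ (h 0 (suc n) ≡.refl) (mod-diagSum n (λ k l e → h (suc k) l (≡.cong suc e)))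

  O-* : ∀ {f g} m n → f ≋[ m ] 0# → g ≋[ n ] 0# → f * g ≋[ m ℕ.+ n ] 0#
  O-* {f} {g} m n p q = ⟨ (λ i h → K.diagSum-0 i (go i h)) ⟩
    where
    go : ∀ i → i ℕ.< m ℕ.+ n → ∀ k l → k ℕ.+ l ≡ i → f k K.* g l K.≈ K.0#
    go i h k l e with k ℕ.<? m
    ... | yes k<m = K.trans (K.*-congʳ (below p k k<m)) (K.zeroˡ _)
    ... | no k≮m with l ℕ.<? n
    ...   | yes l<n = K.trans (K.*-congˡ (below q l l<n)) (K.zeroʳ _)
    ...   | no l≮n = ⊥-elim (ℕₚ.<⇒≱ h (ℕₚ.≤-trans (ℕₚ.+-mono-≤ (ℕₚ.≮⇒≥ k≮m) (ℕₚ.≮⇒≥ l≮n)) (ℕₚ.≤-reflexive e)))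

  opaque
    mono : K.Carrier → ℕ → S
    mono c zero n = cst c n
    mono c (suc e) zero = K.0#
    mono c (suc e) (suc n) = mono c e n

    mono-cong : ∀ {c d e e′} → c K.≈ d → e ≡ e′ → mono c e ≋ mono d e′
    mono-cong {c} {d} {e} p ≡.refl = ⟨ go e ⟩
      where
      go : ∀ e n → mono c e n K.≈ mono d e n
      go zero zero = p
      go zero (suc n) = K.refl
      go (suc e) zero = K.refl
      go (suc e) (suc n) = go e n

    cst-* : ∀ c f n → (cst c * f) n K.≈ c K.* f n
    cst-* c f zero = K.refl
    cst-* c f (suc n) = K.trans (K.+-congˡ (K.diagSum-0 n (λ k l _ → K.zeroˡ _))) (K.+-identityʳ _)

    mono-shift : ∀ c e f n → (mono c e * f) (e ℕ.+ n) K.≈ c K.* f n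
    mono-shift c zero f n = cst-* c f n
    mono-shift c (suc e) f n = K.trans (K.+-congʳ (K.zeroˡ _)) (K.trans (K.+-identityˡ _) (mono-shift c e f n))

    O-mono : ∀ c e → mono c e ≋[ e ] 0#
    O-mono c e = ⟨ go e ⟩
      where
      go : ∀ e n → n ℕ.< e → mono c e n K.≈ K.0#
      go (suc e) zero h = K.refl
      go (suc e) (suc n) (s≤s h) = go e n h

    mono-* : ∀ c d e e′ → mono c e * mono d e′ ≋ mono (c K.* d) (e ℕ.+ e′)
    mono-* c d e e′ = ⟨ go e ⟩
      where
      scl : ∀ e n → c K.* mono d e n K.≈ mono (c K.* d) e n
      scl zero zero = K.refl
      scl zero (suc n) = K.zeroʳ _
      scl (suc e) zero = K.zeroʳ _
      scl (suc e) (suc n) = scl e n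
      go : ∀ e n → (mono c e * mono d e′) n K.≈ mono (c K.* d) (e ℕ.+ e′) n
      go zero n = K.trans (cst-* c (mono d e′) n) (scl e′ n)
      go (suc e) zero = K.zeroˡ _
      go (suc e) (suc n) = K.trans (K.+-congʳ (K.zeroˡ _)) (K.trans (K.+-identityˡ _) (go e n))

    mono-0 : ∀ c → mono c 0 ≋ cst c
    mono-0 c = ⟨ (λ n → K.refl) ⟩

    mono-neg : ∀ c e → mono (K.- c) e ≋ - mono c e
    mono-neg c e = ⟨ go e ⟩
      where
      go : ∀ e n → mono (K.- c) e n K.≈ K.- mono c e n
      go zero zero = K.refl
      go zero (suc n) = K.sym K.-0#≈0#
      go (suc e) zero = K.sym K.-0#≈0#
      go (suc e) (suc n) = go e n

    mono-+ : ∀ c d e → mono (c K.+ d) e ≋ mono c e + mono d e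
    mono-+ c d e = ⟨ go e ⟩
      where
      go : ∀ e n → mono (c K.+ d) e n K.≈ mono c e n K.+ mono d e n
      go zero zero = K.refl
      go zero (suc n) = K.sym (K.+-identityˡ _)
      go (suc e) zero = K.sym (K.+-identityˡ _)
      go (suc e) (suc n) = go e n

    mono-^ : ∀ c e k → mono c e ^ k ≋ mono (c K.^ k) (e ℕ.* k)
    mono-^ c e zero = ⟨ (λ n → K.reflexive (≡.cong (λ m → mono K.1# m n) (≡.sym (ℕₚ.*-zeroʳ e)))) ⟩
    mono-^ c e (suc k) = trans (*-congˡ (mono-^ c e k))
      (trans (mono-* c (c K.^ k) e (e ℕ.* k)) (mono-cong K.refl (≡.sym (ℕₚ.*-suc e k))))

    cst-cong : ∀ {c d} → c K.≈ d → cst c ≋ cst d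
    cst-cong p = mono-cong {e = 0} p ≡.refl

    cst-hom-* : ∀ c d → cst (c K.* d) ≋ cst c * cst d
    cst-hom-* c d = sym (mono-* c d 0 0)

    cst-hom-+ : ∀ c d → cst (c K.+ d) ≋ cst c + cst d
    cst-hom-+ c d = mono-+ c d 0

  -- invList f n = [ g n , … , g 0 ] for the inverse g of f, where f 0 = 1.
  invList : S → ℕ → List K.Carrier
  invList f zero = L.[ K.1# ]
  invList f (suc n) =
    (K.- L.foldr K._+_ K.0# (L.zipWith K._*_ (L.map (λ i → f (suc i)) (L.upTo (suc n))) (invList f n))) ∷ invList f n

  inv : S → S
  inv f n with invList f n
  ... | [] = K.0#
  ... | g ∷ _ = g

  map-upTo-suc : ∀ {A : Set} (F : ℕ → A) n → L.map F (L.upTo (suc n)) ≡ F 0 ∷ L.map (F ∘ suc) (L.upTo n)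
  map-upTo-suc F n = ≡.cong (F 0 ∷_) (≡.trans (Lₚ.map-applyUpTo suc F n) (≡.sym (Lₚ.map-applyUpTo (λ x → x) (F ∘ suc) n)))

  sum-upTo : ∀ (F : ℕ → ℕ → K.Carrier) n →
             L.foldr K._+_ K.0# (L.map (λ i → F i (n ℕ.∸ i)) (L.upTo (suc n))) K.≈ K.diagSum n F
  sum-upTo F zero = K.+-identityʳ _
  sum-upTo F (suc n) = K.trans (K.reflexive (≡.cong (L.foldr K._+_ K.0#) (map-upTo-suc (λ i → F i (suc n ℕ.∸ i)) (suc n))))
    (K.+-congˡ (sum-upTo (λ k l → F (suc k) l) n))

  private
    sum-invList : ∀ f F n → L.foldr K._+_ K.0# (L.zipWith K._*_ (L.map F (L.upTo (suc n))) (invList f n))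
                  K.≈ K.diagSum n (λ k l → F k K.* inv f l)
    sum-invList f F zero = K.+-identityʳ _
    sum-invList f F (suc n) = K.trans
      (K.reflexive (≡.cong (λ xs → L.foldr K._+_ K.0# (L.zipWith K._*_ xs (invList f (suc n)))) (map-upTo-suc F (suc n))))
      (K.+-congˡ (sum-invList f (F ∘ suc) n))

  inv-inverseʳ : ∀ f → f 0 K.≈ K.1# → f * inv f ≋ 1#
  inv-inverseʳ f h = ⟨ go ⟩
    where
    go : ∀ n → (f * inv f) n K.≈ cst K.1# n
    go zero = K.trans (K.*-identityʳ _) h
    go (suc n) = K.trans (K.+-congʳ (K.trans (K.*-congʳ h) (K.*-identityˡ _)))
      (K.trans (K.+-congʳ (K.-‿cong (sum-invList f (λ i → f (suc i)) n))) (K.-‿inverseˡ _))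

  inv-unique : ∀ f g → f 0 K.≈ K.1# → f * g ≋ 1# → inv f ≋ g
  inv-unique f g h p = cancel g (trans (*-comm g f) p) (trans (inv-inverseʳ f h) (sym p))

  pochTo : K.Carrier → ℕ → ℕ → ℕ → S
  pochTo c a d zero = 1#
  pochTo c a d (suc M) = pochTo c a d M * (1# - mono c (a ℕ.+ d ℕ.* M))

  pochTo-cong : ∀ {c c′ a a′ d d′} → c K.≈ c′ → a ≡ a′ → d ≡ d′ → ∀ M → pochTo c a d M ≋ pochTo c′ a′ d′ M
  pochTo-cong p ≡.refl ≡.refl zero = refl
  pochTo-cong {a = a} {d = d} p ≡.refl ≡.refl (suc M) =
    *-cong (pochTo-cong p ≡.refl ≡.refl M) (+-congˡ (-‿cong (mono-cong {e = a ℕ.+ d ℕ.* M} p ≡.refl)))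

  pochTo-0 : ∀ c a d M → 1 ℕ.≤ a → pochTo c a d M 0 K.≈ K.1#
  pochTo-0 c a d zero h = K.refl
  pochTo-0 c (suc a) d (suc M) h = K.trans (K.*-cong (pochTo-0 c (suc a) d M h) (K.trans (K.+-congˡ (K.trans (K.-‿cong (below (O-mono c _) 0 (s≤s z≤n))) K.-0#≈0#)) (K.+-identityʳ _))) (K.*-identityʳ _)

  pochTo-step : ∀ c a d M → pochTo c a d (suc M) ≋[ a ℕ.+ d ℕ.* M ] pochTo c a d M
  pochTo-step c a d M = mod-trans
    (mod-* mod-refl (mod-+ mod-refl (mod-neg (O-mono c (a ℕ.+ d ℕ.* M)))))
    (mod-≈ (trans (*-congˡ (trans (+-congˡ -0#≈0#) (+-identityʳ _))) (*-identityʳ _)))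

  -- The additional factors are 1 - c q^e with e at least a + M, because the exponents grow by d ≥
  -- 1.
  pochTo-stable : ∀ c a d M j → 1 ℕ.≤ d → pochTo c a d (j ℕ.+ M) ≋[ a ℕ.+ M ] pochTo c a d M
  pochTo-stable c a d M zero h = mod-refl
  pochTo-stable c a (suc d) M (suc j) h = mod-trans
    (mod-weaken (ℕₚ.+-monoʳ-≤ a (ℕₚ.≤-trans (ℕₚ.m≤n+m M j) (ℕₚ.m≤n*m (j ℕ.+ M) (suc d)))) (pochTo-step c a (suc d) (j ℕ.+ M)))
    (pochTo-stable c a (suc d) M j h)

  opaque
    -- Coefficient n is read from n + 1 factors, as in the definition used by the theorem. The case
    -- a = 0 is allowed; its first factor is the constant 1 - c.
    poch : K.Carrier → ℕ → ℕ → S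
    poch c a d n = pochTo c a d (suc n) n

    poch-coefficient : ∀ c a d n → poch c a d n K.≈ pochTo c a d (suc n) n
    poch-coefficient c a d n = K.refl

    pochTo-limit′ : ∀ c a d M → 1 ℕ.≤ d → pochTo c a d M ≋[ a ℕ.+ M ] poch c a d
    pochTo-limit′ c a d M h = ⟨ go ⟩
      where
      go : ∀ i → i ℕ.< a ℕ.+ M → pochTo c a d M i K.≈ pochTo c a d (suc i) i
      go i i< with ℕₚ.≤-total M (suc i)
      ... | inj₁ le = K.sym (≡.subst (λ m → pochTo c a d m i K.≈ pochTo c a d M i) (ℕₚ.m∸n+n≡m le)
                        (below (pochTo-stable c a d M (suc i ℕ.∸ M) h) i i<))
      ... | inj₂ ge = ≡.subst (λ m → pochTo c a d m i K.≈ pochTo c a d (suc i) i) (ℕₚ.m∸n+n≡m ge)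
                        (below (pochTo-stable c a d (suc i) (M ℕ.∸ suc i) h) i (ℕₚ.m≤n+m (suc i) a))

  pochTo-limit : ∀ c a d M → 1 ℕ.≤ d → pochTo c a d M ≋[ M ] poch c a d
  pochTo-limit c a d M h = mod-weaken (ℕₚ.m≤n+m M a) (pochTo-limit′ c a d M h)

-- The Jacobi triple product for power series

tri : ℕ → ℕ
tri zero = 0
tri (suc j) = tri j ℕ.+ j

module TripleProduct (K : CommutativeRing 0ℓ 0ℓ) where
  open Series K

  -- The j-th term (- u)ʲ p^(j(j-1)/2) of the bilateral series, for u = c q^a, p = q^d = u v and v = c′ q^b.
  exponent : ℕ → ℕ → ℕ → ℤ → ℕ
  exponent a b d (+ j) = a ℕ.* j ℕ.+ d ℕ.* tri j
  exponent a b d -[1+ j ] = b ℕ.* suc j ℕ.+ d ℕ.* tri (suc j)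

  power : K.Carrier → K.Carrier → ℤ → K.Carrier
  power c c′ (+ j) = c K.^ j
  power c c′ -[1+ j ] = c′ K.^ suc j

  thetaTerm : K.Carrier → K.Carrier → ℕ → ℕ → ℕ → ℤ → S
  thetaTerm c c′ a b d j = mono (power (K.- c) (K.- c′) j) (exponent a b d j)

  one^ : ∀ n → K.1# K.^ n K.≈ K.1#
  one^ zero = K.refl
  one^ (suc n) = K.trans (K.*-identityˡ _) (one^ n)

  mono1-^ : ∀ d n → mono K.1# d ^ n ≋ mono K.1# (d ℕ.* n)
  mono1-^ d n = trans (mono-^ K.1# d n) (mono-cong (one^ n) ≡.refl)

  private
    triple-exponent : ∀ a d j t → (a ℕ.+ d ℕ.* j) ℕ.+ (a ℕ.* j ℕ.+ d ℕ.* t) ≡ a ℕ.* suc j ℕ.+ d ℕ.* (t ℕ.+ j)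
    triple-exponent = ℕS.solve 4 (λ a d j t → (a ℕS.:+ d ℕS.:* j) ℕS.:+ (a ℕS.:* j ℕS.:+ d ℕS.:* t)
      ℕS.:= a ℕS.:* (ℕS.con 1 ℕS.:+ j) ℕS.:+ d ℕS.:* (t ℕS.:+ j)) ≡.refl
      where module ℕS = Data.Nat.Solver.+-*-Solver

    tri-bound : ∀ d x j → 1 ℕ.≤ d → j ℕ.∸ 1 ℕ.≤ x ℕ.+ d ℕ.* tri j
    tri-bound d x zero h = z≤n
    tri-bound (suc d) x (suc j) h = ℕₚ.≤-trans (ℕₚ.m≤n+m j (tri j))
      (ℕₚ.≤-trans (ℕₚ.m≤m+n (tri j ℕ.+ j) (d ℕ.* (tri j ℕ.+ j))) (ℕₚ.m≤n+m _ x))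

    -- Only the triangular part of the exponent is used, so the bound survives a = 0 or b = 0, as
    -- `dissection` requires; the price is the loss of one.
    thetaTerm-O : ∀ c c′ a b d j → 1 ℕ.≤ d → thetaTerm c c′ a b d j ≋[ ℤ.∣ j ∣ ℕ.∸ 1 ] 0#
    thetaTerm-O c c′ a b d (+ j) h = mod-weaken (tri-bound d (a ℕ.* j) j h) (O-mono _ _)
    thetaTerm-O c c′ a b d -[1+ j ] h = mod-weaken (tri-bound d (b ℕ.* suc j) (suc j) h) (O-mono _ _)

    gap : ∀ N k l → k ℕ.+ l ≡ N ℕ.+ N → N ℕ.∸ suc (k ℕ.⊓ l) ℕ.≤ ℤ.∣ k ℤ.⊖ N ∣ ℕ.∸ 1
    gap N k l e with ℕₚ.≤-total k N
    ... | inj₁ k≤N = ℕₚ.≤-reflexive (≡.trans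
            (≡.cong (λ m → N ℕ.∸ suc m) (ℕₚ.m≤n⇒m⊓n≡m (ℕₚ.≤-trans k≤N N≤l)))
            (≡.trans (≡.trans (≡.cong (N ℕ.∸_) (ℕₚ.+-comm 1 k)) (≡.sym (ℕₚ.∸-+-assoc N k 1)))
              (≡.cong (ℕ._∸ 1) (≡.sym (ℤₚ.∣⊖∣-≤ k≤N)))))
      where N≤l : N ℕ.≤ l
            N≤l = ℕₚ.+-cancelˡ-≤ N N l (ℕₚ.≤-trans (ℕₚ.≤-reflexive (≡.sym e)) (ℕₚ.+-monoˡ-≤ l k≤N))
    ... | inj₂ N≤k = ℕₚ.≤-reflexive (≡.trans
            (≡.cong (λ m → N ℕ.∸ suc m) (ℕₚ.m≥n⇒m⊓n≡n (ℕₚ.≤-trans l≤N N≤k)))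
            (≡.trans (≡.trans (≡.cong (N ℕ.∸_) (ℕₚ.+-comm 1 l)) (≡.sym (ℕₚ.∸-+-assoc N l 1)))
              (≡.cong (ℕ._∸ 1) (≡.trans N∸l≡k∸N (≡.sym (≡.trans (ℤₚ.∣m⊖n∣≡∣n⊖m∣ k N) (ℤₚ.∣⊖∣-≤ N≤k)))))))
      where l≤N : l ℕ.≤ N
            l≤N = ℕₚ.+-cancelˡ-≤ N l N (ℕₚ.≤-trans (ℕₚ.+-monoˡ-≤ l N≤k) (ℕₚ.≤-reflexive e))
            N∸l≡k∸N : N ℕ.∸ l ≡ k ℕ.∸ N
            N∸l≡k∸N = ≡.trans (≡.sym (ℕₚ.[m+n]∸[m+o]≡n∸o N N l))
              (≡.trans (≡.cong (ℕ._∸ (N ℕ.+ l)) (≡.sym e))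
              (≡.trans (≡.cong₂ ℕ._∸_ (ℕₚ.+-comm k l) (ℕₚ.+-comm N l)) (ℕₚ.[m+n]∸[m+o]≡n∸o l k N)))

    absorb : ∀ {x z} m N → x ≋[ m ] 1# → z ≋[ N ℕ.∸ m ] 0# → x * z ≋[ N ] z
    absorb {x} {z} m N p q = mod-trans
      (mod-≈ (solve 2 (λ x z → x ⊠ z ⊜ z ⊞ (x ⊟ con (+ 1)) ⊠ z) ≡.refl x z))
      (mod-trans (mod-+ mod-refl (mod-weaken (ℕₚ.m≤n+m∸n N m) (O-* m (N ℕ.∸ m) x-1 q)))
        (mod-≈ (+-identityʳ z)))
      where x-1 : x - 1# ≋[ m ] 0#
            x-1 = mod-trans (mod-+ p mod-refl) (mod-≈ (-‿inverseʳ 1#))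

  module _ (c c′ : K.Carrier) (cc′ : c K.* c′ K.≈ K.1#) (a b d : ℕ) (a+b : a ℕ.+ b ≡ d) (1≤d : 1 ℕ.≤ d) where
    private
      D I : ℕ → S
      D = pochTo K.1# d d
      I n = inv (D n)

      D∞ : S
      D∞ = poch K.1# d d

      I-D : ∀ n → I n * D n ≋ 1#
      I-D n = trans (*-comm _ _) (inv-inverseʳ (D n) (pochTo-0 K.1# d d n 1≤d))

      module F = FiniteTripleProduct (mono c a) (mono c′ b) (mono K.1# d)
        (trans (mono-* c c′ a b) (mono-cong cc′ a+b)) D I refl
        (λ n → *-congˡ (+-congˡ (-‿cong (trans (mono-cong K.refl (≡.sym (ℕₚ.*-suc d n))) (sym (mono1-^ d (suc n)))))))
        I-D

      mono-p^ : ∀ w e n → mono w e * mono K.1# d ^ n ≋ mono w (e ℕ.+ d ℕ.* n)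
      mono-p^ w e n = trans (*-congˡ (mono1-^ d n)) (trans (mono-* w K.1# e (d ℕ.* n)) (mono-cong (K.*-identityʳ w) ≡.refl))

      fin≈pochTo : ∀ w e N → F.fin (mono w e) N ≋ pochTo w e d N
      fin≈pochTo w e zero = refl
      fin≈pochTo w e (suc N) = *-cong (fin≈pochTo w e N) (+-congˡ (-‿cong (mono-p^ w e N)))

      geo≈mono : ∀ w e j → F.geo (mono w e) j ≋ mono ((K.- w) K.^ j) (e ℕ.* j ℕ.+ d ℕ.* tri j)
      geo≈mono w e zero = trans (sym (mono-0 K.1#)) (mono-cong K.refl (≡.sym (≡.cong₂ ℕ._+_ (ℕₚ.*-zeroʳ e) (ℕₚ.*-zeroʳ d))))
      geo≈mono w e (suc j) = begin
        - (mono w e * mono K.1# d ^ j * F.geo (mono w e) j)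
          ≈⟨ -‿cong (*-cong (mono-p^ w e j) (geo≈mono w e j)) ⟩
        - (mono w (e ℕ.+ d ℕ.* j) * mono ((K.- w) K.^ j) (e ℕ.* j ℕ.+ d ℕ.* tri j))
          ≈⟨ trans (-‿distribˡ-* _ _) (*-congʳ (sym (mono-neg w _))) ⟩
        mono (K.- w) (e ℕ.+ d ℕ.* j) * mono ((K.- w) K.^ j) (e ℕ.* j ℕ.+ d ℕ.* tri j)
          ≈⟨ trans (mono-* _ _ _ _) (mono-cong K.refl (triple-exponent e d j (tri j))) ⟩
        mono ((K.- w) K.^ suc j) (e ℕ.* suc j ℕ.+ d ℕ.* tri (suc j)) ∎
        where open ≋-Reasoning

      zTerm≈ : ∀ j → F.zTerm (mono c a) (mono c′ b) j ≋ thetaTerm c c′ a b d j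
      zTerm≈ (+ j) = geo≈mono c a j
      zTerm≈ -[1+ j ] = geo≈mono c′ b (suc j)

      D→D∞ : ∀ n m → m ℕ.≤ suc n → D n ≋[ m ] D∞
      D→D∞ n m h = mod-weaken (ℕₚ.≤-trans h (ℕₚ.+-monoˡ-≤ n 1≤d)) (pochTo-limit′ K.1# d d n 1≤d)

      I·D∞ : ∀ n m → m ℕ.≤ suc n → I n * D∞ ≋[ m ] 1#
      I·D∞ n m h = mod-trans (mod-* mod-refl (mod-sym (D→D∞ n m h))) (mod-≈ (I-D n))

      normalised : ∀ N k l → k ℕ.+ l ≡ N ℕ.+ N → D∞ * D (N ℕ.+ N) * (I k * I l) ≋[ suc (k ℕ.⊓ l) ] 1#
      normalised N k l e = mod-trans
        (mod-* (mod-* mod-refl (D→D∞ (N ℕ.+ N) _ (s≤s (ℕₚ.≤-trans (ℕₚ.m⊓n≤m k l) (ℕₚ.≤-trans (ℕₚ.m≤m+n k l) (ℕₚ.≤-reflexive e)))))) mod-refl)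
        (mod-trans (mod-≈ (solve 3 (λ x i j → x ⊠ x ⊠ (i ⊠ j) ⊜ i ⊠ x ⊠ (j ⊠ x)) ≡.refl D∞ (I k) (I l)))
        (mod-trans (mod-* (I·D∞ k _ (s≤s (ℕₚ.m⊓n≤m k l))) (I·D∞ l _ (s≤s (ℕₚ.m⊓n≤n k l))))
        (mod-≈ (*-identityʳ 1#))))

    -- The two kinds of error complement each other. The normalised q-binomial coefficient is 1 up
    -- to order min(k, l) + 1 (`normalised`), while the theta term has order at least N - (min(k, l)
    -- + 1) (`gap`). By `absorb` the coefficient may be replaced by 1 modulo q^N in every term.
    tripleProduct : ∀ N → diagSum (N ℕ.+ N) (λ k l → thetaTerm c c′ a b d (k ℤ.⊖ N)) ≋[ N ]
                          poch K.1# d d * (poch c a d * poch c′ b d)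
    tripleProduct N = mod-trans
      (mod-diagSum (N ℕ.+ N) (λ k l e → mod-sym (mod-trans
        (mod-≈ (trans (*-congˡ (*-congˡ (zTerm≈ (k ℤ.⊖ N)))) (sym (*-assoc _ _ _))))
        (absorb (suc (k ℕ.⊓ l)) N (normalised N k l e) (mod-weaken (gap N k l e) (thetaTerm-O c c′ a b d (k ℤ.⊖ N) 1≤d))))))
      (mod-trans (mod-≈ (begin
        diagSum (N ℕ.+ N) (λ k l → D∞ * D (N ℕ.+ N) * F.term N k l)     ≈⟨ diagSum-*ˡ (N ℕ.+ N) _ (F.term N) ⟩
        D∞ * D (N ℕ.+ N) * diagSum (N ℕ.+ N) (F.term N)                 ≈⟨ trans (*-assoc _ _ _) (*-congˡ (*-comm _ _)) ⟩
        D∞ * (diagSum (N ℕ.+ N) (F.term N) * D (N ℕ.+ N))               ≈⟨ *-congˡ (F.finite-tripleProduct N N (N ℕ.+ N) ≡.refl) ⟩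
        D∞ * (F.fin (mono c a) N * F.fin (mono c′ b) N)            ≈⟨ *-congˡ (*-cong (fin≈pochTo c a N) (fin≈pochTo c′ b N)) ⟩
        D∞ * (pochTo c a d N * pochTo c′ b d N)                            ∎))
        (mod-* mod-refl (mod-* (pochTo-limit c a d N 1≤d) (pochTo-limit c′ b d N 1≤d))))
      where open ≋-Reasoning

-- Ring homomorphisms and their action on polynomial expressions

record RingHom (R R′ : CommutativeRing 0ℓ 0ℓ) : Set where
  private
    module R = RingKit R
    module R′ = RingKit R′
  field
    fun : R.Carrier → R′.Carrier
    hom-cong : ∀ {x y} → x R.≈ y → fun x R′.≈ fun y
    hom-+ : ∀ x y → fun (x R.+ y) R′.≈ fun x R′.+ fun y
    hom-* : ∀ x y → fun (x R.* y) R′.≈ fun x R′.* fun y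
    hom-1 : fun R.1# R′.≈ R′.1#

  hom-0 : fun R.0# R′.≈ R′.0#
  hom-0 = R′.+-cancelˡ (fun R.0#) _ _
    (R′.trans (R′.sym (hom-+ R.0# R.0#)) (R′.trans (hom-cong (R.+-identityˡ R.0#)) (R′.sym (R′.+-identityʳ _))))

  hom-neg : ∀ x → fun (R.- x) R′.≈ R′.- fun x
  hom-neg x = R′.+-cancelˡ (fun x) _ _
    (R′.trans (R′.sym (hom-+ x (R.- x))) (R′.trans (hom-cong (R.-‿inverseʳ x)) (R′.trans hom-0 (R′.sym (R′.-‿inverseʳ _)))))

  hom-sub : ∀ x y → fun (x R.- y) R′.≈ fun x R′.- fun y
  hom-sub x y = R′.trans (hom-+ x (R.- y)) (R′.+-congˡ (hom-neg y))

  hom-^ : ∀ x n → fun (x R.^ n) R′.≈ fun x R′.^ n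
  hom-^ x zero = hom-1
  hom-^ x (suc n) = R′.trans (hom-* x (x R.^ n)) (R′.*-congˡ (hom-^ x n))

  hom-diagSum : ∀ n f → fun (R.diagSum n f) R′.≈ R′.diagSum n (λ k l → fun (f k l))
  hom-diagSum zero f = R′.refl
  hom-diagSum (suc n) f = R′.trans (hom-+ _ _) (R′.+-congˡ (hom-diagSum n (λ k l → f (suc k) l)))

  private
    hom-⁺ : ∀ n → fun R.⟪ + n ⟫ R′.≈ R′.⟪ + n ⟫
    hom-⁺ zero = hom-0
    hom-⁺ (suc n) = R′.trans (hom-+ _ _) (R′.+-cong hom-1 (hom-⁺ n))

  hom-⟪⟫ : ∀ i → fun R.⟪ i ⟫ R′.≈ R′.⟪ i ⟫
  hom-⟪⟫ (+ n) = hom-⁺ n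
  hom-⟪⟫ -[1+ n ] = R′.trans (hom-neg _) (R′.-‿cong (hom-⁺ (suc n)))

  hom-⟦⟧ : ∀ {n} (e : Ex n) ρ → fun (R.⟦ e ⟧ ρ) R′.≈ R′.⟦ e ⟧ (Vec.map fun ρ)
  hom-⟦⟧ (var zero) (x ∷ ρ) = R′.refl
  hom-⟦⟧ (var (suc i)) (x ∷ ρ) = hom-⟦⟧ (var i) ρ
  hom-⟦⟧ (con (+ 0)) ρ = hom-0
  hom-⟦⟧ (con (+ 1)) ρ = hom-1
  hom-⟦⟧ (con (+ suc (suc n))) ρ = hom-⟪⟫ (+ suc (suc n))
  hom-⟦⟧ (con -[1+ n ]) ρ = hom-⟪⟫ -[1+ n ]
  hom-⟦⟧ (e ⊞ f) ρ = R′.trans (hom-+ _ _) (R′.+-cong (hom-⟦⟧ e ρ) (hom-⟦⟧ f ρ))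
  hom-⟦⟧ (e ⊠ f) ρ = R′.trans (hom-* _ _) (R′.*-cong (hom-⟦⟧ e ρ) (hom-⟦⟧ f ρ))
  hom-⟦⟧ (e ⊟ f) ρ = R′.trans (hom-sub _ _) (R′.+-cong (hom-⟦⟧ e ρ) (R′.-‿cong (hom-⟦⟧ f ρ)))
  hom-⟦⟧ (e ⊡ k) ρ = R′.trans (hom-^ _ k) (R′.^-congˡ k (hom-⟦⟧ e ρ))
  hom-⟦⟧ (⊖ e) ρ = R′.trans (hom-neg _) (R′.-‿cong (hom-⟦⟧ e ρ))

-- The substitutions q ↦ q⁵ and q ↦ ωq, and extraction of exponents modulo 5

module Substitution (K : CommutativeRing 0ℓ 0ℓ) where
  open Series K

  cstHom : RingHom K seriesRing
  cstHom = record { fun = cst ; hom-cong = cst-cong ; hom-+ = cst-hom-+ ; hom-* = cst-hom-* ; hom-1 = refl }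

  -- f(q) ↦ f(q⁵)
  V : S → S
  V f 0 = f 0
  V f 1 = K.0#
  V f 2 = K.0#
  V f 3 = K.0#
  V f 4 = K.0#
  V f (suc (suc (suc (suc (suc n))))) = V (λ k → f (suc k)) n

  private
    V-local : ∀ f g n → (∀ i → i ℕ.≤ n → f i K.≈ g i) → V f n K.≈ V g n
    V-local f g 0 h = h 0 z≤n
    V-local f g 1 h = K.refl
    V-local f g 2 h = K.refl
    V-local f g 3 h = K.refl
    V-local f g 4 h = K.refl
    V-local f g (suc (suc (suc (suc (suc n))))) h =
      V-local (λ k → f (suc k)) (λ k → g (suc k)) n (λ i le → h (suc i) (s≤s (ℕₚ.≤-trans le (ℕₚ.m≤n+m n 4))))

    -- Stated for c f + g because both uses have this form: c = 1 gives additivity, and the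
    -- recursion of the Cauchy product produces c = f 0.
    V-linear : ∀ c f g n → V (λ k → c K.* f k K.+ g k) n K.≈ c K.* V f n K.+ V g n
    V-linear c f g 0 = K.refl
    V-linear c f g 1 = K.sym (K.trans (K.+-congʳ (K.zeroʳ c)) (K.+-identityˡ _))
    V-linear c f g 2 = K.sym (K.trans (K.+-congʳ (K.zeroʳ c)) (K.+-identityˡ _))
    V-linear c f g 3 = K.sym (K.trans (K.+-congʳ (K.zeroʳ c)) (K.+-identityˡ _))
    V-linear c f g 4 = K.sym (K.trans (K.+-congʳ (K.zeroʳ c)) (K.+-identityˡ _))
    V-linear c f g (suc (suc (suc (suc (suc n))))) = V-linear c (λ k → f (suc k)) (λ k → g (suc k)) n

    V-+ : ∀ f g → V (f + g) ≋ V f + V g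
    V-+ f g = ⟨ (λ n → K.trans (V-local (f + g) (λ k → K.1# K.* f k K.+ g k) n (λ i _ → K.+-congʳ (K.sym (K.*-identityˡ _))))
      (K.trans (V-linear K.1# f g n) (K.+-congʳ (K.*-identityˡ _)))) ⟩

    drop0 : ∀ {x y} → x K.≈ y → ∀ z → K.0# K.* z K.+ x K.≈ y
    drop0 p z = K.trans (K.+-congʳ (K.zeroˡ z)) (K.trans (K.+-identityˡ _) p)

    V-* : ∀ f g → V (f * g) ≋ V f * V g
    V-* f g = ⟨ (λ n → K.sym (go n f)) ⟩
      where
      z : ∀ x → K.0# K.* x K.≈ K.0#
      z = K.zeroˡ
      go : ∀ n f → (V f * V g) n K.≈ V (f * g) n
      go 0 f = K.refl
      go 1 f = K.trans (K.+-cong (K.zeroʳ _) (z _)) (K.+-identityˡ _)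
      go 2 f = K.trans (K.+-cong (K.zeroʳ _) (drop0 (z _) _)) (K.+-identityˡ _)
      go 3 f = K.trans (K.+-cong (K.zeroʳ _) (drop0 (drop0 (z _) _) _)) (K.+-identityˡ _)
      go 4 f = K.trans (K.+-cong (K.zeroʳ _) (drop0 (drop0 (drop0 (z _) _) _) _)) (K.+-identityˡ _)
      go (suc (suc (suc (suc (suc n))))) f = K.trans
        (K.+-congˡ (drop0 (drop0 (drop0 (drop0 (go n (λ k → f (suc k))) _) _) _) _))
        (K.sym (V-linear (f 0) (λ k → g (suc k)) ((λ k → f (suc k)) * g) n))

  V-0 : ∀ n → V (λ _ → K.0#) n K.≈ K.0#
  V-0 0 = K.refl
  V-0 1 = K.refl
  V-0 2 = K.refl
  V-0 3 = K.refl
  V-0 4 = K.refl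
  V-0 (suc (suc (suc (suc (suc n))))) = V-0 n

  private
    V-cst : ∀ c n → V (cst c) n K.≈ cst c n
    V-cst c 0 = K.refl
    V-cst c 1 = K.refl
    V-cst c 2 = K.refl
    V-cst c 3 = K.refl
    V-cst c 4 = K.refl
    V-cst c (suc (suc (suc (suc (suc n))))) = V-0 n

  VHom : RingHom seriesRing seriesRing
  VHom = record
    { fun = V ; hom-cong = λ p → ⟨ (λ n → V-local _ _ n (λ i _ → at p i)) ⟩
    ; hom-+ = V-+ ; hom-* = V-* ; hom-1 = ⟨ V-cst K.1# ⟩ }

  module VH = RingHom VHom

  V-mod : ∀ {f g n} → f ≋[ n ] g → V f ≋[ n ] V g
  V-mod p = ⟨ (λ i h → V-local _ _ i (λ j le → below p j (ℕₚ.≤-<-trans le h))) ⟩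

  opaque
    unfolding mono
    V-mono : ∀ c e → V (mono c e) ≋ mono c (e ℕ.* 5)
    V-mono c e = ⟨ go e ⟩
      where
      go : ∀ e n → V (mono c e) n K.≈ mono c (e ℕ.* 5) n
      go zero n = V-cst c n
      go (suc e) 0 = K.refl
      go (suc e) 1 = K.refl
      go (suc e) 2 = K.refl
      go (suc e) 3 = K.refl
      go (suc e) 4 = K.refl
      go (suc e) (suc (suc (suc (suc (suc n))))) = go e n

    mono-before : ∀ c e f n → n ℕ.< e → (mono c e * f) n K.≈ K.0#
    mono-before c (suc e) f zero h = K.zeroˡ _
    mono-before c (suc e) f (suc n) (s≤s h) = K.trans (K.+-congʳ (K.zeroˡ _)) (K.trans (K.+-identityˡ _) (mono-before c e f n h))

  V-pochTo : ∀ c a d M → V (pochTo c a d M) ≋ pochTo c (a ℕ.* 5) (d ℕ.* 5) M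
  V-pochTo c a d zero = VH.hom-1
  V-pochTo c a d (suc M) = trans (V-* _ _) (*-cong (V-pochTo c a d M) (trans (VH.hom-sub _ _)
    (+-cong VH.hom-1 (-‿cong (trans (V-mono c _) (mono-cong K.refl (ex a d M)))))))
    where
    module ℕS = Data.Nat.Solver.+-*-Solver
    ex : ∀ a d M → (a ℕ.+ d ℕ.* M) ℕ.* 5 ≡ a ℕ.* 5 ℕ.+ d ℕ.* 5 ℕ.* M
    ex = ℕS.solve 3 (λ a d M → (a ℕS.:+ d ℕS.:* M) ℕS.:* ℕS.con 5 ℕS.:= a ℕS.:* ℕS.con 5 ℕS.:+ d ℕS.:* ℕS.con 5 ℕS.:* M) ≡.refl

  V-poch : ∀ c a d → 1 ℕ.≤ d → V (poch c a d) ≋ poch c (a ℕ.* 5) (d ℕ.* 5)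
  V-poch c a (suc d) h = limit-unique (λ M → V (pochTo c a (suc d) M))
    (λ M → V-mod (pochTo-limit c a (suc d) M h))
    (λ M → mod-trans (mod-≈ (V-pochTo c a (suc d) M)) (pochTo-limit c (a ℕ.* 5) (suc d ℕ.* 5) M (s≤s z≤n)))

  U : ℕ → S → S
  U r f n = f (r ℕ.+ n ℕ.* 5)

  U-cong : ∀ r {f g} → f ≋ g → U r f ≋ U r g
  U-cong r p = ⟨ (λ n → at p (r ℕ.+ n ℕ.* 5)) ⟩

  private
    V-at : ∀ f n → V f (n ℕ.* 5) K.≈ f n
    V-at f zero = K.refl
    V-at f (suc n) = V-at (λ k → f (suc k)) n

    V-off : ∀ r f n → r ℕ.< 4 → V f (suc r ℕ.+ n ℕ.* 5) K.≈ K.0#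
    V-off 0 f zero h = K.refl
    V-off 1 f zero h = K.refl
    V-off 2 f zero h = K.refl
    V-off 3 f zero h = K.refl
    V-off (suc (suc (suc (suc r)))) f n (s≤s (s≤s (s≤s (s≤s ()))))
    V-off 0 f (suc n) h = V-off 0 (λ k → f (suc k)) n h
    V-off 1 f (suc n) h = V-off 1 (λ k → f (suc k)) n h
    V-off 2 f (suc n) h = V-off 2 (λ k → f (suc k)) n h
    V-off 3 f (suc n) h = V-off 3 (λ k → f (suc k)) n h

  U-hit : ∀ i f → U i (mono K.1# i * V f) ≋ f
  U-hit i f = ⟨ (λ n → K.trans (mono-shift K.1# i (V f) (n ℕ.* 5)) (K.trans (K.*-identityˡ _) (V-at f n))) ⟩

  U-above : ∀ i s f → s ℕ.< 4 → U (i ℕ.+ suc s) (mono K.1# i * V f) ≋ 0#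
  U-above i s f h = ⟨ (λ n → K.trans (K.reflexive (≡.cong (mono K.1# i * V f) (ℕₚ.+-assoc i (suc s) (n ℕ.* 5))))
    (K.trans (mono-shift K.1# i (V f) (suc s ℕ.+ n ℕ.* 5)) (K.trans (K.*-identityˡ _) (V-off s f n h)))) ⟩

  U-below : ∀ r s f → s ℕ.< 4 → U r (mono K.1# (r ℕ.+ suc s) * V f) ≋ 0#
  U-below r s f h = ⟨ go ⟩
    where
    go : ∀ n → (mono K.1# (r ℕ.+ suc s) * V f) (r ℕ.+ n ℕ.* 5) K.≈ K.0#
    go zero = mono-before K.1# (r ℕ.+ suc s) (V f) (r ℕ.+ 0) (ℕₚ.+-monoʳ-< r (s≤s z≤n))
    go (suc n) = K.trans (K.reflexive (≡.cong (mono K.1# (r ℕ.+ suc s) * V f) (re r s (n ℕ.* 5) h)))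
      (K.trans (mono-shift K.1# (r ℕ.+ suc s) (V f) (suc (3 ℕ.∸ s) ℕ.+ n ℕ.* 5)) (K.trans (K.*-identityˡ _) (V-off (3 ℕ.∸ s) f n (s≤s (ℕₚ.m∸n≤m 3 s)))))
      where
      re : ∀ r s m → s ℕ.< 4 → r ℕ.+ (5 ℕ.+ m) ≡ (r ℕ.+ suc s) ℕ.+ (suc (3 ℕ.∸ s) ℕ.+ m)
      re r 0 m h = ≡.trans (≡.cong (r ℕ.+_) ≡.refl) (≡.sym (ℕₚ.+-assoc r 1 _))
      re r 1 m h = ≡.sym (ℕₚ.+-assoc r 2 _)
      re r 2 m h = ≡.sym (ℕₚ.+-assoc r 3 _)
      re r 3 m h = ≡.sym (ℕₚ.+-assoc r 4 _)
      re r (suc (suc (suc (suc s)))) m (s≤s (s≤s (s≤s (s≤s ()))))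

  -- A series presented by its components: the i-th is placed at the exponents ≡ i modulo 5. `U r`
  -- recovers the component, so two such sums can be compared residue by residue.
  comb : (ℕ → S) → S
  comb f = t 0 + (t 1 + (t 2 + (t 3 + t 4)))
    where
    t : ℕ → S
    t i = mono K.1# i * V (f i)

  private
    lt0 : 0 ℕ.< 4
    lt0 = s≤s z≤n
    lt1 : 1 ℕ.< 4
    lt1 = s≤s (s≤s z≤n)
    lt2 : 2 ℕ.< 4
    lt2 = s≤s (s≤s (s≤s z≤n))
    lt3 : 3 ℕ.< 4
    lt3 = s≤s (s≤s (s≤s (s≤s z≤n)))

    only : ∀ {x y} → y ≋ 0# → x + y ≋ x
    only h = trans (+-congˡ h) (+-identityʳ _)

    skip : ∀ {x y z} → x ≋ 0# → y ≋ z → x + y ≋ z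
    skip h p = trans (+-cong h p) (+-identityˡ _)

    zero₂ : ∀ {x y} → x ≋ 0# → y ≋ 0# → x + y ≋ 0#
    zero₂ h p = trans (+-cong h p) (+-identityˡ _)

  U-comb-0 : ∀ f → U 0 (comb f) ≋ f 0
  U-comb-0 f = trans (only (zero₂ (U-below 0 0 (f 1) lt0) (zero₂ (U-below 0 1 (f 2) lt1) (zero₂ (U-below 0 2 (f 3) lt2) (U-below 0 3 (f 4) lt3))))) (U-hit 0 (f 0))

  U-comb-1 : ∀ f → U 1 (comb f) ≋ f 1
  U-comb-1 f = skip (U-above 0 0 (f 0) lt0) (trans (only (zero₂ (U-below 1 0 (f 2) lt0) (zero₂ (U-below 1 1 (f 3) lt1) (U-below 1 2 (f 4) lt2)))) (U-hit 1 (f 1)))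

  U-comb-2 : ∀ f → U 2 (comb f) ≋ f 2
  U-comb-2 f = skip (U-above 0 1 (f 0) lt1) (skip (U-above 1 0 (f 1) lt0) (trans (only (zero₂ (U-below 2 0 (f 3) lt0) (U-below 2 1 (f 4) lt1))) (U-hit 2 (f 2))))

  U-comb-4 : ∀ f → U 4 (comb f) ≋ f 4
  U-comb-4 f = skip (U-above 0 3 (f 0) lt3) (skip (U-above 1 2 (f 1) lt2) (skip (U-above 2 1 (f 2) lt1) (skip (U-above 3 0 (f 3) lt0) (U-hit 4 (f 4)))))

  -- The substitution q ↦ ωq.
  twist : K.Carrier → S → S
  twist ω f n = ω K.^ n K.* f n

  twistHom : K.Carrier → RingHom seriesRing seriesRing
  twistHom ω = record
    { fun = twist ω ; hom-cong = λ p → ⟨ (λ n → K.*-congˡ (at p n)) ⟩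
    ; hom-+ = λ f g → ⟨ (λ n → K.distribˡ _ _ _) ⟩
    ; hom-* = λ f g → ⟨ (λ n → K.trans (K.sym (K.diagSum-*ˡ n _ (λ k l → f k K.* g l))) (K.diagSum-cong n (λ k l e →
        K.trans (K.*-congʳ (K.trans (K.reflexive (≡.cong (ω K.^_) (≡.sym e))) (K.^-homo-* ω k l)))
          (K.solve 4 (λ a b c d → (a ⊠ b) ⊠ (c ⊠ d) ⊜ (a ⊠ c) ⊠ (b ⊠ d)) ≡.refl _ _ _ _)))) ⟩
    ; hom-1 = ⟨ one ⟩ }
    where
    one : ∀ n → ω K.^ n K.* cst K.1# n K.≈ cst K.1# n
    one zero = K.*-identityˡ _
    one (suc n) = K.zeroʳ _

  twist-mod : ∀ ω {f g n} → f ≋[ n ] g → twist ω f ≋[ n ] twist ω g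
  twist-mod ω p = ⟨ (λ i h → K.*-congˡ (below p i h)) ⟩

  opaque
    unfolding mono
    twist-mono : ∀ ω c e → twist ω (mono c e) ≋ mono (ω K.^ e K.* c) e
    twist-mono ω c e = ⟨ (λ n → K.trans (go e n) (at (mono-cong {e = e} (K.*-congˡ (K.*-identityˡ c)) ≡.refl) n)) ⟩
      where
      go : ∀ e n → ω K.^ n K.* mono c e n K.≈ mono (ω K.^ e K.* (K.1# K.* c)) e n
      go zero zero = K.*-congˡ (K.sym (K.*-identityˡ c))
      go zero (suc n) = K.zeroʳ _
      go (suc e) zero = K.zeroʳ _
      go (suc e) (suc n) = K.trans (K.*-assoc _ _ _) (K.trans (K.*-congˡ (go e n)) (scl e n))
        where
        scl : ∀ i n → ω K.* mono (ω K.^ e K.* (K.1# K.* c)) i n K.≈ mono (ω K.^ suc e K.* (K.1# K.* c)) i n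
        scl zero zero = K.sym (K.*-assoc _ _ _)
        scl zero (suc n) = K.zeroʳ _
        scl (suc i) zero = K.zeroʳ _
        scl (suc i) (suc n) = scl i n

  pow-mod5 : ∀ ω → ω K.^ 5 K.≈ K.1# → ∀ r m → ω K.^ (r ℕ.+ 5 ℕ.* m) K.≈ ω K.^ r
  pow-mod5 ω h r m = K.trans (K.^-homo-* ω r (5 ℕ.* m))
    (K.trans (K.*-congˡ (K.trans (K.sym (K.^-assocʳ ω 5 m)) (K.trans (K.^-congˡ m h) (one m)))) (K.*-identityʳ _))
    where
    one : ∀ n → K.1# K.^ n K.≈ K.1#
    one zero = K.refl
    one (suc n) = K.trans (K.*-identityˡ _) (one n)

  twist-V : ∀ ω → ω K.^ 5 K.≈ K.1# → ∀ f → twist ω (V f) ≋ V f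
  twist-V ω h f = ⟨ (λ n → go f n) ⟩
    where
    go : ∀ f n → ω K.^ n K.* V f n K.≈ V f n
    go f 0 = K.*-identityˡ _
    go f 1 = K.zeroʳ _
    go f 2 = K.zeroʳ _
    go f 3 = K.zeroʳ _
    go f 4 = K.zeroʳ _
    go f (suc (suc (suc (suc (suc n))))) = K.trans
      (K.*-congʳ (K.trans (K.^-homo-* ω 5 n) (K.trans (K.*-congʳ h) (K.*-identityˡ _)))) (go (λ k → f (suc k)) n)

  twist-poch : ∀ ω → ω K.^ 5 K.≈ K.1# → ∀ a → twist ω (poch K.1# a 5) ≋ poch (ω K.^ a) a 5
  twist-poch ω h a = limit-unique (λ M → twist ω (pochTo K.1# a 5 M))
    (λ M → twist-mod ω (pochTo-limit K.1# a 5 M (s≤s z≤n)))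
    (λ M → mod-trans (mod-≈ (go M)) (pochTo-limit (ω K.^ a) a 5 M (s≤s z≤n)))
    where
    module T = RingHom (twistHom ω)
    go : ∀ M → twist ω (pochTo K.1# a 5 M) ≋ pochTo (ω K.^ a) a 5 M
    go zero = T.hom-1
    go (suc M) = trans (T.hom-* _ _) (*-cong (go M) (trans (T.hom-sub _ _) (+-cong T.hom-1 (-‿cong
      (trans (twist-mono ω K.1# _) (mono-cong (K.trans (K.*-identityʳ _) (pow-mod5 ω h a M)) ≡.refl))))))

  poch-split : poch K.1# 1 1 ≋ poch K.1# 1 5 * poch K.1# 2 5 * poch K.1# 3 5 * poch K.1# 4 5 * poch K.1# 5 5
  poch-split = limit-unique (λ M → pochTo K.1# 1 1 (M ℕ.* 5))
    (λ M → mod-weaken (ℕₚ.m≤m*n M 5) (pochTo-limit K.1# 1 1 (M ℕ.* 5) (s≤s z≤n)))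
    (λ M → mod-trans (mod-≈ (go M))
      (mod-* (mod-* (mod-* (mod-* (lim 1 M) (lim 2 M)) (lim 3 M)) (lim 4 M)) (lim 5 M)))
    where
    lim : ∀ a M → pochTo K.1# a 5 M ≋[ M ] poch K.1# a 5
    lim a M = pochTo-limit K.1# a 5 M (s≤s z≤n)
    ex : ∀ r M → 1 ℕ.+ 1 ℕ.* (r ℕ.+ M ℕ.* 5) ≡ suc r ℕ.+ 5 ℕ.* M
    ex r M = ≡.cong suc (≡.trans (ℕₚ.*-identityˡ _) (≡.cong (r ℕ.+_) (ℕₚ.*-comm M 5)))
    fac : ∀ r M → (1# - mono K.1# (1 ℕ.+ 1 ℕ.* (r ℕ.+ M ℕ.* 5))) ≋ (1# - mono K.1# (suc r ℕ.+ 5 ℕ.* M))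
    fac r M = +-congˡ (-‿cong (mono-cong K.refl (ex r M)))
    go : ∀ M → pochTo K.1# 1 1 (M ℕ.* 5) ≋ pochTo K.1# 1 5 M * pochTo K.1# 2 5 M * pochTo K.1# 3 5 M * pochTo K.1# 4 5 M * pochTo K.1# 5 5 M
    go zero = sym (trans (*-identityʳ _) (trans (*-identityʳ _) (trans (*-identityʳ _) (*-identityʳ _))))
    go (suc M) = trans
      (*-cong (*-cong (*-cong (*-cong (*-cong (go M) (fac 0 M)) (fac 1 M)) (fac 2 M)) (fac 3 M)) (fac 4 M))
      (solve 10 (λ a b c d e a′ b′ c′ d′ e′ →
        a ⊠ b ⊠ c ⊠ d ⊠ e ⊠ a′ ⊠ b′ ⊠ c′ ⊠ d′ ⊠ e′ ⊜
        (a ⊠ a′) ⊠ (b ⊠ b′) ⊠ (c ⊠ c′) ⊠ (d ⊠ d′) ⊠ (e ⊠ e′)) ≡.refl _ _ _ _ _ _ _ _ _ _)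

  cyclotomic : K.Carrier → K.Carrier
  cyclotomic w = K.1# K.+ w K.+ w K.^ 2 K.+ w K.^ 3 K.+ w K.^ 4

  -- The difference of the two sides is a multiple of 1 + w + w² + w³ + w⁴ already as a polynomial
  -- in w and z; the last factor inside `solve` is the quotient.
  roots : ∀ w → cyclotomic w K.≈ K.0# → ∀ z →
          (1# - z) * (1# - cst w * z) * (1# - cst (w K.^ 2) * z) * (1# - cst (w K.^ 3) * z) * (1# - cst (w K.^ 4) * z) ≋ 1# - z ^ 5
  roots w h z = trans
    (*-cong (*-cong (*-cong refl (pw 2)) (pw 3)) (pw 4))
    (trans (solve 2 (λ w z →
       (con (+ 1) ⊟ z) ⊠ (con (+ 1) ⊟ w ⊠ z) ⊠ (con (+ 1) ⊟ w ⊡ 2 ⊠ z) ⊠ (con (+ 1) ⊟ w ⊡ 3 ⊠ z) ⊠ (con (+ 1) ⊟ w ⊡ 4 ⊠ z)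
       ⊜ (con (+ 1) ⊟ z ⊡ 5) ⊞ (con (+ 1) ⊞ w ⊞ w ⊡ 2 ⊞ w ⊡ 3 ⊞ w ⊡ 4) ⊠
         (⊖ z ⊞ (w ⊞ w ⊡ 3) ⊠ z ⊡ 2 ⊟ (w ⊡ 3 ⊞ w ⊡ 5) ⊠ z ⊡ 3 ⊞ w ⊡ 6 ⊠ z ⊡ 4 ⊞ (con (+ 1) ⊟ w ⊞ w ⊡ 5 ⊟ w ⊡ 6) ⊠ z ⊡ 5))
         ≡.refl (cst w) z)
    (trans (+-congˡ (trans (*-congʳ cyc0) (zeroˡ _))) (+-identityʳ _)))
    where
    module C = RingHom cstHom
    pw : ∀ k → 1# - cst (w K.^ k) * z ≋ 1# - cst w ^ k * z
    pw k = +-congˡ (-‿cong (*-congʳ (C.hom-^ w k)))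
    cyc0 : 1# + cst w + cst w ^ 2 + cst w ^ 3 + cst w ^ 4 ≋ 0#
    cyc0 = trans (sym (trans (C.hom-+ _ _) (+-cong (trans (C.hom-+ _ _) (+-cong (trans (C.hom-+ _ _) (+-cong (C.hom-+ _ _) (C.hom-^ w 2))) (C.hom-^ w 3))) (C.hom-^ w 4))))
      (trans (cst-cong h) ⟨ (λ { zero → K.refl ; (suc n) → K.refl }) ⟩)

  -- `roots` applied to each factor, with z = q^(a + dM).
  poch-roots : ∀ w → cyclotomic w K.≈ K.0# → ∀ a d → 1 ℕ.≤ d →
             poch K.1# a d * poch w a d * poch (w K.^ 2) a d * poch (w K.^ 3) a d * poch (w K.^ 4) a d ≋ poch K.1# (a ℕ.* 5) (d ℕ.* 5)
  poch-roots w h a (suc d′) le = limit-unique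
    (λ M → pochTo K.1# a d M * pochTo w a d M * pochTo (w K.^ 2) a d M * pochTo (w K.^ 3) a d M * pochTo (w K.^ 4) a d M)
    (λ M → mod-* (mod-* (mod-* (mod-* (lim _ M) (lim _ M)) (lim _ M)) (lim _ M)) (lim _ M))
    (λ M → mod-trans (mod-≈ (go M)) (pochTo-limit K.1# (a ℕ.* 5) (d ℕ.* 5) M (s≤s z≤n)))
    where
    d = suc d′
    lim : ∀ c M → pochTo c a d M ≋[ M ] poch c a d
    lim c M = pochTo-limit c a d M le
    fac : ∀ c e → 1# - mono c e ≋ 1# - cst c * mono K.1# e
    fac c e = +-congˡ (-‿cong (trans (mono-cong {e = e} (K.sym (K.*-identityʳ c)) ≡.refl)
      (trans (sym (mono-* c K.1# 0 e)) (*-congʳ (mono-0 c)))))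
    one^5 : K.1# K.^ 5 K.≈ K.1#
    one^5 = K.solve 0 (con (+ 1) ⊡ 5 ⊜ con (+ 1)) ≡.refl
    ex : ∀ a d M → (a ℕ.+ d ℕ.* M) ℕ.* 5 ≡ a ℕ.* 5 ℕ.+ d ℕ.* 5 ℕ.* M
    ex = ℕS.solve 3 (λ a d M → (a ℕS.:+ d ℕS.:* M) ℕS.:* ℕS.con 5 ℕS.:= a ℕS.:* ℕS.con 5 ℕS.:+ d ℕS.:* ℕS.con 5 ℕS.:* M) ≡.refl
      where module ℕS = Data.Nat.Solver.+-*-Solver
    go : ∀ M → pochTo K.1# a d M * pochTo w a d M * pochTo (w K.^ 2) a d M * pochTo (w K.^ 3) a d M * pochTo (w K.^ 4) a d M
         ≋ pochTo K.1# (a ℕ.* 5) (d ℕ.* 5) M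
    go zero = trans (*-identityʳ _) (trans (*-identityʳ _) (trans (*-identityʳ _) (*-identityʳ _)))
    go (suc M) = trans
      (solve 10 (λ a b c d e a′ b′ c′ d′ e′ →
        (a ⊠ a′) ⊠ (b ⊠ b′) ⊠ (c ⊠ c′) ⊠ (d ⊠ d′) ⊠ (e ⊠ e′) ⊜
        a ⊠ b ⊠ c ⊠ d ⊠ e ⊠ (a′ ⊠ b′ ⊠ c′ ⊠ d′ ⊠ e′)) ≡.refl _ _ _ _ _ _ _ _ _ _)
      (*-cong (go M) (trans
        (*-cong (*-cong (*-cong (*-cong refl (fac _ _)) (fac _ _)) (fac _ _)) (fac _ _))
        (trans (roots w h (mono K.1# (a ℕ.+ d ℕ.* M)))
          (+-congˡ (-‿cong (trans (mono-^ K.1# _ 5) (mono-cong one^5 (ex a d M))))))))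

-- Theta exponents and the dissection of the triple product modulo 5

module ℤK = RingKit ℤₚ.+-*-commutativeRing

module Theta (K : CommutativeRing 0ℓ 0ℓ) where
  open Series K
  open TripleProduct K
  open Substitution K

  power-⊖ : ∀ {c c′} → c K.* c′ K.≈ K.1# → ∀ m n → power c c′ (m ℤ.⊖ n) K.≈ c K.^ m K.* c′ K.^ n
  power-⊖ h zero zero = K.sym (K.*-identityʳ _)
  power-⊖ h (suc m) zero = K.sym (K.*-identityʳ _)
  power-⊖ h zero (suc n) = K.sym (K.*-identityˡ _)
  power-⊖ {c} {c′} h (suc m) (suc n) = begin
    power c c′ (suc m ℤ.⊖ suc n)            ≡⟨ ≡.cong (power c c′) (ℤₚ.[1+m]⊖[1+n]≡m⊖n m n) ⟩
    power c c′ (m ℤ.⊖ n)                    ≈⟨ power-⊖ h m n ⟩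
    c K.^ m K.* c′ K.^ n                    ≈⟨ K.trans (K.*-congʳ h) (K.*-identityˡ _) ⟨
    c K.* c′ K.* (c K.^ m K.* c′ K.^ n)     ≈⟨ K.solve 4 (λ a b x y → a ⊠ b ⊠ (x ⊠ y) ⊜ a ⊠ x ⊠ (b ⊠ y)) ≡.refl _ _ _ _ ⟩
    c K.^ suc m K.* c′ K.^ suc n            ∎
    where open import Relation.Binary.Reasoning.Setoid K.setoid

  2*tri : ∀ j → + 2 ℤ.* + tri j ≡ + j ℤ.* (+ j ℤ.- + 1)
  2*tri zero = ≡.refl
  2*tri (suc j) = ≡.trans (ℤₚ.*-distribˡ-+ (+ 2) (+ tri j) (+ j)) (≡.trans (≡.cong (ℤ._+ + 2 ℤ.* + j) (2*tri j))
    (ℤK.solve 1 (λ j → j ⊠ (j ⊟ con (+ 1)) ⊞ con (+ 2) ⊠ j ⊜ (con (+ 1) ⊞ j) ⊠ (con (+ 1) ⊞ j ⊟ con (+ 1))) ≡.refl (+ j)))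

  -- One quadratic form in j for both signs. Doubling removes the triangular numbers, so exponent
  -- identities become polynomial identities over ℤ and are halved afterwards.
  2*exponent : ∀ a b j → + 2 ℤ.* + exponent a b (a ℕ.+ b) j ≡ (+ a ℤ.+ + b) ℤ.* (j ℤ.* j) ℤ.+ (+ a ℤ.- + b) ℤ.* j
  2*exponent a b (+ j) = begin
    + 2 ℤ.* (+ (a ℕ.* j) ℤ.+ + ((a ℕ.+ b) ℕ.* tri j))
      ≡⟨ ≡.cong₂ (λ x y → + 2 ℤ.* (x ℤ.+ y)) (ℤₚ.pos-* a j) (ℤₚ.pos-* (a ℕ.+ b) (tri j)) ⟩
    + 2 ℤ.* (+ a ℤ.* + j ℤ.+ (+ a ℤ.+ + b) ℤ.* + tri j)
      ≡⟨ ℤK.solve 5 (λ a b j t two → two ⊠ (a ⊠ j ⊞ (a ⊞ b) ⊠ t) ⊜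
           two ⊠ a ⊠ j ⊞ (a ⊞ b) ⊠ (two ⊠ t)) ≡.refl (+ a) (+ b) (+ j) (+ tri j) (+ 2) ⟩
    + 2 ℤ.* + a ℤ.* + j ℤ.+ (+ a ℤ.+ + b) ℤ.* (+ 2 ℤ.* + tri j)
      ≡⟨ ≡.cong (λ x → + 2 ℤ.* + a ℤ.* + j ℤ.+ (+ a ℤ.+ + b) ℤ.* x) (2*tri j) ⟩
    + 2 ℤ.* + a ℤ.* + j ℤ.+ (+ a ℤ.+ + b) ℤ.* (+ j ℤ.* (+ j ℤ.- + 1))
      ≡⟨ ℤK.solve 3 (λ a b j → con (+ 2) ⊠ a ⊠ j ⊞ (a ⊞ b) ⊠ (j ⊠ (j ⊟ con (+ 1)))
           ⊜ (a ⊞ b) ⊠ (j ⊠ j) ⊞ (a ⊟ b) ⊠ j) ≡.refl (+ a) (+ b) (+ j) ⟩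
    (+ a ℤ.+ + b) ℤ.* (+ j ℤ.* + j) ℤ.+ (+ a ℤ.- + b) ℤ.* + j ∎
    where open ≡.≡-Reasoning
  2*exponent a b -[1+ j ] = ≡.trans
    (≡.cong (λ d → + 2 ℤ.* + (b ℕ.* suc j ℕ.+ d ℕ.* tri (suc j))) (ℕₚ.+-comm a b))
    (≡.trans (2*exponent b a (+ suc j))
      (ℤK.solve 3 (λ a b j → (b ⊞ a) ⊠ (j ⊠ j) ⊞ (b ⊟ a) ⊠ j
         ⊜ (a ⊞ b) ⊠ ((⊖ j) ⊠ (⊖ j)) ⊞ (a ⊟ b) ⊠ (⊖ j)) ≡.refl (+ a) (+ b) (+ suc j)))

  exponent-scale : ∀ a b j → exponent a b (a ℕ.+ b) j ℕ.* 5 ≡ exponent (a ℕ.* 5) (b ℕ.* 5) ((a ℕ.+ b) ℕ.* 5) j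
  exponent-scale a b (+ j) = ℕS.solve 4 (λ a j d t → (a ℕS.:* j ℕS.:+ d ℕS.:* t) ℕS.:* ℕS.con 5
    ℕS.:= a ℕS.:* ℕS.con 5 ℕS.:* j ℕS.:+ d ℕS.:* ℕS.con 5 ℕS.:* t) ≡.refl a j (a ℕ.+ b) (tri j)
    where module ℕS = Data.Nat.Solver.+-*-Solver
  exponent-scale a b -[1+ j ] = ℕS.solve 4 (λ a j d t → (a ℕS.:* j ℕS.:+ d ℕS.:* t) ℕS.:* ℕS.con 5
    ℕS.:= a ℕS.:* ℕS.con 5 ℕS.:* j ℕS.:+ d ℕS.:* ℕS.con 5 ℕS.:* t) ≡.refl b (suc j) (a ℕ.+ b) (tri (suc j))
    where module ℕS = Data.Nat.Solver.+-*-Solver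

  private
    half : ∀ {x y} → + 2 ℤ.* + x ≡ + 2 ℤ.* + y → x ≡ y
    half {x} {y} p = ℤₚ.+-injective (ℤₚ.*-cancelˡ-≡ (+ 2) (+ x) (+ y) p)

    ⊖-affine : ∀ r i N → (r ℕ.+ i ℕ.* 5) ℤ.⊖ (2 ℕ.+ N ℕ.* 5) ≡ (+ r ℤ.- + 2) ℤ.+ + 5 ℤ.* (i ℤ.⊖ N)
    ⊖-affine r i N = begin
      (r ℕ.+ i ℕ.* 5) ℤ.⊖ (2 ℕ.+ N ℕ.* 5)
        ≡⟨ ℤₚ.m-n≡m⊖n (r ℕ.+ i ℕ.* 5) (2 ℕ.+ N ℕ.* 5) ⟨
      (+ r ℤ.+ + (i ℕ.* 5)) ℤ.- (+ 2 ℤ.+ + (N ℕ.* 5))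
        ≡⟨ ≡.cong₂ (λ x y → (+ r ℤ.+ x) ℤ.- (+ 2 ℤ.+ y)) (ℤₚ.pos-* i 5) (ℤₚ.pos-* N 5) ⟩
      (+ r ℤ.+ + i ℤ.* + 5) ℤ.- (+ 2 ℤ.+ + N ℤ.* + 5)
        ≡⟨ ℤK.solve 3 (λ r i n → (r ⊞ i ⊠ con (+ 5)) ⊟ (con (+ 2) ⊞ n ⊠ con (+ 5))
             ⊜ (r ⊟ con (+ 2)) ⊞ con (+ 5) ⊠ (i ⊟ n)) ≡.refl (+ r) (+ i) (+ N) ⟩
      (+ r ℤ.- + 2) ℤ.+ + 5 ℤ.* (+ i ℤ.- + N)
        ≡⟨ ≡.cong (λ x → (+ r ℤ.- + 2) ℤ.+ + 5 ℤ.* x) (ℤₚ.m-n≡m⊖n i N) ⟩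
      (+ r ℤ.- + 2) ℤ.+ + 5 ℤ.* (i ℤ.⊖ N) ∎
      where open ≡.≡-Reasoning

    -- Put J = 5j + s with s = r - 2. Then J² + J = (s² + s) + 25j² + (10s + 5)j, which forces a + b
    -- = 25, a - b = 10s + 5 and the prefactor exponent e = s(s + 1)/2.
    exponent-dissect : ∀ r a b e → + a ℤ.- + b ≡ + 10 ℤ.* (+ r ℤ.- + 2) ℤ.+ + 5 → a ℕ.+ b ≡ 25 →
      + 2 ℤ.* + e ≡ (+ r ℤ.- + 2) ℤ.* (+ r ℤ.- + 2) ℤ.+ (+ r ℤ.- + 2) →
      ∀ i N → exponent 1 0 1 ((r ℕ.+ i ℕ.* 5) ℤ.⊖ (2 ℕ.+ N ℕ.* 5)) ≡ e ℕ.+ exponent a b 25 (i ℤ.⊖ N)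
    exponent-dissect r a b e hd hs he i N = half (begin
      + 2 ℤ.* + exponent 1 0 1 ((r ℕ.+ i ℕ.* 5) ℤ.⊖ (2 ℕ.+ N ℕ.* 5))
        ≡⟨ 2*exponent 1 0 J ⟩
      + 1 ℤ.* (J ℤ.* J) ℤ.+ + 1 ℤ.* J
        ≡⟨ ≡.cong (λ J → + 1 ℤ.* (J ℤ.* J) ℤ.+ + 1 ℤ.* J) (⊖-affine r i N) ⟩
      + 1 ℤ.* ((s ℤ.+ + 5 ℤ.* j) ℤ.* (s ℤ.+ + 5 ℤ.* j)) ℤ.+ + 1 ℤ.* (s ℤ.+ + 5 ℤ.* j)
        ≡⟨ ℤK.solve 2 (λ s j → con (+ 1) ⊠ ((s ⊞ con (+ 5) ⊠ j) ⊠ (s ⊞ con (+ 5) ⊠ j)) ⊞ con (+ 1) ⊠ (s ⊞ con (+ 5) ⊠ j)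
             ⊜ (s ⊠ s ⊞ s) ⊞ (con (+ 25) ⊠ (j ⊠ j) ⊞ (con (+ 10) ⊠ s ⊞ con (+ 5)) ⊠ j)) ≡.refl s j ⟩
      (s ℤ.* s ℤ.+ s) ℤ.+ (+ 25 ℤ.* (j ℤ.* j) ℤ.+ (+ 10 ℤ.* s ℤ.+ + 5) ℤ.* j)
        ≡⟨ ≡.cong₂ ℤ._+_ (≡.sym he) (≡.cong₂ (λ x y → + x ℤ.* (j ℤ.* j) ℤ.+ y ℤ.* j) (≡.sym hs) (≡.sym hd)) ⟩
      + 2 ℤ.* + e ℤ.+ ((+ a ℤ.+ + b) ℤ.* (j ℤ.* j) ℤ.+ (+ a ℤ.- + b) ℤ.* j)
        ≡⟨ ≡.cong (λ x → + 2 ℤ.* + e ℤ.+ x) (≡.sym (≡.trans (≡.cong (λ d → + 2 ℤ.* + exponent a b d j) (≡.sym hs)) (2*exponent a b j))) ⟩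
      + 2 ℤ.* + e ℤ.+ + 2 ℤ.* + exponent a b 25 j
        ≡⟨ ℤₚ.*-distribˡ-+ (+ 2) (+ e) _ ⟨
      + 2 ℤ.* + (e ℕ.+ exponent a b 25 j) ∎)
      where
      open ≡.≡-Reasoning
      J = (r ℕ.+ i ℕ.* 5) ℤ.⊖ (2 ℕ.+ N ℕ.* 5)
      s = + r ℤ.- + 2
      j = i ℤ.⊖ N

  module _ (x x′ : K.Carrier) (xx′ : x K.* x′ K.≈ K.1#) where
    private
      c = K.- x
      c′ = K.- x′

      neg-unit : ∀ {a b} → a K.* b K.≈ K.1# → K.- a K.* K.- b K.≈ K.1#
      neg-unit {a} {b} h = K.trans (K.solve 2 (λ a b → (⊖ a) ⊠ (⊖ b) ⊜ a ⊠ b) ≡.refl a b) h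

      unit^5 : x K.^ 5 K.* x′ K.^ 5 K.≈ K.1#
      unit^5 = K.trans (K.sym (K.^-distrib-* x x′ 5)) (K.trans (K.^-congˡ 5 xx′) (one^ 5))

      neg^5 : ∀ w n → (K.- w) K.^ (n ℕ.* 5) K.≈ (K.- (w K.^ 5)) K.^ n
      neg^5 w n = K.trans (K.reflexive (≡.cong ((K.- w) K.^_) (ℕₚ.*-comm n 5)))
        (K.trans (K.sym (K.^-assocʳ (K.- w) 5 n)) (K.^-congˡ n (K.solve 1 (λ w → (⊖ w) ⊡ 5 ⊜ ⊖ (w ⊡ 5)) ≡.refl w)))

      term-dissect : ∀ r a b e → + a ℤ.- + b ≡ + 10 ℤ.* (+ r ℤ.- + 2) ℤ.+ + 5 → a ℕ.+ b ≡ 25 →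
        + 2 ℤ.* + e ≡ (+ r ℤ.- + 2) ℤ.* (+ r ℤ.- + 2) ℤ.+ (+ r ℤ.- + 2) → ∀ i N →
        thetaTerm x x′ 1 0 1 ((r ℕ.+ i ℕ.* 5) ℤ.⊖ (2 ℕ.+ N ℕ.* 5)) ≋
        mono (c K.^ r K.* c′ K.^ 2) e * thetaTerm (x K.^ 5) (x′ K.^ 5) a b 25 (i ℤ.⊖ N)
      term-dissect r a b e hd hs he i N = trans (mono-cong pw (exponent-dissect r a b e hd hs he i N)) (sym (mono-* _ _ _ _))
        where
        open import Relation.Binary.Reasoning.Setoid K.setoid
        pw : power c c′ ((r ℕ.+ i ℕ.* 5) ℤ.⊖ (2 ℕ.+ N ℕ.* 5)) K.≈
             c K.^ r K.* c′ K.^ 2 K.* power (K.- (x K.^ 5)) (K.- (x′ K.^ 5)) (i ℤ.⊖ N)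
        pw = begin
          power c c′ ((r ℕ.+ i ℕ.* 5) ℤ.⊖ (2 ℕ.+ N ℕ.* 5))
            ≈⟨ power-⊖ (neg-unit xx′) (r ℕ.+ i ℕ.* 5) (2 ℕ.+ N ℕ.* 5) ⟩
          c K.^ (r ℕ.+ i ℕ.* 5) K.* c′ K.^ (2 ℕ.+ N ℕ.* 5)
            ≈⟨ K.*-cong (K.trans (K.^-homo-* c r (i ℕ.* 5)) (K.*-congˡ (neg^5 x i))) (K.trans (K.^-homo-* c′ 2 (N ℕ.* 5)) (K.*-congˡ (neg^5 x′ N))) ⟩
          c K.^ r K.* (K.- (x K.^ 5)) K.^ i K.* (c′ K.^ 2 K.* (K.- (x′ K.^ 5)) K.^ N)
            ≈⟨ K.solve 4 (λ a b c d → a ⊠ b ⊠ (c ⊠ d) ⊜ a ⊠ c ⊠ (b ⊠ d)) ≡.refl _ _ _ _ ⟩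
          c K.^ r K.* c′ K.^ 2 K.* ((K.- (x K.^ 5)) K.^ i K.* (K.- (x′ K.^ 5)) K.^ N)
            ≈⟨ K.*-congˡ (power-⊖ (neg-unit unit^5) i N) ⟨
          c K.^ r K.* c′ K.^ 2 K.* power (K.- (x K.^ 5)) (K.- (x′ K.^ 5)) (i ℤ.⊖ N) ∎

    private
      Θ : ℕ → ℕ → S
      Θ a b = poch K.1# 25 25 * (poch (x K.^ 5) a 25 * poch (x′ K.^ 5) b 25)

    -- The terms of the theta series with index ≡ s modulo 5, for s = -2, ..., 2, form a theta
    -- series in q²⁵ and x⁵, hence again a triple product. Starting the second product at exponent 0
    -- makes the exponent j(j + 1)/2.
    dissection : poch K.1# 1 1 * (poch x 1 1 * poch x′ 0 1) ≋
      mono (c K.^ 0 K.* c′ K.^ 2) 1 * Θ 5 20 + (mono (c K.^ 1 K.* c′ K.^ 2) 0 * Θ 10 15 + (mono (c K.^ 2 K.* c′ K.^ 2) 0 * Θ 15 10 +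
      (mono (c K.^ 3 K.* c′ K.^ 2) 1 * Θ 20 5 + mono (c K.^ 4 K.* c′ K.^ 2) 3 * Θ 25 0)))
    dissection = limit-unique
      -- The window |j| ≤ 5N + 2 contains exactly 2N + 1 blocks of five, so each residue class
      -- inherits the symmetric window |j| ≤ N.
      (λ N → diagSum (2 ℕ.+ N ℕ.* 5 ℕ.+ (2 ℕ.+ N ℕ.* 5)) (λ k l → thetaTerm x x′ 1 0 1 (k ℤ.⊖ (2 ℕ.+ N ℕ.* 5))))
      (λ N → mod-weaken (ℕₚ.≤-trans (ℕₚ.m≤m*n N 5) (ℕₚ.m≤n+m (N ℕ.* 5) 2)) (tripleProduct x x′ xx′ 1 0 1 ≡.refl (s≤s z≤n) (2 ℕ.+ N ℕ.* 5)))
      (λ N → mod-trans (mod-≈ (blocks N)) (mod-+ (lim 5 20 ≡.refl N) (mod-+ (lim 10 15 ≡.refl N) (mod-+ (lim 15 10 ≡.refl N)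
        (mod-+ (lim 20 5 ≡.refl N) (lim 25 0 ≡.refl N))))))
      where
      P : ℕ → ℕ → ℕ → S
      P a b N = diagSum (N ℕ.+ N) (λ i l → thetaTerm (x K.^ 5) (x′ K.^ 5) a b 25 (i ℤ.⊖ N))
      lim : ∀ a b {w e} → a ℕ.+ b ≡ 25 → ∀ N → mono w e * P a b N ≋[ N ] mono w e * Θ a b
      lim a b h N = mod-* mod-refl (tripleProduct (x K.^ 5) (x′ K.^ 5) unit^5 a b 25 h (s≤s z≤n) N)
      size : ∀ N → 2 ℕ.+ N ℕ.* 5 ℕ.+ (2 ℕ.+ N ℕ.* 5) ≡ 4 ℕ.+ (N ℕ.+ N) ℕ.* 5
      size = ℕS.solve 1 (λ n → ℕS.con 2 ℕS.:+ n ℕS.:* ℕS.con 5 ℕS.:+ (ℕS.con 2 ℕS.:+ n ℕS.:* ℕS.con 5)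
        ℕS.:= ℕS.con 4 ℕS.:+ (n ℕS.:+ n) ℕS.:* ℕS.con 5) ≡.refl
        where module ℕS = Data.Nat.Solver.+-*-Solver
      module _ (N : ℕ) where
        T : ℕ → ℕ → ℕ → ℕ → S
        T w a b i = thetaTerm (x K.^ 5) (x′ K.^ 5) a b 25 (i ℤ.⊖ N)
        M : ℕ → ℕ → S
        M r e = mono (c K.^ r K.* c′ K.^ 2) e
        blocks : diagSum (2 ℕ.+ N ℕ.* 5 ℕ.+ (2 ℕ.+ N ℕ.* 5)) (λ k l → thetaTerm x x′ 1 0 1 (k ℤ.⊖ (2 ℕ.+ N ℕ.* 5))) ≋
                 M 0 1 * P 5 20 N + (M 1 0 * P 10 15 N + (M 2 0 * P 15 10 N + (M 3 1 * P 20 5 N + M 4 3 * P 25 0 N)))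
        blocks = trans (reflexive (≡.cong (λ n → diagSum n (λ k l → thetaTerm x x′ 1 0 1 (k ℤ.⊖ (2 ℕ.+ N ℕ.* 5)))) (size N)))
          (trans (diagSum-blocks (N ℕ.+ N) (λ k l → thetaTerm x x′ 1 0 1 (k ℤ.⊖ (2 ℕ.+ N ℕ.* 5))))
          (trans (diagSum-cong (N ℕ.+ N) (λ i l _ →
            +-cong (term-dissect 0 5 20 1 ≡.refl ≡.refl ≡.refl i N)
            (+-cong (term-dissect 1 10 15 0 ≡.refl ≡.refl ≡.refl i N)
            (+-cong (term-dissect 2 15 10 0 ≡.refl ≡.refl ≡.refl i N)
            (+-cong (term-dissect 3 20 5 1 ≡.refl ≡.refl ≡.refl i N)
            (term-dissect 4 25 0 3 ≡.refl ≡.refl ≡.refl i N))))))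
          (trans (diagSum-+ (N ℕ.+ N) (λ i l → M 0 1 * T 0 5 20 i) (λ i l → M 1 0 * T 1 10 15 i + (M 2 0 * T 2 15 10 i + (M 3 1 * T 3 20 5 i + M 4 3 * T 4 25 0 i))))
          (+-cong (diagSum-*ˡ (N ℕ.+ N) _ (λ i l → T 0 5 20 i))
          (trans (diagSum-+ (N ℕ.+ N) (λ i l → M 1 0 * T 1 10 15 i) (λ i l → M 2 0 * T 2 15 10 i + (M 3 1 * T 3 20 5 i + M 4 3 * T 4 25 0 i)))
          (+-cong (diagSum-*ˡ (N ℕ.+ N) _ (λ i l → T 1 10 15 i))
          (trans (diagSum-+ (N ℕ.+ N) (λ i l → M 2 0 * T 2 15 10 i) (λ i l → M 3 1 * T 3 20 5 i + M 4 3 * T 4 25 0 i))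
          (+-cong (diagSum-*ˡ (N ℕ.+ N) _ (λ i l → T 2 15 10 i))
          (trans (diagSum-+ (N ℕ.+ N) (λ i l → M 3 1 * T 3 20 5 i) (λ i l → M 4 3 * T 4 25 0 i))
          (+-cong (diagSum-*ˡ (N ℕ.+ N) _ (λ i l → T 3 20 5 i)) (diagSum-*ˡ (N ℕ.+ N) _ (λ i l → T 4 25 0 i))))))))))))

-- Theta series, their derivative series, and first-order deformation

module Bilateral (K : CommutativeRing 0ℓ 0ℓ) where
  open Series K
  open TripleProduct K
  open Substitution K
  open Theta K

  partial : (ℤ → S) → ℕ → S
  partial f N = diagSum (N ℕ.+ N) (λ k l → f (k ℤ.⊖ N))

  -- The coefficient of q^n uses only |j| ≤ n, which is the whole sum once the j-th term has order
  -- at least |j|; `exponent-≥` guarantees this for a, b ≥ 1.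
  bilateral : (ℤ → S) → S
  bilateral f n = partial f n n

  private
    partial-step : ∀ f → (∀ j → f j ≋[ ℤ.∣ j ∣ ] 0#) → ∀ N → partial f (suc N) ≋[ suc N ] partial f N
    partial-step f h N = mod-trans (mod-≈ (reflexive (≡.cong (λ n → diagSum (suc n) (λ k l → f (k ℤ.⊖ suc N))) (ℕₚ.+-suc N N))))
      (mod-trans (mod-+ (h _) (mod-trans (mod-≈ (diagSum-last (N ℕ.+ N) (λ k l → f (suc k ℤ.⊖ suc N))))
        (mod-+ (mod-≈ (diagSum-cong (N ℕ.+ N) (λ k l _ → reflexive (≡.cong f (ℤₚ.[1+m]⊖[1+n]≡m⊖n k N))))) end)))
      (mod-≈ (trans (+-identityˡ _) (+-identityʳ _))))
      where
      end : f (suc (suc (N ℕ.+ N)) ℤ.⊖ suc N) ≋[ suc N ] 0#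
      end = ≡.subst (λ j → f j ≋[ suc N ] 0#) (≡.sym (≡.trans (≡.cong (ℤ._⊖ suc N) (≡.cong suc (≡.sym (ℕₚ.+-suc N N))))
        (≡.trans (ℤₚ.⊖-≥ (ℕₚ.m≤n+m (suc N) (suc N))) (≡.cong +_ (ℕₚ.m+n∸n≡m (suc N) (suc N)))))) (h (+ suc N))

  bilateral-limit : ∀ f → (∀ j → f j ≋[ ℤ.∣ j ∣ ] 0#) → ∀ N → partial f N ≋[ suc N ] bilateral f
  bilateral-limit f h N = ⟨ (λ i i< → ≡.subst (λ m → partial f m i K.≈ partial f i i) (ℕₚ.m∸n+n≡m (ℕₚ.≤-pred i<)) (go i (N ℕ.∸ i))) ⟩
    where
    go : ∀ i j → partial f (j ℕ.+ i) i K.≈ partial f i i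
    go i zero = K.refl
    go i (suc j) = K.trans (below (partial-step f h (j ℕ.+ i)) i (s≤s (ℕₚ.m≤n+m i j))) (go i j)

  sign : ℤ → K.Carrier
  sign = power (K.- K.1#) (K.- K.1#)

  -- The exponent e(j) satisfies 2 e(j) = (a + b) j² + (a - b) j; theta′ 3 2 is the series S.
  theta theta′ : ℕ → ℕ → S
  theta a b = bilateral (λ j → mono (sign j) (exponent a b (a ℕ.+ b) j))
  theta′ a b = bilateral (λ j → mono (sign j K.* K.⟪ j ⟫) (exponent a b (a ℕ.+ b) j))

  exponent-≥ : ∀ a b j → 1 ℕ.≤ a → 1 ℕ.≤ b → ℤ.∣ j ∣ ℕ.≤ exponent a b (a ℕ.+ b) j
  exponent-≥ (suc a) b (+ j) p q = ℕₚ.≤-trans (ℕₚ.m≤m+n j (a ℕ.* j)) (ℕₚ.m≤m+n _ _)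
  exponent-≥ a (suc b) -[1+ j ] p q = ℕₚ.≤-trans (ℕₚ.m≤m+n (suc j) (b ℕ.* suc j)) (ℕₚ.m≤m+n _ _)

  module _ (a b : ℕ) (1≤a : 1 ℕ.≤ a) (1≤b : 1 ℕ.≤ b) where
    private
      d = a ℕ.+ b
      1≤d : 1 ℕ.≤ d
      1≤d = ℕₚ.≤-trans 1≤a (ℕₚ.m≤m+n a b)

      small : ∀ (w : ℤ → K.Carrier) j → mono (w j) (exponent a b d j) ≋[ ℤ.∣ j ∣ ] 0#
      small w j = mod-weaken (exponent-≥ a b j 1≤a 1≤b) (O-mono _ _)

    mono-limit : ∀ (w : ℤ → K.Carrier) N → partial (λ j → mono (w j) (exponent a b d j)) N ≋[ suc N ]
                 bilateral (λ j → mono (w j) (exponent a b d j))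
    mono-limit w = bilateral-limit _ (small w)

    theta-product : theta a b ≋ poch K.1# d d * (poch K.1# a d * poch K.1# b d)
    theta-product = limit-unique (partial (λ j → mono (sign j) (exponent a b d j)))
      (λ N → mod-weaken (ℕₚ.n≤1+n N) (mono-limit sign N))
      (tripleProduct K.1# K.1# (K.*-identityˡ _) a b d ≡.refl 1≤d)

    private
      -- The first-order expansion (1 + δ)^j = 1 + jδ.
      deform : ∀ δ → δ K.* δ K.≈ K.0# → ∀ j → (K.- (K.1# K.+ δ)) K.^ j K.≈
               (K.- K.1#) K.^ j K.+ δ K.* ((K.- K.1#) K.^ j K.* K.⟪ + j ⟫)
      deform δ h zero = K.sym (K.trans (K.+-congˡ (K.trans (K.*-congˡ (K.zeroʳ _)) (K.zeroʳ _))) (K.+-identityʳ _))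
      deform δ h (suc j) = K.trans (K.*-congˡ (deform δ h j)) (K.trans
        (K.solve 3 (λ δ s n → (⊖ (con (+ 1) ⊞ δ)) ⊠ (s ⊞ δ ⊠ (s ⊠ n)) ⊜
          ((⊖ con (+ 1)) ⊠ s ⊞ δ ⊠ ((⊖ con (+ 1)) ⊠ s ⊠ (con (+ 1) ⊞ n))) ⊟ δ ⊠ δ ⊠ (s ⊠ n)) ≡.refl δ _ _)
        (K.trans (K.+-congˡ (K.trans (K.-‿cong (K.trans (K.*-congʳ h) (K.zeroˡ _))) K.-0#≈0#)) (K.+-identityʳ _)))

      deformℤ : ∀ δ → δ K.* δ K.≈ K.0# → ∀ j → power (K.- (K.1# K.+ δ)) (K.- (K.1# K.- δ)) j K.≈
                sign j K.+ δ K.* (sign j K.* K.⟪ j ⟫)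
      deformℤ δ h (+ j) = deform δ h j
      deformℤ δ h -[1+ j ] = K.trans
        (deform (K.- δ) (K.trans (K.solve 1 (λ x → (⊖ x) ⊠ (⊖ x) ⊜ x ⊠ x) ≡.refl δ) h) (suc j))
        (K.+-congˡ (K.solve 3 (λ d s n → (⊖ d) ⊠ (s ⊠ n) ⊜ d ⊠ (s ⊠ (⊖ n))) ≡.refl δ _ K.⟪ + suc j ⟫))

    -- Moving the base point from 1 to 1 + δ differentiates the theta series termwise, which is how
    -- `theta′` enters. The statement is made at q⁵ because that is where `dissection` produces it.
    theta-deform : ∀ δ → δ K.* δ K.≈ K.0# →
      poch K.1# (d ℕ.* 5) (d ℕ.* 5) * (poch (K.1# K.+ δ) (a ℕ.* 5) (d ℕ.* 5) * poch (K.1# K.- δ) (b ℕ.* 5) (d ℕ.* 5)) ≋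
      V (theta a b) + cst δ * V (theta′ a b)
    theta-deform δ h = limit-unique
      (partial (thetaTerm (K.1# K.+ δ) (K.1# K.- δ) (a ℕ.* 5) (b ℕ.* 5) (d ℕ.* 5)))
      (tripleProduct (K.1# K.+ δ) (K.1# K.- δ)
        (K.trans (K.solve 1 (λ x → (con (+ 1) ⊞ x) ⊠ (con (+ 1) ⊟ x) ⊜ con (+ 1) ⊟ x ⊠ x) ≡.refl δ)
          (K.trans (K.+-congˡ (K.trans (K.-‿cong h) K.-0#≈0#)) (K.+-identityʳ _)))
        (a ℕ.* 5) (b ℕ.* 5) (d ℕ.* 5) (≡.sym (ℕₚ.*-distribʳ-+ 5 a b)) (ℕₚ.≤-trans 1≤d (ℕₚ.m≤m*n d 5)))
      (λ N → mod-trans (mod-≈ (trans (diagSum-cong (N ℕ.+ N) (λ k l _ → term (k ℤ.⊖ N)))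
          (trans (diagSum-+ (N ℕ.+ N) (λ k l → V (xs (k ℤ.⊖ N))) (λ k l → cst δ * V (ds (k ℤ.⊖ N))))
            (+-cong (sym (VH.hom-diagSum (N ℕ.+ N) (λ k l → xs (k ℤ.⊖ N))))
              (trans (diagSum-*ˡ (N ℕ.+ N) _ (λ k l → V (ds (k ℤ.⊖ N)))) (*-congˡ (sym (VH.hom-diagSum (N ℕ.+ N) (λ k l → ds (k ℤ.⊖ N))))))))))
        (mod-+ (V-mod (mod-weaken (ℕₚ.n≤1+n N) (mono-limit sign N)))
          (mod-* mod-refl (V-mod (mod-weaken (ℕₚ.n≤1+n N) (mono-limit (λ j → sign j K.* K.⟪ j ⟫) N))))))
      where
      xs ds : ℤ → S
      xs j = mono (sign j) (exponent a b d j)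
      ds j = mono (sign j K.* K.⟪ j ⟫) (exponent a b d j)
      term : ∀ j → thetaTerm (K.1# K.+ δ) (K.1# K.- δ) (a ℕ.* 5) (b ℕ.* 5) (d ℕ.* 5) j ≋ V (xs j) + cst δ * V (ds j)
      term j = trans (mono-cong (deformℤ δ h j) (≡.sym (exponent-scale a b j)))
        (trans (mono-+ (sign j) (δ K.* (sign j K.* K.⟪ j ⟫)) (exponent a b d j ℕ.* 5)) (+-cong (sym (V-mono _ _))
          (trans (sym (mono-* δ (sign j K.* K.⟪ j ⟫) 0 _)) (*-cong (mono-0 δ) (sym (V-mono _ _))))))

  poch-first : ∀ c d → 1 ℕ.≤ d → poch c 0 d ≋ (1# - cst c) * poch c d d
  poch-first c d h = limit-unique (λ M → pochTo c 0 d (suc M))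
    (λ M → mod-weaken (ℕₚ.n≤1+n M) (pochTo-limit c 0 d (suc M) h))
    (λ M → mod-trans (mod-≈ (go M)) (mod-* mod-refl (pochTo-limit c d d M h)))
    where
    go : ∀ M → pochTo c 0 d (suc M) ≋ (1# - cst c) * pochTo c d d M
    go zero = trans (*-comm _ _) (*-congʳ (+-congˡ (-‿cong (trans (mono-cong K.refl (ℕₚ.*-zeroʳ d)) (mono-0 c)))))
    go (suc M) = trans (*-cong (go M) (+-congˡ (-‿cong (mono-cong K.refl (ℕₚ.*-suc d M))))) (*-assoc _ _ _)

  -- In the uses c = 1 + δ or 1 - δ with δ² = 0: next to a factor δ the deformation is invisible.
  poch-absorb : ∀ δ c a d → 1 ℕ.≤ d → δ K.* c K.≈ δ → cst δ * poch c a d ≋ cst δ * poch K.1# a d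
  poch-absorb δ c a d h p = limit-unique (λ M → cst δ * pochTo c a d M)
    (λ M → mod-* mod-refl (pochTo-limit c a d M h))
    (λ M → mod-trans (mod-≈ (go M)) (mod-* mod-refl (pochTo-limit K.1# a d M h)))
    where
    mv : ∀ M → cst δ * (1# - mono c (a ℕ.+ d ℕ.* M)) ≋ cst δ * (1# - mono K.1# (a ℕ.+ d ℕ.* M))
    mv M = trans (distrib′ _ _) (trans (+-congˡ (-‿cong (trans (sc c) (trans
      (mono-cong {e = a ℕ.+ d ℕ.* M} (K.trans p (K.sym (K.*-identityʳ δ))) ≡.refl) (sym (sc K.1#)))))) (sym (distrib′ _ _)))
      where
      distrib′ : ∀ x y → x * (1# - y) ≋ x - x * y
      distrib′ = solve 2 (λ x y → x ⊠ (con (+ 1) ⊟ y) ⊜ x ⊟ x ⊠ y) ≡.refl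
      sc : ∀ w → cst δ * mono w (a ℕ.+ d ℕ.* M) ≋ mono (δ K.* w) (a ℕ.+ d ℕ.* M)
      sc w = trans (*-congʳ (sym (mono-0 δ))) (mono-* δ w 0 _)
    go : ∀ M → cst δ * pochTo c a d M ≋ cst δ * pochTo K.1# a d M
    go zero = refl
    go (suc M) = trans (sym (*-assoc _ _ _)) (trans (*-congʳ (go M)) (trans
      (solve 3 (λ x y z → x ⊠ y ⊠ z ⊜ x ⊠ z ⊠ y) ≡.refl _ _ _) (trans (*-congʳ (mv M))
      (solve 3 (λ x y z → x ⊠ z ⊠ y ⊜ x ⊠ (y ⊠ z)) ≡.refl _ _ _))))

-- Change of the coefficient ring

module CoefficientMap {R R′ : CommutativeRing 0ℓ 0ℓ} (φ : RingHom R R′) where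
  private
    module R = Series R
    module R′ = Series R′
    module RS = Substitution R
    module RS′ = Substitution R′
    module RB = Bilateral R
    module RB′ = Bilateral R′
    module RT = TripleProduct R
    module RT′ = TripleProduct R′
    module φ = RingHom φ

  mapS : R.S → R′.S
  mapS f n = φ.fun (f n)

  mapHom : RingHom R.seriesRing R′.seriesRing
  mapHom = record
    { fun = mapS ; hom-cong = λ p → R′.⟨ (λ n → φ.hom-cong (R.at p n)) ⟩
    ; hom-+ = λ f g → R′.⟨ (λ n → φ.hom-+ _ _) ⟩
    ; hom-* = λ f g → R′.⟨ (λ n → R′.K.trans (φ.hom-diagSum n _) (R′.K.diagSum-cong n (λ k l _ → φ.hom-* _ _))) ⟩
    ; hom-1 = R′.⟨ (λ { zero → φ.hom-1 ; (suc n) → φ.hom-0 }) ⟩ }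

  private module M = RingHom mapHom

  map-mod : ∀ {f g n} → f R.≋[ n ] g → mapS f R′.≋[ n ] mapS g
  map-mod p = R′.⟨ (λ i h → φ.hom-cong (R.below p i h)) ⟩

  opaque
    unfolding R.mono
    map-mono : ∀ c e → mapS (R.mono c e) R′.≋ R′.mono (φ.fun c) e
    map-mono c e = R′.⟨ go e ⟩
      where
      go : ∀ e n → φ.fun (R.mono c e n) R′.K.≈ R′.mono (φ.fun c) e n
      go zero zero = R′.K.refl
      go zero (suc n) = φ.hom-0
      go (suc e) zero = φ.hom-0
      go (suc e) (suc n) = go e n

  map-poch : ∀ a d → 1 ℕ.≤ d → mapS (R.poch R.K.1# a d) R′.≋ R′.poch R′.K.1# a d
  map-poch a d h = R′.limit-unique (λ M → mapS (R.pochTo R.K.1# a d M))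
    (λ M → map-mod (R.pochTo-limit R.K.1# a d M h))
    (λ M → R′.mod-trans (R′.mod-≈ (go M)) (R′.pochTo-limit R′.K.1# a d M h))
    where
    go : ∀ M → mapS (R.pochTo R.K.1# a d M) R′.≋ R′.pochTo R′.K.1# a d M
    go zero = M.hom-1
    go (suc M) = R′.trans (M.hom-* _ _) (R′.*-cong (go M) (R′.trans (M.hom-sub _ _)
      (R′.+-cong M.hom-1 (R′.-‿cong (R′.trans (map-mono R.K.1# _) (R′.mono-cong φ.hom-1 ≡.refl))))))

  map-V : ∀ f → mapS (RS.V f) R′.≋ RS′.V (mapS f)
  map-V f = R′.⟨ (λ n → go n f) ⟩
    where
    go : ∀ n f → φ.fun (RS.V f n) R′.K.≈ RS′.V (mapS f) n
    go 0 f = R′.K.refl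
    go 1 f = φ.hom-0
    go 2 f = φ.hom-0
    go 3 f = φ.hom-0
    go 4 f = φ.hom-0
    go (suc (suc (suc (suc (suc n))))) f = go n (λ k → f (suc k))

  map-theta′ : ∀ a b → mapS (RB.theta′ a b) R′.≋ RB′.theta′ a b
  map-theta′ a b = R′.⟨ (λ n → R′.K.trans
    (R′.at (M.hom-diagSum (n ℕ.+ n) (λ k l → term (k ℤ.⊖ n))) n)
    (R′.at (R′.diagSum-cong (n ℕ.+ n) (λ k l _ → step (k ℤ.⊖ n))) n)) ⟩
    where
    term : ℤ → R.S
    term j = R.mono (RB.sign j R.K.* R.K.⟪ j ⟫) (RT.exponent a b (a ℕ.+ b) j)
    sgn : ∀ j → φ.fun (RB.sign j) R′.K.≈ RB′.sign j
    neg1 : φ.fun (R.K.- R.K.1#) R′.K.≈ R′.K.- R′.K.1#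
    neg1 = R′.K.trans (φ.hom-neg _) (R′.K.-‿cong φ.hom-1)
    sgn (+ j) = R′.K.trans (φ.hom-^ _ j) (R′.K.^-congˡ j neg1)
    sgn -[1+ j ] = R′.K.trans (φ.hom-^ _ (suc j)) (R′.K.^-congˡ (suc j) neg1)
    step : ∀ j → mapS (term j) R′.≋ R′.mono (RB′.sign j R′.K.* R′.K.⟪ j ⟫) (RT′.exponent a b (a ℕ.+ b) j)
    step j = R′.trans (map-mono _ _) (R′.mono-cong (R′.K.trans (φ.hom-* _ _) (R′.K.*-cong (sgn j) (φ.hom-⟪⟫ j))) (exp≡ j))
      where
      exp≡ : ∀ j → RT.exponent a b (a ℕ.+ b) j ≡ RT′.exponent a b (a ℕ.+ b) j
      exp≡ (+ j) = ≡.refl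
      exp≡ -[1+ j ] = ≡.refl

-- The products A, B, E₁, E₅ and the dissection of the deformed theta product

module Products (K : CommutativeRing 0ℓ 0ℓ) where
  open Series K
  open Substitution K
  open Bilateral K
  open TripleProduct K
  open Theta K

  [_,_] : ℕ → ℕ → S
  [ a , d ] = poch K.1# a d

  A B E₁ E₅ : S
  A = [ 1 , 5 ] * [ 4 , 5 ]
  B = [ 2 , 5 ] * [ 3 , 5 ]
  E₁ = [ 1 , 1 ]
  E₅ = [ 5 , 5 ]

  q : S
  q = mono K.1# 1

  E₁-factor : E₁ ≋ A * B * E₅
  E₁-factor = trans poch-split (solve 5 (λ a b c d e → a ⊠ b ⊠ c ⊠ d ⊠ e ⊜ a ⊠ d ⊠ (b ⊠ c) ⊠ e) ≡.refl _ _ _ _ _)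

  VE₁ : V E₁ ≋ E₅
  VE₁ = V-poch K.1# 1 1 (s≤s z≤n)

  constant-1 : ∀ m n → 1 ℕ.≤ m → 1 ℕ.≤ n → [ m , n ] 0 K.≈ K.1#
  constant-1 m n h h′ = K.trans (poch-coefficient K.1# m n 0) (pochTo-0 K.1# m n 1 h)

  E₅-unit : E₅ * inv E₅ ≋ 1#
  E₅-unit = inv-inverseʳ E₅ (constant-1 5 5 (s≤s z≤n) (s≤s z≤n))

  A-unit : A * inv A ≋ 1#
  A-unit = inv-inverseʳ A (K.trans (K.*-cong (constant-1 1 5 (s≤s z≤n) (s≤s z≤n)) (constant-1 4 5 (s≤s z≤n) (s≤s z≤n))) (K.*-identityˡ _))

  B-unit : B * inv B ≋ 1#
  B-unit = inv-inverseʳ B (K.trans (K.*-cong (constant-1 2 5 (s≤s z≤n) (s≤s z≤n)) (constant-1 3 5 (s≤s z≤n) (s≤s z≤n))) (K.*-identityˡ _))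

  V-unit : ∀ {f g} → f * g ≋ 1# → V f * V g ≋ 1#
  V-unit h = trans (sym (VH.hom-* _ _)) (trans (VH.hom-cong h) VH.hom-1)

  V-q : V q ≋ q ^ 5
  V-q = trans (V-mono K.1# 1) (trans (mono-cong (K.sym (one^ 5)) ≡.refl) (sym (mono-^ K.1# 1 5)))

  V-injective : ∀ {f g} → V f ≋ V g → f ≋ g
  V-injective {f} {g} h = trans (sym (U-hit 0 f)) (trans (U-cong 0 (*-congˡ h)) (U-hit 0 g))

  theta-X : theta 3 2 ≋ E₅ * B
  theta-X = trans (theta-product 3 2 (s≤s z≤n) (s≤s z≤n)) (*-congˡ (*-comm _ _))

  theta-Y : theta 4 1 ≋ E₅ * A
  theta-Y = trans (theta-product 4 1 (s≤s z≤n) (s≤s z≤n)) (*-congˡ (*-comm _ _))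

  poch-cong : ∀ {c c′} a d → 1 ℕ.≤ d → c K.≈ c′ → poch c a d ≋ poch c′ a d
  poch-cong {c} {c′} a d h p = limit-unique (pochTo c a d) (λ M → pochTo-limit c a d M h)
    (λ M → mod-trans (mod-≈ (pochTo-cong p ≡.refl ≡.refl M)) (pochTo-limit c′ a d M h))

  -- η = 0 gives the dissection of (q, wq, q/w; q)_∞, w = 1 Jacobi's identity for E₁³, and w = ζ, η = ε the crank.
  module Dissected (w η : K.Carrier) (w⁵ : w K.^ 5 K.≈ K.1#) (η² : η K.* η K.≈ K.0#) where
    x x′ δ : K.Carrier
    x = w K.* (K.1# K.+ η)
    x′ = w K.^ 4 K.* (K.1# K.- η)
    δ = K.⟪ + 5 ⟫ K.* η

    private
      drop-η² : ∀ {y z} t → y K.≈ z K.+ η K.* η K.* t → y K.≈ z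
      drop-η² t h = K.trans h (K.trans (K.+-congˡ (K.trans (K.*-congʳ η²) (K.zeroˡ t))) (K.+-identityʳ _))

      drop-w⁵ : ∀ {y z} t → y K.≈ z K.+ (w K.^ 5 K.- K.1#) K.* t → y K.≈ z
      drop-w⁵ t h = K.trans h (K.trans (K.+-congˡ (K.trans (K.*-congʳ (K.trans (K.+-congʳ w⁵) (K.-‿inverseʳ _))) (K.zeroˡ t))) (K.+-identityʳ _))

    xx′ : x K.* x′ K.≈ K.1#
    xx′ = drop-η² (K.- (w K.^ 5)) (K.trans (K.solve 2 (λ w h → w ⊠ (con (+ 1) ⊞ h) ⊠ (w ⊡ 4 ⊠ (con (+ 1) ⊟ h))
      ⊜ w ⊡ 5 ⊞ h ⊠ h ⊠ (⊖ (w ⊡ 5))) ≡.refl w η) (K.+-congʳ w⁵))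

    δ² : δ K.* δ K.≈ K.0#
    δ² = drop-η² (K.⟪ + 25 ⟫) (K.solve 1 (λ h → con (+ 5) ⊠ h ⊠ (con (+ 5) ⊠ h) ⊜ con (+ 0) ⊞ h ⊠ h ⊠ con (+ 25)) ≡.refl η)

    x⁵ : x K.^ 5 K.≈ K.1# K.+ δ
    x⁵ = K.trans (K.^-distrib-* w (K.1# K.+ η) 5) (K.trans (K.*-congʳ w⁵) (K.trans (K.*-identityˡ _)
      (drop-η² (K.⟪ + 10 ⟫ K.+ K.⟪ + 10 ⟫ K.* η K.+ K.⟪ + 5 ⟫ K.* η K.^ 2 K.+ η K.^ 3) (K.solve 1 (λ h →
        (con (+ 1) ⊞ h) ⊡ 5 ⊜ con (+ 1) ⊞ con (+ 5) ⊠ h ⊞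
        h ⊠ h ⊠ (con (+ 10) ⊞ con (+ 10) ⊠ h ⊞ con (+ 5) ⊠ h ⊡ 2 ⊞ h ⊡ 3)) ≡.refl η))))

    x′⁵ : x′ K.^ 5 K.≈ K.1# K.- δ
    x′⁵ = K.trans (K.^-distrib-* (w K.^ 4) (K.1# K.- η) 5) (K.trans (K.*-congʳ (K.trans (K.^-assocʳ w 4 5)
        (K.trans (K.sym (K.^-assocʳ w 5 4)) (K.trans (K.^-congˡ 4 w⁵) (one^ 4))))) (K.trans (K.*-identityˡ _)
      (drop-η² (K.⟪ + 10 ⟫ K.- K.⟪ + 10 ⟫ K.* η K.+ K.⟪ + 5 ⟫ K.* η K.^ 2 K.- η K.^ 3) (K.solve 1 (λ h →
        (con (+ 1) ⊟ h) ⊡ 5 ⊜ con (+ 1) ⊟ con (+ 5) ⊠ h ⊞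
        h ⊠ h ⊠ (con (+ 10) ⊟ con (+ 10) ⊠ h ⊞ con (+ 5) ⊠ h ⊡ 2 ⊟ h ⊡ 3)) ≡.refl η))))

    private
      dd : δ K.* (K.1# K.- δ) K.≈ δ
      dd = K.trans (K.solve 1 (λ d → d ⊠ (con (+ 1) ⊟ d) ⊜ d ⊟ d ⊠ d) ≡.refl δ)
        (K.trans (K.+-congˡ (K.trans (K.-‿cong δ²) K.-0#≈0#)) (K.+-identityʳ _))
      dd′ : δ K.* (K.1# K.+ δ) K.≈ δ
      dd′ = K.trans (K.solve 1 (λ d → d ⊠ (con (+ 1) ⊞ d) ⊜ d ⊞ d ⊠ d) ≡.refl δ)
        (K.trans (K.+-congˡ δ²) (K.+-identityʳ _))
      neg-δ² : (K.- δ) K.* (K.- δ) K.≈ K.0#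
      neg-δ² = K.trans (K.solve 1 (λ x → (⊖ x) ⊠ (⊖ x) ⊜ x ⊠ x) ≡.refl δ) δ²

    X Y S₀ S₁ e : S
    X = V (E₅ * B)
    Y = V (E₅ * A)
    S₀ = V (theta′ 3 2)
    S₁ = V (theta′ 4 1)
    e = V E₅

    private
      25≥1 : 1 ℕ.≤ 25
      25≥1 = s≤s z≤n

      Θ : ℕ → ℕ → S
      Θ a b = [ 25 , 25 ] * (poch (x K.^ 5) a 25 * poch (x′ K.^ 5) b 25)

      Θ⁺ : ∀ a b → 1 ℕ.≤ a → 1 ℕ.≤ b → a ℕ.+ b ≡ 5 → Θ (a ℕ.* 5) (b ℕ.* 5) ≋ V (theta a b) + cst δ * V (theta′ a b)
      Θ⁺ a b ha hb h = trans (*-congˡ (*-cong (poch-cong _ 25 25≥1 x⁵) (poch-cong _ 25 25≥1 x′⁵)))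
        (trans (reflexive (≡.cong (λ d → [ d ℕ.* 5 , d ℕ.* 5 ] * (poch (K.1# K.+ δ) (a ℕ.* 5) (d ℕ.* 5) * poch (K.1# K.- δ) (b ℕ.* 5) (d ℕ.* 5))) (≡.sym h)))
          (theta-deform a b ha hb δ δ²))

      -- Exchanging the two exponents is the same as exchanging x⁵ with x⁻⁵, that is, δ ↦ -δ.
      Θ⁻ : ∀ a b → 1 ℕ.≤ a → 1 ℕ.≤ b → a ℕ.+ b ≡ 5 → Θ (b ℕ.* 5) (a ℕ.* 5) ≋ V (theta a b) - cst δ * V (theta′ a b)
      Θ⁻ a b ha hb h = trans (*-congˡ (trans (*-comm _ _) (*-cong (poch-cong _ 25 25≥1 x′⁵) (poch-cong _ 25 25≥1
            (K.trans x⁵ (K.+-congˡ (K.sym (K.-‿involutive δ))))))))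
        (trans (reflexive (≡.cong (λ d → [ d ℕ.* 5 , d ℕ.* 5 ] * (poch (K.1# K.- δ) (a ℕ.* 5) (d ℕ.* 5) * poch (K.1# K.- (K.- δ)) (b ℕ.* 5) (d ℕ.* 5))) (≡.sym h)))
          (trans (theta-deform a b ha hb (K.- δ) neg-δ²) (+-congˡ (trans (*-congʳ (C.hom-neg δ)) (sym (-‿distribˡ-* _ _))))))
        where module C = RingHom cstHom

      -- The first factor of the second product is 1 - x′⁵ = δ, and by `poch-absorb` this δ makes
      -- the remaining factors undeformed.
      Θ⁰ : Θ 25 0 ≋ cst δ * e ^ 3
      Θ⁰ = trans (*-congˡ (*-cong (poch-cong 25 25 25≥1 x⁵) (trans (poch-cong 0 25 25≥1 x′⁵) (trans (poch-first (K.1# K.- δ) 25 25≥1) (*-congʳ 1-1+δ)))))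
        (trans (solve 4 (λ p u d v → p ⊠ (u ⊠ (d ⊠ v)) ⊜ p ⊠ (d ⊠ u) ⊠ v) ≡.refl _ _ _ _)
        (trans (*-congʳ (*-congˡ (poch-absorb δ _ 25 25 25≥1 dd′)))
        (trans (solve 3 (λ p d v → p ⊠ (d ⊠ p) ⊠ v ⊜ p ⊠ p ⊠ (d ⊠ v)) ≡.refl _ _ _)
        (trans (*-congˡ (poch-absorb δ _ 25 25 25≥1 dd))
        (trans (solve 2 (λ p d → p ⊠ p ⊠ (d ⊠ p) ⊜ d ⊠ p ⊡ 3) ≡.refl _ _) (*-congˡ (^-congˡ 3 (sym (V-poch K.1# 5 5 (s≤s z≤n))))))))))
        where
        1-1+δ : 1# - cst (K.1# K.- δ) ≋ cst δ
        1-1+δ = trans (sym (RingHom.hom-sub cstHom K.1# (K.1# K.- δ)))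
          (cst-cong (K.solve 1 (λ d → con (+ 1) ⊟ (con (+ 1) ⊟ d) ⊜ d) ≡.refl δ))

      c c′ : K.Carrier
      c = K.- x
      c′ = K.- x′

      c₀ : c K.^ 0 K.* c′ K.^ 2 K.≈ w K.^ 3 K.* (K.1# K.- K.⟪ + 2 ⟫ K.* η)
      c₀ = drop-η² (w K.^ 3) (drop-w⁵ (w K.^ 3 K.* (K.1# K.- η) K.^ 2) (K.solve 2 (λ w h →
        con (+ 1) ⊠ (⊖ (w ⊡ 4 ⊠ (con (+ 1) ⊟ h))) ⊡ 2 ⊜
        w ⊡ 3 ⊠ (con (+ 1) ⊟ con (+ 2) ⊠ h) ⊞ h ⊠ h ⊠ w ⊡ 3 ⊞ (w ⊡ 5 ⊟ con (+ 1)) ⊠ (w ⊡ 3 ⊠ (con (+ 1) ⊟ h) ⊡ 2)) ≡.refl w η))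

      c₂ : c K.^ 2 K.* c′ K.^ 2 K.≈ K.1#
      c₂ = K.trans (K.solve 2 (λ a b → (⊖ a) ⊡ 2 ⊠ (⊖ b) ⊡ 2 ⊜ (a ⊠ b) ⊡ 2) ≡.refl x x′) (K.trans (K.^-congˡ 2 xx′) (one^ 2))

      c₁ : c K.^ 1 K.* c′ K.^ 2 K.≈ K.- x′
      c₁ = K.trans (K.solve 2 (λ a b → (⊖ a) ⊡ 1 ⊠ (⊖ b) ⊡ 2 ⊜ (a ⊠ b) ⊠ (⊖ b)) ≡.refl x x′) (K.trans (K.*-congʳ xx′) (K.*-identityˡ _))

      c₃ : c K.^ 3 K.* c′ K.^ 2 K.≈ K.- x
      c₃ = K.trans (K.solve 2 (λ a b → (⊖ a) ⊡ 3 ⊠ (⊖ b) ⊡ 2 ⊜ (a ⊠ b) ⊡ 2 ⊠ (⊖ a)) ≡.refl x x′)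
        (K.trans (K.*-congʳ (K.trans (K.^-congˡ 2 xx′) (one^ 2))) (K.*-identityˡ _))

      c₄ : c K.^ 4 K.* c′ K.^ 2 K.≈ x K.^ 2
      c₄ = K.trans (K.solve 2 (λ a b → (⊖ a) ⊡ 4 ⊠ (⊖ b) ⊡ 2 ⊜ (a ⊠ b) ⊡ 2 ⊠ a ⊡ 2) ≡.refl x x′)
        (K.trans (K.*-congʳ (K.trans (K.^-congˡ 2 xx′) (one^ 2))) (K.*-identityˡ _))

      mono≋ : ∀ {u v} k → u K.≈ v → mono u k ≋ cst v * q ^ k
      mono≋ {u} {v} k p = trans (mono-cong (K.trans p (K.sym (K.*-identityʳ v))) ≡.refl)
        (trans (sym (mono-* v K.1# 0 k)) (*-cong (mono-0 v) (sym (trans (mono-^ K.1# 1 k) (mono-cong (one^ k) (ℕₚ.*-identityˡ k))))))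

    private
      W N D : S
      W = cst w
      N = cst η
      D = cst δ
      module C = RingHom cstHom

      cx : cst x ≋ W * (1# + N)
      cx = trans (C.hom-* _ _) (*-congˡ (trans (C.hom-+ _ _) (+-congʳ C.hom-1)))

      cx′ : cst x′ ≋ W ^ 4 * (1# - N)
      cx′ = trans (C.hom-* _ _) (*-cong (C.hom-^ w 4) (trans (C.hom-sub _ _) (+-congʳ C.hom-1)))

      cδ : D ≋ ⟪ + 5 ⟫ * N
      cδ = trans (C.hom-* _ _) (*-congʳ (C.hom-⟪⟫ (+ 5)))

      NN : N * N ≋ 0#
      NN = trans (sym (C.hom-* η η)) (trans (cst-cong η²) C.hom-0)

    -- The five classes pair up: s = -2 and 1 give the deformed `theta 4 1` with opposite signs of δ
    -- = 5η, s = -1 and 0 do the same for `theta 3 2`, and s = 2 leaves only the derivative term δ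
    -- e³.
    theta-dissection : E₁ * (poch x 1 1 * poch x′ 0 1) ≋
      W ^ 3 * (1# - ⟪ + 2 ⟫ * N) * q * (Y - ⟪ + 5 ⟫ * N * S₁)
      - W ^ 4 * (1# - N) * (X - ⟪ + 5 ⟫ * N * S₀) + (X + ⟪ + 5 ⟫ * N * S₀)
      - W * (1# + N) * q * (Y + ⟪ + 5 ⟫ * N * S₁)
      + W ^ 2 * (1# + N) ^ 2 * q ^ 3 * (⟪ + 5 ⟫ * N * e ^ 3)
    theta-dissection = trans (dissection x x′ xx′) (trans
      (+-cong (*-cong (trans (mono≋ 1 c₀) (*-congʳ (trans (C.hom-* _ _) (*-cong (C.hom-^ w 3) (trans (C.hom-sub _ _)
              (+-cong C.hom-1 (-‿cong (trans (C.hom-* _ _) (*-congʳ (C.hom-⟪⟫ (+ 2))))))))))) 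
            (trans (Θ⁻ 4 1 (s≤s z≤n) (s≤s z≤n) ≡.refl) (+-cong (VH.hom-cong theta-Y) (-‿cong (*-congʳ cδ)))))
      (+-cong (*-cong (trans (mono≋ 0 c₁) (*-congʳ (trans (C.hom-neg _) (-‿cong cx′))))
            (trans (Θ⁻ 3 2 (s≤s z≤n) (s≤s z≤n) ≡.refl) (+-cong (VH.hom-cong theta-X) (-‿cong (*-congʳ cδ)))))
      (+-cong (*-cong (trans (mono≋ 0 c₂) (*-congʳ C.hom-1))
            (trans (Θ⁺ 3 2 (s≤s z≤n) (s≤s z≤n) ≡.refl) (+-cong (VH.hom-cong theta-X) (*-congʳ cδ))))
      (+-cong (*-cong (trans (mono≋ 1 c₃) (*-congʳ (trans (C.hom-neg _) (-‿cong cx))))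
            (trans (Θ⁺ 4 1 (s≤s z≤n) (s≤s z≤n) ≡.refl) (+-cong (VH.hom-cong theta-Y) (*-congʳ cδ))))
      (*-cong (trans (mono≋ 3 c₄) (*-congʳ (trans (C.hom-^ x 2) (^-congˡ 2 cx)))) (trans Θ⁰ (*-congʳ cδ)))))))
      (solve 8 (λ w n q x y s s′ e →
        w ⊡ 3 ⊠ (con (+ 1) ⊟ con (+ 2) ⊠ n) ⊠ q ⊡ 1 ⊠ (y ⊟ con (+ 5) ⊠ n ⊠ s′) ⊞
        ((⊖ (w ⊡ 4 ⊠ (con (+ 1) ⊟ n))) ⊠ q ⊡ 0 ⊠ (x ⊟ con (+ 5) ⊠ n ⊠ s) ⊞
        (con (+ 1) ⊠ q ⊡ 0 ⊠ (x ⊞ con (+ 5) ⊠ n ⊠ s) ⊞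
        ((⊖ (w ⊠ (con (+ 1) ⊞ n))) ⊠ q ⊡ 1 ⊠ (y ⊞ con (+ 5) ⊠ n ⊠ s′) ⊞
        (w ⊠ (con (+ 1) ⊞ n)) ⊡ 2 ⊠ q ⊡ 3 ⊠ (con (+ 5) ⊠ n ⊠ e ⊡ 3))))
        ⊜
        w ⊡ 3 ⊠ (con (+ 1) ⊟ con (+ 2) ⊠ n) ⊠ q ⊠ (y ⊟ con (+ 5) ⊠ n ⊠ s′)
        ⊟ w ⊡ 4 ⊠ (con (+ 1) ⊟ n) ⊠ (x ⊟ con (+ 5) ⊠ n ⊠ s) ⊞ (x ⊞ con (+ 5) ⊠ n ⊠ s)
        ⊟ w ⊠ (con (+ 1) ⊞ n) ⊠ q ⊠ (y ⊞ con (+ 5) ⊠ n ⊠ s′)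
        ⊞ w ⊡ 2 ⊠ (con (+ 1) ⊞ n) ⊡ 2 ⊠ q ⊡ 3 ⊠ (con (+ 5) ⊠ n ⊠ e ⊡ 3)) ≡.refl W N q X Y S₀ S₁ e))

    -- The constant factor 1 - 1/x separates the theta series from T(x). It is a unit for w = ζ and
    -- equals η for w = 1.
    theta-factor : E₁ * (poch x 1 1 * poch x′ 0 1) ≋ (1# - W ^ 4 * (1# - N)) * (E₁ * (poch x 1 1 * poch x′ 1 1))
    theta-factor = trans (*-congˡ (*-congˡ (trans (poch-first x′ 1 (s≤s z≤n)) (*-congʳ (+-congˡ (-‿cong cx′))))))
      (solve 4 (λ a b c d → a ⊠ (b ⊠ (c ⊠ d)) ⊜ c ⊠ (a ⊠ (b ⊠ d))) ≡.refl _ _ _ _)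

-- Fifth roots of unity: the dissection of E₁ and the quintic relation between A and B

module Quintic (K : CommutativeRing 0ℓ 0ℓ) (ζ : RingKit.Carrier K)
  (ζ-cyclotomic : RingKit._≈_ K (Substitution.cyclotomic K ζ) (RingKit.0# K))
  (fifth : RingKit.Carrier K) (5*fifth : RingKit._≈_ K (RingKit._*_ K (RingKit.⟪_⟫ K (+ 5)) fifth) (RingKit.1# K)) where
  open Series K
  open Substitution K
  open Bilateral K
  open Products K
  private
    module C = RingHom cstHom

  a b e : S
  a = V A
  b = V B
  e = V E₅

  E₅≋abe : E₅ ≋ a * b * e
  E₅≋abe = trans (sym VE₁) (trans (VH.hom-cong E₁-factor) (trans (VH.hom-* _ _) (*-congʳ (VH.hom-* _ _))))

  module Root (w : K.Carrier) (cyc : cyclotomic w K.≈ K.0#) where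
    W : S
    W = cst w

    W-cyc : 1# + W + W ^ 2 + W ^ 3 + W ^ 4 ≋ 0#
    W-cyc = trans (sym (trans (C.hom-+ _ _) (+-cong (trans (C.hom-+ _ _) (+-cong (trans (C.hom-+ _ _) (+-cong (trans (C.hom-+ _ _) (+-congʳ C.hom-1)) (C.hom-^ w 2))) (C.hom-^ w 3))) (C.hom-^ w 4))))
      (trans (cst-cong cyc) C.hom-0)

    w⁵ : w K.^ 5 K.≈ K.1#
    w⁵ = K.modulo (w K.- K.1#) cyc (K.solve 1 (λ w → w ⊡ 5 ⊜
      con (+ 1) ⊞ (con (+ 1) ⊞ w ⊞ w ⊡ 2 ⊞ w ⊡ 3 ⊞ w ⊡ 4) ⊠ (w ⊟ con (+ 1))) ≡.refl w)

    module Dd = Dissected w K.0# w⁵ (K.zeroˡ K.0#)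

    -- With u = W⁴ the bracket is 4 + 3u + 2u² + u³, and (4 + 3u + 2u² + u³)(1 - u) = 5 - (1 + u +
    -- u² + u³ + u⁴) = 5.
    unit : cst fifth * (⟪ + 4 ⟫ + ⟪ + 3 ⟫ * W ^ 4 + ⟪ + 2 ⟫ * W ^ 3 + W ^ 2) * (1# - W ^ 4) ≋ 1#
    unit = trans (*-assoc _ _ _) (trans (*-congˡ (modulo _ W-cyc (solve 1 (λ w →
        (con (+ 4) ⊞ con (+ 3) ⊠ w ⊡ 4 ⊞ con (+ 2) ⊠ w ⊡ 3 ⊞ w ⊡ 2) ⊠ (con (+ 1) ⊟ w ⊡ 4)
        ⊜ con (+ 5) ⊞ (con (+ 1) ⊞ w ⊞ w ⊡ 2 ⊞ w ⊡ 3 ⊞ w ⊡ 4) ⊠ (⊖ con (+ 1) ⊞ w ⊞ w ⊡ 2 ⊞ w ⊡ 3 ⊟ con (+ 3) ⊠ w ⊡ 4)) ≡.refl W)))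
      (trans (*-comm _ _) (trans (*-congʳ (sym (C.hom-⟪⟫ (+ 5)))) (trans (sym (C.hom-* _ _)) (trans (cst-cong 5*fifth) C.hom-1)))))

    -- The dissection at η = 0 has only four terms. Both e b and q e a come with multiples of 1 -
    -- w⁴, since w³ - w = (w² + w³)(1 - w⁴) for w⁵ = 1, and this unit is cancelled.
    theta-root : E₁ * (poch w 1 1 * poch (w K.^ 4) 1 1) ≋ e * b + (W ^ 2 + W ^ 3) * q * (e * a)
    theta-root = cancel _ unit (begin
      (1# - W ^ 4) * (E₁ * (poch w 1 1 * poch (w K.^ 4) 1 1))
        ≈⟨ *-cong (+-congˡ (-‿cong (sym (trans (*-congˡ (trans (+-congˡ (-‿cong C.hom-0)) (trans (+-congˡ -0#≈0#) (+-identityʳ _)))) (*-identityʳ _)))))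
             (*-congˡ (*-cong (poch-cong 1 1 (s≤s z≤n) (K.sym (K.trans (K.*-congˡ (K.+-identityʳ _)) (K.*-identityʳ _))))
               (poch-cong 1 1 (s≤s z≤n) (K.sym (K.trans (K.*-congˡ (K.trans (K.+-congˡ K.-0#≈0#) (K.+-identityʳ _))) (K.*-identityʳ _)))))) ⟩
      (1# - W ^ 4 * (1# - N)) * (E₁ * (poch Dd.x 1 1 * poch Dd.x′ 1 1))
        ≈⟨ trans (sym Dd.theta-factor) Dd.theta-dissection ⟩
      _
        -- All terms containing η are gathered into one multiple of `n`, which vanishes here because
        -- η = 0.
        ≈⟨ solve 8 (λ w n q x y s s′ e →
             w ⊡ 3 ⊠ (con (+ 1) ⊟ con (+ 2) ⊠ n) ⊠ q ⊠ (y ⊟ con (+ 5) ⊠ n ⊠ s′)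
             ⊟ w ⊡ 4 ⊠ (con (+ 1) ⊟ n) ⊠ (x ⊟ con (+ 5) ⊠ n ⊠ s) ⊞ (x ⊞ con (+ 5) ⊠ n ⊠ s)
             ⊟ w ⊠ (con (+ 1) ⊞ n) ⊠ q ⊠ (y ⊞ con (+ 5) ⊠ n ⊠ s′)
             ⊞ w ⊡ 2 ⊠ (con (+ 1) ⊞ n) ⊡ 2 ⊠ q ⊡ 3 ⊠ (con (+ 5) ⊠ n ⊠ e ⊡ 3)
             ⊜ w ⊡ 3 ⊠ q ⊠ y ⊟ w ⊡ 4 ⊠ x ⊞ x ⊟ w ⊠ q ⊠ y ⊞ n ⊠
               (w ⊡ 3 ⊠ q ⊠ (con (+ 10) ⊠ n ⊠ s′ ⊟ con (+ 2) ⊠ y ⊟ con (+ 5) ⊠ s′)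
                ⊞ w ⊡ 4 ⊠ (x ⊞ con (+ 5) ⊠ s ⊟ con (+ 5) ⊠ n ⊠ s) ⊞ con (+ 5) ⊠ s
                ⊟ w ⊠ q ⊠ (y ⊞ con (+ 5) ⊠ s′ ⊞ con (+ 5) ⊠ n ⊠ s′)
                ⊞ w ⊡ 2 ⊠ (con (+ 1) ⊞ n) ⊡ 2 ⊠ q ⊡ 3 ⊠ (con (+ 5) ⊠ e ⊡ 3))) ≡.refl W N q Dd.X Dd.Y Dd.S₀ Dd.S₁ Dd.e ⟩
      _
        ≈⟨ modulo _ C.hom-0 refl ⟩
      W ^ 3 * q * Dd.Y - W ^ 4 * Dd.X + Dd.X - W * q * Dd.Y
        ≈⟨ +-cong (+-cong (+-cong (*-congˡ VY) (-‿cong (*-congˡ VX))) VX) (-‿cong (*-congˡ VY)) ⟩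
      W ^ 3 * q * (e * a) - W ^ 4 * (e * b) + e * b - W * q * (e * a)
        ≈⟨ modulo (W * (W ^ 2 - 1#) * q * (e * a)) W-cyc (solve 4 (λ w q x y →
             w ⊡ 3 ⊠ q ⊠ y ⊟ w ⊡ 4 ⊠ x ⊞ x ⊟ w ⊠ q ⊠ y ⊜
             (con (+ 1) ⊟ w ⊡ 4) ⊠ (x ⊞ (w ⊡ 2 ⊞ w ⊡ 3) ⊠ q ⊠ y) ⊞
             (con (+ 1) ⊞ w ⊞ w ⊡ 2 ⊞ w ⊡ 3 ⊞ w ⊡ 4) ⊠ (w ⊠ (w ⊡ 2 ⊟ con (+ 1)) ⊠ q ⊠ y)) ≡.refl W q (e * b) (e * a)) ⟩
      (1# - W ^ 4) * (e * b + (W ^ 2 + W ^ 3) * q * (e * a)) ∎)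
      where
      open ≋-Reasoning
      N = cst K.0#
      VX : Dd.X ≋ e * b
      VX = VH.hom-* E₅ B
      VY : Dd.Y ≋ e * a
      VY = VH.hom-* E₅ A

    homogeneous-roots : ∀ y z → (y + z) * (y + W * z) * (y + W ^ 2 * z) * (y + W ^ 3 * z) * (y + W ^ 4 * z) ≋ y ^ 5 + z ^ 5
    homogeneous-roots y z = modulo _ W-cyc (solve 3 (λ w y z →
      (y ⊞ z) ⊠ (y ⊞ w ⊠ z) ⊠ (y ⊞ w ⊡ 2 ⊠ z) ⊠ (y ⊞ w ⊡ 3 ⊠ z) ⊠ (y ⊞ w ⊡ 4 ⊠ z) ⊜
      (y ⊡ 5 ⊞ z ⊡ 5) ⊞ (con (+ 1) ⊞ w ⊞ w ⊡ 2 ⊞ w ⊡ 3 ⊞ w ⊡ 4) ⊠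
        (z ⊠ y ⊡ 4 ⊞ (w ⊞ w ⊡ 3) ⊠ z ⊡ 2 ⊠ y ⊡ 3 ⊞ (w ⊡ 3 ⊞ w ⊡ 5) ⊠ z ⊡ 3 ⊠ y ⊡ 2 ⊞ w ⊡ 6 ⊠ z ⊡ 4 ⊠ y
         ⊟ (con (+ 1) ⊟ w ⊞ w ⊡ 5 ⊟ w ⊡ 6) ⊠ z ⊡ 5)) ≡.refl W y z)

  private
    -- The fifth cyclotomic polynomial at w divides its value at w^k for k prime to 5; the cofactors
    -- are the quotients.
    cyc-power : ∀ {w} → cyclotomic w K.≈ K.0# → cyclotomic (w K.^ 2) K.≈ K.0# × (cyclotomic (w K.^ 3) K.≈ K.0# × cyclotomic (w K.^ 4) K.≈ K.0#)
    cyc-power {w} h =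
      K.modulo (K.1# K.- w K.+ w K.^ 2 K.- w K.^ 3 K.+ w K.^ 4) h (K.solve 1 (λ w → cy (w ⊡ 2) ⊜ con (+ 0) ⊞ cy w ⊠
        (con (+ 1) ⊟ w ⊞ w ⊡ 2 ⊟ w ⊡ 3 ⊞ w ⊡ 4)) ≡.refl w) ,
      K.modulo (K.1# K.- w K.+ w K.^ 3 K.- w K.^ 4 K.+ w K.^ 5 K.- w K.^ 7 K.+ w K.^ 8) h (K.solve 1 (λ w → cy (w ⊡ 3) ⊜ con (+ 0) ⊞ cy w ⊠
        (con (+ 1) ⊟ w ⊞ w ⊡ 3 ⊟ w ⊡ 4 ⊞ w ⊡ 5 ⊟ w ⊡ 7 ⊞ w ⊡ 8)) ≡.refl w) ,
      K.modulo (K.1# K.- w K.+ w K.^ 4 K.- w K.^ 6 K.+ w K.^ 8 K.- w K.^ 11 K.+ w K.^ 12) h (K.solve 1 (λ w → cy (w ⊡ 4) ⊜ con (+ 0) ⊞ cy w ⊠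
        (con (+ 1) ⊟ w ⊞ w ⊡ 4 ⊟ w ⊡ 6 ⊞ w ⊡ 8 ⊟ w ⊡ 11 ⊞ w ⊡ 12)) ≡.refl w)
      where
      cy : Ex 1 → Ex 1
      cy w = con (+ 1) ⊞ w ⊞ w ⊡ 2 ⊞ w ⊡ 3 ⊞ w ⊡ 4

  ζ²-cyc : cyclotomic (ζ K.^ 2) K.≈ K.0#
  ζ²-cyc = proj₁ (cyc-power ζ-cyclotomic)

  module Z = Root ζ ζ-cyclotomic
  module Z² = Root (ζ K.^ 2) ζ²-cyc
  open Z using () renaming (W to Ζ)

  ζ-reduce : ∀ n {m} → ζ K.^ (m ℕ.+ 5 ℕ.* n) K.≈ ζ K.^ m
  ζ-reduce n {m} = pow-mod5 ζ Z.w⁵ m n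

  -- One E₁ together with the products at ζ, ζ², ζ³, ζ⁴ covers all fifth roots of unity, and
  -- `poch-roots` collapses these five to E₅.
  theta-root-product : (E₁ * (poch ζ 1 1 * poch (ζ K.^ 4) 1 1)) * (E₁ * (poch (ζ K.^ 2) 1 1 * poch ((ζ K.^ 2) K.^ 4) 1 1)) ≋ E₁ * E₅
  theta-root-product = trans
    (trans (*-congˡ (*-congˡ (*-congˡ (poch-cong 1 1 (s≤s z≤n) (K.trans (K.^-assocʳ ζ 2 4) (ζ-reduce 1 {3}))))))
      (solve 5 (λ e a b c d → (e ⊠ (a ⊠ d)) ⊠ (e ⊠ (b ⊠ c)) ⊜ e ⊠ (e ⊠ a ⊠ b ⊠ c ⊠ d)) ≡.refl E₁ (poch ζ 1 1) (poch (ζ K.^ 2) 1 1) (poch (ζ K.^ 3) 1 1) (poch (ζ K.^ 4) 1 1)))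
    (*-congˡ (poch-roots ζ ζ-cyclotomic 1 1 (s≤s z≤n)))

  W₂≋ : Z².W ≋ Ζ ^ 2
  W₂≋ = C.hom-^ ζ 2

  -- The coefficients ζ² + ζ³ and ζ⁴ + ζ⁶ = ζ + ζ⁴ have sum -1 and product -1.
  E₁-dissection : E₁ * E₅ ≋ e ^ 2 * (b ^ 2 - q * a * b - (q * a) ^ 2)
  E₁-dissection = trans (sym theta-root-product) (trans (*-cong Z.theta-root (trans Z².theta-root
      (+-congˡ (*-congʳ (*-congʳ (+-cong (^-congˡ 2 W₂≋) (^-congˡ 3 W₂≋)))))))
    (modulo (e ^ 2 * ((1# - Ζ + Ζ ^ 2) * q * a * b + (1# - Ζ + Ζ ^ 5) * (q * a) ^ 2)) Z.W-cyc
      (solve 5 (λ w q a b e → (e ⊠ b ⊞ (w ⊡ 2 ⊞ w ⊡ 3) ⊠ q ⊠ (e ⊠ a)) ⊠ (e ⊠ b ⊞ ((w ⊡ 2) ⊡ 2 ⊞ (w ⊡ 2) ⊡ 3) ⊠ q ⊠ (e ⊠ a)) ⊜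
        e ⊡ 2 ⊠ (b ⊡ 2 ⊟ q ⊠ a ⊠ b ⊟ (q ⊠ a) ⊡ 2) ⊞ (con (+ 1) ⊞ w ⊞ w ⊡ 2 ⊞ w ⊡ 3 ⊞ w ⊡ 4) ⊠
          (e ⊡ 2 ⊠ ((con (+ 1) ⊟ w ⊞ w ⊡ 2) ⊠ q ⊠ a ⊠ b ⊞ (con (+ 1) ⊟ w ⊞ w ⊡ 5) ⊠ (q ⊠ a) ⊡ 2))) ≡.refl Ζ q a b e)))

  private
    tw : ℕ → S → S
    tw k = twist (ζ K.^ k)

    ζᵏ⁵ : ∀ k → (ζ K.^ k) K.^ 5 K.≈ K.1#
    ζᵏ⁵ k = K.trans (K.^-assocʳ ζ k 5) (K.trans (K.reflexive (≡.cong (ζ K.^_) (ℕₚ.*-comm k 5)))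
      (ζ-reduce k {0}))

    tw-factor : ∀ k → tw k E₁ ≋ poch ((ζ K.^ 1) K.^ k) 1 5 * poch ((ζ K.^ 2) K.^ k) 2 5 * poch ((ζ K.^ 3) K.^ k) 3 5 * poch ((ζ K.^ 4) K.^ k) 4 5 * E₅
    tw-factor k = trans (T.hom-cong poch-split) (trans (T.hom-* _ _) (*-cong (trans (T.hom-* _ _) (*-cong (trans (T.hom-* _ _) (*-cong (trans (T.hom-* _ _)
      (*-cong (each 1) (each 2))) (each 3))) (each 4))) (trans (twist-poch (ζ K.^ k) (ζᵏ⁵ k) 5) (poch-cong 5 5 (s≤s z≤n) (ζᵏ⁵ k)))))
      where
      module T = RingHom (twistHom (ζ K.^ k))
      each : ∀ m → tw k [ m , 5 ] ≋ poch ((ζ K.^ m) K.^ k) m 5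
      each m = trans (twist-poch (ζ K.^ k) (ζᵏ⁵ k) m) (poch-cong m 5 (s≤s z≤n)
        (K.trans (K.^-assocʳ ζ k m) (K.trans (K.reflexive (≡.cong (ζ K.^_) (ℕₚ.*-comm k m))) (K.sym (K.^-assocʳ ζ m k)))))

    -- For exponents ≡ m modulo 5 with m = 1, ..., 4 the twists run through all roots of unity and
    -- give [5m, 25]; exponents divisible by 5 are fixed and give E₅⁵. The extra e supplies the
    -- missing [25, 25], completing the first four to E₁(q⁵) = E₅.
    norm-E₁ : E₁ * tw 1 E₁ * tw 2 E₁ * tw 3 E₁ * tw 4 E₁ * e ≋ E₅ ^ 6
    norm-E₁ = begin
      E₁ * tw 1 E₁ * tw 2 E₁ * tw 3 E₁ * tw 4 E₁ * e
        ≈⟨ *-congʳ (*-cong (*-cong (*-cong (*-cong poch-split (tw-factor 1)) (tw-factor 2)) (tw-factor 3)) (tw-factor 4)) ⟩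
      _
        ≈⟨ *-congʳ (trans (regroup _ _ _ _ _ _ _ _ _ _ _ _ _ _ _ _ _ _ _ _ _) (*-congʳ (*-cong (*-cong (*-cong (R 1 c1) (R 2 c2)) (R 3 c3)) (R 4 c4)))) ⟩
      [ 5 , 25 ] * [ 10 , 25 ] * [ 15 , 25 ] * [ 20 , 25 ] * E₅ ^ 5 * e
        ≈⟨ trans (*-congˡ (V-poch K.1# 5 5 (s≤s z≤n))) (solve 6 (λ a b c d e f → a ⊠ b ⊠ c ⊠ d ⊠ e ⊡ 5 ⊠ f ⊜ (a ⊠ b ⊠ c ⊠ d ⊠ f) ⊠ e ⊡ 5) ≡.refl _ _ _ _ _ _) ⟩
      [ 5 , 25 ] * [ 10 , 25 ] * [ 15 , 25 ] * [ 20 , 25 ] * [ 25 , 25 ] * E₅ ^ 5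
        ≈⟨ *-congʳ (sym (trans (sym VE₁) (trans (VH.hom-cong poch-split) (trans (VH.hom-* _ _) (*-cong (trans (VH.hom-* _ _) (*-cong (trans (VH.hom-* _ _)
             (*-cong (trans (VH.hom-* _ _) (*-cong (v 1) (v 2))) (v 3))) (v 4))) (v 5)))))) ⟩
      E₅ ^ 6 ∎
      where
      open ≋-Reasoning
      v : ∀ m → V [ m , 5 ] ≋ [ m ℕ.* 5 , 25 ]
      v m = V-poch K.1# m 5 (s≤s z≤n)
      c1 : cyclotomic (ζ K.^ 1) K.≈ K.0#
      c1 = K.trans (K.solve 1 (λ w → cy (w ⊡ 1) ⊜ cy w) ≡.refl ζ) ζ-cyclotomic
        where
        cy : Ex 1 → Ex 1
        cy w = con (+ 1) ⊞ w ⊞ w ⊡ 2 ⊞ w ⊡ 3 ⊞ w ⊡ 4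
      c2 = proj₁ (cyc-power ζ-cyclotomic)
      c3 = proj₁ (proj₂ (cyc-power ζ-cyclotomic))
      c4 = proj₂ (proj₂ (cyc-power ζ-cyclotomic))
      R : ∀ m → cyclotomic (ζ K.^ m) K.≈ K.0# →
          [ m , 5 ] * poch ((ζ K.^ m) K.^ 1) m 5 * poch ((ζ K.^ m) K.^ 2) m 5 * poch ((ζ K.^ m) K.^ 3) m 5 * poch ((ζ K.^ m) K.^ 4) m 5 ≋ [ m ℕ.* 5 , 25 ]
      R m h = trans (*-congʳ (*-congʳ (*-congʳ (*-congˡ (poch-cong m 5 (s≤s z≤n) (K.*-identityʳ _)))))) (poch-roots (ζ K.^ m) h m 5 (s≤s z≤n))
      regroup = solve 21 (λ a0 b0 c0 d0 a1 b1 c1 d1 a2 b2 c2 d2 a3 b3 c3 d3 a4 b4 c4 d4 e →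
        (a0 ⊠ b0 ⊠ c0 ⊠ d0 ⊠ e) ⊠ (a1 ⊠ b1 ⊠ c1 ⊠ d1 ⊠ e) ⊠ (a2 ⊠ b2 ⊠ c2 ⊠ d2 ⊠ e) ⊠ (a3 ⊠ b3 ⊠ c3 ⊠ d3 ⊠ e) ⊠ (a4 ⊠ b4 ⊠ c4 ⊠ d4 ⊠ e) ⊜
        (a0 ⊠ a1 ⊠ a2 ⊠ a3 ⊠ a4) ⊠ (b0 ⊠ b1 ⊠ b2 ⊠ b3 ⊠ b4) ⊠ (c0 ⊠ c1 ⊠ c2 ⊠ c3 ⊠ c4) ⊠ (d0 ⊠ d1 ⊠ d2 ⊠ d3 ⊠ d4) ⊠ e ⊡ 5) ≡.refl

    -- The quadratic form of `E₁-dissection` after q ↦ uq; for a fifth root of unity u the series a,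
    -- b, e in q⁵ are unaffected.
    Q₂ : S → S
    Q₂ u = b ^ 2 - u * q * a * b - (u * q * a) ^ 2

    tw-dissection : ∀ k → tw k E₁ * E₅ ≋ e ^ 2 * Q₂ (Ζ ^ k)
    tw-dissection k = trans (*-congˡ (sym twE₅)) (trans (sym (T.hom-* _ _)) (trans (T.hom-cong E₁-dissection) (trans (T.hom-* _ _) (*-cong
      (trans (T.hom-^ _ 2) (^-congˡ 2 (tv E₅)))
      (trans (T.hom-sub _ _) (+-cong (trans (T.hom-sub _ _) (+-cong (trans (T.hom-^ _ 2) (^-congˡ 2 (tv B)))
        (-‿cong (trans (T.hom-* _ _) (*-cong twqa (tv B))))))
        (-‿cong (trans (T.hom-^ _ 2) (^-congˡ 2 twqa)))))))))
      where
      module T = RingHom (twistHom (ζ K.^ k))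
      tv : ∀ f → tw k (V f) ≋ V f
      tv f = twist-V (ζ K.^ k) (ζᵏ⁵ k) f
      twE₅ : tw k E₅ ≋ E₅
      twE₅ = trans (T.hom-cong (sym VE₁)) (trans (tv E₁) VE₁)
      twqa : tw k (q * a) ≋ Ζ ^ k * q * a
      twqa = trans (T.hom-* _ _) (*-cong (trans (twist-mono (ζ K.^ k) K.1# 1)
        (trans (mono-cong (K.*-congʳ (K.*-identityʳ _)) ≡.refl) (trans (sym (mono-* (ζ K.^ k) K.1# 0 1)) (*-congʳ (trans (mono-0 _) (C.hom-^ ζ k)))))) (tv A))

    c₁ c₂ : S
    c₁ = Ζ + Ζ ^ 4
    c₂ = Ζ ^ 2 + Ζ ^ 3

    c-sum : c₁ + c₂ ≋ - 1#
    c-sum = modulo 1# Z.W-cyc (solve 1 (λ w → w ⊞ w ⊡ 4 ⊞ (w ⊡ 2 ⊞ w ⊡ 3) ⊜ ⊖ con (+ 1) ⊞ (con (+ 1) ⊞ w ⊞ w ⊡ 2 ⊞ w ⊡ 3 ⊞ w ⊡ 4) ⊠ con (+ 1)) ≡.refl Ζ)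

    c-product : c₁ * c₂ ≋ - 1#
    c-product = modulo (1# - Ζ + Ζ ^ 3) Z.W-cyc (solve 1 (λ w → (w ⊞ w ⊡ 4) ⊠ (w ⊡ 2 ⊞ w ⊡ 3) ⊜
      ⊖ con (+ 1) ⊞ (con (+ 1) ⊞ w ⊞ w ⊡ 2 ⊞ w ⊡ 3 ⊞ w ⊡ 4) ⊠ (con (+ 1) ⊟ w ⊞ w ⊡ 3)) ≡.refl Ζ)

    Q₂-factor : ∀ u → Q₂ u ≋ (b + u * (c₁ * (q * a))) * (b + u * (c₂ * (q * a)))
    Q₂-factor u = sym (trans (solve 6 (λ u c d q a b → (b ⊞ u ⊠ (c ⊠ (q ⊠ a))) ⊠ (b ⊞ u ⊠ (d ⊠ (q ⊠ a))) ⊜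
        b ⊡ 2 ⊞ (c ⊞ d) ⊠ (u ⊠ q ⊠ a ⊠ b) ⊞ c ⊠ d ⊠ (u ⊠ q ⊠ a) ⊡ 2) ≡.refl u c₁ c₂ q a b)
      (trans (+-cong (+-congˡ (*-congʳ c-sum)) (*-congʳ c-product))
      (solve 3 (λ x y z → x ⊞ (⊖ con (+ 1)) ⊠ y ⊞ (⊖ con (+ 1)) ⊠ z ⊜ x ⊟ y ⊟ z) ≡.refl _ _ _)))

    -- Each linear factor b + u c q a has norm b⁵ + (c q a)⁵. As c₁ + c₂ = c₁c₂ = -1, the power sum
    -- c₁⁵ + c₂⁵ = s⁵ - 5s³p + 5sp² equals -11, the origin of this constant.
    Q₂-product : Q₂ 1# * Q₂ (Ζ ^ 1) * Q₂ (Ζ ^ 2) * Q₂ (Ζ ^ 3) * Q₂ (Ζ ^ 4) ≋ b ^ 10 - ⟪ + 11 ⟫ * (q * a) ^ 5 * b ^ 5 - (q * a) ^ 10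
    Q₂-product = begin
      _ ≈⟨ *-cong (*-cong (*-cong (*-cong (Q₂-factor _) (Q₂-factor _)) (Q₂-factor _)) (Q₂-factor _)) (Q₂-factor _) ⟩
      _ ≈⟨ solve 10 (λ a b c d e a′ b′ c′ d′ e′ → (a ⊠ a′) ⊠ (b ⊠ b′) ⊠ (c ⊠ c′) ⊠ (d ⊠ d′) ⊠ (e ⊠ e′) ⊜
             (a ⊠ b ⊠ c ⊠ d ⊠ e) ⊠ (a′ ⊠ b′ ⊠ c′ ⊠ d′ ⊠ e′)) ≡.refl _ _ _ _ _ _ _ _ _ _ ⟩
      _ ≈⟨ *-cong (half c₁) (half c₂) ⟩
      (b ^ 5 + (c₁ * (q * a)) ^ 5) * (b ^ 5 + (c₂ * (q * a)) ^ 5)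
        ≈⟨ solve 4 (λ c d z b → (b ⊡ 5 ⊞ (c ⊠ z) ⊡ 5) ⊠ (b ⊡ 5 ⊞ (d ⊠ z) ⊡ 5) ⊜
             b ⊡ 10 ⊞ ((c ⊞ d) ⊡ 5 ⊟ con (+ 5) ⊠ (c ⊞ d) ⊡ 3 ⊠ (c ⊠ d) ⊞ con (+ 5) ⊠ (c ⊞ d) ⊠ (c ⊠ d) ⊡ 2) ⊠ z ⊡ 5 ⊠ b ⊡ 5 ⊞ (c ⊠ d) ⊡ 5 ⊠ z ⊡ 10)
             ≡.refl c₁ c₂ (q * a) b ⟩
      _ ≈⟨ +-cong (+-congˡ (*-congʳ (*-congʳ (+-cong (+-cong (^-congˡ 5 c-sum) (-‿cong (*-cong (*-congˡ (^-congˡ 3 c-sum)) c-product))) (*-cong (*-congˡ c-sum) (^-congˡ 2 c-product)))))) (*-congʳ (^-congˡ 5 c-product)) ⟩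
      _ ≈⟨ solve 2 (λ z b → b ⊡ 10 ⊞ ((⊖ con (+ 1)) ⊡ 5 ⊟ con (+ 5) ⊠ (⊖ con (+ 1)) ⊡ 3 ⊠ (⊖ con (+ 1)) ⊞ con (+ 5) ⊠ (⊖ con (+ 1)) ⊠ (⊖ con (+ 1)) ⊡ 2) ⊠ z ⊡ 5 ⊠ b ⊡ 5 ⊞ (⊖ con (+ 1)) ⊡ 5 ⊠ z ⊡ 10
             ⊜ b ⊡ 10 ⊟ con (+ 11) ⊠ z ⊡ 5 ⊠ b ⊡ 5 ⊟ z ⊡ 10) ≡.refl (q * a) b ⟩
      b ^ 10 - ⟪ + 11 ⟫ * (q * a) ^ 5 * b ^ 5 - (q * a) ^ 10 ∎
      where
      open ≋-Reasoning
      half : ∀ c → (b + 1# * (c * (q * a))) * (b + Ζ ^ 1 * (c * (q * a))) * (b + Ζ ^ 2 * (c * (q * a))) * (b + Ζ ^ 3 * (c * (q * a))) * (b + Ζ ^ 4 * (c * (q * a)))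
             ≋ b ^ 5 + (c * (q * a)) ^ 5
      half c = trans (*-congʳ (*-congʳ (*-congʳ (*-cong (+-congˡ (*-identityˡ _)) (+-congˡ (*-congʳ (*-identityʳ Ζ))))))) (Z.homogeneous-roots b (c * (q * a)))

    -- (a b e)¹¹ = E₅⁶ E₅⁵: the norm supplies E₅⁶, and the other five E₅ pair with the five twists,
    -- where the dissection applies. The factor e¹¹ then cancels.
    quintic-V : a ^ 11 * b ^ 11 ≋ b ^ 10 - ⟪ + 11 ⟫ * (q * a) ^ 5 * b ^ 5 - (q * a) ^ 10
    quintic-V = cancel (V (inv E₅) ^ 11) e¹¹ (begin
      e ^ 11 * (a ^ 11 * b ^ 11)
        ≈⟨ solve 3 (λ a b e → e ⊡ 11 ⊠ (a ⊡ 11 ⊠ b ⊡ 11) ⊜ (a ⊠ b ⊠ e) ⊡ 6 ⊠ (a ⊠ b ⊠ e) ⊡ 5) ≡.refl a b e ⟩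
      (a * b * e) ^ 6 * (a * b * e) ^ 5
        ≈⟨ *-cong (^-congˡ 6 E₅≋abe) (^-congˡ 5 E₅≋abe) ⟨
      E₅ ^ 6 * E₅ ^ 5
        ≈⟨ *-congʳ norm-E₁ ⟨
      E₁ * tw 1 E₁ * tw 2 E₁ * tw 3 E₁ * tw 4 E₁ * e * E₅ ^ 5
        ≈⟨ solve 7 (λ t0 t1 t2 t3 t4 e f → t0 ⊠ t1 ⊠ t2 ⊠ t3 ⊠ t4 ⊠ e ⊠ f ⊡ 5 ⊜ (t0 ⊠ f) ⊠ (t1 ⊠ f) ⊠ (t2 ⊠ f) ⊠ (t3 ⊠ f) ⊠ (t4 ⊠ f) ⊠ e) ≡.refl _ _ _ _ _ _ _ ⟩
      (E₁ * E₅) * (tw 1 E₁ * E₅) * (tw 2 E₁ * E₅) * (tw 3 E₁ * E₅) * (tw 4 E₁ * E₅) * e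
        ≈⟨ *-congʳ (*-cong (*-cong (*-cong (*-cong (trans E₁-dissection (*-congˡ Q₂1)) (tw-dissection 1)) (tw-dissection 2)) (tw-dissection 3)) (tw-dissection 4)) ⟩
      _
        ≈⟨ solve 6 (λ e t0 t1 t2 t3 t4 → (e ⊡ 2 ⊠ t0) ⊠ (e ⊡ 2 ⊠ t1) ⊠ (e ⊡ 2 ⊠ t2) ⊠ (e ⊡ 2 ⊠ t3) ⊠ (e ⊡ 2 ⊠ t4) ⊠ e ⊜ e ⊡ 11 ⊠ (t0 ⊠ t1 ⊠ t2 ⊠ t3 ⊠ t4)) ≡.refl e _ _ _ _ _ ⟩
      e ^ 11 * (Q₂ 1# * Q₂ (Ζ ^ 1) * Q₂ (Ζ ^ 2) * Q₂ (Ζ ^ 3) * Q₂ (Ζ ^ 4))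
        ≈⟨ *-congˡ Q₂-product ⟩
      e ^ 11 * (b ^ 10 - ⟪ + 11 ⟫ * (q * a) ^ 5 * b ^ 5 - (q * a) ^ 10) ∎)
      where
      open ≋-Reasoning
      e¹¹ : V (inv E₅) ^ 11 * e ^ 11 ≋ 1#
      e¹¹ = trans (sym (^-distrib-* _ _ 11)) (trans (^-congˡ 11 (trans (*-comm _ _) (V-unit E₅-unit))) (solve 0 (con (+ 1) ⊡ 11 ⊜ con (+ 1)) ≡.refl))
      Q₂1 : b ^ 2 - q * a * b - (q * a) ^ 2 ≋ Q₂ 1#
      Q₂1 = solve 3 (λ q a b → b ⊡ 2 ⊟ q ⊠ a ⊠ b ⊟ (q ⊠ a) ⊡ 2 ⊜ b ⊡ 2 ⊟ con (+ 1) ⊠ q ⊠ a ⊠ b ⊟ (con (+ 1) ⊠ q ⊠ a) ⊡ 2) ≡.refl q a b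

  quintic : A ^ 11 * B ^ 11 ≋ B ^ 10 - ⟪ + 11 ⟫ * q * A ^ 5 * B ^ 5 - q ^ 2 * A ^ 10
  quintic = V-injective (trans (trans (VH.hom-* _ _) (*-cong (VH.hom-^ A 11) (VH.hom-^ B 11))) (trans quintic-V (sym (trans
    (trans (VH.hom-sub _ _) (+-cong (trans (VH.hom-sub _ _) (+-cong (VH.hom-^ B 10) (-‿cong
       (trans (VH.hom-* _ _) (*-cong (trans (VH.hom-* _ _) (*-cong (trans (VH.hom-* _ _) (*-cong (VH.hom-⟪⟫ (+ 11)) V-q)) (VH.hom-^ A 5))) (VH.hom-^ B 5))))))
       (-‿cong (trans (VH.hom-* _ _) (*-cong (trans (VH.hom-^ q 2) (^-congˡ 2 V-q)) (VH.hom-^ A 10))))))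
    (solve 3 (λ q a b → b ⊡ 10 ⊟ con (+ 11) ⊠ q ⊡ 5 ⊠ a ⊡ 5 ⊠ b ⊡ 5 ⊟ (q ⊡ 5) ⊡ 2 ⊠ a ⊡ 10 ⊜
       b ⊡ 10 ⊟ con (+ 11) ⊠ (q ⊠ a) ⊡ 5 ⊠ b ⊡ 5 ⊟ (q ⊠ a) ⊡ 10) ≡.refl q a b)))))

-- Crank algebras, and the passage of identities between Q and its extension

-- The multiplicity with which G counts the cranks ≡ k modulo 5.
weight : ℕ → ℤ
weight 0 = + 0
weight 1 = + 1
weight 2 = + 3
weight 3 = -[1+ 2 ]
weight 4 = -[1+ 0 ]
weight (suc (suc (suc (suc (suc n))))) = weight n

-- The interface of ℚ(ζ)[ε] with its functional. The generating function is studied from these laws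
-- alone; `ψ` is Q-linear, kills the ε-free powers of ζ, and reads the weight of k from ε ζ^k.
record CrankAlgebra (Q : CommutativeRing 0ℓ 0ℓ) : Set₁ where
  private module Q = RingKit Q
  field
    K : CommutativeRing 0ℓ 0ℓ
    ι : RingHom Q K
  private module K = RingKit K
  open RingHom ι renaming (fun to ι⟨_⟩) using ()
  field
    ζ ε fifth : K.Carrier
    ζ-cyclotomic : Substitution.cyclotomic K ζ K.≈ K.0#
    ε²≈0 : ε K.* ε K.≈ K.0#
    5*fifth : K.⟪ + 5 ⟫ K.* fifth K.≈ K.1#
    ψ : K.Carrier → Q.Carrier
    ψ-cong : ∀ {x y} → x K.≈ y → ψ x Q.≈ ψ y
    ψ-+ : ∀ x y → ψ (x K.+ y) Q.≈ ψ x Q.+ ψ y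
    ψ-ι : ∀ c x → ψ (ι⟨ c ⟩ K.* x) Q.≈ c Q.* ψ x
    ψ-ζ : ∀ k → ψ (ζ K.^ k) Q.≈ Q.0#
    ψ-εζ : ∀ k → ψ (ε K.* ζ K.^ k) Q.≈ Q.⟪ weight k ⟫

module CrankSeries {Q : CommutativeRing 0ℓ 0ℓ} (M : CrankAlgebra Q) where
  open CrankAlgebra M
  private
    module ι = RingHom ι
    module KS = Substitution K
    module KB = Bilateral K
    module C = RingHom KS.cstHom
  module SQ = Series Q
  module PQ = Products Q
  module BQ = Bilateral Q
  module UQ = Substitution Q
  open CoefficientMap ι
  module Mp = RingHom mapHom
  open Series K
  open Products K
  open Quintic K ζ ζ-cyclotomic fifth 5*fifth

  private module Q = SQ.K

  Ψ : S → SQ.S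
  Ψ f n = ψ (f n)

  Ψ-cong : ∀ {f g} → f ≋ g → Ψ f SQ.≋ Ψ g
  Ψ-cong p = SQ.⟨ (λ n → ψ-cong (at p n)) ⟩

  Ψ-+ : ∀ f g → Ψ (f + g) SQ.≋ Ψ f SQ.+ Ψ g
  Ψ-+ f g = SQ.⟨ (λ n → ψ-+ _ _) ⟩

  ψ-0 : ψ K.0# Q.≈ Q.0#
  ψ-0 = Q.trans (ψ-cong (K.sym (K.trans (K.*-congʳ ι.hom-0) (K.zeroˡ K.0#)))) (Q.trans (ψ-ι Q.0# K.0#) (Q.zeroˡ _))

  Ψ-map : ∀ g f → Ψ (mapS g * f) SQ.≋ g SQ.* Ψ f
  Ψ-map g f = SQ.⟨ (λ n → Q.trans (ψ-diagSum n (λ k l → ι.fun (g k) K.* f l)) (Q.diagSum-cong n (λ k l _ → ψ-ι _ _))) ⟩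
    where
    ψ-diagSum : ∀ n f → ψ (K.diagSum n f) Q.≈ Q.diagSum n (λ k l → ψ (f k l))
    ψ-diagSum zero f = Q.refl
    ψ-diagSum (suc n) f = Q.trans (ψ-+ _ _) (Q.+-congˡ (ψ-diagSum n (λ k l → f (suc k) l)))

  Ψ-term : ∀ g c → Ψ (mapS g * cst c) SQ.≋ g SQ.* SQ.cst (ψ c)
  Ψ-term g c = SQ.trans (Ψ-map g (cst c)) (SQ.*-congˡ SQ.⟨ (λ { zero → Q.refl ; (suc n) → ψ-0 }) ⟩)

  N Ζ : S
  N = cst ε
  Ζ = cst ζ

  NN : N * N ≋ 0#
  NN = trans (sym (C.hom-* ε ε)) (trans (cst-cong ε²≈0) C.hom-0)

  map-E : ∀ m n → 1 ℕ.≤ n → mapS PQ.[ m , n ] ≋ [ m , n ]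
  map-E m n h = map-poch m n h

  private
    1≤ : ∀ {n} → 1 ℕ.≤ suc n
    1≤ = s≤s z≤n

  map-A : mapS PQ.A ≋ A
  map-A = trans (Mp.hom-* _ _) (*-cong (map-E 1 5 1≤) (map-E 4 5 1≤))

  map-B : mapS PQ.B ≋ B
  map-B = trans (Mp.hom-* _ _) (*-cong (map-E 2 5 1≤) (map-E 3 5 1≤))

  map-VV : ∀ {f g} → mapS f ≋ g → mapS (UQ.V f) ≋ KS.V g
  map-VV p = trans (map-V _) (KS.VH.hom-cong p)

  -- `ρQ` and `ρK` list the same eight series over Q and over the extension, so a formula written
  -- once as an `Ex 8` can be moved in either direction.
  ρQ : Vec SQ.S 8
  ρQ = UQ.V PQ.A ∷ UQ.V PQ.B ∷ UQ.V PQ.E₅ ∷ PQ.q ∷ UQ.V (BQ.theta′ 3 2) ∷ UQ.V (BQ.theta′ 4 1) ∷ PQ.E₁ ∷ PQ.E₅ ∷ []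

  S₀ S₁ : S
  S₀ = KS.V (KB.theta′ 3 2)
  S₁ = KS.V (KB.theta′ 4 1)

  ρK : Vec S 8
  ρK = a ∷ b ∷ e ∷ q ∷ S₀ ∷ S₁ ∷ E₁ ∷ E₅ ∷ []

  ρ-map : Vec.map mapS ρQ ≈ᵛ ρK
  ρ-map = map-VV map-A ∷ map-VV map-B ∷ map-VV (map-E 5 5 1≤) ∷ trans (map-mono Q.1# 1) (mono-cong ι.hom-1 ≡.refl) ∷
    map-VV (map-theta′ 3 2) ∷ map-VV (map-theta′ 4 1) ∷ map-E 1 1 1≤ ∷ map-E 5 5 1≤ ∷ []

  transfer : ∀ (f : Ex 8) → mapS (SQ.⟦ f ⟧ ρQ) ≋ ⟦ f ⟧ ρK
  transfer f = trans (Mp.hom-⟦⟧ f ρQ) (⟦⟧-cong f ρ-map)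

  Ψ-⟦⟧ : ∀ (f : Ex 8) c → Ψ (⟦ f ⟧ ρK * cst c) SQ.≋ SQ.⟦ f ⟧ ρQ SQ.* SQ.cst (ψ c)
  Ψ-⟦⟧ f c = SQ.trans (Ψ-cong (*-congʳ (sym (transfer f)))) (Ψ-term (SQ.⟦ f ⟧ ρQ) c)

  -- Multiply by ζ and apply `Ψ`: since ψ(εζ) is the weight of 1, which is 1, a series defined over
  -- Q is returned unchanged. Thus equality of the ε-parts suffices.
  descend : ∀ (l r : Ex 8) → N * ⟦ l ⟧ ρK ≋ N * ⟦ r ⟧ ρK → SQ.⟦ l ⟧ ρQ SQ.≋ SQ.⟦ r ⟧ ρQ
  descend l r p = SQ.trans (SQ.sym (coefficient l)) (SQ.trans (Ψ-cong (trans (split l) (trans (*-congʳ p) (sym (split r))))) (coefficient r))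
    where
    split : ∀ f → ⟦ f ⟧ ρK * cst (ε K.* ζ K.^ 1) ≋ N * ⟦ f ⟧ ρK * cst (ζ K.^ 1)
    split f = trans (*-congˡ (C.hom-* _ _)) (solve 3 (λ x n z → x ⊠ (n ⊠ z) ⊜ n ⊠ x ⊠ z) ≡.refl _ _ _)
    coefficient : ∀ f → Ψ (⟦ f ⟧ ρK * cst (ε K.* ζ K.^ 1)) SQ.≋ SQ.⟦ f ⟧ ρQ
    coefficient f = SQ.trans (Ψ-⟦⟧ f _) (SQ.trans (SQ.*-congˡ (SQ.trans (SQ.cst-cong (Q.trans (ψ-εζ 1) Q.⟪1⟫)) SQ.refl)) (SQ.*-identityʳ _))

  expr : N-ary 8 (Ex 8) (Ex 8) → Ex 8
  expr f = f $ⁿ tabulate var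

  dissection′ : Ex 8
  dissection′ = expr (λ w n q x y s s′ e →
    w ⊡ 3 ⊠ (con (+ 1) ⊟ con (+ 2) ⊠ n) ⊠ q ⊠ (y ⊟ con (+ 5) ⊠ n ⊠ s′)
    ⊟ w ⊡ 4 ⊠ (con (+ 1) ⊟ n) ⊠ (x ⊟ con (+ 5) ⊠ n ⊠ s) ⊞ (x ⊞ con (+ 5) ⊠ n ⊠ s)
    ⊟ w ⊠ (con (+ 1) ⊞ n) ⊠ q ⊠ (y ⊞ con (+ 5) ⊠ n ⊠ s′)
    ⊞ w ⊡ 2 ⊠ (con (+ 1) ⊞ n) ⊡ 2 ⊠ q ⊡ 3 ⊠ (con (+ 5) ⊠ n ⊠ e ⊡ 3))

  VX : KS.V (E₅ * B) ≋ e * b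
  VX = KS.VH.hom-* E₅ B
  VY : KS.V (E₅ * A) ≋ e * a
  VY = KS.VH.hom-* E₅ A

  module D₁ = Dissected K.1# ε (TripleProduct.one^ K 5) ε²≈0

  ε-absorb : ∀ {y} → y K.≈ K.1# K.+ ε → ε K.* y K.≈ ε
  ε-absorb h = K.trans (K.*-congˡ h) (K.trans (K.distribˡ _ _ _) (K.trans (K.+-cong (K.*-identityʳ ε) ε²≈0) (K.+-identityʳ _)))

  ε-absorb′ : ∀ {y} → y K.≈ K.1# K.- ε → ε K.* y K.≈ ε
  ε-absorb′ h = K.trans (K.*-congˡ h) (K.modulo (K.- K.1#) ε²≈0 (K.solve 1 (λ h → h ⊠ (con (+ 1) ⊟ h) ⊜ h ⊞ h ⊠ h ⊠ (⊖ con (+ 1))) ≡.refl ε))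

  -- At x = 1 + ε the factor ε absorbs both deformations.
  cube : N * (E₁ * (poch D₁.x 1 1 * poch D₁.x′ 1 1)) ≋ N * E₁ ^ 3
  cube = begin
    N * (E₁ * (poch D₁.x 1 1 * poch D₁.x′ 1 1))
      ≈⟨ solve 4 (λ n e x y → n ⊠ (e ⊠ (x ⊠ y)) ⊜ e ⊠ (n ⊠ x) ⊠ y) ≡.refl _ _ _ _ ⟩
    E₁ * (N * poch D₁.x 1 1) * poch D₁.x′ 1 1
      ≈⟨ *-congʳ (*-congˡ (poch-absorb ε _ 1 1 1≤ (ε-absorb (K.*-identityˡ _)))) ⟩
    E₁ * (N * E₁) * poch D₁.x′ 1 1
      ≈⟨ solve 3 (λ n e y → e ⊠ (n ⊠ e) ⊠ y ⊜ e ⊠ e ⊠ (n ⊠ y)) ≡.refl _ _ _ ⟩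
    E₁ * E₁ * (N * poch D₁.x′ 1 1)
      ≈⟨ *-congˡ (poch-absorb ε _ 1 1 1≤ (ε-absorb′ (K.trans (K.*-congʳ (TripleProduct.one^ K 4)) (K.*-identityˡ _)))) ⟩
    E₁ * E₁ * (N * E₁)
      ≈⟨ solve 2 (λ n e → e ⊠ e ⊠ (n ⊠ e) ⊜ n ⊠ e ⊡ 3) ≡.refl _ _ ⟩
    N * E₁ ^ 3 ∎
    where
    open ≋-Reasoning
    open Bilateral K using (poch-absorb)

  -- Jacobi's identity, with the sum over (-1)^n n q^(n(n+1)/2), n in ℤ, sorted by n modulo 5. The
  -- coefficients come from n = 5j + s, the classes s and -1 - s being joined; s = 2 is its own
  -- partner and yields 5q³e³.
  J-left J-right : Ex 8
  J-left = expr (λ a b e q s s′ E₁ E₅ → E₁ ⊡ 3)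
  J-right = expr (λ a b e q s s′ E₁ E₅ →
    con (+ 10) ⊠ s ⊞ e ⊠ b ⊟ q ⊠ (con (+ 10) ⊠ s′ ⊞ con (+ 3) ⊠ (e ⊠ a)) ⊞ con (+ 5) ⊠ q ⊡ 3 ⊠ e ⊡ 3)

  jacobi-N : N * ⟦ J-left ⟧ ρK ≋ N * ⟦ J-right ⟧ ρK
  jacobi-N = trans (sym (trans (*-congʳ first) cube)) (trans (sym D₁.theta-factor) (trans D₁.theta-dissection
    (trans (⟦⟧-cong dissection′ (C.hom-1 ∷ refl ∷ refl ∷ VX ∷ VY ∷ refl ∷ refl ∷ refl ∷ []))
    (modulo _ NN (solve 7 (λ n q x y s s′ e →
      con (+ 1) ⊡ 3 ⊠ (con (+ 1) ⊟ con (+ 2) ⊠ n) ⊠ q ⊠ (y ⊟ con (+ 5) ⊠ n ⊠ s′)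
      ⊟ con (+ 1) ⊡ 4 ⊠ (con (+ 1) ⊟ n) ⊠ (x ⊟ con (+ 5) ⊠ n ⊠ s) ⊞ (x ⊞ con (+ 5) ⊠ n ⊠ s)
      ⊟ con (+ 1) ⊠ (con (+ 1) ⊞ n) ⊠ q ⊠ (y ⊞ con (+ 5) ⊠ n ⊠ s′)
      ⊞ con (+ 1) ⊡ 2 ⊠ (con (+ 1) ⊞ n) ⊡ 2 ⊠ q ⊡ 3 ⊠ (con (+ 5) ⊠ n ⊠ e ⊡ 3)
      ⊜ n ⊠ (con (+ 10) ⊠ s ⊞ x ⊟ q ⊠ (con (+ 10) ⊠ s′ ⊞ con (+ 3) ⊠ y) ⊞ con (+ 5) ⊠ q ⊡ 3 ⊠ e ⊡ 3) ⊞
        n ⊠ n ⊠ (con (+ 5) ⊠ q ⊠ s′ ⊟ con (+ 5) ⊠ s ⊞ con (+ 5) ⊠ q ⊡ 3 ⊠ e ⊡ 3 ⊠ (con (+ 2) ⊞ n))) ≡.refl N q (e * b) (e * a) S₀ S₁ e)))))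
    where
    -- For w = 1 the factor 1 - 1/x is ε itself, so both sides of the dissection are multiples of ε.
    first : 1# - cst K.1# ^ 4 * (1# - N) ≋ N
    first = trans (+-congˡ (-‿cong (*-congʳ (^-congˡ 4 C.hom-1)))) (solve 1 (λ n → con (+ 1) ⊟ con (+ 1) ⊡ 4 ⊠ (con (+ 1) ⊟ n) ⊜ n) ≡.refl N)

  jacobi : SQ.⟦ J-left ⟧ ρQ SQ.≋ SQ.⟦ J-right ⟧ ρQ
  jacobi = descend J-left J-right jacobi-N

  E₁-left E₁-right E₅-left E₅-right : Ex 8
  E₁-left = expr (λ a b e q s s′ E₁ E₅ → E₁ ⊠ E₅)
  E₁-right = expr (λ a b e q s s′ E₁ E₅ → e ⊡ 2 ⊠ (b ⊡ 2 ⊟ q ⊠ a ⊠ b ⊟ (q ⊠ a) ⊡ 2))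
  E₅-left = expr (λ a b e q s s′ E₁ E₅ → E₅)
  E₅-right = expr (λ a b e q s s′ E₁ E₅ → a ⊠ b ⊠ e)

  ascend : ∀ (l r : Ex 8) → SQ.⟦ l ⟧ ρQ SQ.≋ SQ.⟦ r ⟧ ρQ → ⟦ l ⟧ ρK ≋ ⟦ r ⟧ ρK
  ascend l r p = trans (sym (transfer l)) (trans (Mp.hom-cong p) (transfer r))

  E₁-dissection-Q : SQ.⟦ E₁-left ⟧ ρQ SQ.≋ SQ.⟦ E₁-right ⟧ ρQ
  E₁-dissection-Q = descend E₁-left E₁-right (*-congˡ E₁-dissection)

  E₅-factor-Q : SQ.⟦ E₅-left ⟧ ρQ SQ.≋ SQ.⟦ E₅-right ⟧ ρQ
  E₅-factor-Q = descend E₅-left E₅-right (*-congˡ E₅≋abe)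

  quintic-Q : PQ.A SQ.^ 11 SQ.* PQ.B SQ.^ 11 SQ.≋
              PQ.B SQ.^ 10 SQ.- SQ.⟪ + 11 ⟫ SQ.* PQ.q SQ.* PQ.A SQ.^ 5 SQ.* PQ.B SQ.^ 5 SQ.- PQ.q SQ.^ 2 SQ.* PQ.A SQ.^ 10
  quintic-Q = SQ.trans (SQ.sym (lift l)) (SQ.trans (Ψ-cong (*-congʳ (trans (Mp.hom-⟦⟧ l ρ) (trans (⟦⟧-cong l ρm) (trans quintic (sym (trans (Mp.hom-⟦⟧ r ρ) (⟦⟧-cong r ρm)))))))) (lift r))
    where
    ρ : Vec SQ.S 3
    ρ = PQ.A ∷ PQ.B ∷ PQ.q ∷ []
    ρm : Vec.map mapS ρ ≈ᵛ (A ∷ B ∷ q ∷ [])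
    ρm = map-A ∷ map-B ∷ trans (map-mono Q.1# 1) (mono-cong ι.hom-1 ≡.refl) ∷ []
    l r : Ex 3
    l = (λ a b q → a ⊡ 11 ⊠ b ⊡ 11) $ⁿ tabulate var
    r = (λ a b q → b ⊡ 10 ⊟ con (+ 11) ⊠ q ⊠ a ⊡ 5 ⊠ b ⊡ 5 ⊟ q ⊡ 2 ⊠ a ⊡ 10) $ⁿ tabulate var
    lift : ∀ f → Ψ (mapS (SQ.⟦ f ⟧ ρ) * cst (ε K.* ζ K.^ 1)) SQ.≋ SQ.⟦ f ⟧ ρ
    lift f = SQ.trans (Ψ-term _ _) (SQ.trans (SQ.*-congˡ (SQ.cst-cong (Q.trans (ψ-εζ 1) Q.⟪1⟫))) (SQ.*-identityʳ _))

-- Evaluation of the derivative series from two dissections of E₁³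

module EtaCube (Q : CommutativeRing 0ℓ 0ℓ) where
  open Series Q
  open Substitution Q
  open Products Q
  open Bilateral Q

  a b e S₀ S₁ : S
  a = V A
  b = V B
  e = V E₅
  S₀ = V (theta′ 3 2)
  S₁ = V (theta′ 4 1)

  q^ : ∀ k → mono K.1# k ≋ q ^ k
  q^ k = sym (trans (mono-^ K.1# 1 k) (mono-cong (TripleProduct.one^ Q k) (ℕₚ.*-identityˡ k)))

  comb-expand : ∀ f → comb f ≋ V (f 0) + q * V (f 1) + q ^ 2 * V (f 2) + q ^ 3 * V (f 3) + q ^ 4 * V (f 4)
  comb-expand f = trans (+-cong (*-congʳ (q^ 0)) (+-cong (*-congʳ (q^ 1)) (+-cong (*-congʳ (q^ 2)) (+-cong (*-congʳ (q^ 3)) (*-congʳ (q^ 4))))))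
    (solve 6 (λ q a b c d e → con (+ 1) ⊠ a ⊞ (q ⊡ 1 ⊠ b ⊞ (q ⊡ 2 ⊠ c ⊞ (q ⊡ 3 ⊠ d ⊞ q ⊡ 4 ⊠ e))) ⊜
      a ⊞ q ⊠ b ⊞ q ⊡ 2 ⊠ c ⊞ q ⊡ 3 ⊠ d ⊞ q ⊡ 4 ⊠ e) ≡.refl q _ _ _ _ _)

  σ : Vec S 6
  σ = A ∷ B ∷ E₅ ∷ q ∷ theta′ 3 2 ∷ theta′ 4 1 ∷ []

  Vσ : Vec S 6
  Vσ = a ∷ b ∷ e ∷ q ^ 5 ∷ S₀ ∷ S₁ ∷ []

  V-⟦⟧ : ∀ (f : Ex 6) → V (⟦ f ⟧ σ) ≋ ⟦ f ⟧ Vσ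
  V-⟦⟧ f = trans (VH.hom-⟦⟧ f σ) (⟦⟧-cong f (refl ∷ refl ∷ refl ∷ V-q ∷ refl ∷ refl ∷ []))

  private
    expr : N-ary 6 (Ex 6) (Ex 6) → Ex 6
    expr f = f $ⁿ tabulate var

    -- Components of (ab)³E₁³ by residue of the exponent: `L` from Jacobi's identity, `R` from (1 -
    -- y - y²)³ = 1 - 3y + 5y³ - 3y⁵ - y⁶. Residues 2, 3, 4 agree outright; residue 0 evaluates
    -- `theta′ 3 2` and residue 1 `theta′ 4 1`.
    L R : ℕ → Ex 6
    L 0 = expr (λ a b e q s t → a ⊡ 3 ⊠ b ⊡ 3 ⊠ (con (+ 10) ⊠ s ⊞ e ⊠ b))
    L 1 = expr (λ a b e q s t → ⊖ (a ⊡ 3 ⊠ b ⊡ 3 ⊠ (con (+ 10) ⊠ t ⊞ con (+ 3) ⊠ (e ⊠ a))))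
    L 3 = expr (λ a b e q s t → con (+ 5) ⊠ e ⊡ 3 ⊠ a ⊡ 3 ⊠ b ⊡ 3)
    L _ = con (+ 0)
    R 0 = expr (λ a b e q s t → e ⊡ 3 ⊠ (b ⊡ 6 ⊟ con (+ 3) ⊠ q ⊠ b ⊠ a ⊡ 5))
    R 1 = expr (λ a b e q s t → ⊖ (e ⊡ 3 ⊠ (con (+ 3) ⊠ b ⊡ 5 ⊠ a ⊞ q ⊠ a ⊡ 6)))
    R 3 = expr (λ a b e q s t → con (+ 5) ⊠ e ⊡ 3 ⊠ a ⊡ 3 ⊠ b ⊡ 3)
    R _ = con (+ 0)

    value : (ℕ → Ex 6) → S
    value F = ⟦ F 0 ⟧ Vσ + q * ⟦ F 1 ⟧ Vσ + q ^ 2 * ⟦ F 2 ⟧ Vσ + q ^ 3 * ⟦ F 3 ⟧ Vσ + q ^ 4 * ⟦ F 4 ⟧ Vσ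

    comb-value : ∀ F → comb (λ i → ⟦ F i ⟧ σ) ≋ value F
    comb-value F = trans (comb-expand (λ i → ⟦ F i ⟧ σ))
      (+-cong (+-cong (+-cong (+-cong (V-⟦⟧ (F 0)) (*-congˡ (V-⟦⟧ (F 1)))) (*-congˡ (V-⟦⟧ (F 2)))) (*-congˡ (V-⟦⟧ (F 3)))) (*-congˡ (V-⟦⟧ (F 4))))

  unit^ : ∀ {x y} k → x * y ≋ 1# → y ^ k * x ^ k ≋ 1#
  unit^ {x} {y} k h = trans (sym (^-distrib-* y x k)) (trans (^-congˡ k (trans (*-comm y x) h)) (one k))
    where
    one : ∀ k → 1# ^ k ≋ 1#
    one zero = refl
    one (suc k) = trans (*-identityˡ _) (one k)

  module _
    (E₁-dissection : E₁ * E₅ ≋ e ^ 2 * (b ^ 2 - q * a * b - (q * a) ^ 2))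
    (E₅-factor : E₅ ≋ a * b * e)
    (jacobi : E₁ ^ 3 ≋ ⟪ + 10 ⟫ * S₀ + e * b - q * (⟪ + 10 ⟫ * S₁ + ⟪ + 3 ⟫ * (e * a)) + ⟪ + 5 ⟫ * q ^ 3 * e ^ 3) where

    E₁-dissection′ : a * b * E₁ ≋ e * (b ^ 2 - q * a * b - (q * a) ^ 2)
    E₁-dissection′ = cancel (V (inv E₅)) (trans (*-comm _ _) (V-unit E₅-unit)) (begin
      e * (a * b * E₁)       ≈⟨ solve 4 (λ a b e f → e ⊠ (a ⊠ b ⊠ f) ⊜ f ⊠ (a ⊠ b ⊠ e)) ≡.refl _ _ _ _ ⟩
      E₁ * (a * b * e)       ≈⟨ *-congˡ E₅-factor ⟨
      E₁ * E₅                ≈⟨ E₁-dissection ⟩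
      _                      ≈⟨ solve 2 (λ e x → e ⊡ 2 ⊠ x ⊜ e ⊠ (e ⊠ x)) ≡.refl _ _ ⟩
      e * (e * (b ^ 2 - q * a * b - (q * a) ^ 2)) ∎)
      where open ≋-Reasoning

    private
      values : value L ≋ value R
      values = begin
        value L
          ≈⟨ solve 6 (λ a b e q s t →
               a ⊡ 3 ⊠ b ⊡ 3 ⊠ (con (+ 10) ⊠ s ⊞ e ⊠ b) ⊞ q ⊠ (⊖ (a ⊡ 3 ⊠ b ⊡ 3 ⊠ (con (+ 10) ⊠ t ⊞ con (+ 3) ⊠ (e ⊠ a))))
               ⊞ q ⊡ 2 ⊠ con (+ 0) ⊞ q ⊡ 3 ⊠ (con (+ 5) ⊠ e ⊡ 3 ⊠ a ⊡ 3 ⊠ b ⊡ 3) ⊞ q ⊡ 4 ⊠ con (+ 0)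
               ⊜ (a ⊠ b) ⊡ 3 ⊠ (con (+ 10) ⊠ s ⊞ e ⊠ b ⊟ q ⊠ (con (+ 10) ⊠ t ⊞ con (+ 3) ⊠ (e ⊠ a)) ⊞ con (+ 5) ⊠ q ⊡ 3 ⊠ e ⊡ 3)) ≡.refl a b e q S₀ S₁ ⟩
        (a * b) ^ 3 * _
          ≈⟨ *-congˡ jacobi ⟨
        (a * b) ^ 3 * E₁ ^ 3
          ≈⟨ ^-distrib-* (a * b) E₁ 3 ⟨
        (a * b * E₁) ^ 3
          ≈⟨ ^-congˡ 3 E₁-dissection′ ⟩
        (e * (b ^ 2 - q * a * b - (q * a) ^ 2)) ^ 3
          ≈⟨ solve 4 (λ a b e q → (e ⊠ (b ⊡ 2 ⊟ q ⊠ a ⊠ b ⊟ (q ⊠ a) ⊡ 2)) ⊡ 3 ⊜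
               e ⊡ 3 ⊠ (b ⊡ 6 ⊟ con (+ 3) ⊠ q ⊡ 5 ⊠ b ⊠ a ⊡ 5) ⊞ q ⊠ (⊖ (e ⊡ 3 ⊠ (con (+ 3) ⊠ b ⊡ 5 ⊠ a ⊞ q ⊡ 5 ⊠ a ⊡ 6)))
               ⊞ q ⊡ 2 ⊠ con (+ 0) ⊞ q ⊡ 3 ⊠ (con (+ 5) ⊠ e ⊡ 3 ⊠ a ⊡ 3 ⊠ b ⊡ 3) ⊞ q ⊡ 4 ⊠ con (+ 0)) ≡.refl a b e q ⟩
        value R ∎
        where open ≋-Reasoning

      combs : comb (λ i → ⟦ L i ⟧ σ) ≋ comb (λ i → ⟦ R i ⟧ σ)
      combs = trans (comb-value L) (trans values (sym (comb-value R)))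

    theta′-32 : A ^ 3 * B ^ 3 * (⟪ + 10 ⟫ * theta′ 3 2 + E₅ * B) ≋ E₅ ^ 3 * (B ^ 6 - ⟪ + 3 ⟫ * q * B * A ^ 5)
    theta′-32 = trans (sym (U-comb-0 (λ i → ⟦ L i ⟧ σ))) (trans (U-cong 0 combs) (U-comb-0 (λ i → ⟦ R i ⟧ σ)))

    V-theta′-32 : a ^ 3 * b ^ 3 * (⟪ + 10 ⟫ * S₀ + e * b) ≋ e ^ 3 * (b ^ 6 - ⟪ + 3 ⟫ * q ^ 5 * b * a ^ 5)
    V-theta′-32 = trans (sym (V-⟦⟧ (L 0))) (trans (VH.hom-cong theta′-32) (V-⟦⟧ (R 0)))

    V-theta′-41 : - (a ^ 3 * b ^ 3 * (⟪ + 10 ⟫ * S₁ + ⟪ + 3 ⟫ * (e * a))) ≋ - (e ^ 3 * (⟪ + 3 ⟫ * b ^ 5 * a + q ^ 5 * a ^ 6))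
    V-theta′-41 = trans (sym (V-⟦⟧ (L 1))) (trans
      (VH.hom-cong (trans (sym (U-comb-1 (λ i → ⟦ L i ⟧ σ))) (trans (U-cong 1 combs) (U-comb-1 (λ i → ⟦ R i ⟧ σ))))) (V-⟦⟧ (R 1)))

-- The generating function at x = ζ(1 + ε) and its image under the functional

-- The ε-part of 10 a³b³ T is (ζ - ζ⁴) p + (ζ² - ζ³) p′, where z = q a; the ε-part of 10 a³b³ T T₀′² is
-- e² ((ζ - ζ⁴) L₁ + (ζ² - ζ³) L₂).
module CorrectionTerm where
  pE p′E : ∀ {n} → Ex n → Ex n → Ex n → Ex n → Ex n
  pE a b e z = a ⊡ 3 ⊠ b ⊡ 3 ⊠ e ⊠ (con (+ 3) ⊠ b ⊟ con (+ 4) ⊠ z) ⊞ e ⊡ 3 ⊠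
    (con (+ 9) ⊠ b ⊠ z ⊡ 5 ⊟ con (+ 3) ⊠ b ⊡ 6 ⊟ con (+ 6) ⊠ b ⊡ 5 ⊠ z ⊟ con (+ 2) ⊠ z ⊡ 6 ⊞ con (+ 10) ⊠ b ⊡ 3 ⊠ z ⊡ 3)
  p′E a b e z = a ⊡ 3 ⊠ b ⊡ 3 ⊠ e ⊠ (b ⊟ con (+ 3) ⊠ z) ⊞ e ⊡ 3 ⊠
    (con (+ 3) ⊠ b ⊠ z ⊡ 5 ⊟ b ⊡ 6 ⊞ con (+ 3) ⊠ b ⊡ 5 ⊠ z ⊞ z ⊡ 6 ⊞ con (+ 20) ⊠ b ⊡ 3 ⊠ z ⊡ 3)

  L₁E L₂E : ∀ {n} → Ex n → Ex n → Ex n → Ex n → Ex n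
  L₁E p p′ b z = p ⊠ (b ⊡ 2 ⊞ z ⊡ 2) ⊞ (con (+ 2) ⊠ b ⊠ z ⊟ z ⊡ 2) ⊠ p′
  L₂E p p′ b z = p′ ⊠ (b ⊡ 2 ⊞ z ⊡ 2) ⊞ (con (+ 2) ⊠ b ⊠ z ⊟ z ⊡ 2) ⊠ (p ⊟ p′)

module CrankGeneratingFunction {Q : CommutativeRing 0ℓ 0ℓ} (M : CrankAlgebra Q) where
  open CrankAlgebra M
  open CrankSeries M
  open CorrectionTerm
  open Series K
  open Products K
  open Quintic K ζ ζ-cyclotomic fifth 5*fifth
  private
    module C = RingHom (Substitution.cstHom K)
    module EQ = EtaCube Q
    module Dx = Dissected ζ ε Z.w⁵ ε²≈0

  E₁-dissection′ : EQ.a SQ.* EQ.b SQ.* PQ.E₁ SQ.≋ EQ.e SQ.* (EQ.b SQ.^ 2 SQ.- PQ.q SQ.* EQ.a SQ.* EQ.b SQ.- (PQ.q SQ.* EQ.a) SQ.^ 2)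
  E₁-dissection′ = EQ.E₁-dissection′ E₁-dissection-Q E₅-factor-Q jacobi

  theta′-32 : PQ.A SQ.^ 3 SQ.* PQ.B SQ.^ 3 SQ.* (SQ.⟪ + 10 ⟫ SQ.* BQ.theta′ 3 2 SQ.+ PQ.E₅ SQ.* PQ.B) SQ.≋
              PQ.E₅ SQ.^ 3 SQ.* (PQ.B SQ.^ 6 SQ.- SQ.⟪ + 3 ⟫ SQ.* PQ.q SQ.* PQ.B SQ.* PQ.A SQ.^ 5)
  theta′-32 = EQ.theta′-32 E₁-dissection-Q E₅-factor-Q jacobi

  private
    rel₀ : a ^ 3 * b ^ 3 * (⟪ + 10 ⟫ * S₀ + e * b) ≋ e ^ 3 * (b ^ 6 - ⟪ + 3 ⟫ * q ^ 5 * b * a ^ 5)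
    rel₀ = ascend
      (expr (λ a b e q s t E₁ E₅ → a ⊡ 3 ⊠ b ⊡ 3 ⊠ (con (+ 10) ⊠ s ⊞ e ⊠ b)))
      (expr (λ a b e q s t E₁ E₅ → e ⊡ 3 ⊠ (b ⊡ 6 ⊟ con (+ 3) ⊠ q ⊡ 5 ⊠ b ⊠ a ⊡ 5)))
      (EQ.V-theta′-32 E₁-dissection-Q E₅-factor-Q jacobi)

    rel₁ : - (a ^ 3 * b ^ 3 * (⟪ + 10 ⟫ * S₁ + ⟪ + 3 ⟫ * (e * a))) ≋ - (e ^ 3 * (⟪ + 3 ⟫ * b ^ 5 * a + q ^ 5 * a ^ 6))
    rel₁ = ascend
      (expr (λ a b e q s t E₁ E₅ → ⊖ (a ⊡ 3 ⊠ b ⊡ 3 ⊠ (con (+ 10) ⊠ t ⊞ con (+ 3) ⊠ (e ⊠ a)))))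
      (expr (λ a b e q s t E₁ E₅ → ⊖ (e ⊡ 3 ⊠ (con (+ 3) ⊠ b ⊡ 5 ⊠ a ⊞ q ⊡ 5 ⊠ a ⊡ 6))))
      (EQ.V-theta′-41 E₁-dissection-Q E₅-factor-Q jacobi)

    -- The derivative series times 10a³b³, the denominator in their evaluations; in this form they
    -- become polynomials in a, b, e and qa.
    σ₀ σ₁ A³ : S
    A³ = a ^ 3 * b ^ 3
    σ₀ = ⟪ + 10 ⟫ * S₀ * A³
    σ₁ = ⟪ + 10 ⟫ * q * S₁ * A³

    σ₀≋ : σ₀ ≋ e ^ 3 * (b ^ 6 - ⟪ + 3 ⟫ * b * (q * a) ^ 5) - a ^ 3 * b ^ 3 * (e * b)
    σ₀≋ = trans (solve 4 (λ a b e s → con (+ 10) ⊠ s ⊠ (a ⊡ 3 ⊠ b ⊡ 3) ⊜ a ⊡ 3 ⊠ b ⊡ 3 ⊠ (con (+ 10) ⊠ s ⊞ e ⊠ b) ⊟ a ⊡ 3 ⊠ b ⊡ 3 ⊠ (e ⊠ b)) ≡.refl a b e S₀)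
      (+-congʳ (trans rel₀ (solve 4 (λ a b e q → e ⊡ 3 ⊠ (b ⊡ 6 ⊟ con (+ 3) ⊠ q ⊡ 5 ⊠ b ⊠ a ⊡ 5) ⊜ e ⊡ 3 ⊠ (b ⊡ 6 ⊟ con (+ 3) ⊠ b ⊠ (q ⊠ a) ⊡ 5)) ≡.refl a b e q)))

    σ₁≋ : σ₁ ≋ e ^ 3 * (⟪ + 3 ⟫ * b ^ 5 * (q * a) + (q * a) ^ 6) - ⟪ + 3 ⟫ * (a ^ 3 * b ^ 3) * (e * (q * a))
    σ₁≋ = trans (solve 5 (λ a b e q s → con (+ 10) ⊠ q ⊠ s ⊠ (a ⊡ 3 ⊠ b ⊡ 3) ⊜
        (⊖ q) ⊠ (⊖ (a ⊡ 3 ⊠ b ⊡ 3 ⊠ (con (+ 10) ⊠ s ⊞ con (+ 3) ⊠ (e ⊠ a)))) ⊟ con (+ 3) ⊠ (a ⊡ 3 ⊠ b ⊡ 3) ⊠ (e ⊠ (q ⊠ a))) ≡.refl a b e q S₁)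
      (+-congʳ (trans (*-congˡ rel₁) (solve 4 (λ a b e q → (⊖ q) ⊠ (⊖ (e ⊡ 3 ⊠ (con (+ 3) ⊠ b ⊡ 5 ⊠ a ⊞ q ⊡ 5 ⊠ a ⊡ 6))) ⊜
        e ⊡ 3 ⊠ (con (+ 3) ⊠ b ⊡ 5 ⊠ (q ⊠ a) ⊞ (q ⊠ a) ⊡ 6)) ≡.refl a b e q)))

    -- `T₀` is the value of T at ε = 0, and `T₀′` its conjugate under ζ ↦ ζ².
    T T₀ T₀′ : S
    T = E₁ * (poch Dx.x 1 1 * poch Dx.x′ 1 1)
    T₀ = e * b + (Ζ ^ 2 + Ζ ^ 3) * q * (e * a)
    T₀′ = e * b + (Ζ + Ζ ^ 4) * q * (e * a)

    p p′ : S
    p = ⟦ pE (var zero) (var (suc zero)) (var (suc (suc zero))) (var (suc (suc (suc zero)))) ⟧ (a ∷ b ∷ e ∷ q * a ∷ [])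
      where open import Data.Fin using (zero; suc)
    p′ = ⟦ p′E (var zero) (var (suc zero)) (var (suc (suc zero))) (var (suc (suc (suc zero)))) ⟧ (a ∷ b ∷ e ∷ q * a ∷ [])
      where open import Data.Fin using (zero; suc)

    T₁ : S
    T₁ = (Ζ - Ζ ^ 4) * p + (Ζ ^ 2 - Ζ ^ 3) * p′

    D₀ D₁ : S → S → S
    D₀ s s′ = ⟪ + 10 ⟫ * A³ * (Ζ ^ 3 * q * (e * a) - Ζ ^ 4 * (e * b) + e * b - Ζ * q * (e * a))
    D₁ s s′ = Ζ ^ 4 * (⟪ + 10 ⟫ * (e * b) * A³ + ⟪ + 5 ⟫ * s) + ⟪ + 5 ⟫ * s - Ζ ^ 3 * (⟪ + 20 ⟫ * q * (e * a) * A³ + ⟪ + 5 ⟫ * s′)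
      - Ζ * (⟪ + 10 ⟫ * q * (e * a) * A³ + ⟪ + 5 ⟫ * s′) + ⟪ + 50 ⟫ * Ζ ^ 2 * q ^ 3 * e ^ 3 * A³

    cycE : ∀ {n} → Ex n → Ex n
    cycE w = con (+ 1) ⊞ w ⊞ w ⊡ 2 ⊞ w ⊡ 3 ⊞ w ⊡ 4

    T-dissected : (1# - Ζ ^ 4 * (1# - N)) * (⟪ + 10 ⟫ * A³ * T) ≋ D₀ σ₀ σ₁ + N * D₁ σ₀ σ₁
    T-dissected = trans (solve 3 (λ x y z → x ⊠ (y ⊠ z) ⊜ y ⊠ (x ⊠ z)) ≡.refl _ _ _) (trans (*-congˡ (trans (sym Dx.theta-factor) (trans Dx.theta-dissection
      (⟦⟧-cong dissection′ (refl ∷ refl ∷ refl ∷ VX ∷ VY ∷ refl ∷ refl ∷ refl ∷ [])))))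
      (modulo _ NN (solve 8 (λ w n q a b e s s′ →
        let x = e ⊠ b ; y = e ⊠ a ; A³ = a ⊡ 3 ⊠ b ⊡ 3 ; σ = con (+ 10) ⊠ s ⊠ A³ ; σ′ = con (+ 10) ⊠ q ⊠ s′ ⊠ A³ in
        con (+ 10) ⊠ A³ ⊠
        (w ⊡ 3 ⊠ (con (+ 1) ⊟ con (+ 2) ⊠ n) ⊠ q ⊠ (y ⊟ con (+ 5) ⊠ n ⊠ s′)
         ⊟ w ⊡ 4 ⊠ (con (+ 1) ⊟ n) ⊠ (x ⊟ con (+ 5) ⊠ n ⊠ s) ⊞ (x ⊞ con (+ 5) ⊠ n ⊠ s)
         ⊟ w ⊠ (con (+ 1) ⊞ n) ⊠ q ⊠ (y ⊞ con (+ 5) ⊠ n ⊠ s′)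
         ⊞ w ⊡ 2 ⊠ (con (+ 1) ⊞ n) ⊡ 2 ⊠ q ⊡ 3 ⊠ (con (+ 5) ⊠ n ⊠ e ⊡ 3))
        ⊜ con (+ 10) ⊠ A³ ⊠ (w ⊡ 3 ⊠ q ⊠ y ⊟ w ⊡ 4 ⊠ x ⊞ x ⊟ w ⊠ q ⊠ y)
          ⊞ n ⊠ (w ⊡ 4 ⊠ (con (+ 10) ⊠ x ⊠ A³ ⊞ con (+ 5) ⊠ σ) ⊞ con (+ 5) ⊠ σ ⊟ w ⊡ 3 ⊠ (con (+ 20) ⊠ q ⊠ y ⊠ A³ ⊞ con (+ 5) ⊠ σ′)
                 ⊟ w ⊠ (con (+ 10) ⊠ q ⊠ y ⊠ A³ ⊞ con (+ 5) ⊠ σ′) ⊞ con (+ 50) ⊠ w ⊡ 2 ⊠ q ⊡ 3 ⊠ e ⊡ 3 ⊠ A³)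
          ⊞ n ⊠ n ⊠ (con (+ 10) ⊠ A³ ⊠ (con (+ 10) ⊠ w ⊡ 3 ⊠ q ⊠ s′ ⊟ con (+ 5) ⊠ w ⊡ 4 ⊠ s ⊟ con (+ 5) ⊠ w ⊠ q ⊠ s′
                     ⊞ con (+ 5) ⊠ w ⊡ 2 ⊠ q ⊡ 3 ⊠ e ⊡ 3 ⊠ (con (+ 2) ⊞ n)))) ≡.refl Ζ N q a b e S₀ S₁)))

    D₀≋ : D₀ σ₀ σ₁ ≋ (1# - Ζ ^ 4) * (⟪ + 10 ⟫ * A³ * T₀)
    D₀≋ = modulo _ Z.W-cyc (solve 5 (λ w q a b e →
      con (+ 10) ⊠ (a ⊡ 3 ⊠ b ⊡ 3) ⊠ (w ⊡ 3 ⊠ q ⊠ (e ⊠ a) ⊟ w ⊡ 4 ⊠ (e ⊠ b) ⊞ e ⊠ b ⊟ w ⊠ q ⊠ (e ⊠ a)) ⊜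
      (con (+ 1) ⊟ w ⊡ 4) ⊠ (con (+ 10) ⊠ (a ⊡ 3 ⊠ b ⊡ 3) ⊠ (e ⊠ b ⊞ (w ⊡ 2 ⊞ w ⊡ 3) ⊠ q ⊠ (e ⊠ a))) ⊞
      cycE w ⊠ (con (+ 10) ⊠ (a ⊡ 3 ⊠ b ⊡ 3) ⊠ (w ⊡ 3 ⊟ w) ⊠ q ⊠ (e ⊠ a))) ≡.refl Ζ q a b e)

    -- This is the ε-coefficient of (1 - ζ⁴ + ζ⁴ε)(10A³T₀ + εT₁), arranged so that the factor 1 -
    -- 1/x can be cancelled in `T-formula`. The polynomials `pE` and `p′E` are what this division
    -- leaves.
    D₁≋ : D₁ σ₀ σ₁ ≋ (1# - Ζ ^ 4) * T₁ + Ζ ^ 4 * (⟪ + 10 ⟫ * A³ * T₀)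
    D₁≋ = trans (+-congʳ (+-cong (+-cong (+-cong (*-congˡ (+-congˡ (*-congˡ σ₀≋))) (*-congˡ σ₀≋)) (-‿cong (*-congˡ (+-congˡ (*-congˡ σ₁≋))))) (-‿cong (*-congˡ (+-congˡ (*-congˡ σ₁≋))))))
      (modulo _ Z.W-cyc (solve 5 (λ w q a b e →
        let x = e ⊠ b ; y = e ⊠ a ; A³ = a ⊡ 3 ⊠ b ⊡ 3 ; z = q ⊠ a
            σ = e ⊡ 3 ⊠ (b ⊡ 6 ⊟ con (+ 3) ⊠ b ⊠ z ⊡ 5) ⊟ a ⊡ 3 ⊠ b ⊡ 3 ⊠ (e ⊠ b)
            σ′ = e ⊡ 3 ⊠ (con (+ 3) ⊠ b ⊡ 5 ⊠ z ⊞ z ⊡ 6) ⊟ con (+ 3) ⊠ (a ⊡ 3 ⊠ b ⊡ 3) ⊠ (e ⊠ z) in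
        w ⊡ 4 ⊠ (con (+ 10) ⊠ x ⊠ A³ ⊞ con (+ 5) ⊠ σ) ⊞ con (+ 5) ⊠ σ ⊟ w ⊡ 3 ⊠ (con (+ 20) ⊠ q ⊠ y ⊠ A³ ⊞ con (+ 5) ⊠ σ′)
          ⊟ w ⊠ (con (+ 10) ⊠ q ⊠ y ⊠ A³ ⊞ con (+ 5) ⊠ σ′) ⊞ con (+ 50) ⊠ w ⊡ 2 ⊠ q ⊡ 3 ⊠ e ⊡ 3 ⊠ A³
        ⊜ (con (+ 1) ⊟ w ⊡ 4) ⊠ ((w ⊟ w ⊡ 4) ⊠ pE a b e z ⊞ (w ⊡ 2 ⊟ w ⊡ 3) ⊠ p′E a b e z)
          ⊞ w ⊡ 4 ⊠ (con (+ 10) ⊠ A³ ⊠ (e ⊠ b ⊞ (w ⊡ 2 ⊞ w ⊡ 3) ⊠ q ⊠ (e ⊠ a)))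
          ⊞ cycE w ⊠
            ( (con (+ 2) ⊠ w ⊞ con (+ 2) ⊠ w ⊡ 2 ⊞ con (+ 2) ⊠ w ⊡ 3 ⊟ con (+ 5) ⊟ con (+ 3) ⊠ w ⊡ 4) ⊠ (A³ ⊠ e ⊠ b ⊟ e ⊡ 3 ⊠ b ⊡ 6 ⊞ con (+ 3) ⊠ (e ⊡ 3 ⊠ b ⊠ z ⊡ 5))
            ⊞ (con (+ 9) ⊠ w ⊟ con (+ 6) ⊠ w ⊡ 2 ⊟ con (+ 11) ⊠ w ⊡ 3 ⊞ con (+ 4) ⊠ w ⊡ 4) ⊠ (A³ ⊠ e ⊠ z)
            ⊞ (con (+ 2) ⊠ w ⊡ 2 ⊟ con (+ 3) ⊠ w ⊟ con (+ 3) ⊠ w ⊡ 3 ⊞ con (+ 2) ⊠ w ⊡ 4) ⊠ (con (+ 3) ⊠ (e ⊡ 3 ⊠ b ⊡ 5 ⊠ z) ⊞ e ⊡ 3 ⊠ z ⊡ 6)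
            ⊞ (con (+ 40) ⊠ w ⊡ 2 ⊟ con (+ 10) ⊠ w ⊟ con (+ 10) ⊠ w ⊡ 3 ⊟ con (+ 10) ⊠ w ⊡ 4) ⊠ (e ⊡ 3 ⊠ b ⊡ 3 ⊠ z ⊡ 3)))
        ≡.refl Ζ q a b e))

    k : S
    k = cst fifth * (⟪ + 4 ⟫ + ⟪ + 3 ⟫ * Ζ ^ 4 + ⟪ + 2 ⟫ * Ζ ^ 3 + Ζ ^ 2)

    k-1 : k * (1# - Ζ ^ 4) - 1# ≋ 0#
    k-1 = trans (+-congʳ Z.unit) (-‿inverseʳ 1#)

    -- To first order the inverse of 1 - ζ⁴ + ζ⁴ε is k - k²ζ⁴ε. The two added summands cancel by k(1
    -- - ζ⁴) = 1, which `factor-unit′` uses to drop them; treating the relations one at a time keeps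
    -- the cofactors short.
    factor-unit : (k - k * k * Ζ ^ 4 * N) * (1# - Ζ ^ 4 * (1# - N)) + k * k * (1# - Ζ ^ 4) * Ζ ^ 4 * N - k * Ζ ^ 4 * N ≋ 1#
    factor-unit = modulo _ k-1 (modulo _ NN (solve 3 (λ k w n →
      (k ⊟ k ⊠ k ⊠ w ⊡ 4 ⊠ n) ⊠ (con (+ 1) ⊟ w ⊡ 4 ⊠ (con (+ 1) ⊟ n)) ⊞ k ⊠ k ⊠ (con (+ 1) ⊟ w ⊡ 4) ⊠ w ⊡ 4 ⊠ n ⊟ k ⊠ w ⊡ 4 ⊠ n
      ⊜ con (+ 1) ⊞ (k ⊠ (con (+ 1) ⊟ w ⊡ 4) ⊟ con (+ 1)) ⊠ con (+ 1) ⊞ n ⊠ n ⊠ (⊖ (k ⊠ k ⊠ w ⊡ 8))) ≡.refl k Ζ N))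

    factor-unit′ : (k - k * k * Ζ ^ 4 * N) * (1# - Ζ ^ 4 * (1# - N)) ≋ 1#
    factor-unit′ = trans (modulo _ k-1 (solve 4 (λ x k w n → x ⊜
      (x ⊞ k ⊠ k ⊠ (con (+ 1) ⊟ w ⊡ 4) ⊠ w ⊡ 4 ⊠ n ⊟ k ⊠ w ⊡ 4 ⊠ n) ⊞ (k ⊠ (con (+ 1) ⊟ w ⊡ 4) ⊟ con (+ 1)) ⊠ (⊖ (k ⊠ w ⊡ 4 ⊠ n))) ≡.refl _ k Ζ N)) factor-unit

    T-formula : ⟪ + 10 ⟫ * A³ * T ≋ ⟪ + 10 ⟫ * A³ * T₀ + N * T₁
    T-formula = cancel _ factor-unit′ (trans T-dissected (trans (+-cong D₀≋ (*-congˡ D₁≋))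
      (sym (modulo (Ζ ^ 4 * T₁) NN (solve 4 (λ w n x y → (con (+ 1) ⊟ w ⊡ 4 ⊠ (con (+ 1) ⊟ n)) ⊠ (x ⊞ n ⊠ y) ⊜
        ((con (+ 1) ⊟ w ⊡ 4) ⊠ x ⊞ n ⊠ ((con (+ 1) ⊟ w ⊡ 4) ⊠ y ⊞ w ⊡ 4 ⊠ x)) ⊞ n ⊠ n ⊠ (w ⊡ 4 ⊠ y)) ≡.refl Ζ N _ _)))))

    T₀T₀′ : T₀ * T₀′ ≋ E₁ * E₅
    T₀T₀′ = sym (trans E₁-dissection (sym (modulo _ Z.W-cyc (solve 5 (λ w q a b e →
      (e ⊠ b ⊞ (w ⊡ 2 ⊞ w ⊡ 3) ⊠ q ⊠ (e ⊠ a)) ⊠ (e ⊠ b ⊞ (w ⊞ w ⊡ 4) ⊠ q ⊠ (e ⊠ a)) ⊜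
      e ⊡ 2 ⊠ (b ⊡ 2 ⊟ q ⊠ a ⊠ b ⊟ (q ⊠ a) ⊡ 2) ⊞ cycE w ⊠ (e ⊡ 2 ⊠ (q ⊠ a ⊠ b ⊞ (con (+ 1) ⊟ w ⊞ w ⊡ 3) ⊠ (q ⊠ a) ⊡ 2))) ≡.refl Ζ q a b e))))

    Z₀ : S
    Z₀ = q * a

    L₁ L₂ : S
    L₁ = p * (b ^ 2 + Z₀ ^ 2) + (⟪ + 2 ⟫ * b * Z₀ - Z₀ ^ 2) * p′
    L₂ = p′ * (b ^ 2 + Z₀ ^ 2) + (⟪ + 2 ⟫ * b * Z₀ - Z₀ ^ 2) * (p - p′)

    -- `T₁` is odd and `T₀′` even under ζ ↦ ζ⁻¹, so the product is again a combination of ζ - ζ⁴ and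
    -- ζ² - ζ³.
    T₁T₀′² : T₁ * T₀′ ^ 2 ≋ e ^ 2 * (Ζ * L₁ + Ζ ^ 2 * L₂ - Ζ ^ 3 * L₂ - Ζ ^ 4 * L₁)
    T₁T₀′² = modulo _ Z.W-cyc (solve 7 (λ w p p′ q a b e →
      let z = q ⊠ a in
      ((w ⊟ w ⊡ 4) ⊠ p ⊞ (w ⊡ 2 ⊟ w ⊡ 3) ⊠ p′) ⊠ (e ⊠ b ⊞ (w ⊞ w ⊡ 4) ⊠ q ⊠ (e ⊠ a)) ⊡ 2 ⊜
      e ⊡ 2 ⊠ (w ⊠ L₁E p p′ b z ⊞ w ⊡ 2 ⊠ L₂E p p′ b z ⊟ w ⊡ 3 ⊠ L₂E p p′ b z ⊟ w ⊡ 4 ⊠ L₁E p p′ b z) ⊞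
      cycE w ⊠ (e ⊡ 2 ⊠ ((con (+ 2) ⊠ b ⊠ z ⊟ z ⊡ 2) ⊠ ((w ⊡ 3 ⊟ w ⊡ 4) ⊠ p ⊞ (con (+ 2) ⊠ w ⊡ 2 ⊟ w ⊟ w ⊡ 3) ⊠ p′)
        ⊞ z ⊡ 2 ⊠ (con (+ 2) ⊠ w ⊟ con (+ 1) ⊟ w ⊡ 3 ⊞ w ⊡ 4) ⊠ ((w ⊟ w ⊡ 4) ⊠ p ⊞ (w ⊡ 2 ⊟ w ⊡ 3) ⊠ p′)))) ≡.refl Ζ p p′ q a b e)

    t : S
    t = ⟪ + 10 ⟫ * A³

  module _ (F : S) (F-inverse : F * (E₁ ^ 2 * (E₁ * (poch Dx.x 1 1 * poch Dx.x′ 1 1))) ≋ 1#) where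
    private
      -- First-order inversion: (tT₀ + εT₁)(tT₀ - εT₁) = t²T₀², where the first factor is tT. The
      -- square of T₀ is made free of ζ by T₀T₀′ = E₁E₅.
      F-formula : E₁ ^ 4 * E₅ ^ 2 * t ^ 2 * F ≋ t * (t * (E₁ * E₅ * T₀′) - N * (e ^ 2 * (Ζ * L₁ + Ζ ^ 2 * L₂ - Ζ ^ 3 * L₂ - Ζ ^ 4 * L₁)))
      F-formula = begin
        E₁ ^ 4 * E₅ ^ 2 * t ^ 2 * F
          ≈⟨ solve 4 (λ x y t f → x ⊡ 4 ⊠ y ⊡ 2 ⊠ t ⊡ 2 ⊠ f ⊜ f ⊠ x ⊡ 2 ⊠ t ⊡ 2 ⊠ (x ⊠ y) ⊡ 2) ≡.refl E₁ E₅ t F ⟩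
        F * E₁ ^ 2 * t ^ 2 * (E₁ * E₅) ^ 2
          ≈⟨ *-congˡ (^-congˡ 2 T₀T₀′) ⟨
        F * E₁ ^ 2 * t ^ 2 * (T₀ * T₀′) ^ 2
          ≈⟨ modulo _ NN (solve 7 (λ f x t u v n w → f ⊠ x ⊡ 2 ⊠ t ⊡ 2 ⊠ (u ⊠ v) ⊡ 2 ⊜
               f ⊠ x ⊡ 2 ⊠ (t ⊠ u ⊞ n ⊠ w) ⊠ ((t ⊠ u ⊟ n ⊠ w) ⊠ v ⊡ 2) ⊞ n ⊠ n ⊠ (f ⊠ x ⊡ 2 ⊠ w ⊡ 2 ⊠ v ⊡ 2)) ≡.refl F E₁ t T₀ T₀′ N T₁) ⟩
        F * E₁ ^ 2 * (t * T₀ + N * T₁) * ((t * T₀ - N * T₁) * T₀′ ^ 2)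
          ≈⟨ *-congʳ (trans (*-congˡ (sym T-formula)) (trans (solve 4 (λ f x t u → f ⊠ x ⊡ 2 ⊠ (t ⊠ u) ⊜ t ⊠ (f ⊠ (x ⊡ 2 ⊠ u))) ≡.refl F E₁ t T) (trans (*-congˡ F-inverse) (*-identityʳ t)))) ⟩
        t * ((t * T₀ - N * T₁) * T₀′ ^ 2)
          ≈⟨ *-congˡ (solve 5 (λ t u v n w → (t ⊠ u ⊟ n ⊠ w) ⊠ v ⊡ 2 ⊜ t ⊠ (u ⊠ v ⊠ v) ⊟ n ⊠ (w ⊠ v ⊡ 2)) ≡.refl t T₀ T₀′ N T₁) ⟩
        t * (t * (T₀ * T₀′ * T₀′) - N * (T₁ * T₀′ ^ 2))
          ≈⟨ *-congˡ (+-cong (*-congˡ (*-congʳ T₀T₀′)) (-‿cong (*-congˡ T₁T₀′²))) ⟩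
        _ ∎
        where open ≋-Reasoning

      tE : Ex 8 → Ex 8 → Ex 8
      tE a b = con (+ 10) ⊠ (a ⊡ 3 ⊠ b ⊡ 3)

      lhsE αE βE γE δE : Ex 8
      lhsE = expr (λ a b e q s s′ E₁ E₅ → E₁ ⊡ 4 ⊠ E₅ ⊡ 2 ⊠ tE a b ⊡ 2)
      αE = expr (λ a b e q s s′ E₁ E₅ → tE a b ⊡ 2 ⊠ E₁ ⊠ E₅ ⊠ (e ⊠ b))
      βE = expr (λ a b e q s s′ E₁ E₅ → tE a b ⊡ 2 ⊠ E₁ ⊠ E₅ ⊠ (q ⊠ (e ⊠ a)))
      γE = expr (λ a b e q s s′ E₁ E₅ → tE a b ⊠ e ⊡ 2 ⊠ L₁E (pE a b e (q ⊠ a)) (p′E a b e (q ⊠ a)) b (q ⊠ a))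
      δE = expr (λ a b e q s s′ E₁ E₅ → tE a b ⊠ e ⊡ 2 ⊠ L₂E (pE a b e (q ⊠ a)) (p′E a b e (q ⊠ a)) b (q ⊠ a))

      εζ : ℕ → K.Carrier
      εζ m = ε K.* ζ K.^ m

      -- Every summand becomes a series over Q times one of the constants on which `ψ` is known.
      spread : t * (t * (E₁ * E₅ * T₀′) - N * (e ^ 2 * (Ζ * L₁ + Ζ ^ 2 * L₂ - Ζ ^ 3 * L₂ - Ζ ^ 4 * L₁))) ≋
        ⟦ αE ⟧ ρK * cst (ζ K.^ 0) + (⟦ βE ⟧ ρK * cst (ζ K.^ 1) + (⟦ βE ⟧ ρK * cst (ζ K.^ 4) +
        (⟦ ⊖ γE ⟧ ρK * cst (εζ 1) + (⟦ ⊖ δE ⟧ ρK * cst (εζ 2) + (⟦ δE ⟧ ρK * cst (εζ 3) + ⟦ γE ⟧ ρK * cst (εζ 4))))))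
      spread = trans (solve 11 (λ t x y w n q a b e l m →
          t ⊠ (t ⊠ (x ⊠ y ⊠ (e ⊠ b ⊞ (w ⊞ w ⊡ 4) ⊠ q ⊠ (e ⊠ a))) ⊟ n ⊠ (e ⊡ 2 ⊠ (w ⊠ l ⊞ w ⊡ 2 ⊠ m ⊟ w ⊡ 3 ⊠ m ⊟ w ⊡ 4 ⊠ l))) ⊜
          t ⊡ 2 ⊠ x ⊠ y ⊠ (e ⊠ b) ⊠ w ⊡ 0 ⊞ (t ⊡ 2 ⊠ x ⊠ y ⊠ (q ⊠ (e ⊠ a)) ⊠ w ⊡ 1 ⊞ (t ⊡ 2 ⊠ x ⊠ y ⊠ (q ⊠ (e ⊠ a)) ⊠ w ⊡ 4 ⊞
          ((⊖ (t ⊠ e ⊡ 2 ⊠ l)) ⊠ (n ⊠ w ⊡ 1) ⊞ ((⊖ (t ⊠ e ⊡ 2 ⊠ m)) ⊠ (n ⊠ w ⊡ 2) ⊞ (t ⊠ e ⊡ 2 ⊠ m ⊠ (n ⊠ w ⊡ 3) ⊞ t ⊠ e ⊡ 2 ⊠ l ⊠ (n ⊠ w ⊡ 4))))))) ≡.refl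
          t E₁ E₅ Ζ N q a b e L₁ L₂)
        (sym (+-cong (*-congˡ (C.hom-^ ζ 0)) (+-cong (*-congˡ (C.hom-^ ζ 1)) (+-cong (*-congˡ (C.hom-^ ζ 4))
          (+-cong (*-congˡ (ce 1)) (+-cong (*-congˡ (ce 2)) (+-cong (*-congˡ (ce 3)) (*-congˡ (ce 4)))))))))
        where
        ce : ∀ m → cst (εζ m) ≋ N * Ζ ^ m
        ce m = trans (C.hom-* _ _) (*-congˡ (C.hom-^ ζ m))

      Ψ-ζ : ∀ f m → Ψ (⟦ f ⟧ ρK * cst (ζ K.^ m)) SQ.≋ SQ.0#
      Ψ-ζ f m = SQ.trans (Ψ-⟦⟧ f _) (SQ.trans (SQ.*-congˡ (SQ.trans (SQ.cst-cong (ψ-ζ m)) (RingHom.hom-0 UQ.cstHom))) (SQ.zeroʳ _))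

      Ψ-εζ : ∀ f m → Ψ (⟦ f ⟧ ρK * cst (εζ m)) SQ.≋ SQ.⟦ f ⟧ ρQ SQ.* SQ.⟪ weight m ⟫
      Ψ-εζ f m = SQ.trans (Ψ-⟦⟧ f _) (SQ.*-congˡ (SQ.trans (SQ.cst-cong (ψ-εζ m)) (RingHom.hom-⟪⟫ UQ.cstHom (weight m))))

    -- The ε-free part disappears. The numbers 2 and 6 are the differences of the weights of 1 and 4
    -- and of 2 and 3.
    Ψ-formula : SQ.⟦ lhsE ⟧ ρQ SQ.* Ψ F SQ.≋ SQ.⟦ ⊖ (con (+ 2) ⊠ γE ⊞ con (+ 6) ⊠ δE) ⟧ ρQ
    Ψ-formula = SQ.trans (SQ.sym (SQ.trans (Ψ-cong (*-congʳ (sym (transfer lhsE)))) (Ψ-map (SQ.⟦ lhsE ⟧ ρQ) F)))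
      (SQ.trans (Ψ-cong (trans F-formula spread))
      (SQ.trans (Ψ-+ _ _) (SQ.trans (SQ.+-cong (Ψ-ζ αE 0) (SQ.trans (Ψ-+ _ _) (SQ.+-cong (Ψ-ζ βE 1) (SQ.trans (Ψ-+ _ _) (SQ.+-cong (Ψ-ζ βE 4)
        (SQ.trans (Ψ-+ _ _) (SQ.+-cong (SQ.trans (Ψ-εζ (⊖ γE) 1) (SQ.*-congˡ SQ.⟪1⟫)) (SQ.trans (Ψ-+ _ _) (SQ.+-cong (Ψ-εζ (⊖ δE) 2) (SQ.trans (Ψ-+ _ _) (SQ.+-cong (Ψ-εζ δE 3) (Ψ-εζ γE 4))))))))))))
      (SQ.solve 2 (λ g d → con (+ 0) ⊞ (con (+ 0) ⊞ (con (+ 0) ⊞ ((⊖ g) ⊠ con (+ 1) ⊞ ((⊖ d) ⊠ con (+ 3) ⊞ (d ⊠ con -[1+ 2 ] ⊞ g ⊠ con -[1+ 0 ]))))) ⊜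
        ⊖ (con (+ 2) ⊠ g ⊞ con (+ 6) ⊠ d)) ≡.refl (SQ.⟦ γE ⟧ ρQ) (SQ.⟦ δE ⟧ ρQ)))))

-- Generating functions of partitions and coloured partitions

module ListSum (R : CommutativeRing 0ℓ 0ℓ) where
  open RingKit R
  open import Relation.Binary.Reasoning.Setoid setoid

  sumL : {A : Set} → (A → Carrier) → List A → Carrier
  sumL f xs = L.foldr _+_ 0# (L.map f xs)

  sumL-cong : {A : Set} {f g : A → Carrier} → (∀ x → f x ≈ g x) → ∀ xs → sumL f xs ≈ sumL g xs
  sumL-cong h [] = refl
  sumL-cong h (x ∷ xs) = +-cong (h x) (sumL-cong h xs)

  sumL-++ : {A : Set} (f : A → Carrier) → ∀ xs ys → sumL f (xs ++ ys) ≈ sumL f xs + sumL f ys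
  sumL-++ f [] ys = sym (+-identityˡ _)
  sumL-++ f (x ∷ xs) ys = trans (+-congˡ (sumL-++ f xs ys)) (sym (+-assoc _ _ _))

  sumL-concatMap : {A B : Set} (f : B → Carrier) (g : A → List B) → ∀ xs →
                   sumL f (concatMap g xs) ≈ sumL (λ x → sumL f (g x)) xs
  sumL-concatMap f g [] = refl
  sumL-concatMap f g (x ∷ xs) = trans (sumL-++ f (g x) (concatMap g xs)) (+-congˡ (sumL-concatMap f g xs))

  sumL-map : {A B : Set} (f : B → Carrier) (g : A → B) → ∀ xs → sumL f (L.map g xs) ≈ sumL (f ∘ g) xs
  sumL-map f g [] = refl
  sumL-map f g (x ∷ xs) = +-congˡ (sumL-map f g xs)

  sumL-*ˡ : {A : Set} (c : Carrier) (f : A → Carrier) → ∀ xs → sumL (λ x → c * f x) xs ≈ c * sumL f xs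
  sumL-*ˡ c f [] = sym (zeroʳ c)
  sumL-*ˡ c f (x ∷ xs) = trans (+-congˡ (sumL-*ˡ c f xs)) (sym (distribˡ _ _ _))

  sumL-*ʳ : {A : Set} (c : Carrier) (f : A → Carrier) → ∀ xs → sumL (λ x → f x * c) xs ≈ sumL f xs * c
  sumL-*ʳ c f xs = trans (sumL-cong (λ x → *-comm _ _) xs) (trans (sumL-*ˡ c f xs) (*-comm _ _))

  sumL-+ : {A : Set} (f g : A → Carrier) → ∀ xs → sumL (λ x → f x + g x) xs ≈ sumL f xs + sumL g xs
  sumL-+ f g [] = sym (+-identityˡ _)
  sumL-+ f g (x ∷ xs) = trans (+-congˡ (sumL-+ f g xs))
    (solve 4 (λ a b c d → (a ⊞ b) ⊞ (c ⊞ d) ⊜ (a ⊞ c) ⊞ (b ⊞ d)) ≡.refl _ _ _ _)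

upTo-suc : ∀ n → upTo (suc n) ≡ upTo n ++ L.[ n ]
upTo-suc n = ≡.sym (Lₚ.upTo-∷ʳ n)

partsBounded-fuel : ∀ f g n b → n ℕ.≤ f → n ℕ.≤ g → D.partsBounded f n b ≡ D.partsBounded g n b
partsBounded-fuel f g zero b p q = ≡.refl
partsBounded-fuel (suc f) (suc g) (suc n) b (s≤s p) (s≤s q) =
  Lₚ.concatMap-cong (λ i → ≡.cong (L.map (suc i ∷_))
    (partsBounded-fuel f g (n ℕ.∸ i) (suc i) (ℕₚ.≤-trans (ℕₚ.m∸n≤m n i) p) (ℕₚ.≤-trans (ℕₚ.m∸n≤m n i) q))) (upTo (suc n ℕ.⊓ b))

module PartitionSeries (K : CommutativeRing 0ℓ 0ℓ) where
  open Series K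
  open ListSum K

  bounded : K.Carrier → ℕ → S
  bounded c b n = sumL (λ p → c K.^ length p) (D.partsBounded n n b)

  opaque
    partitionSeries : K.Carrier → S
    partitionSeries c n = sumL (λ p → c K.^ length p) (D.partitions n)

  private
    open import Relation.Binary.Reasoning.Setoid K.setoid

    block : K.Carrier → ℕ → ℕ → K.Carrier
    block c n i = sumL (λ p → c K.^ length p) (L.map (suc i ∷_) (D.partsBounded n (n ℕ.∸ i) (suc i)))

    block≈ : ∀ c n i → block c n i K.≈ c K.* bounded c (suc i) (n ℕ.∸ i)
    block≈ c n i = K.trans (sumL-map _ (suc i ∷_) (D.partsBounded n (n ℕ.∸ i) (suc i)))
      (K.trans (sumL-*ˡ c (λ p → c K.^ length p) (D.partsBounded n (n ℕ.∸ i) (suc i)))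
        (K.*-congˡ (K.reflexive (≡.cong (sumL (λ p → c K.^ length p)) (partsBounded-fuel n (n ℕ.∸ i) (n ℕ.∸ i) (suc i) (ℕₚ.m∸n≤m n i) ℕₚ.≤-refl)))))

    bounded-suc : ∀ c b n → bounded c b (suc n) K.≈ sumL (block c n) (upTo (suc n ℕ.⊓ b))
    bounded-suc c b n = sumL-concatMap (λ p → c K.^ length p) (λ i → L.map (suc i ∷_) (D.partsBounded n (n ℕ.∸ i) (suc i))) (upTo (suc n ℕ.⊓ b))

  -- A partition with parts at most b + 1 either has no part b + 1 or starts with one, whose removal
  -- leaves a partition with the same bound. For total n + 1 ≤ b the second kind does not occur, and
  -- the minimum in the enumeration hides the bound.
  bounded-recurrence : ∀ c b → bounded c (suc b) ≋ bounded c b + mono c (suc b) * bounded c (suc b)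
  bounded-recurrence c b = ⟨ go ⟩
    where
    go : ∀ n → bounded c (suc b) n K.≈ bounded c b n K.+ (mono c (suc b) * bounded c (suc b)) n
    go zero = K.sym (K.trans (K.+-congˡ (Substitution.mono-before K c (suc b) (bounded c (suc b)) 0 (s≤s z≤n))) (K.+-identityʳ _))
    go (suc n) with ℕₚ.≤-<-connex b n
    ... | inj₁ b≤n = begin
      bounded c (suc b) (suc n)
        ≈⟨ bounded-suc c (suc b) n ⟩
      sumL (block c n) (upTo (suc (n ℕ.⊓ b)))
        ≡⟨ ≡.cong (λ m → sumL (block c n) (upTo (suc m))) (ℕₚ.m≥n⇒m⊓n≡n b≤n) ⟩
      sumL (block c n) (upTo (suc b))
        ≡⟨ ≡.cong (sumL (block c n)) (upTo-suc b) ⟩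
      sumL (block c n) (upTo b ++ L.[ b ])
        ≈⟨ K.trans (sumL-++ (block c n) (upTo b) L.[ b ]) (K.+-congˡ (K.+-identityʳ _)) ⟩
      sumL (block c n) (upTo b) K.+ block c n b
        ≡⟨ ≡.cong (λ m → sumL (block c n) (upTo m) K.+ block c n b) (ℕₚ.m≥n⇒m⊓n≡n (ℕₚ.≤-trans b≤n (ℕₚ.n≤1+n n))) ⟨
      sumL (block c n) (upTo (suc n ℕ.⊓ b)) K.+ block c n b
        ≈⟨ K.+-cong (K.sym (bounded-suc c b n)) (K.trans (block≈ c n b) (K.sym (mono-shift c (suc b) (bounded c (suc b)) (n ℕ.∸ b)))) ⟩
      bounded c b (suc n) K.+ (mono c (suc b) * bounded c (suc b)) (suc b ℕ.+ (n ℕ.∸ b))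
        ≡⟨ ≡.cong (λ m → bounded c b (suc n) K.+ (mono c (suc b) * bounded c (suc b)) (suc m)) (ℕₚ.m+[n∸m]≡n b≤n) ⟩
      bounded c b (suc n) K.+ (mono c (suc b) * bounded c (suc b)) (suc n) ∎
    ... | inj₂ n<b = begin
      bounded c (suc b) (suc n)
        ≈⟨ bounded-suc c (suc b) n ⟩
      sumL (block c n) (upTo (suc (n ℕ.⊓ b)))
        ≡⟨ ≡.cong (λ m → sumL (block c n) (upTo m)) (≡.trans (≡.cong suc (ℕₚ.m≤n⇒m⊓n≡m (ℕₚ.<⇒≤ n<b))) (≡.sym (ℕₚ.m≤n⇒m⊓n≡m n<b))) ⟩
      sumL (block c n) (upTo (suc n ℕ.⊓ b))
        ≈⟨ bounded-suc c b n ⟨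
      bounded c b (suc n)
        ≈⟨ K.trans (K.+-congˡ (Substitution.mono-before K c (suc b) (bounded c (suc b)) (suc n) (s≤s n<b))) (K.+-identityʳ _) ⟨
      bounded c b (suc n) K.+ (mono c (suc b) * bounded c (suc b)) (suc n) ∎

  private
    bounded-0 : ∀ c → bounded c 0 ≋ 1#
    bounded-0 c = ⟨ (λ { zero → K.+-identityʳ _ ; (suc n) → K.refl }) ⟩

    pochTo-bounded : ∀ c b → pochTo c 1 1 b * bounded c b ≋ 1#
    pochTo-bounded c zero = trans (*-identityˡ _) (bounded-0 c)
    pochTo-bounded c (suc b) = trans (*-assoc _ _ _) (trans (*-congˡ step) (pochTo-bounded c b))
      where
      step : (1# - mono c (1 ℕ.+ 1 ℕ.* b)) * bounded c (suc b) ≋ bounded c b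
      step = trans (*-congʳ (+-congˡ (-‿cong (mono-cong K.refl (≡.cong suc (ℕₚ.*-identityˡ b))))))
        (trans (solve 2 (λ m x → (con (+ 1) ⊟ m) ⊠ x ⊜ x ⊟ m ⊠ x) ≡.refl _ _)
        (trans (+-congʳ (bounded-recurrence c b)) (solve 2 (λ x y → x ⊞ y ⊟ y ⊜ x) ≡.refl _ _)))

    opaque
      unfolding partitionSeries
      bounded-limit : ∀ c b → bounded c b ≋[ b ] partitionSeries c
      bounded-limit c b = ⟨ go ⟩
        where
        go : ∀ n → n ℕ.< b → bounded c b n K.≈ partitionSeries c n
        go zero h = K.refl
        go (suc n) h = K.trans (bounded-suc c b n) (K.trans (K.reflexive (≡.cong (λ m → sumL (block c n) (upTo m))
          (≡.trans (ℕₚ.m≤n⇒m⊓n≡m (ℕₚ.<⇒≤ h)) (≡.sym (ℕₚ.⊓-idem (suc n)))))) (K.sym (bounded-suc c (suc n) n)))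

  partitionSeries-inverse : ∀ c → poch c 1 1 * partitionSeries c ≋ 1#
  partitionSeries-inverse c = limit-unique (λ M → pochTo c 1 1 M * bounded c M)
    (λ M → mod-* (pochTo-limit c 1 1 M (s≤s z≤n)) (bounded-limit c M))
    (λ M → mod-≈ (pochTo-bounded c M))

  colourWeight : ∀ {k} → Vec K.Carrier k → Vec (List ℕ) k → K.Carrier
  colourWeight [] [] = K.1#
  colourWeight (c ∷ cs) (p ∷ ps) = c K.^ length p K.* colourWeight cs ps

  opaque
    colouredSeries : ∀ {k} → Vec K.Carrier k → S
    colouredSeries {k} cs n = sumL (colourWeight cs) (D.coloredPartitions k n)

    colouredSeries-coefficient : ∀ {k} (cs : Vec K.Carrier k) n → colouredSeries cs n ≡ sumL (colourWeight cs) (D.coloredPartitions k n)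
    colouredSeries-coefficient cs n = ≡.refl

  opaque
    unfolding partitionSeries colouredSeries
    colouredSeries-[] : colouredSeries [] ≋ 1#
    colouredSeries-[] = ⟨ (λ { zero → K.+-identityʳ _ ; (suc n) → K.refl }) ⟩

    colouredSeries-∷ : ∀ {k} c (cs : Vec K.Carrier k) → colouredSeries (c ∷ cs) ≋ partitionSeries c * colouredSeries cs
    colouredSeries-∷ {k} c cs = ⟨ go ⟩
      where
      go : ∀ n → colouredSeries (c ∷ cs) n K.≈ (partitionSeries c * colouredSeries cs) n
      go n = K.trans (sumL-concatMap (colourWeight (c ∷ cs)) (λ i → concatMap (λ p → L.map (p ∷_) (D.coloredPartitions k (n ℕ.∸ i))) (D.partitions i)) (upTo (suc n)))
        (K.trans (sumL-cong (λ i → K.trans (sumL-concatMap (colourWeight (c ∷ cs)) (λ p → L.map (p ∷_) (D.coloredPartitions k (n ℕ.∸ i))) (D.partitions i))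
          (K.trans (sumL-cong (λ p → K.trans (sumL-map (colourWeight (c ∷ cs)) (p ∷_) (D.coloredPartitions k (n ℕ.∸ i)))
              (sumL-*ˡ (c K.^ length p) (colourWeight cs) (D.coloredPartitions k (n ℕ.∸ i)))) (D.partitions i))
            (sumL-*ʳ (colouredSeries cs (n ℕ.∸ i)) (λ p → c K.^ length p) (D.partitions i)))) (upTo (suc n)))
        (sum-upTo (λ i j → partitionSeries c i K.* colouredSeries cs j) n))

  fiveColours : K.Carrier → K.Carrier → S
  fiveColours x y = colouredSeries (x ∷ y ∷ K.1# ∷ K.1# ∷ K.1# ∷ [])

  fiveColours-product : ∀ x y → fiveColours x y ≋ partitionSeries x * (partitionSeries y * partitionSeries K.1# ^ 3)
  fiveColours-product x y = trans (colouredSeries-∷ x _) (*-congˡ (trans (colouredSeries-∷ y _) (*-congˡ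
    (trans (colouredSeries-∷ _ _) (*-congˡ (trans (colouredSeries-∷ _ _) (*-congˡ (trans (colouredSeries-∷ _ _) (*-congˡ colouredSeries-[])))))))))

  fiveColours-comm : ∀ x y → fiveColours x y ≋ fiveColours y x
  fiveColours-comm x y = trans (fiveColours-product x y) (trans
    (solve 3 (λ a b c → a ⊠ (b ⊠ c) ⊜ b ⊠ (a ⊠ c)) ≡.refl _ _ _) (sym (fiveColours-product y x)))

  -- The three unmarked colours contribute E₁³, of which one factor belongs to T; the grouping is
  -- the one assumed for F in `CrankGeneratingFunction`.
  fiveColours-inverse : ∀ x y → fiveColours x y * (poch K.1# 1 1 ^ 2 * (poch K.1# 1 1 * (poch x 1 1 * poch y 1 1))) ≋ 1#
  fiveColours-inverse x y = trans (*-congʳ (fiveColours-product x y)) (trans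
      (solve 6 (λ a b c a′ b′ c′ → a ⊠ (b ⊠ c ⊡ 3) ⊠ (c′ ⊡ 2 ⊠ (c′ ⊠ (a′ ⊠ b′))) ⊜ (a′ ⊠ a) ⊠ (b′ ⊠ b) ⊠ (c′ ⊠ c) ⊡ 3) ≡.refl _ _ _ _ _ _)
      (trans (*-cong (*-cong (partitionSeries-inverse x) (partitionSeries-inverse y)) (^-congˡ 3 (partitionSeries-inverse K.1#)))
        (solve 0 (con (+ 1) ⊠ con (+ 1) ⊠ con (+ 1) ⊡ 3 ⊜ con (+ 1)) ≡.refl)))

-- Oddness of the weight, and crank moments as coefficients of the generating function

weight-shift : ∀ j m → weight (j ℕ.* 5 ℕ.+ m) ≡ weight m
weight-shift zero m = ≡.refl
weight-shift (suc j) m = weight-shift j m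

weight-4* : ∀ k → weight (4 ℕ.* k) ≡ ℤ.- weight k
weight-4* 0 = ≡.refl
weight-4* 1 = ≡.refl
weight-4* 2 = ≡.refl
weight-4* 3 = ≡.refl
weight-4* 4 = ≡.refl
weight-4* (suc (suc (suc (suc (suc k))))) = ≡.trans (≡.cong weight (ℕₚ.*-distribˡ-+ 4 5 k)) (weight-4* k)

-- Modulo 5 the factor 4 is -1, so 4a + b and 4(a + 4b) agree and the sign comes from `weight-4*`.
weight-odd : ∀ a b → weight (4 ℕ.* a ℕ.+ 1 ℕ.* b) ≡ ℤ.- weight (1 ℕ.* a ℕ.+ 4 ℕ.* b)
weight-odd a b = ≡.trans (≡.sym (weight-shift (3 ℕ.* b) (4 ℕ.* a ℕ.+ 1 ℕ.* b)))
  (≡.trans (≡.cong weight (ex a b)) (weight-4* (1 ℕ.* a ℕ.+ 4 ℕ.* b)))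
  where
  module ℕS = Data.Nat.Solver.+-*-Solver
  ex : ∀ a b → 3 ℕ.* b ℕ.* 5 ℕ.+ (4 ℕ.* a ℕ.+ 1 ℕ.* b) ≡ 4 ℕ.* (1 ℕ.* a ℕ.+ 4 ℕ.* b)
  ex = ℕS.solve 2 (λ a b → ℕS.con 3 ℕS.:* b ℕS.:* ℕS.con 5 ℕS.:+ (ℕS.con 4 ℕS.:* a ℕS.:+ ℕS.con 1 ℕS.:* b) ℕS.:=
    ℕS.con 4 ℕS.:* (ℕS.con 1 ℕS.:* a ℕS.:+ ℕS.con 4 ℕS.:* b)) ≡.refl

firstLength secondLength : Vec (List ℕ) 5 → ℕ
firstLength (p ∷ _) = length p
secondLength (_ ∷ p ∷ _) = length p

-- The 4 stands for -1 modulo 5: it keeps the argument natural and equals the exponent of ζ in x′ =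
-- ζ⁴(1 - ε).
crankWeight : Vec (List ℕ) 5 → ℤ
crankWeight π = weight (1 ℕ.* firstLength π ℕ.+ 4 ℕ.* secondLength π)

module CrankMoments {Q : CommutativeRing 0ℓ 0ℓ} (M : CrankAlgebra Q) where
  open CrankAlgebra M
  open CrankSeries M
  open CrankGeneratingFunction M
  open PartitionSeries K
  private
    module Q = RingKit Q
    module K = RingKit K
    module ι = RingHom ι
    module LQ = ListSum Q
    module LK = ListSum K
    open K using (_≈_; _+_; _*_; _-_; -_; _^_; 1#; ⟪_⟫)

  moment : SQ.S
  moment n = LQ.sumL (λ π → Q.⟪ + firstLength π ⟫ Q.* Q.⟪ crankWeight π ⟫) (D.coloredPartitions 5 n)

  private
    -- These elements multiply by adding both indices. Hence the weight of a coloured partition is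
    -- again some u m i, and ψ returns i times the weight of m.
    u : ℕ → ℤ → K.Carrier
    u m i = ζ ^ m * (1# + ⟪ i ⟫ * ε)

    u-cong : ∀ {m m′ i i′} → m ≡ m′ → i ≡ i′ → u m i ≈ u m′ i′
    u-cong ≡.refl ≡.refl = K.refl

    u-* : ∀ m m′ i i′ → u m i * u m′ i′ ≈ u (m ℕ.+ m′) (i ℤ.+ i′)
    u-* m m′ i i′ = K.trans (K.modulo (ζ ^ m * ζ ^ m′ * ⟪ i ⟫ * ⟪ i′ ⟫) ε²≈0
      (K.solve 5 (λ z z′ i i′ e → z ⊠ (con (+ 1) ⊞ i ⊠ e) ⊠ (z′ ⊠ (con (+ 1) ⊞ i′ ⊠ e)) ⊜
        z ⊠ z′ ⊠ (con (+ 1) ⊞ (i ⊞ i′) ⊠ e) ⊞ e ⊠ e ⊠ (z ⊠ z′ ⊠ i ⊠ i′)) ≡.refl (ζ ^ m) (ζ ^ m′) ⟪ i ⟫ ⟪ i′ ⟫ ε))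
      (K.*-cong (K.sym (K.^-homo-* ζ m m′)) (K.+-congˡ (K.*-congʳ (K.sym (K.⟪⟫-+ i i′)))))

    u-1 : 1# ≈ u 0 (+ 0)
    u-1 = K.sym (K.trans (K.*-identityˡ _) (K.trans (K.+-congˡ (K.zeroˡ ε)) (K.+-identityʳ _)))

    u-^ : ∀ m i n → u m i ^ n ≈ u (m ℕ.* n) (i ℤ.* + n)
    u-^ m i zero = K.trans u-1 (u-cong (≡.sym (ℕₚ.*-zeroʳ m)) (≡.sym (ℤₚ.*-zeroʳ i)))
    u-^ m i (suc n) = K.trans (K.*-congˡ (u-^ m i n)) (K.trans (u-* m (m ℕ.* n) i (i ℤ.* + n))
      (u-cong (≡.sym (ℕₚ.*-suc m n)) (≡.sym (ℤₚ.*-suc i (+ n)))))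

    ψ-u : ∀ m i → ψ (u m i) Q.≈ Q.⟪ i ⟫ Q.* Q.⟪ weight m ⟫
    ψ-u m i = begin
      ψ (u m i)
        ≈⟨ ψ-cong (K.trans (K.solve 3 (λ z i e → z ⊠ (con (+ 1) ⊞ i ⊠ e) ⊜ z ⊞ i ⊠ (e ⊠ z)) ≡.refl _ _ _)
             (K.+-congˡ (K.*-congʳ (K.sym (ι.hom-⟪⟫ i))))) ⟩
      ψ (ζ ^ m + ι.fun Q.⟪ i ⟫ * (ε * ζ ^ m))
        ≈⟨ Q.trans (ψ-+ _ _) (Q.+-cong (ψ-ζ m) (Q.trans (ψ-ι _ _) (Q.*-congˡ (ψ-εζ m)))) ⟩
      Q.0# Q.+ Q.⟪ i ⟫ Q.* Q.⟪ weight m ⟫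
        ≈⟨ Q.+-identityˡ _ ⟩
      Q.⟪ i ⟫ Q.* Q.⟪ weight m ⟫ ∎
      where open import Relation.Binary.Reasoning.Setoid Q.setoid

    statistic : ℕ → ℤ → ℕ → ℤ → Vec (List ℕ) 5 → Q.Carrier
    statistic m i m′ i′ π = Q.⟪ i ℤ.* + firstLength π ℤ.+ i′ ℤ.* + secondLength π ⟫ Q.*
      Q.⟪ weight (m ℕ.* firstLength π ℕ.+ m′ ℕ.* secondLength π) ⟫

    ψ-sum : ∀ {A : Set} (f : A → K.Carrier) xs → ψ (LK.sumL f xs) Q.≈ LQ.sumL (λ x → ψ (f x)) xs
    ψ-sum f [] = ψ-0
    ψ-sum f (x ∷ xs) = Q.trans (ψ-+ _ _) (Q.+-congˡ (ψ-sum f xs))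

    one^ : ∀ n → 1# ^ n ≈ 1#
    one^ = TripleProduct.one^ K

    ψ-fiveColours : ∀ m i m′ i′ x y → x ≈ u m i → y ≈ u m′ i′ → ∀ n →
      Ψ (fiveColours x y) n Q.≈ LQ.sumL (statistic m i m′ i′) (D.coloredPartitions 5 n)
    ψ-fiveColours m i m′ i′ x y hx hy n = Q.trans (ψ-cong (K.reflexive (colouredSeries-coefficient (x ∷ y ∷ 1# ∷ 1# ∷ 1# ∷ []) n)))
      (Q.trans (ψ-sum (colourWeight (x ∷ y ∷ 1# ∷ 1# ∷ 1# ∷ [])) (D.coloredPartitions 5 n)) (LQ.sumL-cong each (D.coloredPartitions 5 n)))
      where
      each : ∀ π → ψ (colourWeight (x ∷ y ∷ 1# ∷ 1# ∷ 1# ∷ []) π) Q.≈ statistic m i m′ i′ π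
      each (p ∷ p′ ∷ p₃ ∷ p₄ ∷ p₅ ∷ []) = Q.trans (ψ-cong (K.trans
        (K.*-cong (K.trans (K.^-congˡ (length p) hx) (u-^ m i (length p)))
          (K.trans (K.*-cong (K.trans (K.^-congˡ (length p′) hy) (u-^ m′ i′ (length p′)))
            (K.trans (K.*-cong (one^ (length p₃)) (K.*-cong (one^ (length p₄)) (K.*-congʳ (one^ (length p₅)))))
              (K.solve 0 (con (+ 1) ⊠ (con (+ 1) ⊠ (con (+ 1) ⊠ con (+ 1))) ⊜ con (+ 1)) ≡.refl))) (K.*-identityʳ _)))
        (u-* (m ℕ.* length p) (m′ ℕ.* length p′) (i ℤ.* + length p) (i′ ℤ.* + length p′))))
        (ψ-u (m ℕ.* length p ℕ.+ m′ ℕ.* length p′) (i ℤ.* + length p ℤ.+ i′ ℤ.* + length p′))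

    ψ-resp : ∀ {f g} → Series._≋_ K f g → ∀ n → Ψ f n Q.≈ Ψ g n
    ψ-resp p n = SQ.at (Ψ-cong p) n

  x x′ : K.Carrier
  x = ζ * (1# + ε)
  x′ = ζ ^ 4 * (1# - ε)

  private
    x≈u : x ≈ u 1 (+ 1)
    x≈u = K.*-cong (K.sym (K.*-identityʳ ζ)) (K.+-congˡ (K.sym (K.trans (K.*-congʳ K.⟪1⟫) (K.*-identityˡ ε))))

    x′≈u : x′ ≈ u 4 -[1+ 0 ]
    x′≈u = K.*-congˡ (K.+-congˡ (K.sym (K.trans (K.*-congʳ (K.-‿cong K.⟪1⟫)) (K.trans (K.sym (K.-‿distribˡ-* _ _)) (K.-‿cong (K.*-identityˡ ε))))))

    second : SQ.S
    second n = LQ.sumL (statistic 1 (+ 0) 4 -[1+ 0 ]) (D.coloredPartitions 5 n)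

    -- Exchanging the first two colours turns -#(π²) into -#(π¹) and negates the crank; by oddness
    -- the two signs cancel. The exchange is commutativity of a product of series, so no bijection
    -- of lists is constructed.
    second≈moment : ∀ n → second n Q.≈ moment n
    second≈moment n = begin
      second n
        ≈⟨ ψ-fiveColours 1 (+ 0) 4 -[1+ 0 ] (u 1 (+ 0)) x′ K.refl x′≈u n ⟨
      Ψ (fiveColours (u 1 (+ 0)) x′) n
        ≈⟨ ψ-resp (fiveColours-comm (u 1 (+ 0)) x′) n ⟩
      Ψ (fiveColours x′ (u 1 (+ 0))) n
        ≈⟨ ψ-fiveColours 4 -[1+ 0 ] 1 (+ 0) x′ (u 1 (+ 0)) x′≈u K.refl n ⟩
      LQ.sumL (statistic 4 -[1+ 0 ] 1 (+ 0)) (D.coloredPartitions 5 n)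
        ≈⟨ LQ.sumL-cong flip (D.coloredPartitions 5 n) ⟩
      moment n ∎
      where
      open import Relation.Binary.Reasoning.Setoid Q.setoid
      flip : ∀ π → statistic 4 -[1+ 0 ] 1 (+ 0) π Q.≈ Q.⟪ + firstLength π ⟫ Q.* Q.⟪ crankWeight π ⟫
      flip π = Q.trans (Q.*-cong
          (Q.trans (Q.reflexive (≡.cong Q.⟪_⟫ (≡.trans (≡.cong₂ ℤ._+_ (ℤₚ.-1*i≡-i (+ firstLength π)) (ℤₚ.*-zeroˡ (+ secondLength π))) (ℤₚ.+-identityʳ (ℤ.- (+ firstLength π)))))) (Q.⟪⟫-neg (+ firstLength π)))
          (Q.trans (Q.reflexive (≡.cong Q.⟪_⟫ (weight-odd (firstLength π) (secondLength π)))) (Q.⟪⟫-neg (crankWeight π))))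
        (Q.solve 2 (λ a b → (⊖ a) ⊠ (⊖ b) ⊜ a ⊠ b) ≡.refl _ _)

  -- The ε-part carries the factor #(π¹) - #(π²); its two halves contribute equally.
  Ψ-fiveColours : Ψ (fiveColours x x′) SQ.≋ moment SQ.+ moment
  Ψ-fiveColours = SQ.⟨ (λ n → Q.trans (ψ-fiveColours 1 (+ 1) 4 -[1+ 0 ] x x′ x≈u x′≈u n)
    (Q.trans (LQ.sumL-cong split (D.coloredPartitions 5 n)) (Q.trans (LQ.sumL-+ _ _ (D.coloredPartitions 5 n)) (Q.+-congˡ (second≈moment n))))) ⟩
    where
    split : ∀ π → statistic 1 (+ 1) 4 -[1+ 0 ] π Q.≈ Q.⟪ + firstLength π ⟫ Q.* Q.⟪ crankWeight π ⟫ Q.+ statistic 1 (+ 0) 4 -[1+ 0 ] π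
    split π = Q.trans (Q.*-congʳ (Q.trans (Q.⟪⟫-+ (+ 1 ℤ.* + firstLength π) (-[1+ 0 ] ℤ.* + secondLength π)) (Q.+-cong (Q.reflexive (≡.cong Q.⟪_⟫ (ℤₚ.*-identityˡ (+ firstLength π))))
        (Q.reflexive (≡.cong Q.⟪_⟫ (≡.sym (ℤₚ.+-identityˡ (-[1+ 0 ] ℤ.* + secondLength π)))))))) (Q.distribʳ _ _ _)

  moment-formula = Ψ-formula (fiveColours x x′) (fiveColours-inverse x x′)

-- Construction of ℚ(ζ)[ε] by quadratic extensions

-- R[t] / (t² - r t + s)
module Quadratic (R : CommutativeRing 0ℓ 0ℓ) (r s : RingKit.Carrier R) where
  open RingKit R

  private
    Pair : Set
    Pair = Carrier × Carrier

    _≈₂_ : Pair → Pair → Set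
    (a , b) ≈₂ (c , d) = (a ≈ c) × (b ≈ d)

    _*₂_ : Pair → Pair → Pair
    (a , b) *₂ (c , d) = (a * c - s * (b * d)) , (a * d + b * c + r * (b * d))

    *₂-identityˡ : ∀ x → ((1# , 0#) *₂ x) ≈₂ x
    *₂-identityˡ (a , b) = solve 3 (λ s a b → con (+ 1) ⊠ a ⊟ s ⊠ (con (+ 0) ⊠ b) ⊜ a) ≡.refl s a b ,
      solve 3 (λ r a b → con (+ 1) ⊠ b ⊞ con (+ 0) ⊠ a ⊞ r ⊠ (con (+ 0) ⊠ b) ⊜ b) ≡.refl r a b

    *₂-comm : ∀ x y → (x *₂ y) ≈₂ (y *₂ x)
    *₂-comm (a , b) (c , d) = solve 5 (λ s a b c d → a ⊠ c ⊟ s ⊠ (b ⊠ d) ⊜ c ⊠ a ⊟ s ⊠ (d ⊠ b)) ≡.refl s a b c d ,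
      solve 5 (λ r a b c d → a ⊠ d ⊞ b ⊠ c ⊞ r ⊠ (b ⊠ d) ⊜ c ⊠ b ⊞ d ⊠ a ⊞ r ⊠ (d ⊠ b)) ≡.refl r a b c d

    *₂-assoc : ∀ x y z → ((x *₂ y) *₂ z) ≈₂ (x *₂ (y *₂ z))
    *₂-assoc (a , b) (c , d) (e , f) =
      solve 8 (λ r s a b c d e f →
        (a ⊠ c ⊟ s ⊠ (b ⊠ d)) ⊠ e ⊟ s ⊠ ((a ⊠ d ⊞ b ⊠ c ⊞ r ⊠ (b ⊠ d)) ⊠ f) ⊜
        a ⊠ (c ⊠ e ⊟ s ⊠ (d ⊠ f)) ⊟ s ⊠ (b ⊠ (c ⊠ f ⊞ d ⊠ e ⊞ r ⊠ (d ⊠ f)))) ≡.refl r s a b c d e f ,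
      solve 8 (λ r s a b c d e f →
        (a ⊠ c ⊟ s ⊠ (b ⊠ d)) ⊠ f ⊞ (a ⊠ d ⊞ b ⊠ c ⊞ r ⊠ (b ⊠ d)) ⊠ e ⊞ r ⊠ ((a ⊠ d ⊞ b ⊠ c ⊞ r ⊠ (b ⊠ d)) ⊠ f) ⊜
        a ⊠ (c ⊠ f ⊞ d ⊠ e ⊞ r ⊠ (d ⊠ f)) ⊞ b ⊠ (c ⊠ e ⊟ s ⊠ (d ⊠ f)) ⊞ r ⊠ (b ⊠ (c ⊠ f ⊞ d ⊠ e ⊞ r ⊠ (d ⊠ f)))) ≡.refl r s a b c d e f

    *₂-distribʳ : ∀ z x y → ((proj₁ x + proj₁ y , proj₂ x + proj₂ y) *₂ z) ≈₂
                  (proj₁ (x *₂ z) + proj₁ (y *₂ z) , proj₂ (x *₂ z) + proj₂ (y *₂ z))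
    *₂-distribʳ (e , f) (a , b) (c , d) =
      solve 7 (λ s a b c d e f → (a ⊞ c) ⊠ e ⊟ s ⊠ ((b ⊞ d) ⊠ f) ⊜ (a ⊠ e ⊟ s ⊠ (b ⊠ f)) ⊞ (c ⊠ e ⊟ s ⊠ (d ⊠ f))) ≡.refl s a b c d e f ,
      solve 7 (λ r a b c d e f → (a ⊞ c) ⊠ f ⊞ (b ⊞ d) ⊠ e ⊞ r ⊠ ((b ⊞ d) ⊠ f) ⊜
        (a ⊠ f ⊞ b ⊠ e ⊞ r ⊠ (b ⊠ f)) ⊞ (c ⊠ f ⊞ d ⊠ e ⊞ r ⊠ (d ⊠ f))) ≡.refl r a b c d e f

    trans₂ : ∀ {x y z} → x ≈₂ y → y ≈₂ z → x ≈₂ z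
    trans₂ (p , p′) (q , q′) = trans p q , trans p′ q′

    *₂-cong : ∀ {x y z w} → x ≈₂ y → z ≈₂ w → (x *₂ z) ≈₂ (y *₂ w)
    *₂-cong (p , p′) (q , q′) = +-cong (*-cong p q) (-‿cong (*-congˡ (*-cong p′ q′))) ,
      +-cong (+-cong (*-cong p q′) (*-cong p′ q)) (*-congˡ (*-cong p′ q′))

  extension : CommutativeRing 0ℓ 0ℓ
  extension = record
    { Carrier = Pair ; _≈_ = _≈₂_ ; _*_ = _*₂_ ; 0# = 0# , 0# ; 1# = 1# , 0#
    ; _+_ = λ { (a , b) (c , d) → (a + c) , (b + d) } ; -_ = λ { (a , b) → (- a) , (- b) }
    ; isCommutativeRing = record
      { isRing = record
        { +-isAbelianGroup = record
          { isGroup = record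
            { isMonoid = record
              { isSemigroup = record
                { isMagma = record
                  { isEquivalence = record { refl = refl , refl ; sym = λ { (p , q) → sym p , sym q } ; trans = trans₂ }
                  ; ∙-cong = λ { (p , q) (p′ , q′) → +-cong p p′ , +-cong q q′ } }
                ; assoc = λ x y z → +-assoc _ _ _ , +-assoc _ _ _ }
              ; identity = (λ x → +-identityˡ _ , +-identityˡ _) , (λ x → +-identityʳ _ , +-identityʳ _) }
            ; inverse = (λ x → -‿inverseˡ _ , -‿inverseˡ _) , (λ x → -‿inverseʳ _ , -‿inverseʳ _)
            ; ⁻¹-cong = λ { (p , q) → -‿cong p , -‿cong q } }
          ; comm = λ x y → +-comm _ _ , +-comm _ _ }
        ; *-cong = *₂-cong
        ; *-assoc = *₂-assoc
        ; *-identity = *₂-identityˡ , (λ x → trans₂ (*₂-comm x (1# , 0#)) (*₂-identityˡ x))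
        ; distrib = (λ z x y → trans₂ (*₂-comm z _) (trans₂ (*₂-distribʳ z x y)
              (+-cong (proj₁ (*₂-comm x z)) (proj₁ (*₂-comm y z)) , +-cong (proj₂ (*₂-comm x z)) (proj₂ (*₂-comm y z)))))
            , *₂-distribʳ }
      ; *-comm = *₂-comm } }

  embed-*₂ : ∀ c x → proj₂ ((c , 0#) *₂ x) ≈ c * proj₂ x
  embed-*₂ c (a , b) = solve 4 (λ r c a b → c ⊠ b ⊞ con (+ 0) ⊠ a ⊞ r ⊠ (con (+ 0) ⊠ b) ⊜ c ⊠ b) ≡.refl r c a b

  embedding : RingHom R extension
  embedding = record
    { fun = λ c → c , 0# ; hom-cong = λ p → p , refl ; hom-+ = λ x y → refl , sym (+-identityˡ 0#)
    ; hom-* = λ x y → solve 3 (λ s x y → x ⊠ y ⊜ x ⊠ y ⊟ s ⊠ (con (+ 0) ⊠ con (+ 0))) ≡.refl s x y ,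
        sym (trans (embed-*₂ x (y , 0#)) (zeroʳ x))
    ; hom-1 = refl , refl }

composeHom : ∀ {R S T : CommutativeRing 0ℓ 0ℓ} → RingHom S T → RingHom R S → RingHom R T
composeHom {T = T} g f = record
  { fun = λ x → g.fun (f.fun x) ; hom-cong = λ p → g.hom-cong (f.hom-cong p)
  ; hom-+ = λ x y → T.trans (g.hom-cong (f.hom-+ x y)) (g.hom-+ _ _)
  ; hom-* = λ x y → T.trans (g.hom-cong (f.hom-* x y)) (g.hom-* _ _)
  ; hom-1 = T.trans (g.hom-cong f.hom-1) g.hom-1 }
  where
  module f = RingHom f
  module g = RingHom g
  module T = RingKit T

-- The data before ε is adjoined: the functional is prescribed on five powers of ζ, and
-- `DualNumbers` applies it to the ε-component and extends the values by ζ⁵ = 1.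
record CyclotomicFunctional (R : CommutativeRing 0ℓ 0ℓ) : Set₁ where
  private module R = RingKit R
  field
    K₁ : CommutativeRing 0ℓ 0ℓ
    ι : RingHom R K₁
  private module K₁ = RingKit K₁
  open RingHom ι renaming (fun to ι⟨_⟩) using ()
  field
    ζ fifth : K₁.Carrier
    ζ-cyclotomic : Substitution.cyclotomic K₁ ζ K₁.≈ K₁.0#
    5*fifth : K₁.⟪ + 5 ⟫ K₁.* fifth K₁.≈ K₁.1#
    ψ : K₁.Carrier → R.Carrier
    ψ-cong : ∀ {x y} → x K₁.≈ y → ψ x R.≈ ψ y
    ψ-+ : ∀ x y → ψ (x K₁.+ y) R.≈ ψ x R.+ ψ y
    ψ-ι : ∀ c x → ψ (ι⟨ c ⟩ K₁.* x) R.≈ c R.* ψ x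
    ψ-ζ : ∀ k → k ℕ.< 5 → ψ (ζ K₁.^ k) R.≈ R.⟪ weight k ⟫

module DualNumbers {R : CommutativeRing 0ℓ 0ℓ} (F : CyclotomicFunctional R) where
  open CyclotomicFunctional F renaming (ψ to ψ₁; ψ-cong to ψ₁-cong; ψ-+ to ψ₁-+; ψ-ι to ψ₁-ι; ψ-ζ to ψ₁-ζ)
  private
    module R = RingKit R
    module K₁ = RingKit K₁
    module ι = RingHom ι

  private
    module Dual = Quadratic K₁ K₁.0# K₁.0#
    module K₂ = RingKit Dual.extension
    module E = RingHom Dual.embedding

    ψ₁-0 : ψ₁ K₁.0# R.≈ R.0#
    ψ₁-0 = R.trans (ψ₁-cong (K₁.sym (K₁.trans (K₁.*-congʳ ι.hom-0) (K₁.zeroˡ K₁.0#)))) (R.trans (ψ₁-ι R.0# K₁.0#) (R.zeroˡ _))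

    ζ⁵ : ζ K₁.^ 5 K₁.≈ K₁.1#
    ζ⁵ = K₁.modulo (ζ K₁.- K₁.1#) ζ-cyclotomic (K₁.solve 1 (λ w → w ⊡ 5 ⊜
      con (+ 1) ⊞ (con (+ 1) ⊞ w ⊞ w ⊡ 2 ⊞ w ⊡ 3 ⊞ w ⊡ 4) ⊠ (w ⊟ con (+ 1))) ≡.refl ζ)

    ψ₁-ζ′ : ∀ k → ψ₁ (ζ K₁.^ k) R.≈ R.⟪ weight k ⟫
    ψ₁-ζ′ 0 = ψ₁-ζ 0 (s≤s z≤n)
    ψ₁-ζ′ 1 = ψ₁-ζ 1 (s≤s (s≤s z≤n))
    ψ₁-ζ′ 2 = ψ₁-ζ 2 (s≤s (s≤s (s≤s z≤n)))
    ψ₁-ζ′ 3 = ψ₁-ζ 3 (s≤s (s≤s (s≤s (s≤s z≤n))))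
    ψ₁-ζ′ 4 = ψ₁-ζ 4 (s≤s (s≤s (s≤s (s≤s (s≤s z≤n)))))
    ψ₁-ζ′ (suc (suc (suc (suc (suc k))))) = R.trans
      (ψ₁-cong (K₁.trans (K₁.^-homo-* ζ 5 k) (K₁.trans (K₁.*-congʳ ζ⁵) (K₁.*-identityˡ _)))) (ψ₁-ζ′ k)

    ε : K₂.Carrier
    ε = K₁.0# , K₁.1#

    ζ₂^ : ∀ k → (E.fun ζ K₂.^ k) K₂.≈ E.fun (ζ K₁.^ k)
    ζ₂^ k = K₂.sym (E.hom-^ ζ k)

  crankAlgebra : CrankAlgebra R
  crankAlgebra = record
    { K = Dual.extension ; ι = composeHom Dual.embedding ι
    ; ζ = E.fun ζ ; ε = ε ; fifth = E.fun fifth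
    ; ζ-cyclotomic = K₂.trans (K₂.sym (K₂.trans (E.hom-⟦⟧ cyclotomicE (ζ ∷ [])) K₂.refl)) (E.hom-cong ζ-cyclotomic)
    ; ε²≈0 = K₁.solve 0 (con (+ 0) ⊠ con (+ 0) ⊟ con (+ 0) ⊠ (con (+ 1) ⊠ con (+ 1)) ⊜ con (+ 0)) ≡.refl ,
        K₁.solve 0 (con (+ 0) ⊠ con (+ 1) ⊞ con (+ 1) ⊠ con (+ 0) ⊞ con (+ 0) ⊠ (con (+ 1) ⊠ con (+ 1)) ⊜ con (+ 0)) ≡.refl
    ; 5*fifth = K₂.trans (K₂.*-congʳ (K₂.sym (E.hom-⟪⟫ (+ 5)))) (K₂.trans (K₂.sym (E.hom-* K₁.⟪ + 5 ⟫ fifth)) (K₂.trans (E.hom-cong 5*fifth) E.hom-1))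
    ; ψ = λ x → ψ₁ (proj₂ x) ; ψ-cong = λ p → ψ₁-cong (proj₂ p) ; ψ-+ = λ x y → ψ₁-+ (proj₂ x) (proj₂ y)
    ; ψ-ι = λ c x → R.trans (ψ₁-cong (Dual.embed-*₂ (ι.fun c) x)) (ψ₁-ι c (proj₂ x))
    ; ψ-ζ = λ k → R.trans (ψ₁-cong (proj₂ (ζ₂^ k))) ψ₁-0
    ; ψ-εζ = λ k → R.trans (ψ₁-cong (K₁.trans (proj₂ (K₂.trans (K₂.*-comm ε (E.fun ζ K₂.^ k)) (K₂.*-congʳ {x = ε} (ζ₂^ k))))
        (K₁.trans (Dual.embed-*₂ (ζ K₁.^ k) ε) (K₁.*-identityʳ _)))) (ψ₁-ζ′ k) }
    where
    cyclotomicE : Ex 1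
    cyclotomicE = (λ w → con (+ 1) ⊞ w ⊞ w ⊡ 2 ⊞ w ⊡ 3 ⊞ w ⊡ 4) (var zero)

-- R(ζ) as R(c)[ζ] with c = ζ + ζ⁻¹, c² = 1 - c and ζ² = c ζ - 1.
module CyclotomicField (R : CommutativeRing 0ℓ 0ℓ) where
  private
    module R = RingKit R
    module Real = Quadratic R (R.- R.1#) (R.- R.1#)
    module K₀ = RingKit Real.extension
    module Full = Quadratic Real.extension (R.0# , R.1#) (R.1# , R.0#)

  field₁ : CommutativeRing 0ℓ 0ℓ
  field₁ = Full.extension

  ι : RingHom R field₁
  ι = composeHom Full.embedding Real.embedding

  ζ : RingKit.Carrier field₁
  ζ = (R.0# , R.0#) , (R.1# , R.0#)

  -- Vanishing on R(c) makes the functional odd. On the multiples of ζ it sends ζ to 1 and cζ to 3,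
  -- because ζ² = cζ - 1 must get weight 3; ζ³ = -cζ - c and ζ⁴ = c - ζ then give -3 and -1.
  ψ : RingKit.Carrier field₁ → R.Carrier
  ψ (_ , (x , y)) = x R.+ R.⟪ + 3 ⟫ R.* y

  private module K₁ = RingKit field₁

  ψ-cong : ∀ {x y} → x K₁.≈ y → ψ x R.≈ ψ y
  ψ-cong (_ , (p , q)) = R.+-cong p (R.*-congˡ q)

  ψ-+ : ∀ x y → ψ (x K₁.+ y) R.≈ ψ x R.+ ψ y
  ψ-+ (_ , (a , b)) (_ , (c , d)) = R.solve 5 (λ t a b c d → a ⊞ c ⊞ t ⊠ (b ⊞ d) ⊜ (a ⊞ t ⊠ b) ⊞ (c ⊞ t ⊠ d)) ≡.refl R.⟪ + 3 ⟫ a b c d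

  ψ-ι : ∀ c x → ψ (RingHom.fun ι c K₁.* x) R.≈ c R.* ψ x
  ψ-ι c x@(_ , y@(a , b)) = R.trans
    (R.+-cong (R.trans (proj₁ (Full.embed-*₂ (c , R.0#) x)) (R.solve 3 (λ c a b → c ⊠ a ⊟ (⊖ con (+ 1)) ⊠ (con (+ 0) ⊠ b) ⊜ c ⊠ a) ≡.refl c a b))
      (R.*-congˡ (R.trans (proj₂ (Full.embed-*₂ (c , R.0#) x)) (Real.embed-*₂ c y))))
    (R.solve 4 (λ t c a b → c ⊠ a ⊞ t ⊠ (c ⊠ b) ⊜ c ⊠ (a ⊞ t ⊠ b)) ≡.refl R.⟪ + 3 ⟫ c a b)

ℚR : CommutativeRing 0ℓ 0ℓ
ℚR = ℚₚ.+-*-commutativeRing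

module ℚζ = CyclotomicField ℚR

rationalFunctional : CyclotomicFunctional ℚR
rationalFunctional = record
  { K₁ = ℚζ.field₁ ; ι = ℚζ.ι ; ζ = ℚζ.ζ ; fifth = RingHom.fun ℚζ.ι (+ 1 / 5)
  ; ζ-cyclotomic = (≡.refl , ≡.refl) , (≡.refl , ≡.refl)
  ; 5*fifth = (≡.refl , ≡.refl) , (≡.refl , ≡.refl)
  ; ψ = ℚζ.ψ ; ψ-cong = λ {x} {y} → ℚζ.ψ-cong {x} {y} ; ψ-+ = ℚζ.ψ-+ ; ψ-ι = ℚζ.ψ-ι
  ; ψ-ζ = λ { 0 _ → ≡.refl ; 1 _ → ≡.refl ; 2 _ → ≡.refl ; 3 _ → ≡.refl ; 4 _ → ≡.refl
            ; (suc (suc (suc (suc (suc k))))) (s≤s (s≤s (s≤s (s≤s (s≤s ()))))) } }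

rationalCrankAlgebra : CrankAlgebra ℚR
rationalCrankAlgebra = DualNumbers.crankAlgebra rationalFunctional

-- Univariate integer polynomials, their parts modulo 5, and homogenisation

-- Integer polynomials in one variable, lowest coefficient first.
addL mulL : List ℤ → List ℤ → List ℤ
addL [] q = q
addL (c ∷ p) [] = c ∷ p
addL (c ∷ p) (d ∷ q) = (c ℤ.+ d) ∷ addL p q
mulL [] q = []
mulL (c ∷ p) q = addL (L.map (c ℤ.*_) q) (+ 0 ∷ mulL p q)

-- The coefficients at the exponents ≡ r modulo 5, for r < 5.
part : ℕ → List ℤ → List ℤ
part r [] = []
part zero (c ∷ p) = c ∷ part 4 p
part (suc r) (c ∷ p) = part r p

module Univariate (R : CommutativeRing 0ℓ 0ℓ) where
  open RingKit R
  open import Relation.Binary.Reasoning.Setoid setoid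

  -- Defined through `con` so that evaluations of explicit lists unfold to the expressions that
  -- `solve` produces.
  coeff : ℤ → Carrier
  coeff c = ⟦ con {0} c ⟧ []

  coeff-+ : ∀ c d → coeff (c ℤ.+ d) ≈ coeff c + coeff d
  coeff-+ c d = trans (sym (con≈ {0} [] (c ℤ.+ d))) (trans (⟪⟫-+ c d) (+-cong (con≈ {0} [] c) (con≈ {0} [] d)))

  coeff-* : ∀ c d → coeff (c ℤ.* d) ≈ coeff c * coeff d
  coeff-* c d = trans (sym (con≈ {0} [] (c ℤ.* d))) (trans (⟪⟫-* c d) (*-cong (con≈ {0} [] c) (con≈ {0} [] d)))

  ev : List ℤ → Carrier → Carrier
  ev [] y = 0#
  ev (c ∷ p) y = coeff c + y * ev p y

  ev-add : ∀ p q y → ev (addL p q) y ≈ ev p y + ev q y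
  ev-add [] q y = sym (+-identityˡ _)
  ev-add (c ∷ p) [] y = sym (+-identityʳ _)
  ev-add (c ∷ p) (d ∷ q) y = trans (+-cong (coeff-+ c d) (*-congˡ (ev-add p q y)))
    (solve 5 (λ c d y a b → c ⊞ d ⊞ y ⊠ (a ⊞ b) ⊜ (c ⊞ y ⊠ a) ⊞ (d ⊞ y ⊠ b)) ≡.refl _ _ _ _ _)

  ev-scale : ∀ c p y → ev (L.map (c ℤ.*_) p) y ≈ coeff c * ev p y
  ev-scale c [] y = sym (zeroʳ _)
  ev-scale c (d ∷ p) y = trans (+-cong (coeff-* c d) (*-congˡ (ev-scale c p y)))
    (solve 4 (λ c d y a → c ⊠ d ⊞ y ⊠ (c ⊠ a) ⊜ c ⊠ (d ⊞ y ⊠ a)) ≡.refl _ _ _ _)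

  ev-mul : ∀ p q y → ev (mulL p q) y ≈ ev p y * ev q y
  ev-mul [] q y = sym (zeroˡ _)
  ev-mul (c ∷ p) q y = begin
    ev (addL (L.map (c ℤ.*_) q) (+ 0 ∷ mulL p q)) y
      ≈⟨ ev-add (L.map (c ℤ.*_) q) (+ 0 ∷ mulL p q) y ⟩
    ev (L.map (c ℤ.*_) q) y + (0# + y * ev (mulL p q) y)
      ≈⟨ +-cong (ev-scale c q y) (+-congˡ (*-congˡ (ev-mul p q y))) ⟩
    coeff c * ev q y + (0# + y * (ev p y * ev q y))
      ≈⟨ solve 4 (λ c y p q → c ⊠ q ⊞ (con (+ 0) ⊞ y ⊠ (p ⊠ q)) ⊜ (c ⊞ y ⊠ p) ⊠ q) ≡.refl _ _ _ _ ⟩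
    ev (c ∷ p) y * ev q y ∎

  ev-parts : ∀ p y → ev p y ≈ ev (part 0 p) (y ^ 5) + y * ev (part 1 p) (y ^ 5) + y ^ 2 * ev (part 2 p) (y ^ 5)
                              + y ^ 3 * ev (part 3 p) (y ^ 5) + y ^ 4 * ev (part 4 p) (y ^ 5)
  ev-parts [] y = solve 1 (λ y → con (+ 0) ⊜ con (+ 0) ⊞ y ⊠ con (+ 0) ⊞ y ⊡ 2 ⊠ con (+ 0) ⊞ y ⊡ 3 ⊠ con (+ 0) ⊞ y ⊡ 4 ⊠ con (+ 0)) ≡.refl y
  ev-parts (c ∷ p) y = trans (+-congˡ (*-congˡ (ev-parts p y)))
    (solve 7 (λ c y p₀ p₁ p₂ p₃ p₄ →
      c ⊞ y ⊠ (p₀ ⊞ y ⊠ p₁ ⊞ y ⊡ 2 ⊠ p₂ ⊞ y ⊡ 3 ⊠ p₃ ⊞ y ⊡ 4 ⊠ p₄) ⊜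
      (c ⊞ y ⊡ 5 ⊠ p₄) ⊞ y ⊠ p₀ ⊞ y ⊡ 2 ⊠ p₁ ⊞ y ⊡ 3 ⊠ p₂ ⊞ y ⊡ 4 ⊠ p₃) ≡.refl _ _ _ _ _ _ _)

  -- Homogenisation: z^(deg p) p(w) in terms of x = w z.
  hev : List ℤ → Carrier → Carrier → Carrier
  hev [] x z = 0#
  hev (c ∷ p) x z = coeff c * z ^ length p + x * hev p x z

  ev-homogenise : ∀ p {w x z} → w * z ≈ x → z ^ length p * ev p w ≈ z * hev p x z
  ev-homogenise [] h = trans (zeroʳ _) (sym (zeroʳ _))
  ev-homogenise (c ∷ p) {w} {x} {z} h = begin
    z * z ^ length p * (coeff c + w * ev p w)
      ≈⟨ solve 5 (λ z zn c w e → z ⊠ zn ⊠ (c ⊞ w ⊠ e) ⊜ z ⊠ (c ⊠ zn) ⊞ (w ⊠ z) ⊠ (zn ⊠ e)) ≡.refl _ _ _ _ _ ⟩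
    z * (coeff c * z ^ length p) + w * z * (z ^ length p * ev p w)
      ≈⟨ +-congˡ (*-cong h (ev-homogenise p h)) ⟩
    z * (coeff c * z ^ length p) + x * (z * hev p x z)
      ≈⟨ solve 4 (λ z a x h → z ⊠ a ⊞ x ⊠ (z ⊠ h) ⊜ z ⊠ (a ⊞ x ⊠ h)) ≡.refl _ _ _ _ ⟩
    z * (coeff c * z ^ length p + x * hev p x z) ∎

-- Closed forms of the moments at exponents ≡ 2 and 4 modulo 5

module ClosedForms {Q : CommutativeRing 0ℓ 0ℓ} (M : CrankAlgebra Q)
  (κ : Series.S Q) (20κ : Series._≋_ Q (RingKit._*_ (Series.seriesRing Q) κ (RingKit.⟪_⟫ (Series.seriesRing Q) (+ 20))) (RingKit.1# (Series.seriesRing Q))) where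
  open CrankMoments M using (moment; moment-formula; Ψ-fiveColours)
  private module CG = CrankGeneratingFunction M
  open Series Q
  open Substitution Q
  open Products Q
  open Univariate seriesRing
  open EtaCube Q using (a; b; e; unit^; comb-expand)
  open Bilateral Q using (theta′)

  A′ B′ E′ a′ b′ e′ w y : S
  A′ = inv A
  B′ = inv B
  E′ = inv E₅
  a′ = V A′
  b′ = V B′
  e′ = V E′
  w = q * (A ^ 5 * B′ ^ 5)
  y = q * (a * b′)

  private
    aa′ : a * a′ ≋ 1#
    aa′ = V-unit A-unit
    bb′ : b * b′ ≋ 1#
    bb′ = V-unit B-unit
    ee′ : e * e′ ≋ 1#
    ee′ = V-unit E₅-unit

  -- The multiplier is the common monomial of the terms that accompany S in the formula for G₄, so S
  -- can be eliminated there in one step.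
  theta′-closed : ⟪ + 10 ⟫ * theta′ 3 2 * (A′ ^ 2 * B′ ^ 3 * E′ ^ 3) ≋ A′ ^ 5 - ⟪ + 3 ⟫ * q * B′ ^ 5 - A′ ^ 2 * B′ ^ 2 * E′ ^ 2
  theta′-closed = begin
    ⟪ + 10 ⟫ * s * (A′ ^ 2 * B′ ^ 3 * E′ ^ 3)
      ≈⟨ trans (*-congʳ (sym (*-identityˡ _))) (*-congʳ (*-congʳ (sym (trans (*-cong (unit^ 3 A-unit) (unit^ 3 B-unit)) (*-identityˡ _))))) ⟩
    (A′ ^ 3 * A ^ 3 * (B′ ^ 3 * B ^ 3)) * (⟪ + 10 ⟫ * s) * (A′ ^ 2 * B′ ^ 3 * E′ ^ 3)
      ≈⟨ solve 7 (λ a a′ b b′ e e′ s → (a′ ⊡ 3 ⊠ a ⊡ 3 ⊠ (b′ ⊡ 3 ⊠ b ⊡ 3)) ⊠ (con (+ 10) ⊠ s) ⊠ (a′ ⊡ 2 ⊠ b′ ⊡ 3 ⊠ e′ ⊡ 3) ⊜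
           a′ ⊡ 5 ⊠ b′ ⊡ 6 ⊠ e′ ⊡ 3 ⊠ (a ⊡ 3 ⊠ b ⊡ 3 ⊠ (con (+ 10) ⊠ s ⊞ e ⊠ b)) ⊟ a′ ⊡ 2 ⊠ b′ ⊡ 2 ⊠ e′ ⊡ 2 ⊠ (a′ ⊡ 3 ⊠ a ⊡ 3) ⊠ (b′ ⊡ 4 ⊠ b ⊡ 4) ⊠ (e′ ⊡ 1 ⊠ e ⊡ 1)) ≡.refl A A′ B B′ E₅ E′ s ⟩
    A′ ^ 5 * B′ ^ 6 * E′ ^ 3 * (A ^ 3 * B ^ 3 * (⟪ + 10 ⟫ * s + E₅ * B)) - A′ ^ 2 * B′ ^ 2 * E′ ^ 2 * (A′ ^ 3 * A ^ 3) * (B′ ^ 4 * B ^ 4) * (E′ ^ 1 * E₅ ^ 1)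
      ≈⟨ +-cong (*-congˡ CG.theta′-32) (-‿cong (trans (*-cong (*-cong (trans (*-congˡ (unit^ 3 A-unit)) (*-identityʳ _)) (unit^ 4 B-unit)) (unit^ 1 E₅-unit)) (trans (*-identityʳ _) (*-identityʳ _)))) ⟩
    A′ ^ 5 * B′ ^ 6 * E′ ^ 3 * (E₅ ^ 3 * (B ^ 6 - ⟪ + 3 ⟫ * q * B * A ^ 5)) - A′ ^ 2 * B′ ^ 2 * E′ ^ 2
      ≈⟨ +-congʳ (solve 7 (λ a a′ b b′ e e′ q → a′ ⊡ 5 ⊠ b′ ⊡ 6 ⊠ e′ ⊡ 3 ⊠ (e ⊡ 3 ⊠ (b ⊡ 6 ⊟ con (+ 3) ⊠ q ⊠ b ⊠ a ⊡ 5)) ⊜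
           a′ ⊡ 5 ⊠ (b′ ⊡ 6 ⊠ b ⊡ 6) ⊠ (e′ ⊡ 3 ⊠ e ⊡ 3) ⊟ con (+ 3) ⊠ q ⊠ b′ ⊡ 5 ⊠ (b′ ⊡ 1 ⊠ b ⊡ 1) ⊠ (a′ ⊡ 5 ⊠ a ⊡ 5) ⊠ (e′ ⊡ 3 ⊠ e ⊡ 3)) ≡.refl A A′ B B′ E₅ E′ q) ⟩
    A′ ^ 5 * (B′ ^ 6 * B ^ 6) * (E′ ^ 3 * E₅ ^ 3) - ⟪ + 3 ⟫ * q * B′ ^ 5 * (B′ ^ 1 * B ^ 1) * (A′ ^ 5 * A ^ 5) * (E′ ^ 3 * E₅ ^ 3) - A′ ^ 2 * B′ ^ 2 * E′ ^ 2
      ≈⟨ +-congʳ (+-cong (u3 (u2 (unit^ 6 B-unit)) (unit^ 3 E₅-unit)) (-‿cong (u3 (u3 (u2 (unit^ 1 B-unit)) (unit^ 5 A-unit)) (unit^ 3 E₅-unit)))) ⟩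
    A′ ^ 5 - ⟪ + 3 ⟫ * q * B′ ^ 5 - A′ ^ 2 * B′ ^ 2 * E′ ^ 2 ∎
    where
    open ≋-Reasoning
    s = theta′ 3 2
    u2 : ∀ {x u} → u ≋ 1# → x * u ≋ x
    u2 h = trans (*-congˡ h) (*-identityʳ _)
    u3 : ∀ {x x′ u} → x ≋ x′ → u ≋ 1# → x * u ≋ x′
    u3 p h = trans (*-cong p h) (*-identityʳ _)

  private
    -- `n₁` and `n₃` are L₁ + 3L₂ at z = by, separated by the terms with a³b³e and with e³ in p and
    -- p′. Both are multiples of 1 - y - y²; for instance 6 + y - 13y² - 7y³ = (1 - y - y²)(6 + 7y).
    n₁ n₃ q̃ h₁₁ : List ℤ
    n₁ = + 6 ∷ + 1 ∷ -[1+ 12 ] ∷ -[1+ 6 ] ∷ []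
    n₃ = -[1+ 5 ] ∷ -[1+ 10 ] ∷ -[1+ 46 ] ∷ + 97 ∷ -[1+ 19 ] ∷ + 98 ∷ + 43 ∷ -[1+ 18 ] ∷ + 9 ∷ []
    -- (1 - 11y⁵ - y¹⁰) / (1 - y - y²)
    q̃ = + 1 ∷ + 1 ∷ + 2 ∷ + 3 ∷ + 5 ∷ -[1+ 2 ] ∷ + 2 ∷ -[1+ 0 ] ∷ + 1 ∷ []
    h₁₁ = + 1 ∷ -[1+ 10 ] ∷ -[1+ 0 ] ∷ []

    q̃⁴ N₁ N₃ : List ℤ
    q̃⁴ = mulL (mulL q̃ q̃) (mulL q̃ q̃)
    N₁ = mulL n₁ q̃⁴
    N₃ = mulL n₃ q̃⁴

    u1 : ∀ {x u} → u ≋ 1# → x * u ≋ x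
    u1 h = trans (*-congˡ h) (*-identityʳ _)

    Zy : q * a ≋ b * y
    Zy = sym (trans (solve 4 (λ q a b b′ → b ⊠ (q ⊠ (a ⊠ b′)) ⊜ q ⊠ a ⊠ (b ⊠ b′)) ≡.refl q a b b′) (u1 bb′))

    E₁-y : a * b * E₁ ≋ e * b ^ 2 * (1# - y - y ^ 2)
    E₁-y = trans CG.E₁-dissection′ (trans (*-congˡ (+-cong (+-congˡ (-‿cong (*-congʳ Zy))) (-‿cong (^-congˡ 2 Zy))))
      (solve 3 (λ e b y → e ⊠ (b ⊡ 2 ⊟ b ⊠ y ⊠ b ⊟ (b ⊠ y) ⊡ 2) ⊜ e ⊠ b ⊡ 2 ⊠ (con (+ 1) ⊟ y ⊟ y ⊡ 2)) ≡.refl e b y))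

    quintic-w : ev h₁₁ w ≋ A ^ 11 * B
    quintic-w = begin
      ev h₁₁ w
        ≈⟨ solve 3 (λ q a b′ → let w = q ⊠ (a ⊡ 5 ⊠ b′ ⊡ 5) in
             con (+ 1) ⊞ w ⊠ (con -[1+ 10 ] ⊞ w ⊠ (con -[1+ 0 ] ⊞ w ⊠ con (+ 0))) ⊜
             con (+ 1) ⊟ con (+ 11) ⊠ q ⊠ a ⊡ 5 ⊠ b′ ⊡ 5 ⊟ q ⊡ 2 ⊠ a ⊡ 10 ⊠ b′ ⊡ 10) ≡.refl q A B′ ⟩
      1# - ⟪ + 11 ⟫ * q * A ^ 5 * B′ ^ 5 - q ^ 2 * A ^ 10 * B′ ^ 10
        ≈⟨ +-congʳ (+-cong (sym (unit^ 10 B-unit)) (-‿cong (sym (u1 (unit^ 5 B-unit))))) ⟩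
      B′ ^ 10 * B ^ 10 - ⟪ + 11 ⟫ * q * A ^ 5 * B′ ^ 5 * (B′ ^ 5 * B ^ 5) - q ^ 2 * A ^ 10 * B′ ^ 10
        ≈⟨ solve 4 (λ q a b b′ → b′ ⊡ 10 ⊠ b ⊡ 10 ⊟ con (+ 11) ⊠ q ⊠ a ⊡ 5 ⊠ b′ ⊡ 5 ⊠ (b′ ⊡ 5 ⊠ b ⊡ 5) ⊟ q ⊡ 2 ⊠ a ⊡ 10 ⊠ b′ ⊡ 10 ⊜
             b′ ⊡ 10 ⊠ (b ⊡ 10 ⊟ con (+ 11) ⊠ q ⊠ a ⊡ 5 ⊠ b ⊡ 5 ⊟ q ⊡ 2 ⊠ a ⊡ 10)) ≡.refl q A B B′ ⟩
      B′ ^ 10 * (B ^ 10 - ⟪ + 11 ⟫ * q * A ^ 5 * B ^ 5 - q ^ 2 * A ^ 10)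
        ≈⟨ *-congˡ (sym (CrankSeries.quintic-Q M)) ⟩
      B′ ^ 10 * (A ^ 11 * B ^ 11)
        ≈⟨ solve 3 (λ a b b′ → b′ ⊡ 10 ⊠ (a ⊡ 11 ⊠ b ⊡ 11) ⊜ a ⊡ 11 ⊠ b ⊠ (b′ ⊡ 10 ⊠ b ⊡ 10)) ≡.refl A B B′ ⟩
      A ^ 11 * B * (B′ ^ 10 * B ^ 10)
        ≈⟨ u1 (unit^ 10 B-unit) ⟩
      A ^ 11 * B ∎
      where
      open ≋-Reasoning

    y⁵ : y ^ 5 ≋ V w
    y⁵ = trans (solve 3 (λ q a b′ → (q ⊠ (a ⊠ b′)) ⊡ 5 ⊜ q ⊡ 5 ⊠ (a ⊡ 5 ⊠ b′ ⊡ 5)) ≡.refl q a b′)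
      (sym (trans (VH.hom-* _ _) (*-cong V-q (trans (VH.hom-* _ _) (*-cong (VH.hom-^ A 5) (VH.hom-^ B′ 5))))))

    V-ev : ∀ p → V (ev p w) ≋ ev p (y ^ 5)
    V-ev [] = VH.hom-0
    V-ev (c ∷ p) = trans (VH.hom-+ _ _) (+-cong (VH.hom-⟦⟧ (con {0} c) []) (trans (VH.hom-* _ _) (*-cong (sym y⁵) (V-ev p))))

    -- The product of the two polynomials involves only y⁵, so it is the image of `quintic-w` under
    -- q ↦ q⁵. This makes q̃(y)/(a¹¹b) the reciprocal of 1 - y - y².
    quintic-y : (1# - y - y ^ 2) * ev q̃ y ≋ a ^ 11 * b
    quintic-y = begin
      (1# - y - y ^ 2) * ev q̃ y
        ≈⟨ *-congʳ (solve 1 (λ y → con (+ 1) ⊟ y ⊟ y ⊡ 2 ⊜ con (+ 1) ⊞ y ⊠ (con -[1+ 0 ] ⊞ y ⊠ (con -[1+ 0 ] ⊞ y ⊠ con (+ 0)))) ≡.refl y) ⟩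
      ev (+ 1 ∷ -[1+ 0 ] ∷ -[1+ 0 ] ∷ []) y * ev q̃ y
        ≈⟨ ev-mul (+ 1 ∷ -[1+ 0 ] ∷ -[1+ 0 ] ∷ []) q̃ y ⟨
      ev (mulL (+ 1 ∷ -[1+ 0 ] ∷ -[1+ 0 ] ∷ []) q̃) y
        ≈⟨ ev-parts (mulL (+ 1 ∷ -[1+ 0 ] ∷ -[1+ 0 ] ∷ []) q̃) y ⟩
      _
        ≈⟨ solve 2 (λ y w →
             con (+ 1) ⊞ w ⊠ (con -[1+ 10 ] ⊞ w ⊠ (con -[1+ 0 ] ⊞ w ⊠ con (+ 0)))
             ⊞ y ⊠ (con (+ 0) ⊞ w ⊠ (con (+ 0) ⊞ w ⊠ con (+ 0))) ⊞ y ⊡ 2 ⊠ (con (+ 0) ⊞ w ⊠ (con (+ 0) ⊞ w ⊠ con (+ 0)))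
             ⊞ y ⊡ 3 ⊠ (con (+ 0) ⊞ w ⊠ (con (+ 0) ⊞ w ⊠ con (+ 0))) ⊞ y ⊡ 4 ⊠ (con (+ 0) ⊞ w ⊠ (con (+ 0) ⊞ w ⊠ con (+ 0)))
             ⊜ con (+ 1) ⊞ w ⊠ (con -[1+ 10 ] ⊞ w ⊠ (con -[1+ 0 ] ⊞ w ⊠ con (+ 0)))) ≡.refl y (y ^ 5) ⟩
      ev h₁₁ (y ^ 5)
        ≈⟨ V-ev h₁₁ ⟨
      V (ev h₁₁ w)
        ≈⟨ trans (VH.hom-cong quintic-w) (trans (VH.hom-* _ _) (*-congʳ (VH.hom-^ A 11))) ⟩
      a ^ 11 * b ∎
      where open ≋-Reasoning

    open CorrectionTerm

    rhsE : ∀ {n} → Ex n → Ex n → Ex n → Ex n → Ex n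
    rhsE a b e z =
      let p = pE a b e z ; p′ = p′E a b e z ; t = con (+ 10) ⊠ (a ⊡ 3 ⊠ b ⊡ 3) in
      ⊖ (con (+ 2) ⊠ (t ⊠ e ⊡ 2 ⊠ L₁E p p′ b z) ⊞ con (+ 6) ⊠ (t ⊠ e ⊡ 2 ⊠ L₂E p p′ b z))

    Y : S
    Y = 1# - y - y ^ 2

    -- Here 200 = 2 · 10²: the 2 counts the moment twice, and (10a³b³)² is split so that four copies
    -- of ab join E₁⁴. The remaining a²b² stays as a separate factor.
    moment-b : ⟪ + 200 ⟫ * (e * b ^ 2 * Y) ^ 4 * (a * b * e) ^ 2 * (a ^ 2 * b ^ 2) * moment ≋
               - (⟪ + 20 ⟫ * (a ^ 6 * b ^ 9 * e ^ 3 * ev n₁ y + a ^ 3 * b ^ 11 * e ^ 5 * ev n₃ y))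
    moment-b = begin
      ⟪ + 200 ⟫ * (e * b ^ 2 * Y) ^ 4 * (a * b * e) ^ 2 * (a ^ 2 * b ^ 2) * moment
        ≈⟨ *-congʳ (*-congʳ (*-cong (*-congˡ (^-congˡ 4 (sym E₁-y))) (^-congˡ 2 (sym (CrankSeries.E₅-factor-Q M))))) ⟩
      ⟪ + 200 ⟫ * (a * b * E₁) ^ 4 * E₅ ^ 2 * (a ^ 2 * b ^ 2) * moment
        ≈⟨ solve 5 (λ a b x f m → con (+ 200) ⊠ (a ⊠ b ⊠ x) ⊡ 4 ⊠ f ⊡ 2 ⊠ (a ⊡ 2 ⊠ b ⊡ 2) ⊠ m ⊜
             x ⊡ 4 ⊠ f ⊡ 2 ⊠ (con (+ 10) ⊠ (a ⊡ 3 ⊠ b ⊡ 3)) ⊡ 2 ⊠ (m ⊞ m)) ≡.refl a b E₁ E₅ moment ⟩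
      E₁ ^ 4 * E₅ ^ 2 * (⟪ + 10 ⟫ * (a ^ 3 * b ^ 3)) ^ 2 * (moment + moment)
        ≈⟨ *-congˡ (sym Ψ-fiveColours) ⟩
      _
        ≈⟨ moment-formula ⟩
      ⟦ rhsE (var zero) (var (suc zero)) (var (suc (suc zero))) (var (suc (suc (suc zero)))) ⟧ (a ∷ b ∷ e ∷ q * a ∷ [])
        ≈⟨ ⟦⟧-cong (rhsE (var zero) (var (suc zero)) (var (suc (suc zero))) (var (suc (suc (suc zero))))) (refl ∷ refl ∷ refl ∷ Zy ∷ []) ⟩
      _
        ≈⟨ solve 4 (λ a b e y → rhsE a b e (b ⊠ y) ⊜ ⊖ (con (+ 20) ⊠ (a ⊡ 6 ⊠ b ⊡ 9 ⊠ e ⊡ 3 ⊠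
             (con (+ 6) ⊞ y ⊠ (con (+ 1) ⊞ y ⊠ (con -[1+ 12 ] ⊞ y ⊠ (con -[1+ 6 ] ⊞ y ⊠ con (+ 0)))))
             ⊞ a ⊡ 3 ⊠ b ⊡ 11 ⊠ e ⊡ 5 ⊠
             (con -[1+ 5 ] ⊞ y ⊠ (con -[1+ 10 ] ⊞ y ⊠ (con -[1+ 46 ] ⊞ y ⊠ (con (+ 97) ⊞ y ⊠ (con -[1+ 19 ] ⊞ y ⊠ (con (+ 98) ⊞ y ⊠
             (con (+ 43) ⊞ y ⊠ (con -[1+ 18 ] ⊞ y ⊠ (con (+ 9) ⊞ y ⊠ con (+ 0))))))))))))) ≡.refl a b e y ⟩
      - (⟪ + 20 ⟫ * (a ^ 6 * b ^ 9 * e ^ 3 * ev n₁ y + a ^ 3 * b ^ 11 * e ^ 5 * ev n₃ y)) ∎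
      where
      open ≋-Reasoning
      open import Data.Fin using (zero; suc)

    ev-q̃⁴ : ev q̃ y ^ 4 ≋ ev q̃⁴ y
    ev-q̃⁴ = sym (trans (ev-mul (mulL q̃ q̃) (mulL q̃ q̃) y) (trans (*-cong (ev-mul q̃ q̃ y) (ev-mul q̃ q̃ y))
      (solve 1 (λ x → x ⊠ x ⊠ (x ⊠ x) ⊜ x ⊡ 4) ≡.refl (ev q̃ y))))

    -- Everything is multiplied by (1 - 11y⁵ - y¹⁰)⁴ = (a¹¹b)⁴.
    moment-y : ⟪ + 10 ⟫ * moment ≋ - (a′ ^ 42 * b′ ^ 7 * e′ ^ 3 * ev N₁ y + a′ ^ 45 * b′ ^ 5 * e′ * ev N₃ y)
    moment-y = begin
      ⟪ + 10 ⟫ * moment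
        ≈⟨ sym (u1 20κ) ⟩
      ⟪ + 10 ⟫ * moment * (κ * ⟪ + 20 ⟫)
        -- The exponents collect those of `moment-b` and of (a¹¹b)⁴: 48 = 4 + 44 for a, 16 = 12 + 4
        -- for b, 6 for e.
        ≈⟨ sym (trans (u1 (unit^ 6 ee′)) (trans (u1 (unit^ 16 bb′)) (u1 (unit^ 48 aa′)))) ⟩
      ⟪ + 10 ⟫ * moment * (κ * ⟪ + 20 ⟫) * (a′ ^ 48 * a ^ 48) * (b′ ^ 16 * b ^ 16) * (e′ ^ 6 * e ^ 6)
        ≈⟨ solve 8 (λ m k a a′ b b′ e e′ → con (+ 10) ⊠ m ⊠ (k ⊠ con (+ 20)) ⊠ (a′ ⊡ 48 ⊠ a ⊡ 48) ⊠ (b′ ⊡ 16 ⊠ b ⊡ 16) ⊠ (e′ ⊡ 6 ⊠ e ⊡ 6) ⊜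
             k ⊠ (a′ ⊡ 48 ⊠ b′ ⊡ 16 ⊠ e′ ⊡ 6) ⊠ (con (+ 200) ⊠ a ⊡ 4 ⊠ b ⊡ 12 ⊠ e ⊡ 6 ⊠ (a ⊡ 11 ⊠ b) ⊡ 4 ⊠ m)) ≡.refl moment κ a a′ b b′ e e′ ⟩
      κ * (a′ ^ 48 * b′ ^ 16 * e′ ^ 6) * (⟪ + 200 ⟫ * a ^ 4 * b ^ 12 * e ^ 6 * (a ^ 11 * b) ^ 4 * moment)
        ≈⟨ *-congˡ (*-congʳ (*-congˡ (^-congˡ 4 (sym quintic-y)))) ⟩
      κ * (a′ ^ 48 * b′ ^ 16 * e′ ^ 6) * (⟪ + 200 ⟫ * a ^ 4 * b ^ 12 * e ^ 6 * (Y * ev q̃ y) ^ 4 * moment)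
        ≈⟨ *-congˡ (solve 6 (λ a b e y t m → con (+ 200) ⊠ a ⊡ 4 ⊠ b ⊡ 12 ⊠ e ⊡ 6 ⊠ (y ⊠ t) ⊡ 4 ⊠ m ⊜
             t ⊡ 4 ⊠ (con (+ 200) ⊠ (e ⊠ b ⊡ 2 ⊠ y) ⊡ 4 ⊠ (a ⊠ b ⊠ e) ⊡ 2 ⊠ (a ⊡ 2 ⊠ b ⊡ 2) ⊠ m)) ≡.refl a b e Y (ev q̃ y) moment) ⟩
      κ * (a′ ^ 48 * b′ ^ 16 * e′ ^ 6) * (ev q̃ y ^ 4 * _)
        ≈⟨ *-congˡ (*-cong ev-q̃⁴ moment-b) ⟩
      κ * (a′ ^ 48 * b′ ^ 16 * e′ ^ 6) * (ev q̃⁴ y * - (⟪ + 20 ⟫ * (a ^ 6 * b ^ 9 * e ^ 3 * ev n₁ y + a ^ 3 * b ^ 11 * e ^ 5 * ev n₃ y)))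
        ≈⟨ solve 10 (λ k a a′ b b′ e e′ t m n → k ⊠ (a′ ⊡ 48 ⊠ b′ ⊡ 16 ⊠ e′ ⊡ 6) ⊠ (t ⊠ ⊖ (con (+ 20) ⊠ (a ⊡ 6 ⊠ b ⊡ 9 ⊠ e ⊡ 3 ⊠ m ⊞ a ⊡ 3 ⊠ b ⊡ 11 ⊠ e ⊡ 5 ⊠ n))) ⊜
             ⊖ (a′ ⊡ 42 ⊠ b′ ⊡ 7 ⊠ e′ ⊡ 3 ⊠ (m ⊠ t) ⊠ (a′ ⊡ 6 ⊠ a ⊡ 6) ⊠ (b′ ⊡ 9 ⊠ b ⊡ 9) ⊠ (e′ ⊡ 3 ⊠ e ⊡ 3)
                ⊞ a′ ⊡ 45 ⊠ b′ ⊡ 5 ⊠ e′ ⊠ (n ⊠ t) ⊠ (a′ ⊡ 3 ⊠ a ⊡ 3) ⊠ (b′ ⊡ 11 ⊠ b ⊡ 11) ⊠ (e′ ⊡ 5 ⊠ e ⊡ 5)) ⊠ (k ⊠ con (+ 20)))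
             ≡.refl κ a a′ b b′ e e′ (ev q̃⁴ y) (ev n₁ y) (ev n₃ y) ⟩
      _
        ≈⟨ trans (u1 20κ) (-‿cong (+-cong
             (trans (u1 (unit^ 3 ee′)) (trans (u1 (unit^ 9 bb′)) (trans (u1 (unit^ 6 aa′)) (*-congˡ (sym (ev-mul n₁ q̃⁴ y))))))
             (trans (u1 (unit^ 5 ee′)) (trans (u1 (unit^ 11 bb′)) (trans (u1 (unit^ 3 aa′)) (*-congˡ (sym (ev-mul n₃ q̃⁴ y)))))))) ⟩
      - (a′ ^ 42 * b′ ^ 7 * e′ ^ 3 * ev N₁ y + a′ ^ 45 * b′ ^ 5 * e′ * ev N₃ y) ∎
      where open ≋-Reasoning

    C₁ C₃ : S
    C₁ = A′ ^ 42 * B′ ^ 7 * E′ ^ 3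
    C₃ = A′ ^ 45 * B′ ^ 5 * E′

    -- Since y^i = q^i (a/b)^i, the part with exponents ≡ i in y is q^i times a series in q⁵; this
    -- is that series with q⁵ replaced by q.
    component : List ℤ → List ℤ → ℕ → S
    component m n i = - ((A * B′) ^ i * (C₁ * ev (part i m) w + C₃ * ev (part i n) w))

    combination : ∀ m n → - (a′ ^ 42 * b′ ^ 7 * e′ ^ 3 * ev m y + a′ ^ 45 * b′ ^ 5 * e′ * ev n y) ≋ comb (component m n)
    combination m n = sym (trans (comb-expand (component m n)) (trans
      (+-cong (+-cong (+-cong (+-cong (Vc 0) (*-congˡ (Vc 1))) (*-congˡ (Vc 2))) (*-congˡ (Vc 3))) (*-congˡ (Vc 4)))
      (trans (solve 14 (λ q r c d m₀ m₁ m₂ m₃ m₄ n₀ n₁ n₂ n₃ n₄ →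
          (⊖ (r ⊡ 0 ⊠ (c ⊠ m₀ ⊞ d ⊠ n₀))) ⊞ q ⊠ (⊖ (r ⊡ 1 ⊠ (c ⊠ m₁ ⊞ d ⊠ n₁))) ⊞ q ⊡ 2 ⊠ (⊖ (r ⊡ 2 ⊠ (c ⊠ m₂ ⊞ d ⊠ n₂)))
          ⊞ q ⊡ 3 ⊠ (⊖ (r ⊡ 3 ⊠ (c ⊠ m₃ ⊞ d ⊠ n₃))) ⊞ q ⊡ 4 ⊠ (⊖ (r ⊡ 4 ⊠ (c ⊠ m₄ ⊞ d ⊠ n₄))) ⊜
          ⊖ (c ⊠ (m₀ ⊞ (q ⊠ r) ⊠ m₁ ⊞ (q ⊠ r) ⊡ 2 ⊠ m₂ ⊞ (q ⊠ r) ⊡ 3 ⊠ m₃ ⊞ (q ⊠ r) ⊡ 4 ⊠ m₄)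
             ⊞ d ⊠ (n₀ ⊞ (q ⊠ r) ⊠ n₁ ⊞ (q ⊠ r) ⊡ 2 ⊠ n₂ ⊞ (q ⊠ r) ⊡ 3 ⊠ n₃ ⊞ (q ⊠ r) ⊡ 4 ⊠ n₄))) ≡.refl
          q (a * b′) _ _ _ _ _ _ _ _ _ _ _ _)
        (-‿cong (+-cong (*-congˡ (sym (ev-parts m y))) (*-congˡ (sym (ev-parts n y))))))))
      where
      Vc : ∀ i → V (component m n i) ≋ - ((a * b′) ^ i * (a′ ^ 42 * b′ ^ 7 * e′ ^ 3 * ev (part i m) (y ^ 5) + a′ ^ 45 * b′ ^ 5 * e′ * ev (part i n) (y ^ 5)))
      Vc i = trans (VH.hom-neg _) (-‿cong (trans (VH.hom-* _ _) (*-cong (trans (VH.hom-^ _ i) (^-congˡ i (VH.hom-* _ _)))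
        (trans (VH.hom-+ _ _) (+-cong
          (trans (VH.hom-* _ _) (*-cong (trans (VH.hom-* _ _) (*-cong (trans (VH.hom-* _ _) (*-cong (VH.hom-^ _ 42) (VH.hom-^ _ 7))) (VH.hom-^ _ 3))) (V-ev (part i m))))
          (trans (VH.hom-* _ _) (*-cong (trans (VH.hom-* _ _) (*-congʳ (trans (VH.hom-* _ _) (*-cong (VH.hom-^ _ 45) (VH.hom-^ _ 5))))) (V-ev (part i n)))))))))

    moment-comb : ⟪ + 10 ⟫ * moment ≋ comb (component N₁ N₃)
    moment-comb = trans moment-y (combination N₁ N₃)

  -- Quotients by `h₁₁` of the parts 2 and 4 of `N₁` and `N₃`. The division is exact: a factor 1 - y
  -- - y² of `n₁` or `n₃` meets one q̃ and forms 1 - 11y⁵ - y¹⁰, which passes to every part.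
  d₁₂ d₁₄ d₃₂ d₃₄ : List ℤ
  d₁₂ = + 75 ∷ + 2000 ∷ + 825 ∷ + 450 ∷ -[1+ 99 ] ∷ []
  d₁₄ = + 460 ∷ + 2430 ∷ + 915 ∷ + 470 ∷ -[1+ 14 ] ∷ []
  d₃₂ = -[1+ 174 ] ∷ -[1+ 9824 ] ∷ -[1+ 28724 ] ∷ + 16325 ∷ -[1+ 21649 ] ∷ + 700 ∷ []
  d₃₄ = -[1+ 1359 ] ∷ -[1+ 20649 ] ∷ -[1+ 19924 ] ∷ + 31625 ∷ -[1+ 8274 ] ∷ + 55 ∷ []

  private
    w·z : w * A′ ^ 5 ≋ q * B′ ^ 5
    w·z = trans (solve 4 (λ q a a′ b′ → q ⊠ (a ⊡ 5 ⊠ b′ ⊡ 5) ⊠ a′ ⊡ 5 ⊜ q ⊠ b′ ⊡ 5 ⊠ (a′ ⊡ 5 ⊠ a ⊡ 5)) ≡.refl q A A′ B′) (u1 (unit^ 5 A-unit))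

    factored : ∀ {p} d → p ≡ mulL h₁₁ d → ev p w ≋ A ^ 11 * B * ev d w
    factored d h = trans (reflexive (≡.cong (λ p → ev p w) h)) (trans (ev-mul h₁₁ d w) (*-congʳ quintic-w))

  -- As wA⁻⁵ = qB⁻⁵, homogenising with z = A⁻⁵ rewrites the polynomials in w by inverse products
  -- only. The powers 5 and 6 of z are the lengths of the two lists.
  moment-2 : U 2 (⟪ + 10 ⟫ * moment) ≋ - (A′ ^ 9 * B′ ^ 8 * E′ ^ 3 * hev d₁₂ (q * B′ ^ 5) (A′ ^ 5) + A′ ^ 7 * B′ ^ 6 * E′ * hev d₃₂ (q * B′ ^ 5) (A′ ^ 5))
  moment-2 = begin
    U 2 (⟪ + 10 ⟫ * moment)
      ≈⟨ trans (U-cong 2 moment-comb) (U-comb-2 (component N₁ N₃)) ⟩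
    - ((A * B′) ^ 2 * (C₁ * ev (part 2 N₁) w + C₃ * ev (part 2 N₃) w))
      ≈⟨ -‿cong (*-congˡ (+-cong (*-congˡ (factored d₁₂ ≡.refl)) (*-congˡ (factored d₃₂ ≡.refl)))) ⟩
    - ((A * B′) ^ 2 * (C₁ * (A ^ 11 * B * ev d₁₂ w) + C₃ * (A ^ 11 * B * ev d₃₂ w)))
      ≈⟨ solve 7 (λ a a′ b b′ e′ m n → ⊖ ((a ⊠ b′) ⊡ 2 ⊠ (a′ ⊡ 42 ⊠ b′ ⊡ 7 ⊠ e′ ⊡ 3 ⊠ (a ⊡ 11 ⊠ b ⊠ m) ⊞ a′ ⊡ 45 ⊠ b′ ⊡ 5 ⊠ e′ ⊠ (a ⊡ 11 ⊠ b ⊠ n))) ⊜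
           ⊖ (a′ ⊡ 4 ⊠ b′ ⊡ 8 ⊠ e′ ⊡ 3 ⊠ ((a′ ⊡ 5) ⊡ 5 ⊠ m) ⊞ a′ ⊡ 2 ⊠ b′ ⊡ 6 ⊠ e′ ⊠ ((a′ ⊡ 5) ⊡ 6 ⊠ n)) ⊠ (a′ ⊡ 13 ⊠ a ⊡ 13) ⊠ (b′ ⊡ 1 ⊠ b ⊡ 1)) ≡.refl A A′ B B′ E′ _ _ ⟩
    - (A′ ^ 4 * B′ ^ 8 * E′ ^ 3 * ((A′ ^ 5) ^ 5 * ev d₁₂ w) + A′ ^ 2 * B′ ^ 6 * E′ * ((A′ ^ 5) ^ 6 * ev d₃₂ w)) * (A′ ^ 13 * A ^ 13) * (B′ ^ 1 * B ^ 1)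
      ≈⟨ trans (u1 (unit^ 1 B-unit)) (u1 (unit^ 13 A-unit)) ⟩
    - (A′ ^ 4 * B′ ^ 8 * E′ ^ 3 * ((A′ ^ 5) ^ 5 * ev d₁₂ w) + A′ ^ 2 * B′ ^ 6 * E′ * ((A′ ^ 5) ^ 6 * ev d₃₂ w))
      ≈⟨ -‿cong (+-cong (*-congˡ (ev-homogenise d₁₂ w·z)) (*-congˡ (ev-homogenise d₃₂ w·z))) ⟩
    _
      ≈⟨ solve 5 (λ a′ b′ e′ m n → ⊖ (a′ ⊡ 4 ⊠ b′ ⊡ 8 ⊠ e′ ⊡ 3 ⊠ (a′ ⊡ 5 ⊠ m) ⊞ a′ ⊡ 2 ⊠ b′ ⊡ 6 ⊠ e′ ⊠ (a′ ⊡ 5 ⊠ n)) ⊜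
           ⊖ (a′ ⊡ 9 ⊠ b′ ⊡ 8 ⊠ e′ ⊡ 3 ⊠ m ⊞ a′ ⊡ 7 ⊠ b′ ⊡ 6 ⊠ e′ ⊠ n)) ≡.refl A′ B′ E′ _ _ ⟩
    _ ∎
    where open ≋-Reasoning

  moment-4 : U 4 (⟪ + 10 ⟫ * moment) ≋ - (A′ ^ 7 * B′ ^ 10 * E′ ^ 3 * hev d₁₄ (q * B′ ^ 5) (A′ ^ 5) + A′ ^ 5 * B′ ^ 8 * E′ * hev d₃₄ (q * B′ ^ 5) (A′ ^ 5))
  moment-4 = begin
    U 4 (⟪ + 10 ⟫ * moment)
      ≈⟨ trans (U-cong 4 moment-comb) (U-comb-4 (component N₁ N₃)) ⟩
    - ((A * B′) ^ 4 * (C₁ * ev (part 4 N₁) w + C₃ * ev (part 4 N₃) w))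
      ≈⟨ -‿cong (*-congˡ (+-cong (*-congˡ (factored d₁₄ ≡.refl)) (*-congˡ (factored d₃₄ ≡.refl)))) ⟩
    - ((A * B′) ^ 4 * (C₁ * (A ^ 11 * B * ev d₁₄ w) + C₃ * (A ^ 11 * B * ev d₃₄ w)))
      ≈⟨ solve 7 (λ a a′ b b′ e′ m n → ⊖ ((a ⊠ b′) ⊡ 4 ⊠ (a′ ⊡ 42 ⊠ b′ ⊡ 7 ⊠ e′ ⊡ 3 ⊠ (a ⊡ 11 ⊠ b ⊠ m) ⊞ a′ ⊡ 45 ⊠ b′ ⊡ 5 ⊠ e′ ⊠ (a ⊡ 11 ⊠ b ⊠ n))) ⊜
           ⊖ (a′ ⊡ 2 ⊠ b′ ⊡ 10 ⊠ e′ ⊡ 3 ⊠ ((a′ ⊡ 5) ⊡ 5 ⊠ m) ⊞ b′ ⊡ 8 ⊠ e′ ⊠ ((a′ ⊡ 5) ⊡ 6 ⊠ n)) ⊠ (a′ ⊡ 15 ⊠ a ⊡ 15) ⊠ (b′ ⊡ 1 ⊠ b ⊡ 1)) ≡.refl A A′ B B′ E′ _ _ ⟩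
    - (A′ ^ 2 * B′ ^ 10 * E′ ^ 3 * ((A′ ^ 5) ^ 5 * ev d₁₄ w) + B′ ^ 8 * E′ * ((A′ ^ 5) ^ 6 * ev d₃₄ w)) * (A′ ^ 15 * A ^ 15) * (B′ ^ 1 * B ^ 1)
      ≈⟨ trans (u1 (unit^ 1 B-unit)) (u1 (unit^ 15 A-unit)) ⟩
    - (A′ ^ 2 * B′ ^ 10 * E′ ^ 3 * ((A′ ^ 5) ^ 5 * ev d₁₄ w) + B′ ^ 8 * E′ * ((A′ ^ 5) ^ 6 * ev d₃₄ w))
      ≈⟨ -‿cong (+-cong (*-congˡ (ev-homogenise d₁₄ w·z)) (*-congˡ (ev-homogenise d₃₄ w·z))) ⟩
    _
      ≈⟨ solve 5 (λ a′ b′ e′ m n → ⊖ (a′ ⊡ 2 ⊠ b′ ⊡ 10 ⊠ e′ ⊡ 3 ⊠ (a′ ⊡ 5 ⊠ m) ⊞ b′ ⊡ 8 ⊠ e′ ⊠ (a′ ⊡ 5 ⊠ n)) ⊜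
           ⊖ (a′ ⊡ 7 ⊠ b′ ⊡ 10 ⊠ e′ ⊡ 3 ⊠ m ⊞ a′ ⊡ 5 ⊠ b′ ⊡ 8 ⊠ e′ ⊠ n)) ≡.refl A′ B′ E′ _ _ ⟩
    _ ∎
    where open ≋-Reasoning

-- From the counts NB₅ to the crank moment over ℚ

module RQ = RingKit ℚR

private
  -- One side is a reduced fraction, the other an iterated sum of units; the step from n to n + 1 is
  -- compared among unreduced fractions.
  ℕ/1 : ∀ n → + n / 1 ≡ RQ.⟪ + n ⟫
  ℕ/1 zero = ≡.refl
  ℕ/1 (suc n) = ≡.trans (ℚₚ.toℚᵘ-injective (begin
      ℚ.toℚᵘ (+ suc n / 1)                       ≈⟨ ℚₚ.toℚᵘ-fromℚᵘ (mkℚᵘ (+ suc n) 0) ⟩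
      mkℚᵘ (+ suc n) 0                           ≈⟨ *≡* (ℤK.solve 1 (λ m → (con (+ 1) ⊞ m) ⊠ con (+ 1) ⊜ (con (+ 1) ⊠ con (+ 1) ⊞ m ⊠ con (+ 1)) ⊠ con (+ 1)) ≡.refl (+ n)) ⟩
      mkℚᵘ (+ 1) 0 ℚᵘ.+ mkℚᵘ (+ n) 0             ≈⟨ ℚᵘₚ.+-congʳ (mkℚᵘ (+ 1) 0) (ℚᵘₚ.≃-sym (ℚₚ.toℚᵘ-fromℚᵘ (mkℚᵘ (+ n) 0))) ⟩
      ℚ.toℚᵘ 1ℚ ℚᵘ.+ ℚ.toℚᵘ (+ n / 1)            ≈⟨ ℚₚ.toℚᵘ-homo-+ 1ℚ (+ n / 1) ⟨
      ℚ.toℚᵘ (1ℚ ℚ.+ (+ n / 1))                  ∎))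
    (≡.cong (1ℚ ℚ.+_) (ℕ/1 n))
    where open import Relation.Binary.Reasoning.Setoid ℚᵘₚ.≃-setoid

ℤ→ℚ≡⟪⟫ : ∀ z → z / 1 ≡ RQ.⟪ z ⟫
ℤ→ℚ≡⟪⟫ (+ n) = ℕ/1 n
ℤ→ℚ≡⟪⟫ -[1+ n ] = ≡.cong ℚ.-_ (ℕ/1 (suc n))

module Enumeration where
  private module LQ = ListSum ℚR

  weight-congruent : ∀ m n t → + m ≡ + n ℤ.+ t ℤ.* + 5 → weight m ≡ weight n
  weight-congruent m n (+ k) h = ≡.trans (≡.cong weight (ℤₚ.+-injective (≡.trans h
    (≡.trans (≡.cong (λ z → + n ℤ.+ z) (≡.sym (ℤₚ.pos-* k 5))) (≡.cong +_ (ℕₚ.+-comm n (k ℕ.* 5))))))) (weight-shift k n)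
  weight-congruent m n -[1+ k ] h = ≡.sym (≡.trans (≡.cong weight (ℤₚ.+-injective (begin
      + n                                                          ≡⟨ ℤK.solve 2 (λ n s → n ⊜ s ⊠ con (+ 5) ⊞ (n ⊞ (⊖ s) ⊠ con (+ 5))) ≡.refl (+ n) (+ suc k) ⟩
      + suc k ℤ.* + 5 ℤ.+ (+ n ℤ.+ -[1+ k ] ℤ.* + 5)               ≡⟨ ≡.cong₂ ℤ._+_ (≡.sym (ℤₚ.pos-* (suc k) 5)) (≡.sym h) ⟩
      + (suc k ℕ.* 5 ℕ.+ m)                                        ∎))) (weight-shift (suc k) m))
    where open ≡.≡-Reasoning

  -- a + 4b = (a - b) + 5b, so the nonnegative remainder of the crank and the natural number a + 4b
  -- differ by a multiple of 5.
  weight-crank : ∀ a b → weight ((+ a ℤ.- + b) ℤ÷.%ℕ 5) ≡ weight (1 ℕ.* a ℕ.+ 4 ℕ.* b)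
  weight-crank a b = ≡.sym (weight-congruent (1 ℕ.* a ℕ.+ 4 ℕ.* b) (z ℤ÷.%ℕ 5) (z ℤ÷./ℕ 5 ℤ.+ + b) (begin
      + (1 ℕ.* a ℕ.+ 4 ℕ.* b)
        ≡⟨ ≡.cong₂ ℤ._+_ (ℤₚ.pos-* 1 a) (ℤₚ.pos-* 4 b) ⟩
      + 1 ℤ.* + a ℤ.+ + 4 ℤ.* + b
        ≡⟨ ℤK.solve 2 (λ a b → con (+ 1) ⊠ a ⊞ con (+ 4) ⊠ b ⊜ (a ⊟ b) ⊞ b ⊠ con (+ 5)) ≡.refl (+ a) (+ b) ⟩
      z ℤ.+ + b ℤ.* + 5
        ≡⟨ ≡.cong (λ x → x ℤ.+ + b ℤ.* + 5) (ℤ÷.a≡a%ℕn+[a/ℕn]*n z 5) ⟩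
      + (z ℤ÷.%ℕ 5) ℤ.+ z ℤ÷./ℕ 5 ℤ.* + 5 ℤ.+ + b ℤ.* + 5
        ≡⟨ ℤK.solve 3 (λ r d b → r ⊞ d ⊠ con (+ 5) ⊞ b ⊠ con (+ 5) ⊜ r ⊞ (d ⊞ b) ⊠ con (+ 5)) ≡.refl (+ (z ℤ÷.%ℕ 5)) (z ℤ÷./ℕ 5) (+ b) ⟩
      + (z ℤ÷.%ℕ 5) ℤ.+ (z ℤ÷./ℕ 5 ℤ.+ + b) ℤ.* + 5 ∎))
    where
    open ≡.≡-Reasoning
    z = + a ℤ.- + b

  G-combination : ℕ → ℕ → ℕ → ℕ → ℚ
  G-combination w₁ w₄ w₂ w₃ = D.ℕ→ℚ w₁ ℚ.- D.ℕ→ℚ w₄ ℚ.+ D.ℕ→ℚ 3 ℚ.* D.ℕ→ℚ w₂ ℚ.- D.ℕ→ℚ 3 ℚ.* D.ℕ→ℚ w₃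

  ℕ→ℚ-+ : ∀ m n → D.ℕ→ℚ (m ℕ.+ n) ≡ D.ℕ→ℚ m ℚ.+ D.ℕ→ℚ n
  ℕ→ℚ-+ m n = ≡.trans (ℤ→ℚ≡⟪⟫ (+ (m ℕ.+ n))) (≡.trans (RQ.⟪⟫-+ (+ m) (+ n)) (≡.sym (≡.cong₂ ℚ._+_ (ℤ→ℚ≡⟪⟫ (+ m)) (ℤ→ℚ≡⟪⟫ (+ n)))))

  -- The four counts run over the same list, so their rational combination is formed partition by
  -- partition; `select` then finds at most one nonzero entry in each.
  combine : ∀ {X : Set} (f₁ f₄ f₂ f₃ : X → ℕ) (g : X → ℚ) →
    (∀ x → G-combination (f₁ x) (f₄ x) (f₂ x) (f₃ x) ≡ g x) → ∀ xs →
    G-combination (sumℕ (L.map f₁ xs)) (sumℕ (L.map f₄ xs)) (sumℕ (L.map f₂ xs)) (sumℕ (L.map f₃ xs)) ≡ LQ.sumL g xs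
  combine f₁ f₄ f₂ f₃ g h [] = ≡.refl
  combine f₁ f₄ f₂ f₃ g h (x ∷ xs) = ≡.trans
    (≡.cong₂ ℚ._-_ (≡.cong₂ ℚ._+_ (≡.cong₂ ℚ._-_ (ℕ→ℚ-+ (f₁ x) _) (ℕ→ℚ-+ (f₄ x) _)) (≡.cong (D.ℕ→ℚ 3 ℚ.*_) (ℕ→ℚ-+ (f₂ x) _))) (≡.cong (D.ℕ→ℚ 3 ℚ.*_) (ℕ→ℚ-+ (f₃ x) _)))
    (≡.trans (RQ.solve 9 (λ t a b c d a′ b′ c′ d′ → (a ⊞ a′) ⊟ (b ⊞ b′) ⊞ t ⊠ (c ⊞ c′) ⊟ t ⊠ (d ⊞ d′) ⊜
        (a ⊟ b ⊞ t ⊠ c ⊟ t ⊠ d) ⊞ (a′ ⊟ b′ ⊞ t ⊠ c′ ⊟ t ⊠ d′)) ≡.refl (D.ℕ→ℚ 3) (D.ℕ→ℚ (f₁ x)) (D.ℕ→ℚ (f₄ x)) (D.ℕ→ℚ (f₂ x)) (D.ℕ→ℚ (f₃ x)) (v f₁) (v f₄) (v f₂) (v f₃))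
    (≡.cong₂ ℚ._+_ (h x) (combine f₁ f₄ f₂ f₃ g h xs)))
    where
    v : ∀ f → ℚ
    v f = D.ℕ→ℚ (sumℕ (L.map f xs))

  select : ∀ a r → r ℕ.< 5 → G-combination (if ⌊ r ℕ.≟ 1 ⌋ then a else 0) (if ⌊ r ℕ.≟ 4 ⌋ then a else 0)
             (if ⌊ r ℕ.≟ 2 ⌋ then a else 0) (if ⌊ r ℕ.≟ 3 ⌋ then a else 0) ≡ RQ.⟪ + a ⟫ ℚ.* RQ.⟪ weight r ⟫
  select a r h = ≡.trans (go r h) (≡.cong (ℚ._* RQ.⟪ weight r ⟫) (ℤ→ℚ≡⟪⟫ (+ a)))
    where
    x = D.ℕ→ℚ a
    go : ∀ r → r ℕ.< 5 → G-combination (if ⌊ r ℕ.≟ 1 ⌋ then a else 0) (if ⌊ r ℕ.≟ 4 ⌋ then a else 0)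
           (if ⌊ r ℕ.≟ 2 ⌋ then a else 0) (if ⌊ r ℕ.≟ 3 ⌋ then a else 0) ≡ x ℚ.* RQ.⟪ weight r ⟫
    go 0 h = ≡.sym (ℚₚ.*-zeroʳ x)
    go 1 h = RQ.solve 1 (λ x → x ⊟ con (+ 0) ⊞ con (+ 3) ⊠ con (+ 0) ⊟ con (+ 3) ⊠ con (+ 0) ⊜ x ⊠ con (+ 1)) ≡.refl x
    go 2 h = RQ.solve 1 (λ x → con (+ 0) ⊟ con (+ 0) ⊞ con (+ 3) ⊠ x ⊟ con (+ 3) ⊠ con (+ 0) ⊜ x ⊠ con (+ 3)) ≡.refl x
    go 3 h = RQ.solve 1 (λ x → con (+ 0) ⊟ con (+ 0) ⊞ con (+ 3) ⊠ con (+ 0) ⊟ con (+ 3) ⊠ x ⊜ x ⊠ con -[1+ 2 ]) ≡.refl x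
    go 4 h = RQ.solve 1 (λ x → con (+ 0) ⊟ x ⊞ con (+ 3) ⊠ con (+ 0) ⊟ con (+ 3) ⊠ con (+ 0) ⊜ x ⊠ con -[1+ 0 ]) ≡.refl x
    go (suc (suc (suc (suc (suc r))))) (s≤s (s≤s (s≤s (s≤s (s≤s ())))))

  open CrankMoments rationalCrankAlgebra using (moment)

  G-moment : ∀ r n → D.G r n ≡ moment (5 ℕ.* n ℕ.+ r)
  G-moment r n = combine _ _ _ _ (λ π → RQ.⟪ + firstLength π ⟫ ℚ.* RQ.⟪ crankWeight π ⟫)
    (λ { (p ∷ p′ ∷ p₃ ∷ p₄ ∷ p₅ ∷ []) → ≡.trans
      (select (length p) ((+ length p ℤ.- + length p′) ℤ÷.%ℕ 5) (ℤ÷.n%ℕd<d (+ length p ℤ.- + length p′) 5))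
      (≡.cong (λ w → RQ.⟪ + length p ⟫ ℚ.* RQ.⟪ w ⟫) (weight-crank (length p) (length p′))) })
    (D.coloredPartitions 5 (5 ℕ.* n ℕ.+ r))

-- The series of the theorem inside the ring of power series

module Bridge where
  open Series ℚR
  open Products ℚR
  open Bilateral ℚR
  open TripleProduct ℚR using (exponent; power)
  open Theta ℚR using (2*exponent)

  one≋ : D.oneS ≋ 1#
  one≋ = ⟨ (λ { zero → ≡.refl ; (suc n) → ≡.refl }) ⟩

  ⊕≋ : ∀ {f f′ g g′} → f ≋ f′ → g ≋ g′ → (f D.⊕ g) ≋ f′ + g′
  ⊕≋ p q = ⟨ (λ n → ≡.cong₂ ℚ._+_ (at p n) (at q n)) ⟩

  ⊛≋ : ∀ {f f′ g g′} → f ≋ f′ → g ≋ g′ → (f D.⊛ g) ≋ f′ * g′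
  ⊛≋ {f} {f′} {g} {g′} p q = trans ⟨ (λ n → sum-upTo (λ i j → f i ℚ.* g j) n) ⟩ (*-cong p q)

  ^S≋ : ∀ {f f′} k → f ≋ f′ → (f D.^S k) ≋ f′ ^ k
  ^S≋ zero p = one≋
  ^S≋ (suc k) p = ⊛≋ p (^S≋ k p)

  ·≋ : ∀ {f f′} c → f ≋ f′ → (c D.· f) ≋ cst c * f′
  ·≋ {f} {f′} c p = ⟨ (λ n → ≡.trans (≡.cong (c ℚ.*_) (at p n)) (≡.sym (cst-* c f′ n))) ⟩

  qPow≋ : ∀ {f f′} k → f ≋ f′ → D.qPow k f ≋ q ^ k * f′
  qPow≋ {f} {f′} k p = trans ⟨ go ⟩ (*-cong (EtaCube.q^ ℚR k) p)
    where
    go : ∀ n → D.qPow k f n ≡ (mono 1ℚ k * f) n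
    go n with k ℕ.≤ᵇ n in eq
    ... | true = ≡.sym (≡.trans (≡.cong (mono 1ℚ k * f) (≡.sym (ℕₚ.m+[n∸m]≡n k≤n)))
        (≡.trans (mono-shift 1ℚ k f (n ℕ.∸ k)) (ℚₚ.*-identityˡ _)))
      where k≤n = ℕₚ.≤ᵇ⇒≤ k n (≡.subst Bool.T (≡.sym eq) tt)
    ... | false = ≡.sym (Substitution.mono-before ℚR 1ℚ k f n (ℕₚ.≰⇒> (λ le → ≡.subst Bool.T eq (ℕₚ.≤⇒≤ᵇ le))))

  finPoch≋ : ∀ a d M → D.finPoch a d M ≋ pochTo 1ℚ a d M
  finPoch≋ a d zero = one≋
  finPoch≋ a d (suc M) = ⊛≋ (finPoch≋ a d M) ⟨ (λ n → ≡.cong₂ ℚ._-_ (at one≋ n)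
    (≡.trans (at (qPow≋ (a ℕ.+ d ℕ.* M) one≋) n) (at (trans (*-identityʳ _) (sym (EtaCube.q^ ℚR (a ℕ.+ d ℕ.* M)))) n))) ⟩

  qPoch≋ : ∀ a d → D.qPoch a d ≋ [ a , d ]
  qPoch≋ a d = ⟨ (λ n → ≡.trans (at (finPoch≋ a d (suc n)) n) (≡.sym (poch-coefficient 1ℚ a d n))) ⟩

  A≋ : D.A ≋ A
  A≋ = ⊛≋ (qPoch≋ 1 5) (qPoch≋ 4 5)

  B≋ : D.B ≋ B
  B≋ = ⊛≋ (qPoch≋ 2 5) (qPoch≋ 3 5)

  private
    invList≡ : ∀ f n → D.invList f n ≡ invList f n
    invList≡ f zero = ≡.refl
    invList≡ f (suc n) = ≡.cong (λ gs → (ℚ.- L.foldr ℚ._+_ 0ℚ (L.zipWith ℚ._*_ (L.map (λ i → f (suc i)) (L.upTo (suc n))) gs)) ∷ gs) (invList≡ f n)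

    invS≡ : ∀ f n → D.invS f n ≡ inv f n
    invS≡ f n with D.invList f n | invList f n | invList≡ f n
    ... | [] | .[] | ≡.refl = ≡.refl
    ... | x ∷ xs | .(x ∷ xs) | ≡.refl = ≡.refl

    ^-constant : ∀ {f} k → f 0 ≡ 1ℚ → (f ^ k) 0 ≡ 1ℚ
    ^-constant zero h = ≡.refl
    ^-constant (suc k) h = ≡.cong₂ ℚ._*_ h (^-constant k h)

  -- Uniqueness of inverses: the theorem inverts the k-th power, the proof takes powers of one
  -- inverse.
  ^-≋ : ∀ {f f′ g} k → f ≋ f′ → f′ 0 ≡ 1ℚ → f′ * g ≋ 1# → (f D.^- k) ≋ g ^ k
  ^-≋ {f} {f′} {g} k p h u = trans {f D.^- k} {inv (f D.^S k)} {g ^ k} ⟨ invS≡ (f D.^S k) ⟩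
    (inv-unique (f D.^S k) (g ^ k) (≡.trans (at (^S≋ k p) 0) (^-constant {f′} k h))
      (trans {(f D.^S k) * g ^ k} {f′ ^ k * g ^ k} {1#} (*-congʳ {g ^ k} {f D.^S k} {f′ ^ k} (^S≋ k p))
        (trans {f′ ^ k * g ^ k} {g ^ k * f′ ^ k} {1#} (*-comm (f′ ^ k) (g ^ k)) (EtaCube.unit^ ℚR {f′} {g} k u))))

  private
    parity : ℕ → ℤ
    parity n = if ⌊ n ℕ.% 2 ℕ.≟ 0 ⌋ then + 1 else ℤ.- (+ 1)

    parity-power : ∀ n → (ℚ.- 1ℚ) RQ.^ n ≡ RQ.⟪ parity n ⟫
    parity-power zero = ≡.refl
    parity-power (suc zero) = ≡.refl
    parity-power (suc (suc n)) = ≡.trans (RQ.solve 1 (λ x → (⊖ con (+ 1)) ⊠ ((⊖ con (+ 1)) ⊠ x) ⊜ x) ≡.refl ((ℚ.- 1ℚ) RQ.^ n)) (parity-power n)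

    sign-parity : ∀ j → RQ.⟪ parity ℤ.∣ j ∣ ⟫ ≡ sign j
    sign-parity (+ n) = ≡.sym (parity-power n)
    sign-parity -[1+ n ] = ≡.sym (parity-power (suc n))

    -- By `2*exponent` the test j(5j + 1) = 2N says that the theta exponent for a = 3, b = 2 equals
    -- N.
    sTerm≡ : ∀ N j → D.sTerm N j ≡ mono (sign j ℚ.* RQ.⟪ j ⟫) (exponent 3 2 5 j) N
    sTerm≡ N j with j ℤ.* (+ 5 ℤ.* j ℤ.+ + 1) ℤ.≟ + (2 ℕ.* N)
    ... | yes p = ≡.trans (≡.trans (ℤ→ℚ≡⟪⟫ (parity ℤ.∣ j ∣ ℤ.* j)) (≡.trans (RQ.⟪⟫-* (parity ℤ.∣ j ∣) j) (≡.cong (ℚ._* RQ.⟪ j ⟫) (sign-parity j))))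
        (≡.sym (≡.trans (≡.cong (mono (sign j ℚ.* RQ.⟪ j ⟫) (exponent 3 2 5 j)) (≡.sym (≡.trans (ℕₚ.+-identityʳ _) e≡N)))
          (≡.trans (≡.sym (at (*-identityʳ (mono (sign j ℚ.* RQ.⟪ j ⟫) (exponent 3 2 5 j))) (exponent 3 2 5 j ℕ.+ 0)))
            (≡.trans (mono-shift (sign j ℚ.* RQ.⟪ j ⟫) (exponent 3 2 5 j) 1# 0) (ℚₚ.*-identityʳ _)))))
      where
      e≡N : exponent 3 2 5 j ≡ N
      e≡N = ℕₚ.*-cancelˡ-≡ (exponent 3 2 5 j) N 2 (ℤₚ.+-injective (≡.trans (ℤₚ.pos-* 2 (exponent 3 2 5 j)) (≡.trans (2*exponent 3 2 j)
        (≡.trans (ℤK.solve 1 (λ j → con (+ 5) ⊠ (j ⊠ j) ⊞ con (+ 1) ⊠ j ⊜ j ⊠ (con (+ 5) ⊠ j ⊞ con (+ 1))) ≡.refl j) p))))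
    ... | no ¬p = ≡.sym (mono-off (λ e≡N → ¬p (≡.trans
        (ℤK.solve 1 (λ j → j ⊠ (con (+ 5) ⊠ j ⊞ con (+ 1)) ⊜ con (+ 5) ⊠ (j ⊠ j) ⊞ con (+ 1) ⊠ j) ≡.refl j)
        (≡.trans (≡.sym (2*exponent 3 2 j)) (≡.trans (≡.sym (ℤₚ.pos-* 2 (exponent 3 2 5 j))) (≡.cong (λ n → + (2 ℕ.* n)) e≡N))))))
      where
      opaque
        unfolding mono
        mono-off : ∀ {c e n} → ¬ e ≡ n → mono c e n ≡ 0ℚ
        mono-off {e = zero} {zero} h = contradiction ≡.refl h
        mono-off {e = zero} {suc n} h = ≡.refl
        mono-off {e = suc e} {zero} h = ≡.refl
        mono-off {e = suc e} {suc n} h = mono-off {e = e} {n} (λ p → h (≡.cong suc p))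

    diagSum-at : ∀ n (F : ℕ → ℕ → S) m → diagSum n F m ≡ RQ.diagSum n (λ k l → F k l m)
    diagSum-at zero F m = ≡.refl
    diagSum-at (suc n) F m = ≡.cong (F 0 (suc n) m ℚ.+_) (diagSum-at n (λ k l → F (suc k) l) m)

  S≋ : D.S-series ≋ theta′ 3 2
  S≋ = ⟨ (λ N → ≡.trans (sum-upTo (λ i _ → D.sTerm N (+ i ℤ.- + N)) (2 ℕ.* N))
    (≡.trans (≡.cong (λ n → RQ.diagSum n (λ i _ → D.sTerm N (+ i ℤ.- + N))) (≡.cong (N ℕ.+_) (ℕₚ.+-identityʳ N)))
    (≡.trans (RQ.diagSum-cong (N ℕ.+ N) (λ k l _ → ≡.trans (sTerm≡ N (+ k ℤ.- + N)) (≡.cong (λ j → mono (sign j ℚ.* RQ.⟪ j ⟫) (exponent 3 2 5 j) N) (ℤₚ.m-n≡m⊖n k N))))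
      (≡.sym (diagSum-at (N ℕ.+ N) (λ k l → mono (sign (k ℤ.⊖ N) ℚ.* RQ.⟪ k ℤ.⊖ N ⟫) (exponent 3 2 5 (k ℤ.⊖ N))) N))))) ⟩

-- The right-hand sides as polynomials in q and inverse products

module RightHandSides {Q : CommutativeRing 0ℓ 0ℓ} (M : CrankAlgebra Q) (tenth twentieth : RingKit.Carrier Q)
  (tenth-inverse : RingKit._≈_ Q (RingKit._*_ Q tenth (RingKit.⟪_⟫ Q (+ 10))) (RingKit.1# Q))
  (twentieth-inverse : RingKit._≈_ Q (RingKit._*_ Q twentieth (RingKit.⟪_⟫ Q (+ 20))) (RingKit.1# Q)) where
  open Series Q
  open Substitution Q
  open Products Q
  open Bilateral Q using (theta′)
  open Univariate seriesRing using (hev)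
  open CrankMoments M using (moment)
  private
    module Q = RingKit Q
    module C = RingHom cstHom
    cst-inverse : ∀ {c} z → c Q.* Q.⟪ z ⟫ Q.≈ Q.1# → cst c * ⟪ z ⟫ ≋ 1#
    cst-inverse z h = trans (*-congˡ (sym (C.hom-⟪⟫ z))) (trans (sym (C.hom-* _ _)) (trans (cst-cong h) C.hom-1))
  open ClosedForms M (cst twentieth) (cst-inverse (+ 20) twentieth-inverse) using (theta′-closed; moment-2; moment-4; d₁₂; d₁₄; d₃₂; d₃₄)
  open ClosedForms M (cst twentieth) (cst-inverse (+ 20) twentieth-inverse) public using (A′; B′; E′)

  τ : S
  τ = cst tenth

  private
    τ10 : τ * ⟪ + 10 ⟫ ≋ 1#
    τ10 = cst-inverse (+ 10) tenth-inverse

  E₁′ : S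
  E₁′ = A′ * B′ * E′

  E₁′-inverse : E₁ * E₁′ ≋ 1#
  E₁′-inverse = trans (*-congʳ E₁-factor) (trans (solve 6 (λ a b e a′ b′ e′ → a ⊠ b ⊠ e ⊠ (a′ ⊠ b′ ⊠ e′) ⊜ (a ⊠ a′) ⊠ (b ⊠ b′) ⊠ (e ⊠ e′)) ≡.refl A B E₅ A′ B′ E′)
    (trans (*-cong (*-cong A-unit B-unit) E₅-unit) (trans (*-identityʳ _) (*-identityʳ _))))

  quotient⁺⁻ quotient⁻⁺ : ℕ → ℕ → ℕ → S
  quotient⁺⁻ i j m = A ^ i * B′ ^ j * E₅ ^ m * E₁′ ^ 18
  quotient⁻⁺ i j m = A′ ^ i * B ^ j * E₅ ^ m * E₁′ ^ 18

  quotient⁻ : ℕ → ℕ → S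
  quotient⁻ i m = A′ ^ i * E₅ ^ m * E₁′ ^ 18

  -- The coefficients of the theorem are entered ten times enlarged, since `moment-2` and `moment-4`
  -- determine ten times the moment. Inside the bracket multiplied by S they are integers and stay
  -- as they are.
  scaled integral : ℤ → ℕ → S → S
  scaled z k f = τ * ⟪ z ⟫ * (q ^ k * f)
  integral z k f = ⟪ z ⟫ * (q ^ k * f)

  private
    -- E₁⁻¹⁸ = (A B E₅)⁻¹⁸ outweighs every positive exponent that occurs, so each quotient is a
    -- monomial in the inverses and no relation remains to be used.
    monomial : ℕ → ℕ → ℕ → S
    monomial i j m = A′ ^ i * (B′ ^ j * E′ ^ m)

    E₁′^18 : E₁′ ^ 18 ≋ A′ ^ 18 * (B′ ^ 18 * E′ ^ 18)
    E₁′^18 = trans (^-distrib-* (A′ * B′) E′ 18) (trans (*-congʳ (^-distrib-* A′ B′ 18)) (*-assoc _ _ _))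

    reduce : ∀ {x x′} i j → x * x′ ≋ 1# → j ℕ.+ i ≡ 18 → x ^ i * x′ ^ 18 ≋ x′ ^ j
    reduce {x} {x′} i j h e = trans (*-congˡ (trans (reflexive (≡.cong (x′ ^_) (≡.sym e))) (^-homo-* x′ j i)))
      (trans (solve 3 (λ a b c → a ⊠ (b ⊠ c) ⊜ b ⊠ (c ⊠ a)) ≡.refl _ _ _) (trans (*-congˡ (EtaCube.unit^ Q i h)) (*-identityʳ _)))

    merge : ∀ x i j → i ℕ.+ 18 ≡ j → x ^ i * x ^ 18 ≋ x ^ j
    merge x i j e = trans (sym (^-homo-* x i 18)) (reflexive (≡.cong (x ^_) e))

    quotient⁺⁻≋ : ∀ i j m α β γ → α ℕ.+ i ≡ 18 → j ℕ.+ 18 ≡ β → γ ℕ.+ m ≡ 18 → quotient⁺⁻ i j m ≋ monomial α β γ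
    quotient⁺⁻≋ i j m α β γ p r s = trans (*-congˡ E₁′^18) (trans
      (solve 6 (λ a b c x y z → a ⊠ b ⊠ c ⊠ (x ⊠ (y ⊠ z)) ⊜ (a ⊠ x) ⊠ ((b ⊠ y) ⊠ (c ⊠ z))) ≡.refl _ _ _ _ _ _)
      (*-cong (reduce i α A-unit p) (*-cong (merge B′ j β r) (reduce m γ E₅-unit s))))

    quotient⁻⁺≋ : ∀ i j m α β γ → i ℕ.+ 18 ≡ α → β ℕ.+ j ≡ 18 → γ ℕ.+ m ≡ 18 → quotient⁻⁺ i j m ≋ monomial α β γ
    quotient⁻⁺≋ i j m α β γ p r s = trans (*-congˡ E₁′^18) (trans
      (solve 6 (λ a b c x y z → a ⊠ b ⊠ c ⊠ (x ⊠ (y ⊠ z)) ⊜ (a ⊠ x) ⊠ ((b ⊠ y) ⊠ (c ⊠ z))) ≡.refl _ _ _ _ _ _)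
      (*-cong (merge A′ i α p) (*-cong (reduce j β B-unit r) (reduce m γ E₅-unit s))))

    quotient⁻≋ : ∀ i m α γ → i ℕ.+ 18 ≡ α → γ ℕ.+ m ≡ 18 → quotient⁻ i m ≋ monomial α 18 γ
    quotient⁻≋ i m α γ p s = trans (*-congˡ E₁′^18) (trans
      (solve 5 (λ a c x y z → a ⊠ c ⊠ (x ⊠ (y ⊠ z)) ⊜ (a ⊠ x) ⊠ (y ⊠ (c ⊠ z))) ≡.refl _ _ _ _ _)
      (*-cong (merge A′ i α p) (*-congˡ (reduce m γ E₅-unit s))))

    U-10 : ∀ r f → U r f ≋ τ * U r (⟪ + 10 ⟫ * f)
    U-10 r f = trans (sym (trans (*-congʳ τ10) (*-identityˡ _))) (trans (*-assoc _ _ _) (*-congˡ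
      ⟨ (λ n → Q.trans (at (*-congʳ (sym ten)) n) (Q.trans (cst-* _ (U r f) n) (Q.trans (Q.sym (cst-* _ f (r ℕ.+ n ℕ.* 5))) (at (*-congʳ ten) (r ℕ.+ n ℕ.* 5))))) ⟩))
      where
      ten : cst Q.⟪ + 10 ⟫ ≋ ⟪ + 10 ⟫
      ten = C.hom-⟪⟫ (+ 10)

    hevE : ∀ {n} → List ℤ → Ex n → Ex n → Ex n
    hevE [] x z = con (+ 0)
    hevE (c ∷ p) x z = con c ⊠ z ⊡ length p ⊞ x ⊠ hevE p x z

    mE : ∀ {n} → Ex n → Ex n → Ex n → ℕ → ℕ → ℕ → Ex n
    mE a b e i j m = a ⊡ i ⊠ (b ⊡ j ⊠ e ⊡ m)

  rhs₂ : S
  rhs₂ =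
    scaled -[1+ 699 ] 5 (quotient⁺⁻ 11 13 17)
    + scaled (+ 21650) 4 (quotient⁺⁻ 6 8 17)
    + scaled -[1+ 16324 ] 3 (quotient⁺⁻ 1 3 17)
    + scaled (+ 28725) 2 (quotient⁻⁺ 4 2 17)
    + scaled (+ 9825) 1 (quotient⁻⁺ 9 7 17)
    + scaled (+ 175) 0 (quotient⁻⁺ 14 12 17)
    + scaled (+ 100) 4 (quotient⁺⁻ 9 10 15)
    + scaled -[1+ 449 ] 3 (quotient⁺⁻ 4 5 15)
    + scaled -[1+ 824 ] 2 (quotient⁻ 1 15)
    + scaled -[1+ 1999 ] 1 (quotient⁻⁺ 6 5 15)
    + scaled -[1+ 74 ] 0 (quotient⁻⁺ 11 10 15)

  private
    sc : ∀ {f g} z k → f ≋ g → scaled z k f ≋ scaled z k g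
    sc z k h = *-congˡ (*-congˡ h)

    it : ∀ {f g} z k → f ≋ g → integral z k f ≋ integral z k g
    it z k h = *-congˡ (*-congˡ h)

    sE iE : ∀ {n} → Ex n → Ex n → ℤ → ℕ → Ex n → Ex n
    sE t q z k f = t ⊠ con z ⊠ (q ⊡ k ⊠ f)
    iE t q z k f = con z ⊠ (q ⊡ k ⊠ f)

  moment-rhs₂ : U 2 moment ≋ rhs₂
  moment-rhs₂ = trans (U-10 2 moment) (trans (*-congˡ moment-2) (trans
    (solve 5 (λ t q a b e → t ⊠ ⊖ (a ⊡ 9 ⊠ b ⊡ 8 ⊠ e ⊡ 3 ⊠ hevE d₁₂ (q ⊠ b ⊡ 5) (a ⊡ 5) ⊞ a ⊡ 7 ⊠ b ⊡ 6 ⊠ e ⊠ hevE d₃₂ (q ⊠ b ⊡ 5) (a ⊡ 5)) ⊜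
      sE t q -[1+ 699 ] 5 (mE a b e 7 31 1) ⊞ sE t q (+ 21650) 4 (mE a b e 12 26 1) ⊞ sE t q -[1+ 16324 ] 3 (mE a b e 17 21 1)
      ⊞ sE t q (+ 28725) 2 (mE a b e 22 16 1) ⊞ sE t q (+ 9825) 1 (mE a b e 27 11 1) ⊞ sE t q (+ 175) 0 (mE a b e 32 6 1)
      ⊞ sE t q (+ 100) 4 (mE a b e 9 28 3) ⊞ sE t q -[1+ 449 ] 3 (mE a b e 14 23 3) ⊞ sE t q -[1+ 824 ] 2 (mE a b e 19 18 3)
      ⊞ sE t q -[1+ 1999 ] 1 (mE a b e 24 13 3) ⊞ sE t q -[1+ 74 ] 0 (mE a b e 29 8 3)) ≡.refl τ q A′ B′ E′)
    (sym (+-cong (+-cong (+-cong (+-cong (+-cong (+-cong (+-cong (+-cong (+-cong (+-cong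
      (sc -[1+ 699 ] 5 (quotient⁺⁻≋ 11 13 17 7 31 1 ≡.refl ≡.refl ≡.refl))
      (sc (+ 21650) 4 (quotient⁺⁻≋ 6 8 17 12 26 1 ≡.refl ≡.refl ≡.refl)))
      (sc -[1+ 16324 ] 3 (quotient⁺⁻≋ 1 3 17 17 21 1 ≡.refl ≡.refl ≡.refl)))
      (sc (+ 28725) 2 (quotient⁻⁺≋ 4 2 17 22 16 1 ≡.refl ≡.refl ≡.refl)))
      (sc (+ 9825) 1 (quotient⁻⁺≋ 9 7 17 27 11 1 ≡.refl ≡.refl ≡.refl)))
      (sc (+ 175) 0 (quotient⁻⁺≋ 14 12 17 32 6 1 ≡.refl ≡.refl ≡.refl)))
      (sc (+ 100) 4 (quotient⁺⁻≋ 9 10 15 9 28 3 ≡.refl ≡.refl ≡.refl)))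
      (sc -[1+ 449 ] 3 (quotient⁺⁻≋ 4 5 15 14 23 3 ≡.refl ≡.refl ≡.refl)))
      (sc -[1+ 824 ] 2 (quotient⁻≋ 1 15 19 3 ≡.refl ≡.refl)))
      (sc -[1+ 1999 ] 1 (quotient⁻⁺≋ 6 5 15 24 13 3 ≡.refl ≡.refl ≡.refl)))
      (sc -[1+ 74 ] 0 (quotient⁻⁺≋ 11 10 15 29 8 3 ≡.refl ≡.refl ≡.refl))))))

  sFactor : S
  sFactor =
    integral (+ 2) 4 (quotient⁺⁻ 11 13 14)
    + integral -[1+ 0 ] 3 (quotient⁺⁻ 6 8 14)
    + integral (+ 2108) 2 (quotient⁺⁻ 1 3 14)
    + integral -[1+ 3 ] 1 (quotient⁻⁺ 4 2 14)
    + integral -[1+ 2 ] 0 (quotient⁻⁺ 9 7 14)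
    + integral -[1+ 4 ] 3 (quotient⁺⁻ 9 10 12)
    + integral (+ 30) 2 (quotient⁺⁻ 4 5 12)

  rhs₄ : S
  rhs₄ =
    τ * ⟪ + 50 ⟫ * (theta′ 3 2 * sFactor)
    + scaled -[1+ 24 ] 5 (quotient⁺⁻ 13 15 17)
    + scaled (+ 8250) 4 (quotient⁺⁻ 8 10 17)
    + scaled (+ 9325) 2 (quotient⁻ 2 17)
    + scaled (+ 20625) 1 (quotient⁻⁺ 7 5 17)
    + scaled (+ 1375) 0 (quotient⁻⁺ 12 10 17)
    + scaled -[1+ 49 ] 4 (quotient⁺⁻ 11 12 15)
    + scaled (+ 9475) 2 (quotient⁺⁻ 1 2 15)
    + scaled -[1+ 2449 ] 1 (quotient⁻⁺ 4 3 15)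
    + scaled -[1+ 474 ] 0 (quotient⁻⁺ 9 8 15)
    + scaled -[1+ 24 ] 3 (quotient⁺⁻ 9 9 13)
    + scaled (+ 150) 2 (quotient⁺⁻ 4 4 13)

  private
    sFactor′ : S
    sFactor′ = ⟪ + 2 ⟫ * (q ^ 4 * monomial 5 28 1) + ⟪ -[1+ 0 ] ⟫ * (q ^ 3 * monomial 10 23 1) + ⟪ + 2108 ⟫ * (q ^ 2 * monomial 15 18 1)
      + ⟪ -[1+ 3 ] ⟫ * (q ^ 1 * monomial 20 13 1) + ⟪ -[1+ 2 ] ⟫ * (q ^ 0 * monomial 25 8 1)
      + ⟪ -[1+ 4 ] ⟫ * (q ^ 3 * monomial 7 25 3) + ⟪ + 30 ⟫ * (q ^ 2 * monomial 12 20 3)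

    s′E : ∀ {n} → Ex n → Ex n → Ex n → Ex n → Ex n
    s′E q a b e = con (+ 2) ⊠ (q ⊡ 4 ⊠ mE a b e 5 28 1) ⊞ con -[1+ 0 ] ⊠ (q ⊡ 3 ⊠ mE a b e 10 23 1) ⊞ con (+ 2108) ⊠ (q ⊡ 2 ⊠ mE a b e 15 18 1)
      ⊞ con -[1+ 3 ] ⊠ (q ⊡ 1 ⊠ mE a b e 20 13 1) ⊞ con -[1+ 2 ] ⊠ (q ⊡ 0 ⊠ mE a b e 25 8 1)
      ⊞ con -[1+ 4 ] ⊠ (q ⊡ 3 ⊠ mE a b e 7 25 3) ⊞ con (+ 30) ⊠ (q ⊡ 2 ⊠ mE a b e 12 20 3)

    -- The extracted monomial is the one with which `theta′-closed` evaluates S.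
    sFactor≋ : sFactor ≋ A′ ^ 2 * B′ ^ 3 * E′ ^ 3 * sFactor′
    sFactor≋ = trans (+-cong (+-cong (+-cong (+-cong (+-cong (+-cong
        (it (+ 2) 4 (quotient⁺⁻≋ 11 13 14 7 31 4 ≡.refl ≡.refl ≡.refl))
        (it -[1+ 0 ] 3 (quotient⁺⁻≋ 6 8 14 12 26 4 ≡.refl ≡.refl ≡.refl)))
        (it (+ 2108) 2 (quotient⁺⁻≋ 1 3 14 17 21 4 ≡.refl ≡.refl ≡.refl)))
        (it -[1+ 3 ] 1 (quotient⁻⁺≋ 4 2 14 22 16 4 ≡.refl ≡.refl ≡.refl)))
        (it -[1+ 2 ] 0 (quotient⁻⁺≋ 9 7 14 27 11 4 ≡.refl ≡.refl ≡.refl)))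
        (it -[1+ 4 ] 3 (quotient⁺⁻≋ 9 10 12 9 28 6 ≡.refl ≡.refl ≡.refl)))
        (it (+ 30) 2 (quotient⁺⁻≋ 4 5 12 14 23 6 ≡.refl ≡.refl ≡.refl)))
      (solve 4 (λ q a b e →
        iE q q (+ 2) 4 (mE a b e 7 31 4) ⊞ iE q q -[1+ 0 ] 3 (mE a b e 12 26 4) ⊞ iE q q (+ 2108) 2 (mE a b e 17 21 4)
        ⊞ iE q q -[1+ 3 ] 1 (mE a b e 22 16 4) ⊞ iE q q -[1+ 2 ] 0 (mE a b e 27 11 4) ⊞ iE q q -[1+ 4 ] 3 (mE a b e 9 28 6)
        ⊞ iE q q (+ 30) 2 (mE a b e 14 23 6) ⊜ a ⊡ 2 ⊠ b ⊡ 3 ⊠ e ⊡ 3 ⊠ s′E q a b e) ≡.refl q A′ B′ E′)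

    theta-part : τ * ⟪ + 50 ⟫ * (theta′ 3 2 * sFactor) ≋ τ * ⟪ + 5 ⟫ * ((A′ ^ 5 - ⟪ + 3 ⟫ * q * B′ ^ 5 - A′ ^ 2 * B′ ^ 2 * E′ ^ 2) * sFactor′)
    theta-part = trans (*-congˡ (*-congˡ sFactor≋)) (trans
      (solve 4 (λ t s m x → t ⊠ con (+ 50) ⊠ (s ⊠ (m ⊠ x)) ⊜ t ⊠ con (+ 5) ⊠ ((con (+ 10) ⊠ s ⊠ m) ⊠ x)) ≡.refl τ (theta′ 3 2) _ sFactor′)
      (*-congˡ (*-congʳ theta′-closed)))

  -- After `theta-part` has replaced S, the products of its three terms with the seven of `sFactor′`
  -- merge with the eleven other terms into the homogenised `d₁₄` and `d₃₄`: an identity of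
  -- polynomials in q, A⁻¹, B⁻¹, E₅⁻¹.
  moment-rhs₄ : U 4 moment ≋ rhs₄
  moment-rhs₄ = trans (U-10 4 moment) (trans (*-congˡ moment-4) (trans
    (solve 5 (λ t q a b e → t ⊠ ⊖ (a ⊡ 7 ⊠ b ⊡ 10 ⊠ e ⊡ 3 ⊠ hevE d₁₄ (q ⊠ b ⊡ 5) (a ⊡ 5) ⊞ a ⊡ 5 ⊠ b ⊡ 8 ⊠ e ⊠ hevE d₃₄ (q ⊠ b ⊡ 5) (a ⊡ 5)) ⊜
      t ⊠ con (+ 5) ⊠ ((a ⊡ 5 ⊟ con (+ 3) ⊠ q ⊠ b ⊡ 5 ⊟ a ⊡ 2 ⊠ b ⊡ 2 ⊠ e ⊡ 2) ⊠ s′E q a b e)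
      ⊞ sE t q -[1+ 24 ] 5 (mE a b e 5 33 1) ⊞ sE t q (+ 8250) 4 (mE a b e 10 28 1) ⊞ sE t q (+ 9325) 2 (mE a b e 20 18 1)
      ⊞ sE t q (+ 20625) 1 (mE a b e 25 13 1) ⊞ sE t q (+ 1375) 0 (mE a b e 30 8 1) ⊞ sE t q -[1+ 49 ] 4 (mE a b e 7 30 3)
      ⊞ sE t q (+ 9475) 2 (mE a b e 17 20 3) ⊞ sE t q -[1+ 2449 ] 1 (mE a b e 22 15 3) ⊞ sE t q -[1+ 474 ] 0 (mE a b e 27 10 3)
      ⊞ sE t q -[1+ 24 ] 3 (mE a b e 9 27 5) ⊞ sE t q (+ 150) 2 (mE a b e 14 22 5)) ≡.refl τ q A′ B′ E′)
    (sym (+-cong (+-cong (+-cong (+-cong (+-cong (+-cong (+-cong (+-cong (+-cong (+-cong (+-cong theta-part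
      (sc -[1+ 24 ] 5 (quotient⁺⁻≋ 13 15 17 5 33 1 ≡.refl ≡.refl ≡.refl)))
      (sc (+ 8250) 4 (quotient⁺⁻≋ 8 10 17 10 28 1 ≡.refl ≡.refl ≡.refl)))
      (sc (+ 9325) 2 (quotient⁻≋ 2 17 20 1 ≡.refl ≡.refl)))
      (sc (+ 20625) 1 (quotient⁻⁺≋ 7 5 17 25 13 1 ≡.refl ≡.refl ≡.refl)))
      (sc (+ 1375) 0 (quotient⁻⁺≋ 12 10 17 30 8 1 ≡.refl ≡.refl ≡.refl)))
      (sc -[1+ 49 ] 4 (quotient⁺⁻≋ 11 12 15 7 30 3 ≡.refl ≡.refl ≡.refl)))
      (sc (+ 9475) 2 (quotient⁺⁻≋ 1 2 15 17 20 3 ≡.refl ≡.refl ≡.refl)))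
      (sc -[1+ 2449 ] 1 (quotient⁻⁺≋ 4 3 15 22 15 3 ≡.refl ≡.refl ≡.refl)))
      (sc -[1+ 474 ] 0 (quotient⁻⁺≋ 9 8 15 27 10 3 ≡.refl ≡.refl ≡.refl)))
      (sc -[1+ 24 ] 3 (quotient⁺⁻≋ 9 9 13 9 27 5 ≡.refl ≡.refl ≡.refl)))
      (sc (+ 150) 2 (quotient⁺⁻≋ 4 4 13 14 22 5 ≡.refl ≡.refl ≡.refl))))))

-- Specialisation to ℚ and conclusion

open import Defs
open import Data.Rational using (-_)

module RationalSides where
  open Bridge
  private
    module SQ = Series ℚR
    module PQ = Products ℚR
    module C = RingHom (Substitution.cstHom ℚR)
  open SQ using (_≋_)
  open RightHandSides rationalCrankAlgebra (+ 1 / 10) (+ 1 / 20) ≡.refl ≡.refl public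

  scaled≋ : ∀ {f f′} c z k → c ≡ (+ 1 / 10) ℚ.* (z / 1) → f ≋ f′ → (c · qPow k f) ≋ scaled z k f′
  scaled≋ {f} {f′} c z k h p = SQ.trans (·≋ c (qPow≋ k p)) (SQ.*-congʳ {PQ.q SQ.^ k SQ.* f′} {SQ.cst c} {τ SQ.* SQ.⟪ z ⟫}
    (SQ.trans (SQ.cst-cong (≡.trans h (≡.cong ((+ 1 / 10) ℚ.*_) (ℤ→ℚ≡⟪⟫ z)))) (SQ.trans (C.hom-* (+ 1 / 10) RQ.⟪ z ⟫)
      (SQ.*-congˡ {τ} {SQ.cst RQ.⟪ z ⟫} {SQ.⟪ z ⟫} (C.hom-⟪⟫ z)))))

  integral≋ : ∀ {f f′} c z k → c ≡ z / 1 → f ≋ f′ → (c · qPow k f) ≋ integral z k f′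
  integral≋ {f} {f′} c z k h p = SQ.trans (·≋ c (qPow≋ k p)) (SQ.*-congʳ {PQ.q SQ.^ k SQ.* f′} {SQ.cst c} {SQ.⟪ z ⟫}
    (SQ.trans (SQ.cst-cong (≡.trans h (ℤ→ℚ≡⟪⟫ z))) (C.hom-⟪⟫ z)))

  private
    c1 : ∀ m n → PQ.[ ℕ.suc m , ℕ.suc n ] 0 ≡ 1ℚ
    c1 m n = PQ.constant-1 (ℕ.suc m) (ℕ.suc n) (s≤s z≤n) (s≤s z≤n)

    A⁻ : ∀ k → (D.A ^- k) ≋ A′ SQ.^ k
    A⁻ k = ^-≋ {D.A} {PQ.A} {A′} k A≋ (≡.cong₂ ℚ._*_ (c1 0 4) (c1 3 4)) PQ.A-unit

    B⁻ : ∀ k → (D.B ^- k) ≋ B′ SQ.^ k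
    B⁻ k = ^-≋ {D.B} {PQ.B} {B′} k B≋ (≡.cong₂ ℚ._*_ (c1 1 4) (c1 2 4)) PQ.B-unit

    E₁⁻ : ∀ k → (D.E₁ ^- k) ≋ E₁′ SQ.^ k
    E₁⁻ k = ^-≋ {D.E₁} {PQ.E₁} {E₁′} k (qPoch≋ 1 1) (c1 0 0) E₁′-inverse

    E₅⁺ : ∀ k → (D.E₅ ^S k) ≋ PQ.E₅ SQ.^ k
    E₅⁺ k = ^S≋ k (qPoch≋ 5 5)

  Q⁺⁻ : ∀ i j m → ((D.A ^S i) ⊛ (D.B ^- j) ⊛ (D.E₅ ^S m) ⊛ (D.E₁ ^- 18)) ≋ quotient⁺⁻ i j m
  Q⁺⁻ i j m = ⊛≋ (⊛≋ (⊛≋ (^S≋ i A≋) (B⁻ j)) (E₅⁺ m)) (E₁⁻ 18)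

  Q⁻⁺ : ∀ i j m → ((D.A ^- i) ⊛ (D.B ^S j) ⊛ (D.E₅ ^S m) ⊛ (D.E₁ ^- 18)) ≋ quotient⁻⁺ i j m
  Q⁻⁺ i j m = ⊛≋ (⊛≋ (⊛≋ (A⁻ i) (^S≋ j B≋)) (E₅⁺ m)) (E₁⁻ 18)

  Q⁻ : ∀ i m → ((D.A ^- i) ⊛ (D.E₅ ^S m) ⊛ (D.E₁ ^- 18)) ≋ quotient⁻ i m
  Q⁻ i m = ⊛≋ (⊛≋ (A⁻ i) (E₅⁺ m)) (E₁⁻ 18)

  rhs₂≋ = ⊕≋ (⊕≋ (⊕≋ (⊕≋ (⊕≋ (⊕≋ (⊕≋ (⊕≋ (⊕≋ (⊕≋
    (scaled≋ (- (+ 70 / 1)) -[1+ 699 ] 5 ≡.refl (Q⁺⁻ 11 13 17))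
    (scaled≋ (+ 2165 / 1) (+ 21650) 4 ≡.refl (Q⁺⁻ 6 8 17)))
    (scaled≋ (- (+ 3265 / 2)) -[1+ 16324 ] 3 ≡.refl (Q⁺⁻ 1 3 17)))
    (scaled≋ (+ 5745 / 2) (+ 28725) 2 ≡.refl (Q⁻⁺ 4 2 17)))
    (scaled≋ (+ 1965 / 2) (+ 9825) 1 ≡.refl (Q⁻⁺ 9 7 17)))
    (scaled≋ (+ 35 / 2) (+ 175) 0 ≡.refl (Q⁻⁺ 14 12 17)))
    (scaled≋ (+ 10 / 1) (+ 100) 4 ≡.refl (Q⁺⁻ 9 10 15)))
    (scaled≋ (- (+ 45 / 1)) -[1+ 449 ] 3 ≡.refl (Q⁺⁻ 4 5 15)))
    (scaled≋ (- (+ 165 / 2)) -[1+ 824 ] 2 ≡.refl (Q⁻ 1 15)))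
    (scaled≋ (- (+ 200 / 1)) -[1+ 1999 ] 1 ≡.refl (Q⁻⁺ 6 5 15)))
    (scaled≋ (- (+ 15 / 2)) -[1+ 74 ] 0 ≡.refl (Q⁻⁺ 11 10 15))

  sFactor≋ = ⊕≋ (⊕≋ (⊕≋ (⊕≋ (⊕≋ (⊕≋
    (integral≋ (+ 2 / 1) (+ 2) 4 ≡.refl (Q⁺⁻ 11 13 14))
    (integral≋ (- (+ 1 / 1)) -[1+ 0 ] 3 ≡.refl (Q⁺⁻ 6 8 14)))
    (integral≋ (+ 2108 / 1) (+ 2108) 2 ≡.refl (Q⁺⁻ 1 3 14)))
    (integral≋ (- (+ 4 / 1)) -[1+ 3 ] 1 ≡.refl (Q⁻⁺ 4 2 14)))
    (integral≋ (- (+ 3 / 1)) -[1+ 2 ] 0 ≡.refl (Q⁻⁺ 9 7 14)))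
    (integral≋ (- (+ 5 / 1)) -[1+ 4 ] 3 ≡.refl (Q⁺⁻ 9 10 12)))
    (integral≋ (+ 30 / 1) (+ 30) 2 ≡.refl (Q⁺⁻ 4 5 12))

  theta-part≋ : ∀ {f} → f ≋ sFactor → ((+ 5 / 1) · (S-series ⊛ f)) ≋ τ SQ.* SQ.⟪ + 50 ⟫ SQ.* (Bilateral.theta′ ℚR 3 2 SQ.* sFactor)
  theta-part≋ {f} p = SQ.trans (·≋ (+ 5 / 1) (⊛≋ S≋ p)) (SQ.*-congʳ {Bilateral.theta′ ℚR 3 2 SQ.* sFactor} {SQ.cst (+ 5 / 1)} {τ SQ.* SQ.⟪ + 50 ⟫}
    (SQ.trans (C.hom-* (+ 1 / 10) RQ.⟪ + 50 ⟫) (SQ.*-congˡ {τ} {SQ.cst RQ.⟪ + 50 ⟫} {SQ.⟪ + 50 ⟫} (C.hom-⟪⟫ (+ 50)))))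

  rhs₄≋ = ⊕≋ (⊕≋ (⊕≋ (⊕≋ (⊕≋ (⊕≋ (⊕≋ (⊕≋ (⊕≋ (⊕≋ (⊕≋ (theta-part≋ sFactor≋)
    (scaled≋ (- (+ 5 / 2)) -[1+ 24 ] 5 ≡.refl (Q⁺⁻ 13 15 17)))
    (scaled≋ (+ 825 / 1) (+ 8250) 4 ≡.refl (Q⁺⁻ 8 10 17)))
    (scaled≋ (+ 1865 / 2) (+ 9325) 2 ≡.refl (Q⁻ 2 17)))
    (scaled≋ (+ 4125 / 2) (+ 20625) 1 ≡.refl (Q⁻⁺ 7 5 17)))
    (scaled≋ (+ 275 / 2) (+ 1375) 0 ≡.refl (Q⁻⁺ 12 10 17)))
    (scaled≋ (- (+ 5 / 1)) -[1+ 49 ] 4 ≡.refl (Q⁺⁻ 11 12 15)))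
    (scaled≋ (+ 1895 / 2) (+ 9475) 2 ≡.refl (Q⁺⁻ 1 2 15)))
    (scaled≋ (- (+ 245 / 1)) -[1+ 2449 ] 1 ≡.refl (Q⁻⁺ 4 3 15)))
    (scaled≋ (- (+ 95 / 2)) -[1+ 474 ] 0 ≡.refl (Q⁻⁺ 9 8 15)))
    (scaled≋ (- (+ 5 / 2)) -[1+ 24 ] 3 ≡.refl (Q⁺⁻ 9 9 13)))
    (scaled≋ (+ 15 / 1) (+ 150) 2 ≡.refl (Q⁺⁻ 4 4 13))

  open CrankMoments rationalCrankAlgebra using (moment)

  G≡U-moment : ∀ r n → G r n ≡ Substitution.U ℚR r moment n
  G≡U-moment r n = ≡.trans (Enumeration.G-moment r n)
    (≡.cong moment (≡.trans (ℕₚ.+-comm (5 ℕ.* n) r) (≡.cong (r ℕ.+_) (ℕₚ.*-comm 5 n))))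

theorem1p4 : (∀ n → G 2 n ≡
    ( (- (+ 70 / 1)) · qPow 5 ((A ^S 11) ⊛ (B ^- 13) ⊛ (E₅ ^S 17) ⊛ (E₁ ^- 18))
    ⊕ (+ 2165 / 1) · qPow 4 ((A ^S 6) ⊛ (B ^- 8) ⊛ (E₅ ^S 17) ⊛ (E₁ ^- 18))
    ⊕ (- (+ 3265 / 2)) · qPow 3 ((A ^S 1) ⊛ (B ^- 3) ⊛ (E₅ ^S 17) ⊛ (E₁ ^- 18))
    ⊕ (+ 5745 / 2) · qPow 2 ((A ^- 4) ⊛ (B ^S 2) ⊛ (E₅ ^S 17) ⊛ (E₁ ^- 18))
    ⊕ (+ 1965 / 2) · qPow 1 ((A ^- 9) ⊛ (B ^S 7) ⊛ (E₅ ^S 17) ⊛ (E₁ ^- 18))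
    ⊕ (+ 35 / 2) · qPow 0 ((A ^- 14) ⊛ (B ^S 12) ⊛ (E₅ ^S 17) ⊛ (E₁ ^- 18))
    ⊕ (+ 10 / 1) · qPow 4 ((A ^S 9) ⊛ (B ^- 10) ⊛ (E₅ ^S 15) ⊛ (E₁ ^- 18))
    ⊕ (- (+ 45 / 1)) · qPow 3 ((A ^S 4) ⊛ (B ^- 5) ⊛ (E₅ ^S 15) ⊛ (E₁ ^- 18))
    ⊕ (- (+ 165 / 2)) · qPow 2 ((A ^- 1) ⊛ (E₅ ^S 15) ⊛ (E₁ ^- 18))
    ⊕ (- (+ 200 / 1)) · qPow 1 ((A ^- 6) ⊛ (B ^S 5) ⊛ (E₅ ^S 15) ⊛ (E₁ ^- 18))
    ⊕ (- (+ 15 / 2)) · qPow 0 ((A ^- 11) ⊛ (B ^S 10) ⊛ (E₅ ^S 15) ⊛ (E₁ ^- 18))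
    ) n)
    × (∀ n → G 4 n ≡
    ( (+ 5 / 1) · (S-series ⊛
    ( (+ 2 / 1) · qPow 4 ((A ^S 11) ⊛ (B ^- 13) ⊛ (E₅ ^S 14) ⊛ (E₁ ^- 18))
    ⊕ (- (+ 1 / 1)) · qPow 3 ((A ^S 6) ⊛ (B ^- 8) ⊛ (E₅ ^S 14) ⊛ (E₁ ^- 18))
    ⊕ (+ 2108 / 1) · qPow 2 ((A ^S 1) ⊛ (B ^- 3) ⊛ (E₅ ^S 14) ⊛ (E₁ ^- 18))
    ⊕ (- (+ 4 / 1)) · qPow 1 ((A ^- 4) ⊛ (B ^S 2) ⊛ (E₅ ^S 14) ⊛ (E₁ ^- 18))
    ⊕ (- (+ 3 / 1)) · qPow 0 ((A ^- 9) ⊛ (B ^S 7) ⊛ (E₅ ^S 14) ⊛ (E₁ ^- 18))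
    ⊕ (- (+ 5 / 1)) · qPow 3 ((A ^S 9) ⊛ (B ^- 10) ⊛ (E₅ ^S 12) ⊛ (E₁ ^- 18))
    ⊕ (+ 30 / 1) · qPow 2 ((A ^S 4) ⊛ (B ^- 5) ⊛ (E₅ ^S 12) ⊛ (E₁ ^- 18))
    ))
    ⊕ (- (+ 5 / 2)) · qPow 5 ((A ^S 13) ⊛ (B ^- 15) ⊛ (E₅ ^S 17) ⊛ (E₁ ^- 18))
    ⊕ (+ 825 / 1) · qPow 4 ((A ^S 8) ⊛ (B ^- 10) ⊛ (E₅ ^S 17) ⊛ (E₁ ^- 18))
    ⊕ (+ 1865 / 2) · qPow 2 ((A ^- 2) ⊛ (E₅ ^S 17) ⊛ (E₁ ^- 18))
    ⊕ (+ 4125 / 2) · qPow 1 ((A ^- 7) ⊛ (B ^S 5) ⊛ (E₅ ^S 17) ⊛ (E₁ ^- 18))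
    ⊕ (+ 275 / 2) · qPow 0 ((A ^- 12) ⊛ (B ^S 10) ⊛ (E₅ ^S 17) ⊛ (E₁ ^- 18))
    ⊕ (- (+ 5 / 1)) · qPow 4 ((A ^S 11) ⊛ (B ^- 12) ⊛ (E₅ ^S 15) ⊛ (E₁ ^- 18))
    ⊕ (+ 1895 / 2) · qPow 2 ((A ^S 1) ⊛ (B ^- 2) ⊛ (E₅ ^S 15) ⊛ (E₁ ^- 18))
    ⊕ (- (+ 245 / 1)) · qPow 1 ((A ^- 4) ⊛ (B ^S 3) ⊛ (E₅ ^S 15) ⊛ (E₁ ^- 18))
    ⊕ (- (+ 95 / 2)) · qPow 0 ((A ^- 9) ⊛ (B ^S 8) ⊛ (E₅ ^S 15) ⊛ (E₁ ^- 18))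
    ⊕ (- (+ 5 / 2)) · qPow 3 ((A ^S 9) ⊛ (B ^- 9) ⊛ (E₅ ^S 13) ⊛ (E₁ ^- 18))
    ⊕ (+ 15 / 1) · qPow 2 ((A ^S 4) ⊛ (B ^- 4) ⊛ (E₅ ^S 13) ⊛ (E₁ ^- 18))
    ) n)
theorem1p4 =
    (λ n → ≡.trans (G≡U-moment 2 n) (≡.trans (SQ.at moment-rhs₂ n) (≡.sym (SQ.at rhs₂≋ n))))
  , (λ n → ≡.trans (G≡U-moment 4 n) (≡.trans (SQ.at moment-rhs₄ n) (≡.sym (SQ.at rhs₄≋ n))))
  where
  open RationalSides
  module SQ = Series ℚR
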